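{- Let $n\ge3$ and $d\ge4$ be integers and let $q$ be a prime power with $\mathrm{char}(\mathbb{F}_q)\nmid d$ and $q>(d+2)^{2(d-1)/(d-3)}$. Then for every $h\in\mathbb{F}_q[T]$ of degree $d$, $$\gamma(h,q)\le\Big\lceil\frac{\log(q^2)}{\log\big(\frac{q}{(d+2)^2}\big)}\Big\rceil.$$
   Context: For $h\in\mathbb{F}_q[T]$, $\gamma(h,q)$ denotes the minimum number $n$ of variables such that, for every $\beta\in\mathbb{F}_q$, the equation $h(X_1)+\cdots+h(X_n)=\beta$ has a solution in $\mathbb{F}_q^n$ (a generalized Waring number). -}

module Defs where

open import Level using (0ℓ)
open import Algebra.Bundles using (CommutativeRing)
open import Data.Nat as ℕ using (ℕ; zero; suc; _≤_; _<_; _^_)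
open import Data.Nat.Primality using (Prime)
open import Data.Fin using (Fin; zero; suc; fromℕ; toℕ)
open import Data.Product using (Σ; ∃; _×_; _,_)
open import Relation.Nullary using (¬_)
open import Relation.Binary.PropositionalEquality using (_≡_)

IsPrimePower : ℕ → Set
IsPrimePower q = Σ ℕ λ p → Σ ℕ λ k → Prime p × 1 ≤ k × q ≡ p ^ k

record FiniteField (q : ℕ) : Set₁ where
  field
    commRing : CommutativeRing 0ℓ 0ℓ
  open CommutativeRing commRing public
  field
    1≉0        : ¬ (1# ≈ 0#)
    inverse    : ∀ x → ¬ (x ≈ 0#) → ∃ λ y → x * y ≈ 1#
    enum       : Fin q → Carrier
    index      : Carrier → Fin q
    enum-index : ∀ x → enum (index x) ≈ x
    index-enum : ∀ i → index (enum i) ≡ i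
    index-cong : ∀ {x y} → x ≈ y → index x ≡ index y

module _ {q : ℕ} (F : FiniteField q) where
  open FiniteField F using (Carrier; _≈_; _+_; _*_; 0#; 1#)

  pow : Carrier → ℕ → Carrier
  pow x zero    = 1#
  pow x (suc n) = x * pow x n

  natF : ℕ → Carrier
  natF zero    = 0#
  natF (suc n) = 1# + natF n

  sumF : ∀ {n} → (Fin n → Carrier) → Carrier
  sumF {zero}  f = 0#
  sumF {suc n} f = f zero + sumF (λ i → f (suc i))

  record PolyOfDegree (d : ℕ) : Set where
    field
      coeff   : Fin (suc d) → Carrier
      leading : ¬ (coeff (fromℕ d) ≈ 0#)

  eval : ∀ {d} → PolyOfDegree d → Carrier → Carrier
  eval h x = sumF (λ i → PolyOfDegree.coeff h i * pow x (toℕ i))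

  WaringSolvable : ∀ {d} → PolyOfDegree d → ℕ → Set
  WaringSolvable h n = ∀ β → ∃ λ (x : Fin n → Carrier) → sumF (λ i → eval h (x i)) ≈ β

  -- γ(h,q) ≤ m : the minimum number of variables is at most m,
  -- i.e. some n ≤ m admits solutions for every β.
  GammaAtMost : ∀ {d} → PolyOfDegree d → ℕ → Set
  GammaAtMost h m = ∃ λ n → n ≤ m × WaringSolvable h n

-- m = ⌈ log(q²) / log(q/(d+2)²) ⌉, for q > (d+2)²: m is the least natural
-- number with m·log(q/(d+2)²) ≥ log(q²), i.e. q^m ≥ q²·(d+2)^(2m).
IsCeilLogRatio : ℕ → ℕ → ℕ → Set
IsCeilLogRatio q d m =
  (q ^ 2 ℕ.* (d ℕ.+ 2) ^ (2 ℕ.* m) ≤ q ^ m) ×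
  (∀ k → q ^ 2 ℕ.* (d ℕ.+ 2) ^ (2 ℕ.* k) ≤ q ^ k → m ≤ k)

-- Let y ∈ ℤ[𝔽_q] be the sum of the group elements [h(c)], c ∈ 𝔽_q, so that the coefficient of yᵐ at β is
-- the number of solutions of h(x₁) + ⋯ + h(x_m) = β. For a monic polynomial P let χ(P) = [∑ h(α)] with α
-- running over the roots of P; χ is multiplicative. Modulo ∑ [c], the series T = ∑ χ(P) t^(deg P) is a
-- polynomial of degree at most d − 1, because by Newton's identities ∑ h(α) depends linearly on one of the
-- coefficients of P as soon as deg P ≥ d; its linear coefficient is y. By the Euler product, the power sums of T
-- count the points of 𝔽_(qⁿ) at which h has a given trace, and Stepanov's method shows that these counts differ
-- by at most C n^C q^(n/2). Hence the powers of the d − 1 inverse roots of T, which are adjoined formally, are of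
-- moderate growth, and the coefficients of y^K differ by at most C K^C ((d − 1) √q)^K.
-- If yᵐ vanishes at β, then x = q yᵐ − qᵐ ∑ [c] has energy Q(x) = ∑ x(c)² ≥ q^(2m). Since Q(x ∗ x) ≥ Q(x)²,
-- the bound for K = 2ʲ m and j → ∞ gives qᵐ ≤ q² (d − 1)^(2m) < q² (d + 2)^(2m), contrary to the choice of m.
module Submission where

open import Defs
open import Level using (0ℓ)
open import Algebra.Bundles using (CommutativeMonoid; CommutativeRing; RawRing)
open import Algebra.Solver.Ring.AlmostCommutativeRing using (fromCommutativeRing; _-Raw-AlmostCommutative⟶_)
import Algebra.Solver.Ring
import Algebra.Properties.Ring
import Algebra.Properties.Semiring.Sum
import Algebra.Properties.Semiring.Exp
import Algebra.Properties.CommutativeSemiring.Exp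
import Algebra.Properties.Semiring.Mult
import Algebra.Properties.CommutativeSemiring.Binomial
import Relation.Binary.Reasoning.Setoid
open import Data.Nat as ℕ using (ℕ; zero; suc; _≤_; _<_; z≤n; s≤s; _∸_; _^_; _*_; _+_)
import Data.Nat.Properties as ℕₚ
open import Data.Fin as Fin using (Fin; zero; suc; toℕ; fromℕ)
import Data.Fin.Properties as Finₚ
open import Data.Vec as Vec using (Vec; []; _∷_)
open import Data.Maybe using (Maybe; just; nothing)
open import Data.Product using (Σ; ∃; _×_; _,_; proj₁; proj₂)
open import Data.Sum as Sum using (_⊎_; inj₁; inj₂)
open import Data.Empty using (⊥; ⊥-elim)
open import Relation.Nullary using (¬_; Dec; yes; no)
open import Relation.Binary.PropositionalEquality as ≡ using (_≡_; _≢_)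
open import Function using (_∘_; id; case_of_)
import Algebra.Properties.CommutativeMonoid.Sum
import Algebra.Properties.Monoid.Sum
import Data.Fin.Permutation as Perm
open import Data.Nat.Combinatorics using (nC1≡n; nCn≡1; nCk+nC[k+1]≡[n+1]C[k+1]; k>n⇒nCk≡0) renaming (_C_ to _choose_)
open import Data.Nat.Divisibility using (_∣_; divides; _∤_)
import Data.Nat.Divisibility as Div
open import Data.Nat.Primality using (Prime; euclidsLemma; prime⇒nonZero; prime⇒nonTrivial)
import Data.Nat.Solver
import Data.Vec.Properties as Vecₚ
open import Data.List as List using (List; []; _∷_)
open import Data.List.Membership.Propositional using (_∈_; lose)
import Data.List.Membership.Propositional.Properties as ∈ₚ
open import Data.List.Relation.Unary.Any using (here; there)
open import Data.Unit using (⊤; tt)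
import Relation.Binary.Definitions as Tri
import Data.Nat.DivMod as DivMod
open import Data.Integer as ℤ using (ℤ)
import Data.Integer.Properties as ℤₚ

-- The argument stays inside ℤ: instead of evaluating complex characters it measures the growth of
-- powers. Dividing ℤ[𝔽_q] by ∑ [c] removes the trivial character and keeps the others, so T stands
-- for all their L-functions at once. Elements of the quotient are functions up to constants, and
-- the size that respects this is the oscillation, the largest |x(c) - x(c′)|; it is
-- submultiplicative up to the factor q. The quotient need not be a domain. Each inverse root is
-- therefore adjoined as the class of X modulo a monic polynomial: the extension is free on 1, ω,
-- ..., its norm is read off coordinates, and bounds for elements of the base descend again.
-- Stepanov's method bounds the number of points with a given trace only from above. As these
-- numbers add up to qⁿ, none of them can be much smaller than the mean either. Every step loses
-- constants or factors polynomial in the exponent. They disappear against the strict inequality d -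
-- 1 < d + 2 once high powers are compared. The weight q^(n/2) is written q^⌊n/2⌋ to remain in ℕ.

-- Commutative rings: construction from laws, a solver with integer coefficients, homomorphisms

record CommRingLaws (C : Set) : Set₁ where
  infix 4 _≈_
  field
    _≈_ : C → C → Set
    add mul : C → C → C
    neg : C → C
    zer one : C
    refl : ∀ {x} → x ≈ x
    sym : ∀ {x y} → x ≈ y → y ≈ x
    trans : ∀ {x y z} → x ≈ y → y ≈ z → x ≈ z
    add-cong : ∀ {x y u v} → x ≈ y → u ≈ v → add x u ≈ add y v
    mul-cong : ∀ {x y u v} → x ≈ y → u ≈ v → mul x u ≈ mul y v
    neg-cong : ∀ {x y} → x ≈ y → neg x ≈ neg y
    add-assoc : ∀ x y z → add (add x y) z ≈ add x (add y z)
    add-comm : ∀ x y → add x y ≈ add y x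
    add-zero : ∀ x → add zer x ≈ x
    add-neg : ∀ x → add (neg x) x ≈ zer
    mul-assoc : ∀ x y z → mul (mul x y) z ≈ mul x (mul y z)
    mul-comm : ∀ x y → mul x y ≈ mul y x
    mul-one : ∀ x → mul one x ≈ x
    distrib : ∀ x y z → mul x (add y z) ≈ add (mul x y) (mul x z)

-- Commutativity supplies the other side of each identity, inverse and distributive law, so the
-- rings of series, polynomials, residues and group ring elements check one side only.
toCommutativeRing : {C : Set} → CommRingLaws C → CommutativeRing 0ℓ 0ℓ
toCommutativeRing {C} L = record
  { Carrier = C ; _≈_ = _≈_ ; _+_ = add ; _*_ = mul ; -_ = neg ; 0# = zer ; 1# = one
  ; isCommutativeRing = record
    { isRing = record
      { +-isAbelianGroup = record
        { isGroup = record
          { isMonoid = record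
            { isSemigroup = record
              { isMagma = record
                { isEquivalence = record { refl = refl ; sym = sym ; trans = trans }
                ; ∙-cong = add-cong }
              ; assoc = add-assoc }
            ; identity = add-zero , λ x → trans (add-comm x zer) (add-zero x) }
          ; inverse = add-neg , λ x → trans (add-comm x (neg x)) (add-neg x)
          ; ⁻¹-cong = neg-cong }
        ; comm = add-comm }
      ; *-cong = mul-cong
      ; *-assoc = mul-assoc
      ; *-identity = mul-one , λ x → trans (mul-comm x one) (mul-one x)
      ; distrib = distrib , λ x y z →
          trans (mul-comm (add y z) x)
            (trans (distrib x y z) (add-cong (mul-comm x y) (mul-comm x z))) }
    ; *-comm = mul-comm } }
  where open CommRingLaws L

module Kit (R : CommutativeRing 0ℓ 0ℓ) where
  open CommutativeRing R public
    using (Carrier; _≈_; -_; 0#; 1#; refl; sym; trans; reflexive; setoid; semiring; commutativeSemiring;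
      +-cong; +-congˡ; +-congʳ; *-cong; *-congˡ; *-congʳ; -‿cong; +-identityˡ; +-identityʳ; -‿inverseˡ; -‿inverseʳ;
      +-assoc; +-comm; *-assoc; *-comm; *-identityˡ; *-identityʳ; distribˡ; distribʳ; zeroˡ; zeroʳ)
    renaming (_+_ to _⊕_; _*_ to _⊗_; _-_ to _⊖_)
  open Algebra.Properties.Ring (CommutativeRing.ring R) public
    using (-‿distribˡ-*; -‿distribʳ-*; -‿involutive; -‿+-comm; -0#≈0#; x∙y⁻¹≈ε⇒x≈y; x≈y⇒x∙y⁻¹≈ε; -1*x≈-x)
  open Algebra.Properties.Semiring.Mult semiring public
    using (×-congʳ; ×-congˡ; ×-homo-+; ×-assocˡ; ×-comm-*; ×-assoc-*; ×1-homo-*) renaming (_×_ to _·_)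
  open Algebra.Properties.Semiring.Exp semiring public
    using (^-congˡ; ^-congʳ; ^-homo-*; ^-assocʳ) renaming (_^_ to _↑_)
  open Algebra.Properties.CommutativeSemiring.Exp commutativeSemiring public using (^-distrib-*)
  open Algebra.Properties.Semiring.Sum semiring public
    using (sum; sum-cong-≋; sum-replicate; sum-replicate-zero; *-distribˡ-sum; *-distribʳ-sum; ∑-distrib-+; ∑-comm; sum-permute)
  module Reasoning = Relation.Binary.Reasoning.Setoid setoid

  private
    module _ where
      open Reasoning

      interchange : ∀ a b c d → (a ⊕ b) ⊕ (c ⊕ d) ≈ (a ⊕ c) ⊕ (b ⊕ d)
      interchange a b c d = begin
        (a ⊕ b) ⊕ (c ⊕ d) ≈⟨ +-assoc a b _ ⟩
        a ⊕ (b ⊕ (c ⊕ d)) ≈⟨ +-congˡ (trans (sym (+-assoc b c d)) (trans (+-congʳ (+-comm b c)) (+-assoc c b d))) ⟩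
        a ⊕ (c ⊕ (b ⊕ d)) ≈⟨ sym (+-assoc a c _) ⟩
        (a ⊕ c) ⊕ (b ⊕ d) ∎

      diff : ℕ × ℕ → Carrier
      diff (m , n) = m · 1# ⊕ - (n · 1#)

      diff-+ : ∀ a b → diff (proj₁ a ℕ.+ proj₁ b , proj₂ a ℕ.+ proj₂ b) ≈ diff a ⊕ diff b
      diff-+ (m , n) (k , l) = begin
        (m ℕ.+ k) · 1# ⊕ - ((n ℕ.+ l) · 1#) ≈⟨ +-cong (×-homo-+ 1# m k) (trans (-‿cong (×-homo-+ 1# n l)) (sym (-‿+-comm _ _))) ⟩
        (m · 1# ⊕ k · 1#) ⊕ (- (n · 1#) ⊕ - (l · 1#)) ≈⟨ interchange _ _ _ _ ⟩
        diff (m , n) ⊕ diff (k , l) ∎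

      diff-* : ∀ a b → diff (proj₁ a ℕ.* proj₁ b ℕ.+ proj₂ a ℕ.* proj₂ b , proj₁ a ℕ.* proj₂ b ℕ.+ proj₂ a ℕ.* proj₁ b) ≈ diff a ⊗ diff b
      diff-* (m , n) (k , l) = begin
        diff (m ℕ.* k ℕ.+ n ℕ.* l , m ℕ.* l ℕ.+ n ℕ.* k)
          ≈⟨ +-cong (trans (×-homo-+ 1# (m ℕ.* k) _) (+-cong (×1-homo-* m k) (×1-homo-* n l)))
                    (-‿cong (trans (×-homo-+ 1# (m ℕ.* l) _) (+-cong (×1-homo-* m l) (×1-homo-* n k)))) ⟩
        (M ⊗ K ⊕ N ⊗ L) ⊕ - (M ⊗ L ⊕ N ⊗ K) ≈⟨ +-congˡ (sym (-‿+-comm _ _)) ⟩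
        (M ⊗ K ⊕ N ⊗ L) ⊕ (- (M ⊗ L) ⊕ - (N ⊗ K)) ≈⟨ +-congˡ (+-comm _ _) ⟩
        (M ⊗ K ⊕ N ⊗ L) ⊕ (- (N ⊗ K) ⊕ - (M ⊗ L)) ≈⟨ interchange _ _ _ _ ⟩
        (M ⊗ K ⊕ - (N ⊗ K)) ⊕ (N ⊗ L ⊕ - (M ⊗ L))
          ≈⟨ +-cong (+-congˡ (-‿distribˡ-* N K)) (trans (+-comm _ _) (+-cong (-‿distribʳ-* M L) (trans (sym (-‿involutive _)) (trans (-‿cong (-‿distribˡ-* N L)) (-‿distribʳ-* (- N) L))))) ⟩
        (M ⊗ K ⊕ - N ⊗ K) ⊕ (M ⊗ - L ⊕ - N ⊗ - L) ≈⟨ +-cong (sym (distribʳ K M (- N))) (sym (distribʳ (- L) M (- N))) ⟩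
        (M ⊕ - N) ⊗ K ⊕ (M ⊕ - N) ⊗ - L ≈⟨ sym (distribˡ _ K (- L)) ⟩
        (M ⊕ - N) ⊗ (K ⊕ - L) ∎
        where
          M N K L : Carrier
          M = m · 1#
          N = n · 1#
          K = k · 1#
          L = l · 1#

      diff-neg : ∀ a → diff (proj₂ a , proj₁ a) ≈ - diff a
      diff-neg (m , n) = trans (+-comm _ _) (trans (+-congˡ (sym (-‿involutive _))) (-‿+-comm _ _))

      diff-≈ : ∀ a b → proj₁ a ℕ.+ proj₂ b ≡ proj₁ b ℕ.+ proj₂ a → diff a ≈ diff b
      diff-≈ (m , n) (k , l) eq = x∙y⁻¹≈ε⇒x≈y _ _ (begin
        diff (m , n) ⊕ - diff (k , l) ≈⟨ +-congˡ (sym (diff-neg (k , l))) ⟩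
        diff (m , n) ⊕ diff (l , k) ≈⟨ sym (diff-+ (m , n) (l , k)) ⟩
        diff (m ℕ.+ l , n ℕ.+ k) ≈⟨ +-congʳ (×-congˡ (≡.trans eq (ℕₚ.+-comm k n))) ⟩
        diff (n ℕ.+ k , n ℕ.+ k) ≈⟨ -‿inverseʳ _ ⟩
        0# ∎)

      -- The pair (m , n) is the integer m - n. The pairs for 0 and 1 evaluate to `0#` and `1#`
      -- themselves and not to a difference, so that equations written with `:0` and `:1` match
      -- their goals definitionally.
      ⟦_⟧ᶜ : ℕ × ℕ → Carrier
      ⟦ zero , zero ⟧ᶜ = 0#
      ⟦ suc zero , zero ⟧ᶜ = 1#
      ⟦ a ⟧ᶜ = diff a

      ⟦⟧ᶜ≈diff : ∀ a → ⟦ a ⟧ᶜ ≈ diff a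
      ⟦⟧ᶜ≈diff (zero , zero) = sym (-‿inverseʳ _)
      ⟦⟧ᶜ≈diff (suc zero , zero) = sym (trans (+-congˡ -0#≈0#) (trans (+-identityʳ _) (+-identityʳ _)))
      ⟦⟧ᶜ≈diff (zero , suc n) = refl
      ⟦⟧ᶜ≈diff (suc zero , suc n) = refl
      ⟦⟧ᶜ≈diff (suc (suc m) , n) = refl

    -- Cancelling the common part after every operation keeps the components small while the solver
    -- normalises.
    reduce : ℕ × ℕ → ℕ × ℕ
    reduce (m , n) = m ∸ n , n ∸ m

    ⟦reduce⟧ : ∀ a → ⟦ reduce a ⟧ᶜ ≈ diff a
    ⟦reduce⟧ a = trans (⟦⟧ᶜ≈diff (reduce a)) (diff-≈ (reduce a) a (max-≡ (proj₁ a) (proj₂ a)))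
      where
        max-≡ : ∀ m n → (m ∸ n) ℕ.+ n ≡ m ℕ.+ (n ∸ m)
        max-≡ zero zero = ≡.refl
        max-≡ zero (suc n) = ≡.refl
        max-≡ (suc m) zero = ≡.refl
        max-≡ (suc m) (suc n) = ≡.trans (ℕₚ.+-suc (m ∸ n) n) (≡.cong suc (max-≡ m n))

    infixl 6 _+ᶜ_
    infixl 7 _*ᶜ_
    _+ᶜ_ _*ᶜ_ : ℕ × ℕ → ℕ × ℕ → ℕ × ℕ
    a +ᶜ b = reduce (proj₁ a ℕ.+ proj₁ b , proj₂ a ℕ.+ proj₂ b)
    a *ᶜ b = reduce (proj₁ a ℕ.* proj₁ b ℕ.+ proj₂ a ℕ.* proj₂ b , proj₁ a ℕ.* proj₂ b ℕ.+ proj₂ a ℕ.* proj₁ b)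

    -ᶜ_ : ℕ × ℕ → ℕ × ℕ
    -ᶜ a = proj₂ a , proj₁ a

    coefficients : RawRing 0ℓ 0ℓ
    coefficients = record
      { Carrier = ℕ × ℕ ; _≈_ = _≡_
      ; _+_ = _+ᶜ_ ; _*_ = _*ᶜ_ ; -_ = -ᶜ_ ; 0# = 0 , 0 ; 1# = 1 , 0 }

    morphism : coefficients -Raw-AlmostCommutative⟶ fromCommutativeRing R
    morphism = record
      { ⟦_⟧ = ⟦_⟧ᶜ
      ; +-homo = λ a b → trans (⟦reduce⟧ (proj₁ a ℕ.+ proj₁ b , proj₂ a ℕ.+ proj₂ b)) (trans (diff-+ a b) (sym (+-cong (⟦⟧ᶜ≈diff a) (⟦⟧ᶜ≈diff b))))
      ; *-homo = λ a b → trans (⟦reduce⟧ (proj₁ a ℕ.* proj₁ b ℕ.+ proj₂ a ℕ.* proj₂ b , proj₁ a ℕ.* proj₂ b ℕ.+ proj₂ a ℕ.* proj₁ b)) (trans (diff-* a b) (sym (*-cong (⟦⟧ᶜ≈diff a) (⟦⟧ᶜ≈diff b))))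
      ; -‿homo = λ a → trans (⟦⟧ᶜ≈diff (-ᶜ a)) (trans (diff-neg a) (-‿cong (sym (⟦⟧ᶜ≈diff a))))
      ; 0-homo = refl ; 1-homo = refl }

    coefficient≟ : ∀ a b → Maybe (⟦ a ⟧ᶜ ≈ ⟦ b ⟧ᶜ)
    coefficient≟ a b with proj₁ a ℕ.+ proj₂ b ℕ.≟ proj₁ b ℕ.+ proj₂ a
    ... | yes eq = just (trans (⟦⟧ᶜ≈diff a) (trans (diff-≈ a b eq) (sym (⟦⟧ᶜ≈diff b))))
    ... | no _ = nothing

  module S = Algebra.Solver.Ring coefficients (fromCommutativeRing R) morphism coefficient≟
  open S public using (solve; _:=_; _:+_; _:*_; :-_; _:-_)

  :0 :1 : ∀ {n} → S.Polynomial n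
  :0 = S.con (0 , 0)
  :1 = S.con (1 , 0)

record Hom (A B : CommutativeRing 0ℓ 0ℓ) : Set where
  private
    module A = Kit A
    module B = Kit B
  field
    ⟦_⟧ : A.Carrier → B.Carrier
    cong : ∀ {x y} → x A.≈ y → ⟦ x ⟧ B.≈ ⟦ y ⟧
    ⊕-homo : ∀ x y → ⟦ x A.⊕ y ⟧ B.≈ ⟦ x ⟧ B.⊕ ⟦ y ⟧
    ⊗-homo : ∀ x y → ⟦ x A.⊗ y ⟧ B.≈ ⟦ x ⟧ B.⊗ ⟦ y ⟧
    neg-homo : ∀ x → ⟦ A.- x ⟧ B.≈ B.- ⟦ x ⟧
    0-homo : ⟦ A.0# ⟧ B.≈ B.0#
    1-homo : ⟦ A.1# ⟧ B.≈ B.1#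

  ·-homo : ∀ n x → ⟦ n A.· x ⟧ B.≈ n B.· ⟦ x ⟧
  ·-homo zero x = 0-homo
  ·-homo (suc n) x = B.trans (⊕-homo x _) (B.+-congˡ (·-homo n x))

  ↑-homo : ∀ x n → ⟦ x A.↑ n ⟧ B.≈ ⟦ x ⟧ B.↑ n
  ↑-homo x zero = 1-homo
  ↑-homo x (suc n) = B.trans (⊗-homo x _) (B.*-congˡ (↑-homo x n))

  sum-homo : ∀ {n} (f : Fin n → A.Carrier) → ⟦ A.sum f ⟧ B.≈ B.sum (λ i → ⟦ f i ⟧)
  sum-homo {zero} f = 0-homo
  sum-homo {suc n} f = B.trans (⊕-homo _ _) (B.+-congˡ (sum-homo (f ∘ suc)))

_∘ₕ_ : ∀ {A B C} → Hom B C → Hom A B → Hom A C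
_∘ₕ_ {A} {B} {C} g f = record
  { ⟦_⟧ = λ x → G.⟦ F.⟦ x ⟧ ⟧
  ; cong = λ e → G.cong (F.cong e)
  ; ⊕-homo = λ x y → C.trans (G.cong (F.⊕-homo x y)) (G.⊕-homo _ _)
  ; ⊗-homo = λ x y → C.trans (G.cong (F.⊗-homo x y)) (G.⊗-homo _ _)
  ; neg-homo = λ x → C.trans (G.cong (F.neg-homo x)) (G.neg-homo _)
  ; 0-homo = C.trans (G.cong F.0-homo) G.0-homo
  ; 1-homo = C.trans (G.cong F.1-homo) G.1-homo }
  where
    module F = Hom f
    module G = Hom g
    module C = Kit C

idₕ : ∀ {A} → Hom A A
idₕ {A} = record
  { ⟦_⟧ = λ x → x ; cong = λ e → e ; ⊕-homo = λ _ _ → refl ; ⊗-homo = λ _ _ → refl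
  ; neg-homo = λ _ → refl ; 0-homo = refl ; 1-homo = refl }
  where open Kit A

-- Power series

module Series (R : CommutativeRing 0ℓ 0ℓ) where
  open Kit R

  Seq : Set
  Seq = ℕ → Carrier

  infix 4 _≋_
  -- A record and not a bare family of equations, so that unification can recover both series from
  -- the type of a proof.
  record _≋_ (f g : Seq) : Set where
    constructor mk
    field at : ∀ n → f n ≈ g n
  open _≋_ public

  conv : Seq → Seq → Seq
  conv f g zero = f 0 ⊗ g 0
  conv f g (suc n) = f 0 ⊗ g (suc n) ⊕ conv (f ∘ suc) g n

  const : Carrier → Seq
  const a zero = a
  const a (suc n) = 0#

  shift : ℕ → Seq → Seq
  shift zero f n = f n
  shift (suc e) f zero = 0#
  shift (suc e) f (suc n) = shift e f n

  monomial : Carrier → ℕ → Seq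
  monomial a e = shift e (const a)

  conv-cong≤ : ∀ n {f f′ g g′} → (∀ i → i ≤ n → f i ≈ f′ i) → (∀ i → i ≤ n → g i ≈ g′ i) → conv f g n ≈ conv f′ g′ n
  conv-cong≤ zero p r = *-cong (p 0 z≤n) (r 0 z≤n)
  conv-cong≤ (suc n) p r = +-cong (*-cong (p 0 z≤n) (r (suc n) ℕₚ.≤-refl))
    (conv-cong≤ n (λ i i≤n → p (suc i) (s≤s i≤n)) (λ i i≤n → r i (ℕₚ.m≤n⇒m≤1+n i≤n)))

  conv-cong : ∀ {f f′ g g′} → (∀ i → f i ≈ f′ i) → (∀ i → g i ≈ g′ i) → ∀ n → conv f g n ≈ conv f′ g′ n
  conv-cong p r n = conv-cong≤ n (λ i _ → p i) (λ i _ → r i)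

  conv-snoc : ∀ f g n → conv f g (suc n) ≈ conv f (g ∘ suc) n ⊕ f (suc n) ⊗ g 0
  conv-snoc f g zero = refl
  conv-snoc f g (suc n) = trans (+-congˡ (conv-snoc (f ∘ suc) g n)) (sym (+-assoc _ _ _))

  conv-comm : ∀ f g n → conv f g n ≈ conv g f n
  conv-comm f g zero = *-comm _ _
  conv-comm f g (suc n) = trans (+-cong (*-comm _ _) (conv-comm (f ∘ suc) g n))
    (trans (+-comm _ _) (sym (conv-snoc g f n)))

  conv-zeroˡ : ∀ f g → (∀ i → f i ≈ 0#) → ∀ n → conv f g n ≈ 0#
  conv-zeroˡ f g p zero = trans (*-congʳ (p 0)) (zeroˡ _)
  conv-zeroˡ f g p (suc n) = trans (+-cong (trans (*-congʳ (p 0)) (zeroˡ _)) (conv-zeroˡ (f ∘ suc) g (p ∘ suc) n)) (+-identityˡ _)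

  conv-constˡ : ∀ a g n → conv (const a) g n ≈ a ⊗ g n
  conv-constˡ a g zero = refl
  conv-constˡ a g (suc n) = trans (+-congˡ (conv-zeroˡ _ g (λ _ → refl) n)) (+-identityʳ _)

  conv-distribʳ : ∀ f f′ g n → conv (λ i → f i ⊕ f′ i) g n ≈ conv f g n ⊕ conv f′ g n
  conv-distribʳ f f′ g zero = distribʳ _ _ _
  conv-distribʳ f f′ g (suc n) = trans (+-cong (distribʳ _ _ _) (conv-distribʳ (f ∘ suc) (f′ ∘ suc) g n))
    (solve 4 (λ a b c d → (a :+ b) :+ (c :+ d) := (a :+ c) :+ (b :+ d)) refl _ _ _ _)

  conv-scaleˡ : ∀ a f g n → conv (λ i → a ⊗ f i) g n ≈ a ⊗ conv f g n
  conv-scaleˡ a f g zero = *-assoc _ _ _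
  conv-scaleˡ a f g (suc n) = trans (+-cong (*-assoc _ _ _) (conv-scaleˡ a (f ∘ suc) g n)) (sym (distribˡ _ _ _))

  conv-assoc : ∀ f g h n → conv (conv f g) h n ≈ conv f (conv g h) n
  conv-assoc f g h zero = *-assoc _ _ _
  conv-assoc f g h (suc n) = begin
    (f 0 ⊗ g 0) ⊗ h (suc n) ⊕ conv (conv f g ∘ suc) h n
      ≈⟨ +-cong (*-assoc _ _ _) (trans (conv-distribʳ (λ i → f 0 ⊗ g (suc i)) (conv (f ∘ suc) g) h n)
                                       (+-cong (conv-scaleˡ (f 0) (g ∘ suc) h n) (conv-assoc (f ∘ suc) g h n))) ⟩
    f 0 ⊗ (g 0 ⊗ h (suc n)) ⊕ (f 0 ⊗ conv (g ∘ suc) h n ⊕ conv (f ∘ suc) (conv g h) n)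
      ≈⟨ sym (+-assoc _ _ _) ⟩
    (f 0 ⊗ (g 0 ⊗ h (suc n)) ⊕ f 0 ⊗ conv (g ∘ suc) h n) ⊕ conv (f ∘ suc) (conv g h) n
      ≈⟨ +-congʳ (sym (distribˡ _ _ _)) ⟩
    f 0 ⊗ conv g h (suc n) ⊕ conv (f ∘ suc) (conv g h) n ∎
    where open Reasoning

  ≋-refl : ∀ {f} → f ≋ f
  ≋-refl = mk λ _ → refl

  ≋-sym : ∀ {f g} → f ≋ g → g ≋ f
  ≋-sym p = mk λ n → sym (at p n)

  ≋-trans : ∀ {f g h} → f ≋ g → g ≋ h → f ≋ h
  ≋-trans p r = mk λ n → trans (at p n) (at r n)

  seriesRing : CommutativeRing 0ℓ 0ℓ
  seriesRing = toCommutativeRing {Seq} record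
    { _≈_ = _≋_
    ; add = λ f g n → f n ⊕ g n ; mul = conv ; neg = λ f n → - f n ; zer = λ _ → 0# ; one = const 1#
    ; refl = ≋-refl ; sym = ≋-sym ; trans = ≋-trans
    ; add-cong = λ p r → mk λ n → +-cong (at p n) (at r n)
    ; mul-cong = λ p r → mk (conv-cong (at p) (at r))
    ; neg-cong = λ p → mk λ n → -‿cong (at p n)
    ; add-assoc = λ _ _ _ → mk λ _ → +-assoc _ _ _
    ; add-comm = λ _ _ → mk λ _ → +-comm _ _
    ; add-zero = λ _ → mk λ _ → +-identityˡ _
    ; add-neg = λ _ → mk λ _ → -‿inverseˡ _
    ; mul-assoc = λ f g h → mk (conv-assoc f g h)
    ; mul-comm = λ f g → mk (conv-comm f g)
    ; mul-one = λ f → mk λ n → trans (conv-constˡ 1# f n) (*-identityˡ _)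
    ; distrib = λ f g h → mk λ n → trans (conv-comm f _ n)
        (trans (conv-distribʳ g h f n) (+-cong (conv-comm g f n) (conv-comm h f n)))
    }

  module 𝕊 = Kit seriesRing

  shift-cong : ∀ e {f g} → (∀ i → f i ≈ g i) → ∀ n → shift e f n ≈ shift e g n
  shift-cong zero p n = p n
  shift-cong (suc e) p zero = refl
  shift-cong (suc e) p (suc n) = shift-cong e p n

  conv-shiftˡ : ∀ e f g n → conv (shift e f) g n ≈ shift e (conv f g) n
  conv-shiftˡ zero f g n = refl
  conv-shiftˡ (suc e) f g zero = zeroˡ _
  conv-shiftˡ (suc e) f g (suc n) = trans (+-congʳ (zeroˡ _)) (trans (+-identityˡ _) (conv-shiftˡ e f g n))

  conv-monomialˡ : ∀ a e g n → conv (monomial a e) g n ≈ shift e (λ i → a ⊗ g i) n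
  conv-monomialˡ a e g n = trans (conv-shiftˡ e (const a) g n) (shift-cong e (conv-constˡ a g) n)

  shift-above : ∀ e f n → shift e f (e ℕ.+ n) ≡ f n
  shift-above zero f n = ≡.refl
  shift-above (suc e) f n = shift-above e f n

  shift-below : ∀ e f n → n < e → shift e f n ≡ 0#
  shift-below (suc e) f zero _ = ≡.refl
  shift-below (suc e) f (suc n) (s≤s p) = shift-below e f n p

  -- The operator t d/dt and not d/dt: it preserves indices and is still a derivation of the Cauchy
  -- product.
  deriv : Seq → Seq
  deriv f n = n · f n

  ·-⊗ : ∀ n x y → n · (x ⊗ y) ≈ x ⊗ (n · y)
  ·-⊗ n x y = sym (×-comm-* n x y)

  ·-zero : ∀ n → n · 0# ≈ 0#
  ·-zero zero = refl
  ·-zero (suc n) = trans (+-identityˡ _) (·-zero n)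

  ·-⊕ : ∀ n x y → n · (x ⊕ y) ≈ n · x ⊕ n · y
  ·-⊕ zero x y = sym (+-identityˡ _)
  ·-⊕ (suc n) x y = trans (+-congˡ (·-⊕ n x y)) (solve 4 (λ a b c d → (a :+ b) :+ (c :+ d) := (a :+ c) :+ (b :+ d)) refl _ _ _ _)

  leibniz : ∀ f g n → n · conv f g n ≈ conv (deriv f) g n ⊕ conv f (deriv g) n
  leibniz f g zero = solve 2 (λ a b → :0 := :0 :* b :+ a :* :0) refl _ _
  leibniz f g (suc n) = begin
    suc n · (f 0 ⊗ g (suc n) ⊕ c)
      ≈⟨ ·-⊕ (suc n) _ _ ⟩
    suc n · (f 0 ⊗ g (suc n)) ⊕ (c ⊕ n · c)
      ≈⟨ +-cong (·-⊗ (suc n) _ _) (+-congˡ (leibniz (f ∘ suc) g n)) ⟩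
    f 0 ⊗ deriv g (suc n) ⊕ (c ⊕ (conv (deriv (f ∘ suc)) g n ⊕ conv (f ∘ suc) (deriv g) n))
      ≈⟨ solve 5 (λ a c d e z → a :+ (c :+ (d :+ e)) := (:0 :* z :+ (c :+ d)) :+ (a :+ e)) refl _ _ _ _ (g (suc n)) ⟩
    (0# ⊗ g (suc n) ⊕ (c ⊕ conv (deriv (f ∘ suc)) g n)) ⊕ (f 0 ⊗ deriv g (suc n) ⊕ conv (f ∘ suc) (deriv g) n)
      -- `deriv f ∘ suc` exceeds `deriv (f ∘ suc)` by `f ∘ suc`, which is where the extra copy of
      -- `c` goes.
      ≈⟨ +-congʳ (+-congˡ (sym (conv-distribʳ (f ∘ suc) (deriv (f ∘ suc)) g n))) ⟩
    conv (deriv f) g (suc n) ⊕ conv f (deriv g) (suc n) ∎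
    where
      open Reasoning
      c = conv (f ∘ suc) g n

  -- inverse-approx N A is correct up to degree N; iterating avoids course-of-values recursion.
  inverse-approx : ℕ → Seq → Seq
  inverse-approx N A zero = 1#
  inverse-approx zero A (suc n) = 0#
  inverse-approx (suc N) A (suc n) = - conv (A ∘ suc) (inverse-approx N A) n

  inverse : Seq → Seq
  inverse A n = inverse-approx n A n

  inverse-stable : ∀ N M A n → n ≤ N → n ≤ M → inverse-approx N A n ≈ inverse-approx M A n
  inverse-stable N M A zero _ _ = refl
  inverse-stable (suc N) (suc M) A (suc n) (s≤s p) (s≤s r) = -‿cong
    (conv-cong≤ n (λ _ _ → refl) (λ i i≤n → inverse-stable N M A i (ℕₚ.≤-trans i≤n p) (ℕₚ.≤-trans i≤n r)))

  inverse-correct : ∀ A → A 0 ≈ 1# → A 𝕊.⊗ inverse A 𝕊.≈ 𝕊.1#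
  inverse-correct A A0 = mk λ where
    zero → trans (*-identityʳ _) A0
    (suc n) → trans (+-cong (trans (*-congʳ A0) (*-identityˡ _))
        (conv-cong≤ n (λ _ _ → refl) (λ i i≤n → inverse-stable i n A i ℕₚ.≤-refl i≤n))) (-‿inverseˡ _)

  conv-cancelˡ : ∀ {A f g} → A 0 ≈ 1# → A 𝕊.⊗ f 𝕊.≈ A 𝕊.⊗ g → f 𝕊.≈ g
  conv-cancelˡ {A} {f} {g} A0 eq = begin
    f ≈⟨ lem f ⟩
    inverse A 𝕊.⊗ (A 𝕊.⊗ f) ≈⟨ 𝕊.*-congˡ eq ⟩
    inverse A 𝕊.⊗ (A 𝕊.⊗ g) ≈⟨ 𝕊.sym (lem g) ⟩
    g ∎
    where
      open 𝕊.Reasoning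
      lem : ∀ h → h 𝕊.≈ inverse A 𝕊.⊗ (A 𝕊.⊗ h)
      lem h = 𝕊.sym (𝕊.trans (𝕊.sym (𝕊.*-assoc (inverse A) A h))
        (𝕊.trans (𝕊.*-congʳ (𝕊.trans (𝕊.*-comm (inverse A) A) (inverse-correct A A0))) (𝕊.*-identityˡ h)))

  -- If A = ∏ (1 − αᵢ t), then powerSum A k = ∑ αᵢᵏ for k ≥ 1: it is −t A′/A.
  powerSum : Seq → Seq
  powerSum A = 𝕊.- (inverse A 𝕊.⊗ deriv A)

  powerSum-spec : ∀ A → A 0 ≈ 1# → A 𝕊.⊗ powerSum A 𝕊.≈ 𝕊.- deriv A
  powerSum-spec A A0 = begin
    A 𝕊.⊗ powerSum A ≈⟨ 𝕊.solve 3 (λ a b c → a 𝕊.:* (𝕊.:- (b 𝕊.:* c)) 𝕊.:= 𝕊.:- ((a 𝕊.:* b) 𝕊.:* c)) 𝕊.refl A (inverse A) (deriv A) ⟩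
    𝕊.- ((A 𝕊.⊗ inverse A) 𝕊.⊗ deriv A) ≈⟨ 𝕊.-‿cong (𝕊.*-congʳ (inverse-correct A A0)) ⟩
    𝕊.- (𝕊.1# 𝕊.⊗ deriv A) ≈⟨ 𝕊.-‿cong (𝕊.*-identityˡ _) ⟩
    𝕊.- deriv A ∎
    where open 𝕊.Reasoning

  -- A series with constant term 1 can be cancelled, so the equation A s = -t A′ determines s. The
  -- identities for power sums below are all checked by means of this equation.
  powerSum-unique : ∀ {A s} → A 0 ≈ 1# → A 𝕊.⊗ s 𝕊.≈ 𝕊.- deriv A → s 𝕊.≈ powerSum A
  powerSum-unique {A} A0 eq = conv-cancelˡ A0 (𝕊.trans eq (𝕊.sym (powerSum-spec A A0)))

  powerSum-cong : ∀ {A B} → A 0 ≈ 1# → A 𝕊.≈ B → powerSum A 𝕊.≈ powerSum B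
  powerSum-cong {A} {B} A0 eq = powerSum-unique (trans (sym (at eq 0)) A0)
    (𝕊.trans (𝕊.*-congʳ (𝕊.sym eq)) (𝕊.trans (powerSum-spec A A0) (mk λ n → -‿cong (×-congʳ n (at eq n)))))

  powerSum-⊗ : ∀ A B → A 0 ≈ 1# → B 0 ≈ 1# → powerSum (A 𝕊.⊗ B) 𝕊.≈ powerSum A 𝕊.⊕ powerSum B
  powerSum-⊗ A B A0 B0 = 𝕊.sym (powerSum-unique (trans (*-cong A0 B0) (*-identityˡ _)) (begin
    (A 𝕊.⊗ B) 𝕊.⊗ (powerSum A 𝕊.⊕ powerSum B)
      ≈⟨ 𝕊.solve 4 (λ a b s t → (a 𝕊.:* b) 𝕊.:* (s 𝕊.:+ t) 𝕊.:= (a 𝕊.:* s) 𝕊.:* b 𝕊.:+ a 𝕊.:* (b 𝕊.:* t)) 𝕊.refl A B (powerSum A) (powerSum B) ⟩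
    (A 𝕊.⊗ powerSum A) 𝕊.⊗ B 𝕊.⊕ A 𝕊.⊗ (B 𝕊.⊗ powerSum B)
      ≈⟨ 𝕊.+-cong (𝕊.*-congʳ (powerSum-spec A A0)) (𝕊.*-congˡ (powerSum-spec B B0)) ⟩
    (𝕊.- deriv A) 𝕊.⊗ B 𝕊.⊕ A 𝕊.⊗ (𝕊.- deriv B)
      ≈⟨ 𝕊.solve 4 (λ a b s t → (𝕊.:- s) 𝕊.:* b 𝕊.:+ a 𝕊.:* (𝕊.:- t) 𝕊.:= 𝕊.:- (s 𝕊.:* b 𝕊.:+ a 𝕊.:* t)) 𝕊.refl A B (deriv A) (deriv B) ⟩
    𝕊.- (deriv A 𝕊.⊗ B 𝕊.⊕ A 𝕊.⊗ deriv B)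
      ≈⟨ 𝕊.-‿cong (mk λ n → sym (leibniz A B n)) ⟩
    𝕊.- deriv (A 𝕊.⊗ B) ∎))
    where open 𝕊.Reasoning

  powerSum-1 : powerSum 𝕊.1# 𝕊.≈ 𝕊.0#
  powerSum-1 = 𝕊.sym (powerSum-unique {𝕊.1#} {𝕊.0#} refl (𝕊.trans (𝕊.zeroʳ 𝕊.1#)
    (mk λ { zero → sym -0#≈0# ; (suc k) → sym (trans (-‿cong (·-zero (suc k))) -0#≈0#) })))

  powerSum-zero : ∀ A → A 0 ≈ 1# → powerSum A 0 ≈ 0#
  powerSum-zero A A0 = trans (sym (trans (*-congʳ A0) (*-identityˡ _))) (trans (at (powerSum-spec A A0) 0) -0#≈0#)

  -- Newton's identity: the coefficient of tⁿ⁺¹ in A s = -t A′, solved for the term that contains s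
  -- (n + 1).
  powerSum-newton : ∀ A → A 0 ≈ 1# → ∀ n → powerSum A (suc n) ≈ - (suc n · A (suc n)) ⊖ conv (A ∘ suc) (powerSum A) n
  powerSum-newton A A0 n = begin
    s (suc n) ≈⟨ sym (trans (*-congʳ A0) (*-identityˡ _)) ⟩
    A 0 ⊗ s (suc n) ≈⟨ solve 2 (λ x y → x := (x :+ y) :- y) refl _ c ⟩
    conv A s (suc n) ⊖ c ≈⟨ +-congʳ (at (powerSum-spec A A0) (suc n)) ⟩
    - (suc n · A (suc n)) ⊖ c ∎
    where
      open Reasoning
      s = powerSum A
      c = conv (A ∘ suc) s n

  powerSum-cong≤ : ∀ {A B} → A 0 ≈ 1# → B 0 ≈ 1# → ∀ n → (∀ i → i ≤ n → A i ≈ B i) →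
    ∀ i → i ≤ n → powerSum A i ≈ powerSum B i
  powerSum-cong≤ {A} {B} A0 B0 n p zero _ = trans (powerSum-zero A A0) (sym (powerSum-zero B B0))
  powerSum-cong≤ {A} {B} A0 B0 (suc n) p (suc i) (s≤s i≤n) = begin
    powerSum A (suc i) ≈⟨ powerSum-newton A A0 i ⟩
    - (suc i · A (suc i)) ⊖ conv (A ∘ suc) (powerSum A) i
      ≈⟨ +-cong (-‿cong (×-congʳ (suc i) (p (suc i) (s≤s i≤n))))
           (-‿cong (conv-cong≤ i (λ j j≤i → p (suc j) (s≤s (ℕₚ.≤-trans j≤i i≤n)))
             (λ j j≤i → powerSum-cong≤ A0 B0 n (λ k k≤n → p k (ℕₚ.m≤n⇒m≤1+n k≤n)) j (ℕₚ.≤-trans j≤i i≤n)))) ⟩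
    - (suc i · B (suc i)) ⊖ conv (B ∘ suc) (powerSum B) i ≈⟨ sym (powerSum-newton B B0 i) ⟩
    powerSum B (suc i) ∎
    where open Reasoning

  -- The leading coefficient does not enter the convolution in Newton's formula, as powerSum A 0 = 0.
  powerSum-top : ∀ {A B} → A 0 ≈ 1# → B 0 ≈ 1# → ∀ n → (∀ i → i ≤ n → A i ≈ B i) →
    powerSum A (suc n) ⊕ suc n · A (suc n) ≈ powerSum B (suc n) ⊕ suc n · B (suc n)
  powerSum-top {A} {B} A0 B0 n p = begin
    powerSum A (suc n) ⊕ suc n · A (suc n) ≈⟨ half A A0 ⟩
    - conv (A ∘ suc) (powerSum A) n ≈⟨ -‿cong (conv≈ n p) ⟩
    - conv (B ∘ suc) (powerSum B) n ≈⟨ sym (half B B0) ⟩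
    powerSum B (suc n) ⊕ suc n · B (suc n) ∎
    where
      open Reasoning
      half : ∀ X → X 0 ≈ 1# → powerSum X (suc n) ⊕ suc n · X (suc n) ≈ - conv (X ∘ suc) (powerSum X) n
      half X X0 = trans (+-congʳ (powerSum-newton X X0 n)) (solve 2 (λ a b → (:- a :- b) :+ a := :- b) refl _ _)
      conv≈ : ∀ n → (∀ i → i ≤ n → A i ≈ B i) → conv (A ∘ suc) (powerSum A) n ≈ conv (B ∘ suc) (powerSum B) n
      conv≈ zero p = trans (trans (*-congˡ (powerSum-zero A A0)) (zeroʳ _)) (sym (trans (*-congˡ (powerSum-zero B B0)) (zeroʳ _)))
      conv≈ (suc n) p = trans (conv-snoc _ _ n) (trans (+-cong
        (conv-cong≤ n (λ i i≤n → p (suc i) (s≤s i≤n)) (λ i i≤n → powerSum-cong≤ A0 B0 (suc n) p (suc i) (s≤s i≤n)))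
        (trans (trans (*-congˡ (powerSum-zero A A0)) (zeroʳ _)) (sym (trans (*-congˡ (powerSum-zero B B0)) (zeroʳ _)))))
        (sym (conv-snoc _ _ n)))

  -- The polynomial 1 - a tᵉ, the reciprocal of the Euler factor of a prime of degree e.
  linear : Carrier → ℕ → Seq
  linear a e = 𝕊.1# 𝕊.⊖ monomial a e

  linear-zero : ∀ a e → 1 ≤ e → linear a e 0 ≈ 1#
  linear-zero a (suc e) _ = trans (+-congˡ -0#≈0#) (+-identityʳ _)

  private
    module _ (a : Carrier) (e : ℕ) (1≤e : 1 ≤ e) where
      s : Seq
      s = powerSum (linear a e)

      recurrence : ∀ n → s n ≈ shift e (λ i → a ⊗ s i) n ⊕ n · monomial a e n
      recurrence n = begin
        s n ≈⟨ solve 2 (λ x y → x := (x :- y) :+ y) refl _ (conv (monomial a e) s n) ⟩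
        (s n ⊖ conv (monomial a e) s n) ⊕ conv (monomial a e) s n
          ≈⟨ +-cong (at (𝕊.solve 2 (λ x y → x 𝕊.:- y 𝕊.:* x 𝕊.:= (𝕊.:1 𝕊.:- y) 𝕊.:* x) 𝕊.refl s (monomial a e)) n) (conv-monomialˡ a e s n) ⟩
        conv (linear a e) s n ⊕ shift e (λ i → a ⊗ s i) n
          ≈⟨ +-congʳ (at (powerSum-spec (linear a e) (linear-zero a e 1≤e)) n) ⟩
        - (n · linear a e n) ⊕ shift e (λ i → a ⊗ s i) n
          ≈⟨ trans (+-comm _ _) (+-congˡ (trans (-‿cong (derivative n)) (-‿involutive _))) ⟩
        shift e (λ i → a ⊗ s i) n ⊕ n · monomial a e n ∎
        where
          open Reasoning
          derivative : ∀ n → n · linear a e n ≈ - (n · monomial a e n)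
          derivative zero = sym -0#≈0#
          derivative (suc n) = trans (×-congʳ (suc n) (+-identityˡ _)) (neg (suc n) _)
            where
              neg : ∀ n x → n · (- x) ≈ - (n · x)
              neg zero x = sym -0#≈0#
              neg (suc n) x = trans (+-congˡ (neg n x)) (-‿+-comm _ _)

      at-e : s (e ℕ.+ 0) ≈ e · a
      at-e = begin
        s (e ℕ.+ 0) ≈⟨ recurrence _ ⟩
        shift e (λ i → a ⊗ s i) (e ℕ.+ 0) ⊕ (e ℕ.+ 0) · monomial a e (e ℕ.+ 0)
          ≈⟨ +-cong (reflexive (shift-above e _ 0)) (trans (×-congʳ (e ℕ.+ 0) (reflexive (shift-above e (const a) 0))) (×-congˡ (ℕₚ.+-identityʳ e))) ⟩
        a ⊗ s 0 ⊕ e · a ≈⟨ +-congʳ (trans (*-congˡ (powerSum-zero (linear a e) (linear-zero a e 1≤e))) (zeroʳ _)) ⟩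
        0# ⊕ e · a ≈⟨ +-identityˡ _ ⟩
        e · a ∎
        where open Reasoning

      beyond-e : ∀ k → s (e ℕ.+ suc k) ≈ a ⊗ s (suc k)
      beyond-e k = begin
        s (e ℕ.+ suc k) ≈⟨ recurrence _ ⟩
        shift e (λ i → a ⊗ s i) (e ℕ.+ suc k) ⊕ (e ℕ.+ suc k) · monomial a e (e ℕ.+ suc k)
          ≈⟨ +-cong (reflexive (shift-above e _ (suc k))) (trans (×-congʳ (e ℕ.+ suc k) (reflexive (shift-above e (const a) (suc k)))) (·-zero (e ℕ.+ suc k))) ⟩
        a ⊗ s (suc k) ⊕ 0# ≈⟨ +-identityʳ _ ⟩
        a ⊗ s (suc k) ∎
        where open Reasoning

      below-e : ∀ n → n < e → s n ≈ 0#
      below-e n n<e = trans (recurrence n) (trans (+-cong (reflexive (shift-below e _ n n<e))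
        (trans (×-congʳ n (reflexive (shift-below e _ n n<e))) (·-zero n))) (+-identityˡ _))

  -- The logarithmic derivative of 1 - a tᵉ is a geometric series in a tᵉ with factor e.
  -- Equivalently, the inverse roots are the e-th roots of a, and each has a^j as its (j e)-th
  -- power.
  powerSum-linear : ∀ a e → 1 ≤ e → ∀ j → powerSum (linear a e) (suc j ℕ.* e) ≈ e · (a ↑ suc j)
  powerSum-linear a e 1≤e zero = trans (at-e a e 1≤e) (×-congʳ e (sym (*-identityʳ a)))
  powerSum-linear a (suc e) 1≤e (suc j) = trans (beyond-e a (suc e) 1≤e (e ℕ.+ j ℕ.* suc e))
    (trans (*-congˡ (powerSum-linear a (suc e) 1≤e j)) (×-comm-* (suc e) a _))

  powerSum-linear∤ : ∀ a e → 1 ≤ e → ∀ n → (∀ j → n ≢ j ℕ.* e) → powerSum (linear a e) n ≈ 0#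
  powerSum-linear∤ a e 1≤e n e∤n = go n n ℕₚ.≤-refl e∤n
    where
      go : ∀ fuel n → n ≤ fuel → (∀ j → n ≢ j ℕ.* e) → powerSum (linear a e) n ≈ 0#
      go _ zero _ e∤n = ⊥-elim (e∤n 0 ≡.refl)
      go (suc fuel) n@(suc n′) (s≤s n≤) e∤n with n ℕ.<? e
      ... | yes n<e = below-e a e 1≤e n n<e
      ... | no n≮e with n ∸ e in eq
      ...   | zero = ⊥-elim (e∤n 1 (≡.trans (ℕₚ.≤-antisym (ℕₚ.m∸n≡0⇒m≤n eq) (ℕₚ.≮⇒≥ n≮e)) (≡.sym (ℕₚ.+-identityʳ e))))
      ...   | suc k = trans (reflexive (≡.cong (powerSum (linear a e)) n≡)) (trans (beyond-e a e 1≤e k)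
                (trans (*-congˡ (go fuel (suc k) k≤ (λ j eq′ → e∤n (suc j) (≡.trans n≡ (≡.cong (e ℕ.+_) eq′))))) (zeroʳ _)))
        where
          n≡ : n ≡ e ℕ.+ suc k
          n≡ = ≡.trans (≡.sym (ℕₚ.m+[n∸m]≡n (ℕₚ.≮⇒≥ n≮e))) (≡.cong (e ℕ.+_) eq)
          k≤ : suc k ≤ fuel
          k≤ = ℕₚ.≤-trans (ℕₚ.≤-reflexive (≡.sym eq)) (ℕₚ.≤-trans (ℕₚ.∸-monoʳ-≤ n 1≤e) n≤)

module SeriesHom {A B : CommutativeRing 0ℓ 0ℓ} (φ : Hom A B) where
  private
    module A = Kit A
    module B = Kit B
    module SA = Series A
    module SB = Series B
  open Hom φ

  conv-homo : ∀ f g n → ⟦ SA.conv f g n ⟧ B.≈ SB.conv (λ i → ⟦ f i ⟧) (λ i → ⟦ g i ⟧) n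
  conv-homo f g zero = ⊗-homo _ _
  conv-homo f g (suc n) = B.trans (⊕-homo _ _) (B.+-cong (⊗-homo _ _) (conv-homo (f ∘ suc) g n))

  powerSum-homo : ∀ F → F 0 A.≈ A.1# → ∀ n → ⟦ SA.powerSum F n ⟧ B.≈ SB.powerSum (λ i → ⟦ F i ⟧) n
  powerSum-homo F F0 = SB.at (SB.powerSum-unique (B.trans (cong F0) 1-homo) (SB.mk λ n →
    B.trans (B.sym (conv-homo F (SA.powerSum F) n)) (B.trans (cong (SA.at (SA.powerSum-spec F F0) n))
      (B.trans (neg-homo _) (B.-‿cong (·-homo n _))))))

-- Quotients and polynomials

module Quotient (A : CommutativeRing 0ℓ 0ℓ) (m : CommutativeRing.Carrier A) where
  open Kit A

  infix 4 _∼_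
  record _∼_ (x y : Carrier) : Set where
    constructor mk
    field
      cofactor : Carrier
      equation : x ≈ y ⊕ cofactor ⊗ m

  ∼-reflexive : ∀ {x y} → x ≈ y → x ∼ y
  ∼-reflexive p = mk 0# (trans p (solve 2 (λ y m → y := y :+ :0 :* m) refl _ m))

  quotientRing : CommutativeRing 0ℓ 0ℓ
  quotientRing = toCommutativeRing {Carrier} record
    { _≈_ = _∼_
    ; add = _⊕_ ; mul = _⊗_ ; neg = -_ ; zer = 0# ; one = 1#
    ; refl = ∼-reflexive refl
    ; sym = λ {x} {y} (mk u p) → mk (- u) (trans (solve 3 (λ y u m → y := (y :+ u :* m) :+ (:- u) :* m) refl y u m) (+-congʳ (sym p)))
    ; trans = λ {x} {y} {z} (mk u p) (mk v r) → mk (v ⊕ u) (trans p (trans (+-congʳ r) (solve 4 (λ z u v m → (z :+ v :* m) :+ u :* m := z :+ (v :+ u) :* m) refl z u v m)))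
    ; add-cong = λ {x} {y} {x′} {y′} (mk u p) (mk v r) → mk (u ⊕ v) (trans (+-cong p r)
        (solve 5 (λ y y′ u v m → (y :+ u :* m) :+ (y′ :+ v :* m) := (y :+ y′) :+ (u :+ v) :* m) refl y y′ u v m))
    ; mul-cong = λ {x} {y} {x′} {y′} (mk u p) (mk v r) → mk (y ⊗ v ⊕ u ⊗ (y′ ⊕ v ⊗ m)) (trans (*-cong p r)
        (solve 5 (λ y y′ u v m → (y :+ u :* m) :* (y′ :+ v :* m) := y :* y′ :+ (y :* v :+ u :* (y′ :+ v :* m)) :* m) refl y y′ u v m))
    ; neg-cong = λ {x} {y} (mk u p) → mk (- u) (trans (-‿cong p) (solve 3 (λ y u m → :- (y :+ u :* m) := :- y :+ (:- u) :* m) refl y u m))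
    ; add-assoc = λ x y z → ∼-reflexive (+-assoc x y z)
    ; add-comm = λ x y → ∼-reflexive (+-comm x y)
    ; add-zero = λ x → ∼-reflexive (+-identityˡ x)
    ; add-neg = λ x → ∼-reflexive (-‿inverseˡ x)
    ; mul-assoc = λ x y z → ∼-reflexive (*-assoc x y z)
    ; mul-comm = λ x y → ∼-reflexive (*-comm x y)
    ; mul-one = λ x → ∼-reflexive (*-identityˡ x)
    ; distrib = λ x y z → ∼-reflexive (distribˡ x y z)
    }

  projection : Hom A quotientRing
  projection = record
    { ⟦_⟧ = λ x → x ; cong = ∼-reflexive ; ⊕-homo = λ _ _ → ∼-reflexive refl ; ⊗-homo = λ _ _ → ∼-reflexive refl
    ; neg-homo = λ _ → ∼-reflexive refl ; 0-homo = ∼-reflexive refl ; 1-homo = ∼-reflexive refl }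

  modulus∼0 : m ∼ 0#
  modulus∼0 = mk 1# (solve 1 (λ m → m := :0 :+ :1 :* m) refl m)

  ∼0⇒multiple : ∀ {x} → x ∼ 0# → ∃ λ u → x ≈ u ⊗ m
  ∼0⇒multiple (mk u p) = u , trans p (+-identityˡ _)

  multiple⇒∼0 : ∀ {x u} → x ≈ u ⊗ m → x ∼ 0#
  multiple⇒∼0 {u = u} p = mk u (trans p (sym (+-identityˡ _)))

-- A vector (c₀ , … , cₙ₋₁) stands for the monic polynomial c₀ + … + cₙ₋₁ Xⁿ⁻¹ + Xⁿ.
module Monic (R : CommutativeRing 0ℓ 0ℓ) where
  open Kit R
  open Series R

  evalM : ∀ {n} → Vec Carrier n → Carrier → Carrier
  evalM [] x = 1#
  evalM (c ∷ v) x = c ⊕ x ⊗ evalM v x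

  -- Synthetic division by X - α: the coefficients of the quotient are the values at α of the
  -- successive tails. The remainder is the value at α.
  quotM : ∀ {n} → Vec Carrier (suc n) → Carrier → Vec Carrier n
  quotM (c ∷ []) α = []
  quotM (c ∷ v@(_ ∷ _)) α = evalM v α ∷ quotM v α

  -- The reversed polynomial tⁿ f(1/t).
  reversed : ∀ {n} → Vec Carrier n → Seq
  reversed [] = const 1#
  reversed {suc n} (c ∷ v) = λ k → reversed v k ⊕ monomial c (suc n) k

  eval-quot : ∀ {n} (v : Vec Carrier (suc n)) α x → evalM v x ≈ (x ⊖ α) ⊗ evalM (quotM v α) x ⊕ evalM v α
  eval-quot (c ∷ []) α x = solve 3 (λ c α x → c :+ x :* :1 := (x :- α) :* :1 :+ (c :+ α :* :1)) refl c α x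
  eval-quot (c ∷ v@(_ ∷ _)) α x = trans (+-congˡ (*-congˡ (eval-quot v α x)))
    (solve 5 (λ c x α q e → c :+ x :* ((x :- α) :* q :+ e) := (x :- α) :* (e :+ x :* q) :+ (c :+ α :* e)) refl c x α (evalM (quotM v α) x) (evalM v α))

  reversed-zero : ∀ {n} (v : Vec Carrier n) → reversed v 0 ≈ 1#
  reversed-zero [] = refl
  reversed-zero (c ∷ v) = trans (+-identityʳ _) (reversed-zero v)

  monomial-⊗ : ∀ a b i j → monomial a i 𝕊.⊗ monomial b j 𝕊.≈ monomial (a ⊗ b) (i ℕ.+ j)
  monomial-⊗ a b i j = mk λ n → trans (conv-monomialˡ a i (monomial b j) n) (go i n)
    where
      inner : ∀ j n → a ⊗ monomial b j n ≈ monomial (a ⊗ b) j n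
      inner zero zero = refl
      inner zero (suc n) = zeroʳ _
      inner (suc j) zero = zeroʳ _
      inner (suc j) (suc n) = inner j n
      go : ∀ i n → shift i (λ k → a ⊗ monomial b j k) n ≈ monomial (a ⊗ b) (i ℕ.+ j) n
      go zero n = inner j n
      go (suc i) zero = refl
      go (suc i) (suc n) = go i n

  monomial-cong : ∀ {a b} e → a ≈ b → monomial a e 𝕊.≈ monomial b e
  monomial-cong e p = mk (shift-cong e λ { zero → p ; (suc _) → refl })

  monomial-⊕ : ∀ a b e → monomial (a ⊕ b) e 𝕊.≈ monomial a e 𝕊.⊕ monomial b e
  monomial-⊕ a b e = mk (go e)
    where
      go : ∀ e n → monomial (a ⊕ b) e n ≈ monomial a e n ⊕ monomial b e n
      go zero zero = refl
      go zero (suc n) = sym (+-identityˡ _)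
      go (suc e) zero = sym (+-identityˡ _)
      go (suc e) (suc n) = go e n

  monomial-0 : ∀ e → monomial 0# e 𝕊.≈ 𝕊.0#
  monomial-0 e = mk (go e)
    where
      go : ∀ e n → monomial 0# e n ≈ 0#
      go zero zero = refl
      go zero (suc n) = refl
      go (suc e) zero = refl
      go (suc e) (suc n) = go e n

  -- The substitution X = 1/t in division with remainder by X - α, multiplied by tⁿ⁺¹.
  reversed-quot : ∀ {n} (v : Vec Carrier (suc n)) α →
    reversed v 𝕊.≈ linear α 1 𝕊.⊗ reversed (quotM v α) 𝕊.⊕ monomial (evalM v α) (suc n)
  reversed-quot (c ∷ []) α = begin
    𝕊.1# 𝕊.⊕ monomial c 1
      ≈⟨ 𝕊.solve 2 (λ a c → 𝕊.:1 𝕊.:+ c 𝕊.:= (𝕊.:1 𝕊.:- a) 𝕊.:* 𝕊.:1 𝕊.:+ (c 𝕊.:+ a)) 𝕊.refl (monomial α 1) (monomial c 1) ⟩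
    linear α 1 𝕊.⊗ 𝕊.1# 𝕊.⊕ (monomial c 1 𝕊.⊕ monomial α 1)
      ≈⟨ 𝕊.+-congˡ (𝕊.sym (𝕊.trans (monomial-cong 1 (+-congˡ (*-identityʳ α))) (monomial-⊕ c α 1))) ⟩
    linear α 1 𝕊.⊗ 𝕊.1# 𝕊.⊕ monomial (c ⊕ α ⊗ 1#) 1 ∎
    where open 𝕊.Reasoning
  reversed-quot {suc n} (c ∷ v@(_ ∷ _)) α = begin
    reversed v 𝕊.⊕ monomial c (suc (suc n))
      ≈⟨ 𝕊.+-congʳ {monomial c (suc (suc n))} (reversed-quot v α) ⟩
    (linear α 1 𝕊.⊗ w 𝕊.⊕ E) 𝕊.⊕ monomial c (suc (suc n))
      ≈⟨ 𝕊.solve 4 (λ a w e c → ((𝕊.:1 𝕊.:- a) 𝕊.:* w 𝕊.:+ e) 𝕊.:+ c 𝕊.:= (𝕊.:1 𝕊.:- a) 𝕊.:* (w 𝕊.:+ e) 𝕊.:+ (c 𝕊.:+ a 𝕊.:* e)) 𝕊.refl (monomial α 1) w E (monomial c (suc (suc n))) ⟩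
    linear α 1 𝕊.⊗ (w 𝕊.⊕ E) 𝕊.⊕ (monomial c (suc (suc n)) 𝕊.⊕ monomial α 1 𝕊.⊗ E)
      ≈⟨ 𝕊.+-congˡ {linear α 1 𝕊.⊗ (w 𝕊.⊕ E)} (𝕊.trans (𝕊.+-congˡ {monomial c (suc (suc n))} (monomial-⊗ α (evalM v α) 1 (suc n))) (𝕊.sym (monomial-⊕ c (α ⊗ evalM v α) (suc (suc n))))) ⟩
    linear α 1 𝕊.⊗ (w 𝕊.⊕ E) 𝕊.⊕ monomial (c ⊕ α ⊗ evalM v α) (suc (suc n)) ∎
    where
      open 𝕊.Reasoning
      w = reversed (quotM v α)
      E = monomial (evalM v α) (suc n)

  reversed-root : ∀ {n} (v : Vec Carrier (suc n)) α → evalM v α ≈ 0# → reversed v 𝕊.≈ linear α 1 𝕊.⊗ reversed (quotM v α)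
  reversed-root {n} v α p = 𝕊.trans (reversed-quot v α) (𝕊.trans
    (𝕊.+-congˡ {linear α 1 𝕊.⊗ reversed (quotM v α)} (𝕊.trans (monomial-cong (suc n) p) (monomial-0 (suc n)))) (𝕊.+-identityʳ _))

  reversed-beyond : ∀ {n} (v : Vec Carrier n) k → n < k → reversed v k ≈ 0#
  reversed-beyond [] (suc k) _ = refl
  reversed-beyond {suc n} (c ∷ v) k n<k = trans (+-cong (reversed-beyond v k (ℕₚ.<-trans (ℕₚ.n<1+n n) n<k)) (go (suc n) k n<k)) (+-identityˡ _)
    where
      go : ∀ e k → e < k → monomial c e k ≈ 0#
      go zero (suc k) _ = refl
      go (suc e) (suc k) (s≤s p) = go e k p

  -- The polynomial X^(n+2) - X; starting at degree two keeps the term -X apart from the leading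
  -- one.
  xⁿ-x : ∀ n → Vec Carrier (suc (suc n))
  xⁿ-x n = 0# ∷ (- 1#) ∷ Vec.replicate n 0#

  eval-xⁿ-x : ∀ n x → evalM (xⁿ-x n) x ≈ x ↑ suc (suc n) ⊖ x
  eval-xⁿ-x n x = trans (+-congˡ (*-congˡ (+-congˡ (*-congˡ (go n)))))
    (solve 2 (λ x y → :0 :+ x :* (:- :1 :+ x :* y) := x :* (x :* y) :- x) refl x (x ↑ n))
    where
      go : ∀ n → evalM (Vec.replicate n 0#) x ≈ x ↑ n
      go zero = refl
      go (suc n) = trans (+-identityˡ _) (*-congˡ (go n))

IsDomain : CommutativeRing 0ℓ 0ℓ → Set
IsDomain R = ∀ a b → a ⊗ b ≈ 0# → a ≈ 0# ⊎ b ≈ 0#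
  where open Kit R

any-or-all : ∀ {n} {A B : Fin n → Set} → (∀ i → A i ⊎ B i) → (∃ λ i → A i) ⊎ (∀ i → B i)
any-or-all {zero} f = inj₂ λ ()
any-or-all {suc n} f with f zero | any-or-all (f ∘ suc)
... | inj₁ a | _ = inj₁ (zero , a)
... | inj₂ b | inj₁ (i , a) = inj₁ (suc i , a)
... | inj₂ b | inj₂ g = inj₂ λ { zero → b ; (suc i) → g i }

module Roots (R : CommutativeRing 0ℓ 0ℓ) (domain : IsDomain R) where
  open Kit R
  open Series R
  open Monic R

  root-of-quot : ∀ {n} (v : Vec Carrier (suc n)) α x → evalM v α ≈ 0# → evalM v x ≈ 0# → x ≈ α ⊎ evalM (quotM v α) x ≈ 0#
  root-of-quot v α x pα px with domain (x ⊖ α) (evalM (quotM v α) x)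
    (trans (sym (trans (+-congˡ pα) (+-identityʳ _))) (trans (sym (eval-quot v α x)) px))
  ... | inj₁ e = inj₁ (x∙y⁻¹≈ε⇒x≈y x α e)
  ... | inj₂ e = inj₂ e

  power-zero : ¬ (1# ≈ 0#) → ∀ x n → x ↑ n ≈ 0# → x ≈ 0#
  power-zero 1≉0 x zero e = ⊥-elim (1≉0 e)
  power-zero 1≉0 x (suc n) e with domain x _ e
  ... | inj₁ x≈0 = x≈0
  ... | inj₂ xⁿ≈0 = power-zero 1≉0 x n xⁿ≈0

  -- Equality in R is not assumed decidable, so the bound on the number of roots is stated
  -- positively, as a coincidence among n + 1 of them. After division by X - α₀ every other root
  -- either equals α₀ or is a root of the quotient.
  too-many-roots : ¬ (1# ≈ 0#) → ∀ {n} (v : Vec Carrier n) (α : Fin (suc n) → Carrier) → (∀ i → evalM v (α i) ≈ 0#) →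
    ∃ λ i → ∃ λ j → i Fin.< j × α i ≈ α j
  too-many-roots 1≉0 [] α p = ⊥-elim (1≉0 (p zero))
  too-many-roots 1≉0 {suc n} v@(_ ∷ _) α p with any-or-all (λ i → root-of-quot v (α zero) (α (suc i)) (p zero) (p (suc i)))
  ... | inj₁ (i , e) = zero , suc i , s≤s z≤n , sym e
  ... | inj₂ f with too-many-roots 1≉0 (quotM v (α zero)) (α ∘ suc) f
  ...   | i , j , i<j , e = suc i , suc j , s≤s i<j , e

  -- Distinct roots can be divided out one after the other. This turns `reversed v` into ∏ (1 - αᵢ
  -- t), whose power sums add up.
  powerSum-roots : ∀ {n} (v : Vec Carrier n) (α : Fin n → Carrier) → (∀ i → evalM v (α i) ≈ 0#) →
    (∀ i j → i Fin.< j → ¬ (α i ≈ α j)) → ∀ k → powerSum (reversed v) (suc k) ≈ sum (λ i → α i ↑ suc k)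
  powerSum-roots [] α p d k = at powerSum-1 (suc k)
  powerSum-roots {suc n} v@(_ ∷ _) α p d k = begin
    powerSum (reversed v) (suc k)
      ≈⟨ at (powerSum-cong (reversed-zero v) (reversed-root v (α zero) (p zero))) (suc k) ⟩
    powerSum (linear (α zero) 1 𝕊.⊗ reversed w) (suc k)
      ≈⟨ at (powerSum-⊗ (linear (α zero) 1) (reversed w) (linear-zero (α zero) 1 (s≤s z≤n)) (reversed-zero w)) (suc k) ⟩
    powerSum (linear (α zero) 1) (suc k) ⊕ powerSum (reversed w) (suc k)
      ≈⟨ +-cong (trans (reflexive (≡.cong (powerSum (linear (α zero) 1)) (≡.sym (ℕₚ.*-identityʳ (suc k))))) (trans (powerSum-linear (α zero) 1 (s≤s z≤n) k) (+-identityʳ _)))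
           (powerSum-roots w (α ∘ suc) (λ i → pick i (root-of-quot v (α zero) (α (suc i)) (p zero) (p (suc i)))) (λ i j i<j → d (suc i) (suc j) (s≤s i<j)) k) ⟩
    α zero ↑ suc k ⊕ sum (λ i → α (suc i) ↑ suc k) ∎
    where
      open Reasoning
      w = quotM v (α zero)
      pick : ∀ i → α (suc i) ≈ α zero ⊎ evalM w (α (suc i)) ≈ 0# → evalM w (α (suc i)) ≈ 0#
      pick i (inj₁ e) = ⊥-elim (d zero (suc i) (s≤s z≤n) (sym e))
      pick i (inj₂ e) = e

module MonicHom {A B : CommutativeRing 0ℓ 0ℓ} (φ : Hom A B) where
  private
    module A = Kit A
    module B = Kit B
    module SA = Series A
    module SB = Series B
    module MA = Monic A
    module MB = Monic B
  open Hom φ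

  evalM-homo : ∀ {n} (v : Vec A.Carrier n) x → ⟦ MA.evalM v x ⟧ B.≈ MB.evalM (Vec.map ⟦_⟧ v) ⟦ x ⟧
  evalM-homo [] x = 1-homo
  evalM-homo (c ∷ v) x = B.trans (⊕-homo _ _) (B.+-congˡ (B.trans (⊗-homo _ _) (B.*-congˡ (evalM-homo v x))))

  reversed-homo : ∀ {n} (v : Vec A.Carrier n) k → ⟦ MA.reversed v k ⟧ B.≈ MB.reversed (Vec.map ⟦_⟧ v) k
  reversed-homo [] zero = 1-homo
  reversed-homo [] (suc k) = 0-homo
  reversed-homo {suc n} (c ∷ v) k = B.trans (⊕-homo _ _) (B.+-cong (reversed-homo v k) (monomial-homo (suc n) k))
    where
      monomial-homo : ∀ e k → ⟦ SA.monomial c e k ⟧ B.≈ SB.monomial ⟦ c ⟧ e k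
      monomial-homo zero zero = B.refl
      monomial-homo zero (suc k) = 0-homo
      monomial-homo (suc e) zero = 0-homo
      monomial-homo (suc e) (suc k) = monomial-homo e k

module Polynomials (R : CommutativeRing 0ℓ 0ℓ) where
  open Kit R
  open Series R

  VanishesFrom : ℕ → Seq → Set
  VanishesFrom N f = ∀ n → N ≤ n → f n ≈ 0#

  conv-vanishes : ∀ N M {f g} → VanishesFrom N f → VanishesFrom M g → VanishesFrom (N ℕ.+ M) (conv f g)
  conv-vanishes zero M {f} {g} p r n _ = conv-zeroˡ f g (λ i → p i z≤n) n
  conv-vanishes (suc N) M p r (suc n) (s≤s le) = trans (+-cong
    (trans (*-congˡ (r (suc n) (ℕₚ.m≤n⇒m≤1+n (ℕₚ.m+n≤o⇒n≤o N le)))) (zeroʳ _))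
    (conv-vanishes N M (λ i le → p (suc i) (s≤s le)) r n le)) (+-identityˡ _)

  conv-top : ∀ a b {f g} → VanishesFrom (suc a) f → VanishesFrom (suc b) g → conv f g (a ℕ.+ b) ≈ f a ⊗ g b
  conv-top zero b {f} {g} p r = trans (conv-cong {g = g} (λ { zero → refl ; (suc i) → p (suc i) (s≤s z≤n) }) (λ _ → refl) b) (conv-constˡ (f 0) g b)
  conv-top (suc a) b p r = trans (+-cong
    (trans (*-congˡ (r (suc a ℕ.+ b) (s≤s (ℕₚ.m≤n+m b a)))) (zeroʳ _))
    (conv-top a b (λ i le → p (suc i) (s≤s le)) r)) (+-identityˡ _)

  conv-vanishes< : ∀ a b {f g} → VanishesFrom (suc a) f → VanishesFrom (suc b) g → VanishesFrom (suc (a ℕ.+ b)) (conv f g)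
  conv-vanishes< zero b {f} {g} p r n le = trans (conv-cong {g = g} (λ { zero → refl ; (suc i) → p (suc i) (s≤s z≤n) }) (λ _ → refl) n)
    (trans (conv-constˡ (f 0) g n) (trans (*-congˡ (r n le)) (zeroʳ _)))
  conv-vanishes< (suc a) b p r (suc n) (s≤s le) = trans (+-cong
    (trans (*-congˡ (r (suc n) (s≤s (ℕₚ.≤-trans (ℕₚ.m≤n+m b (suc a)) le)))) (zeroʳ _))
    (conv-vanishes< a b (λ i le → p (suc i) (s≤s le)) r n le)) (+-identityˡ _)

  -- `bound` is some bound and not the degree, which cannot be computed over a ring without
  -- decidable equality. Equality of polynomials ignores it.
  record Poly : Set where
    no-eta-equality
    field
      coeff : Seq
      bound : ℕ
      vanish : VanishesFrom bound coeff
  open Poly public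

  infix 4 _≈ₚ_
  record _≈ₚ_ (f g : Poly) : Set where
    constructor mk
    field eq : coeff f 𝕊.≈ coeff g
  open _≈ₚ_ public

  _+ₚ_ _*ₚ_ : Poly → Poly → Poly
  coeff (f +ₚ g) n = coeff f n ⊕ coeff g n
  bound (f +ₚ g) = bound f ℕ.⊔ bound g
  vanish (f +ₚ g) n le = trans (+-cong (vanish f n (ℕₚ.m⊔n≤o⇒m≤o (bound f) (bound g) le)) (vanish g n (ℕₚ.m⊔n≤o⇒n≤o (bound f) (bound g) le))) (+-identityˡ _)
  coeff (f *ₚ g) = conv (coeff f) (coeff g)
  bound (f *ₚ g) = bound f ℕ.+ bound g
  vanish (f *ₚ g) = conv-vanishes (bound f) (bound g) (vanish f) (vanish g)

  -ₚ_ : Poly → Poly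
  coeff (-ₚ f) n = - coeff f n
  bound (-ₚ f) = bound f
  vanish (-ₚ f) n le = trans (-‿cong (vanish f n le)) -0#≈0#

  0ₚ : Poly
  coeff 0ₚ n = 0#
  bound 0ₚ = 0
  vanish 0ₚ n le = refl

  constant : Carrier → Poly
  coeff (constant a) = const a
  bound (constant a) = 1
  vanish (constant a) (suc n) le = refl

  X : Poly
  coeff X = shift 1 (const 1#)
  bound X = 2
  vanish X (suc zero) (s≤s ())
  vanish X (suc (suc n)) le = refl

  polyRing : CommutativeRing 0ℓ 0ℓ
  polyRing = toCommutativeRing {Poly} record
    { _≈_ = _≈ₚ_
    ; add = _+ₚ_ ; mul = _*ₚ_ ; neg = -ₚ_ ; zer = 0ₚ ; one = constant 1#
    ; refl = mk 𝕊.refl ; sym = λ (mk p) → mk (𝕊.sym p) ; trans = λ (mk p) (mk r) → mk (𝕊.trans p r)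
    ; add-cong = λ (mk p) (mk r) → mk (𝕊.+-cong p r)
    ; mul-cong = λ (mk p) (mk r) → mk (𝕊.*-cong p r)
    ; neg-cong = λ (mk p) → mk (𝕊.-‿cong p)
    ; add-assoc = λ f g h → mk (𝕊.+-assoc (coeff f) (coeff g) (coeff h))
    ; add-comm = λ f g → mk (𝕊.+-comm (coeff f) (coeff g))
    ; add-zero = λ f → mk (𝕊.+-identityˡ (coeff f))
    ; add-neg = λ f → mk (𝕊.-‿inverseˡ (coeff f))
    ; mul-assoc = λ f g h → mk (𝕊.*-assoc (coeff f) (coeff g) (coeff h))
    ; mul-comm = λ f g → mk (𝕊.*-comm (coeff f) (coeff g))
    ; mul-one = λ f → mk (𝕊.*-identityˡ (coeff f))
    ; distrib = λ f g h → mk (𝕊.distribˡ (coeff f) (coeff g) (coeff h))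
    }

  module ℙ = Kit polyRing

  constants : Hom R polyRing
  constants = record
    { ⟦_⟧ = constant
    ; cong = λ p → mk (mk λ { zero → p ; (suc _) → refl })
    ; ⊕-homo = λ a b → mk (mk λ { zero → refl ; (suc _) → sym (+-identityˡ _) })
    ; ⊗-homo = λ a b → mk (mk λ { zero → refl ; (suc n) → sym (trans (conv-constˡ a (const b) (suc n)) (zeroʳ _)) })
    ; neg-homo = λ a → mk (mk λ { zero → refl ; (suc _) → sym -0#≈0# })
    ; 0-homo = mk (mk λ { zero → refl ; (suc _) → refl })
    ; 1-homo = mk (mk λ _ → refl) }

  C : Carrier → Poly
  C = Hom.⟦_⟧ constants

  coeff-C⊗ : ∀ a f n → coeff (C a ℙ.⊗ f) n ≈ a ⊗ coeff f n
  coeff-C⊗ a f n = conv-constˡ a (coeff f) n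

  coeff-X⊗ : ∀ f n → coeff (X ℙ.⊗ f) n ≈ shift 1 (coeff f) n
  coeff-X⊗ f n = trans (conv-monomialˡ 1# 1 (coeff f) n) (shift-cong 1 (λ i → *-identityˡ _) n)

  tail : Poly → Poly
  coeff (tail f) = coeff f ∘ suc
  bound (tail f) = bound f ∸ 1
  vanish (tail f) n le = vanish f (suc n) (ℕₚ.≤-trans (ℕₚ.m≤n+m∸n (bound f) 1) (s≤s le))

  horner : ∀ f → f ℙ.≈ C (coeff f 0) ℙ.⊕ X ℙ.⊗ tail f
  horner f = mk (mk λ where
    zero → sym (trans (+-congˡ (coeff-X⊗ (tail f) 0)) (+-identityʳ _))
    (suc n) → sym (trans (+-congˡ (coeff-X⊗ (tail f) (suc n))) (+-identityˡ _)))

  poly-induction : (P : Poly → Set) → (∀ {f g} → f ℙ.≈ g → P f → P g) → P ℙ.0# →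
    (∀ a f → P f → P (C a ℙ.⊕ X ℙ.⊗ f)) → ∀ f → P f
  poly-induction P resp P0 step f = go (bound f) f ℕₚ.≤-refl
    where
      go : ∀ N f → bound f ≤ N → P f
      go zero f le = resp (mk (mk λ n → sym (vanish f n (ℕₚ.≤-trans le z≤n)))) P0
      go (suc N) f le = resp (ℙ.sym (horner f)) (step (coeff f 0) (tail f) (go N (tail f) (ℕₚ.∸-monoˡ-≤ 1 le)))

  expand : ∀ D f → VanishesFrom D (coeff f) → f ℙ.≈ ℙ.sum {D} (λ i → C (coeff f (toℕ i)) ℙ.⊗ X ℙ.↑ toℕ i)
  expand zero f p = mk (mk λ n → p n z≤n)
  expand (suc D) f p = ℙ.trans (horner f) (ℙ.+-cong (ℙ.sym (ℙ.*-identityʳ _)) (begin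
    X ℙ.⊗ tail f ≈⟨ ℙ.*-congˡ (expand D (tail f) (λ n le → p (suc n) (s≤s le))) ⟩
    X ℙ.⊗ ℙ.sum {D} (λ i → C (coeff f (suc (toℕ i))) ℙ.⊗ X ℙ.↑ toℕ i) ≈⟨ ℙ.*-distribˡ-sum {D} X _ ⟩
    ℙ.sum {D} (λ i → X ℙ.⊗ (C (coeff f (suc (toℕ i))) ℙ.⊗ X ℙ.↑ toℕ i))
      ≈⟨ ℙ.sum-cong-≋ {D} (λ i → ℙ.solve 3 (λ x c y → x ℙ.:* (c ℙ.:* y) ℙ.:= c ℙ.:* (x ℙ.:* y)) ℙ.refl X (C (coeff f (suc (toℕ i)))) (X ℙ.↑ toℕ i)) ⟩
    ℙ.sum {D} (λ i → C (coeff f (suc (toℕ i))) ℙ.⊗ X ℙ.↑ suc (toℕ i)) ∎))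
    where open ℙ.Reasoning

  open Monic R using (reversed)
  open Monic polyRing using () renaming (evalM to evalMₚ)

  toPoly : ∀ {n} → Vec Carrier n → Poly
  toPoly v = evalMₚ (Vec.map C v) X

  toPoly-∷ : ∀ {n} c (v : Vec Carrier n) k → coeff (toPoly (c ∷ v)) k ≈ const c k ⊕ shift 1 (coeff (toPoly v)) k
  toPoly-∷ c v k = +-congˡ (coeff-X⊗ (toPoly v) k)

  toPoly-top : ∀ {n} (v : Vec Carrier n) → coeff (toPoly v) n ≈ 1#
  toPoly-top [] = refl
  toPoly-top {suc n} (c ∷ v) = trans (toPoly-∷ c v (suc n)) (trans (+-identityˡ _) (toPoly-top v))

  toPoly-vanish : ∀ {n} (v : Vec Carrier n) → VanishesFrom (suc n) (coeff (toPoly v))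
  toPoly-vanish [] (suc k) _ = refl
  toPoly-vanish (c ∷ v) (suc k) (s≤s le) = trans (toPoly-∷ c v (suc k)) (trans (+-identityˡ _) (toPoly-vanish v k le))

  record Division (f p : Poly) (n : ℕ) : Set where
    field
      quo rem : Poly
      division : f ℙ.≈ quo ℙ.⊗ p ℙ.⊕ rem
      rem-vanish : VanishesFrom n (coeff rem)

  -- Horner induction on the dividend: if r is the remainder of f, then a + X r may reach degree n,
  -- and subtracting the monic divisor times its coefficient `t` at n brings it below n again.
  divide : ∀ {n} (v : Vec Carrier n) f → Division f (toPoly v) n
  divide {n} v = poly-induction (λ f → Division f p n) resp base step
    where
      p = toPoly v
      open Division
      resp : ∀ {f g} → f ℙ.≈ g → Division f p n → Division g p n
      resp e d = record { quo = quo d ; rem = rem d ; division = ℙ.trans (ℙ.sym e) (division d) ; rem-vanish = rem-vanish d }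
      base : Division ℙ.0# p n
      base = record { quo = ℙ.0# ; rem = ℙ.0# ; division = ℙ.solve 1 (λ p → ℙ.:0 ℙ.:= ℙ.:0 ℙ.:* p ℙ.:+ ℙ.:0) ℙ.refl p ; rem-vanish = λ _ _ → refl }
      step : ∀ a f → Division f p n → Division (C a ℙ.⊕ X ℙ.⊗ f) p n
      step a f d = record
        { quo = C t ℙ.⊕ X ℙ.⊗ quo d
        ; rem = s ℙ.⊖ C t ℙ.⊗ p
        ; division = ℙ.trans (ℙ.+-congˡ {C a} (ℙ.*-congˡ {X} (division d)))
            (ℙ.solve 6 (λ a x q p r t → a ℙ.:+ x ℙ.:* (q ℙ.:* p ℙ.:+ r) ℙ.:= (t ℙ.:+ x ℙ.:* q) ℙ.:* p ℙ.:+ ((a ℙ.:+ x ℙ.:* r) ℙ.:- t ℙ.:* p)) ℙ.refl (C a) X (quo d) p (rem d) (C t))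
        ; rem-vanish = vanishing }
        where
          s = C a ℙ.⊕ X ℙ.⊗ rem d
          t = coeff s n
          coeff-s : ∀ k → n < k → coeff s k ≈ 0#
          coeff-s (suc k) (s≤s le) = trans (+-cong refl (coeff-X⊗ (rem d) (suc k))) (trans (+-identityˡ _) (rem-vanish d k le))
          vanishing : VanishesFrom n (coeff (s ℙ.⊖ C t ℙ.⊗ p))
          vanishing k le with ℕₚ.m≤n⇒m<n∨m≡n le
          ... | inj₁ n<k = trans (+-cong (coeff-s k n<k) (trans (-‿cong (trans (coeff-C⊗ t p k) (trans (*-congˡ (toPoly-vanish v k n<k)) (zeroʳ _)))) -0#≈0#)) (+-identityˡ _)
          ... | inj₂ ≡.refl = trans (+-congˡ (-‿cong (trans (coeff-C⊗ t p n) (trans (*-congˡ (toPoly-top v)) (*-identityʳ _))))) (-‿inverseʳ _)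

  -- Over any ring the leading coefficient of u survives multiplication by a monic polynomial.
  -- Descending from `bound u`, each coefficient of u is thus recognised as a coefficient of the
  -- product.
  cofactor-vanish : ∀ {n} (v : Vec Carrier n) u N → VanishesFrom (N ℕ.+ n) (coeff (u ℙ.⊗ toPoly v)) → VanishesFrom N (coeff u)
  cofactor-vanish {n} v u N p = go (bound u) (λ k le → vanish u k (ℕₚ.m+n≤o⇒m≤o (bound u) le))
    where
      go : ∀ a → VanishesFrom (a ℕ.+ N) (coeff u) → VanishesFrom N (coeff u)
      go zero r = r
      go (suc a) r = go a λ k le → case k (ℕₚ.m≤n⇒m<n∨m≡n le)
        where
          case : ∀ k → a ℕ.+ N < k ⊎ a ℕ.+ N ≡ k → coeff u k ≈ 0#
          case k (inj₁ lt) = r k lt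
          case k (inj₂ ≡.refl) = begin
            coeff u (a ℕ.+ N) ≈⟨ sym (trans (*-congˡ (toPoly-top v)) (*-identityʳ _)) ⟩
            coeff u (a ℕ.+ N) ⊗ coeff (toPoly v) n ≈⟨ sym (conv-top (a ℕ.+ N) n r (toPoly-vanish v)) ⟩
            coeff (u ℙ.⊗ toPoly v) ((a ℕ.+ N) ℕ.+ n) ≈⟨ p _ (ℕₚ.+-monoˡ-≤ n (ℕₚ.m≤n+m N a)) ⟩
            0# ∎
            where open Reasoning

  multiple-vanish : ∀ {n} (v : Vec Carrier n) u → VanishesFrom n (coeff (u ℙ.⊗ toPoly v)) → u ℙ.≈ ℙ.0#
  multiple-vanish v u p = mk (mk λ k → cofactor-vanish v u 0 p k z≤n)

-- Finite fields

module SingleTerm (M : CommutativeMonoid 0ℓ 0ℓ) where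
  open CommutativeMonoid M
  open Algebra.Properties.CommutativeMonoid.Sum M using (sum; sum-replicate-zero; sum-cong-≋)

  sum-ε : ∀ {n} (f : Fin n → Carrier) → (∀ i → f i ≈ ε) → sum f ≈ ε
  sum-ε {n} f p = trans (sum-cong-≋ p) (sum-replicate-zero n)

  sum-single : ∀ {n} (f : Fin n → Carrier) i → (∀ j → j ≢ i → f j ≈ ε) → sum f ≈ f i
  sum-single {suc n} f zero p = trans (∙-congˡ (sum-ε (f ∘ suc) (λ j → p (suc j) λ ()))) (identityʳ _)
  sum-single {suc n} f (suc i) p = trans (∙-cong (p zero λ ()) (sum-single (f ∘ suc) i (λ j j≢i → p (suc j) (j≢i ∘ Finₚ.suc-injective)))) (identityˡ _)

absorption : ∀ n k → suc k * (suc n choose suc k) ≡ suc n * (n choose k)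
absorption zero zero = ≡.refl
absorption zero (suc k) = ≡.trans (≡.cong (suc (suc k) *_) (k>n⇒nCk≡0 {1} {suc (suc k)} (s≤s (s≤s z≤n))))
  (≡.trans (ℕₚ.*-zeroʳ (suc (suc k))) (≡.sym (≡.trans (ℕₚ.*-identityˡ _) (k>n⇒nCk≡0 {0} {suc k} (s≤s z≤n)))))
absorption (suc n) zero = ≡.trans (ℕₚ.*-identityˡ _) (≡.trans (nC1≡n (suc (suc n))) (≡.sym (ℕₚ.*-identityʳ _)))
absorption (suc n) (suc k) = begin
  suc (suc k) * (suc (suc n) choose suc (suc k)) ≡⟨ ≡.cong (suc (suc k) *_) (nCk+nC[k+1]≡[n+1]C[k+1] (suc n) (suc k)) ⟨
  suc (suc k) * (a + b) ≡⟨ solve 3 (λ k a b → (con 2 :+ k) :* (a :+ b) := a :+ ((con 1 :+ k) :* a :+ (con 2 :+ k) :* b)) ≡.refl k a b ⟩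
  a + (suc k * a + suc (suc k) * b) ≡⟨ ≡.cong (a +_) (≡.cong₂ _+_ (absorption n k) (absorption n (suc k))) ⟩
  a + (suc n * (n choose k) + suc n * (n choose suc k)) ≡⟨ ≡.cong (a +_) (≡.sym (ℕₚ.*-distribˡ-+ (suc n) (n choose k) (n choose suc k))) ⟩
  a + suc n * (n choose k + n choose suc k) ≡⟨ ≡.cong (λ x → a + suc n * x) (nCk+nC[k+1]≡[n+1]C[k+1] n k) ⟩
  suc (suc n) * (suc n choose suc k) ∎
  where
    open ≡.≡-Reasoning
    open Data.Nat.Solver.+-*-Solver
    a = suc n choose suc k
    b = suc n choose suc (suc k)

-- By absorption p divides (k + 1) times the binomial coefficient, and it does not divide k + 1.
prime∣C : ∀ {p} → Prime p → ∀ k → suc k < p → p ∣ (p choose suc k)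
prime∣C {suc n} pr k k<p with euclidsLemma (suc k) (suc n choose suc k) pr (divides (n choose k) (≡.trans (absorption n k) (ℕₚ.*-comm (suc n) (n choose k))))
... | inj₁ p∣k = ⊥-elim (Div.>⇒∤ k<p p∣k)
... | inj₂ p∣C = p∣C

module Frobenius (B : CommutativeRing 0ℓ 0ℓ) {p : ℕ} (pr : Prime p) (p·1≈0 : Kit._≈_ B (Kit._·_ B p (Kit.1# B)) (Kit.0# B)) where
  open Kit B
  module Bin = Algebra.Properties.CommutativeSemiring.Binomial commutativeSemiring

  multiple·≈0 : ∀ {m} x → p ∣ m → m · x ≈ 0#
  multiple·≈0 x (divides k ≡.refl) = begin
    (k ℕ.* p) · x ≈⟨ sym (×-assocˡ x k p) ⟩
    k · (p · x) ≈⟨ ×-congʳ k (×-congʳ p (sym (*-identityˡ x))) ⟩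
    k · (p · (1# ⊗ x)) ≈⟨ ×-congʳ k (sym (×-assoc-* p 1# x)) ⟩
    k · ((p · 1#) ⊗ x) ≈⟨ ×-congʳ k (trans (*-congʳ p·1≈0) (zeroˡ x)) ⟩
    k · 0# ≈⟨ Series.·-zero B k ⟩
    0# ∎
    where open Reasoning

  ↑p-⊕ : ∀ x y → (x ⊕ y) ↑ p ≈ x ↑ p ⊕ y ↑ p
  ↑p-⊕ x y = go p pr ≡.refl
    where
      open Algebra.Properties.Monoid.Sum (CommutativeRing.+-monoid B) using (sum-init-last)
      go : ∀ m → Prime m → m ≡ p → (x ⊕ y) ↑ m ≈ x ↑ m ⊕ y ↑ m
      go zero prm _ = ⊥-elim (ℕ.NonZero.nonZero (prime⇒nonZero prm))
      go m@(suc m′) prm ≡.refl = begin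
        (x ⊕ y) ↑ m ≈⟨ Bin.theorem m x y ⟩
        sum t ≈⟨ sum-init-last t ⟩
        (t zero ⊕ sum (λ i → t (suc (Fin.inject₁ i)))) ⊕ t (suc (fromℕ m′))
          ≈⟨ +-cong (+-cong first (SingleTerm.sum-ε (CommutativeRing.+-commutativeMonoid B) (λ (i : Fin m′) → t (suc (Fin.inject₁ i))) middle)) last ⟩
        (y ↑ m ⊕ 0#) ⊕ x ↑ m ≈⟨ solve 2 (λ a b → (b :+ :0) :+ a := a :+ b) refl (x ↑ m) (y ↑ m) ⟩
        x ↑ m ⊕ y ↑ m ∎
        where
          open Reasoning
          t : Fin (suc m) → Carrier
          t = Bin.binomialTerm x y m
          first : t zero ≈ y ↑ m
          first = trans (+-identityʳ _) (*-identityˡ _)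
          middle : ∀ i → t (suc (Fin.inject₁ i)) ≈ 0#
          middle i = multiple·≈0 _ (prime∣C prm (toℕ (Fin.inject₁ i)) (s≤s (≡.subst (_< m′) (≡.sym (Finₚ.toℕ-inject₁ i)) (Finₚ.toℕ<n i))))
          last : t (suc (fromℕ m′)) ≈ x ↑ m
          last = trans (×-congˡ (≡.trans (≡.cong (λ k → m choose suc k) (Finₚ.toℕ-fromℕ m′)) (nCn≡1 m)))
            (trans (+-identityʳ _) (trans (*-cong (^-congʳ x (≡.cong suc (Finₚ.toℕ-fromℕ m′)))
              (^-congʳ y (≡.trans (≡.cong (m ∸_) (≡.cong suc (Finₚ.toℕ-fromℕ m′))) (ℕₚ.n∸n≡0 m)))) (*-identityʳ _)))

  ↑p^k-⊕ : ∀ k x y → (x ⊕ y) ↑ (p ^ k) ≈ x ↑ (p ^ k) ⊕ y ↑ (p ^ k)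
  ↑p^k-⊕ zero x y = trans (*-identityʳ _) (sym (+-cong (*-identityʳ _) (*-identityʳ _)))
  ↑p^k-⊕ (suc k) x y = begin
    (x ⊕ y) ↑ (p ℕ.* p ^ k) ≈⟨ sym (^-assocʳ _ p (p ^ k)) ⟩
    ((x ⊕ y) ↑ p) ↑ (p ^ k) ≈⟨ ^-congˡ (p ^ k) (↑p-⊕ x y) ⟩
    (x ↑ p ⊕ y ↑ p) ↑ (p ^ k) ≈⟨ ↑p^k-⊕ k _ _ ⟩
    (x ↑ p) ↑ (p ^ k) ⊕ (y ↑ p) ↑ (p ^ k) ≈⟨ +-cong (^-assocʳ x p (p ^ k)) (^-assocʳ y p (p ^ k)) ⟩
    x ↑ (p ℕ.* p ^ k) ⊕ y ↑ (p ℕ.* p ^ k) ∎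
    where open Reasoning

record FrobeniusRing (q : ℕ) (B : CommutativeRing 0ℓ 0ℓ) : Set where
  open Kit B
  field
    positive : 1 ≤ q
    additive : ∀ x y → (x ⊕ y) ↑ q ≈ x ↑ q ⊕ y ↑ q

module FrobeniusPowers {q B} (frob : FrobeniusRing q B) where
  open Kit B
  open FrobeniusRing frob

  q^-positive : ∀ i → 1 ≤ q ^ i
  q^-positive zero = s≤s z≤n
  q^-positive (suc i) = ℕₚ.*-mono-≤ positive (q^-positive i)

  ↑q^-⊕ : ∀ i x y → (x ⊕ y) ↑ (q ^ i) ≈ x ↑ (q ^ i) ⊕ y ↑ (q ^ i)
  ↑q^-⊕ zero x y = trans (*-identityʳ _) (sym (+-cong (*-identityʳ _) (*-identityʳ _)))
  ↑q^-⊕ (suc k) x y = begin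
    (x ⊕ y) ↑ (q ℕ.* q ^ k) ≈⟨ sym (^-assocʳ _ q (q ^ k)) ⟩
    ((x ⊕ y) ↑ q) ↑ (q ^ k) ≈⟨ ^-congˡ (q ^ k) (additive x y) ⟩
    (x ↑ q ⊕ y ↑ q) ↑ (q ^ k) ≈⟨ ↑q^-⊕ k _ _ ⟩
    (x ↑ q) ↑ (q ^ k) ⊕ (y ↑ q) ↑ (q ^ k) ≈⟨ +-cong (^-assocʳ x q (q ^ k)) (^-assocʳ y q (q ^ k)) ⟩
    x ↑ (q ℕ.* q ^ k) ⊕ y ↑ (q ℕ.* q ^ k) ∎
    where open Reasoning

  0↑ : ∀ n → 1 ≤ n → 0# ↑ n ≈ 0#
  0↑ (suc n) _ = zeroˡ _

  ↑q^-0 : ∀ i → 0# ↑ (q ^ i) ≈ 0#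
  ↑q^-0 i = 0↑ (q ^ i) (q^-positive i)

  ↑q^-⊖ : ∀ i x y → (x ⊖ y) ↑ (q ^ i) ≈ x ↑ (q ^ i) ⊖ y ↑ (q ^ i)
  ↑q^-⊖ i x y = begin
    (x ⊖ y) ↑ Q ≈⟨ solve 2 (λ a b → a := (a :+ b) :- b) refl _ (y ↑ Q) ⟩
    ((x ⊖ y) ↑ Q ⊕ y ↑ Q) ⊖ y ↑ Q ≈⟨ +-congʳ (sym (↑q^-⊕ i (x ⊖ y) y)) ⟩
    ((x ⊖ y) ⊕ y) ↑ Q ⊖ y ↑ Q ≈⟨ +-congʳ (^-congˡ Q (solve 2 (λ x y → (x :- y) :+ y := x) refl x y)) ⟩
    x ↑ Q ⊖ y ↑ Q ∎
    where
      open Reasoning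
      Q = q ^ i

  ↑q^-sum : ∀ i {n} (f : Fin n → Carrier) → sum f ↑ (q ^ i) ≈ sum (λ j → f j ↑ (q ^ i))
  ↑q^-sum i {zero} f = ↑q^-0 i
  ↑q^-sum i {suc n} f = trans (↑q^-⊕ i _ _) (+-congˡ (↑q^-sum i (f ∘ suc)))

  ↑q^-comm : ∀ x i j → (x ↑ (q ^ i)) ↑ (q ^ j) ≈ x ↑ (q ^ (i ℕ.+ j))
  ↑q^-comm x i j = trans (^-assocʳ x (q ^ i) (q ^ j)) (^-congʳ x (≡.sym (ℕₚ.^-distribˡ-+-* q i j)))

module Field {q : ℕ} (F : FiniteField q) (pp : IsPrimePower q) where
  open FiniteField F using (commRing; 1≉0; inverse; enum; index; enum-index; index-enum; index-cong) public
  open Kit commRing public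

  char : ℕ
  char = proj₁ pp

  p-prime : Prime char
  p-prime = proj₁ (proj₂ (proj₂ pp))

  q≡p^k : q ≡ char ^ proj₁ (proj₂ pp)
  q≡p^k = proj₂ (proj₂ (proj₂ (proj₂ pp)))

  2≤q : 2 ≤ q
  2≤q = ℕₚ.≤-trans (ℕ.nonTrivial⇒n>1 char {{prime⇒nonTrivial p-prime}})
    (ℕₚ.≤-trans (ℕₚ.≤-reflexive (≡.sym (ℕₚ.*-identityʳ char))) (ℕₚ.≤-trans (ℕₚ.^-monoʳ-≤ char {{prime⇒nonZero p-prime}} (proj₁ (proj₂ (proj₂ (proj₂ pp))))) (ℕₚ.≤-reflexive (≡.sym q≡p^k))))

  1≤q : 1 ≤ q
  1≤q = ℕₚ.≤-trans (s≤s z≤n) 2≤q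

  index-injective : ∀ {x y} → index x ≡ index y → x ≈ y
  index-injective {x} {y} e = trans (sym (enum-index x)) (trans (reflexive (≡.cong enum e)) (enum-index y))

  infix 4 _≟_
  _≟_ : ∀ x y → Dec (x ≈ y)
  x ≟ y with index x Finₚ.≟ index y
  ... | yes e = yes (index-injective e)
  ... | no ne = no λ e → ne (index-cong e)

  domain : IsDomain commRing
  domain a b ab≈0 with a ≟ 0#
  ... | yes e = inj₁ e
  ... | no a≉0 = inj₂ (begin
    b ≈⟨ sym (*-identityˡ b) ⟩
    1# ⊗ b ≈⟨ *-congʳ (sym (proj₂ (inverse a a≉0))) ⟩
    (a ⊗ a⁻¹) ⊗ b ≈⟨ solve 3 (λ a i b → (a :* i) :* b := i :* (a :* b)) refl a a⁻¹ b ⟩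
    a⁻¹ ⊗ (a ⊗ b) ≈⟨ trans (*-congˡ ab≈0) (zeroʳ _) ⟩
    0# ∎)
    where
      open Reasoning
      a⁻¹ = proj₁ (inverse a a≉0)

  bijection : (f g : Carrier → Carrier) → (∀ {x y} → x ≈ y → f x ≈ f y) → (∀ {x y} → x ≈ y → g x ≈ g y) →
    (∀ x → f (g x) ≈ x) → (∀ x → g (f x) ≈ x) → Perm.Permutation q q
  bijection f g f-cong g-cong fg gf = Perm.permutation (λ i → index (f (enum i))) (λ i → index (g (enum i)))
    (λ i → ≡.trans (index-cong (trans (f-cong (enum-index _)) (fg _))) (index-enum i))
    (λ i → ≡.trans (index-cong (trans (g-cong (enum-index _)) (gf _))) (index-enum i))

  module _ (M : CommutativeMonoid 0ℓ 0ℓ) where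
    private
      module M = CommutativeMonoid M
      module ΣM = Algebra.Properties.CommutativeMonoid.Sum M

    sum-bijection : (φ : Carrier → M.Carrier) → (∀ {x y} → x ≈ y → φ x M.≈ φ y) →
      (f g : Carrier → Carrier) → (∀ {x y} → x ≈ y → f x ≈ f y) → (∀ {x y} → x ≈ y → g x ≈ g y) →
      (∀ x → f (g x) ≈ x) → (∀ x → g (f x) ≈ x) →
      ΣM.sum {q} (λ i → φ (enum i)) M.≈ ΣM.sum {q} (λ i → φ (f (enum i)))
    sum-bijection φ φ-cong f g f-cong g-cong fg gf = M.trans
      (ΣM.sum-permute {q} {q} (λ i → φ (enum i)) (bijection f g f-cong g-cong fg gf))
      (ΣM.sum-cong-≋ {q} (λ i → φ-cong (enum-index _)))

  -- Translation by 1 permutes the field, so the sum of all elements does not change although each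
  -- of the q summands grows by 1.
  q·1≈0 : q · 1# ≈ 0#
  q·1≈0 = begin
    q · 1# ≈⟨ sym (sum-replicate q) ⟩
    sum {q} (λ _ → 1#) ≈⟨ solve 2 (λ s t → t := (s :+ t) :- s) refl (sum {q} enum) _ ⟩
    (sum {q} enum ⊕ sum {q} (λ _ → 1#)) ⊖ sum {q} enum ≈⟨ +-congʳ (sym (∑-distrib-+ {q} enum (λ _ → 1#))) ⟩
    sum {q} (λ i → enum i ⊕ 1#) ⊖ sum {q} enum
      ≈⟨ +-congʳ (sym (sum-bijection (CommutativeRing.+-commutativeMonoid commRing) (λ x → x) (λ e → e) (_⊕ 1#) (_⊖ 1#) +-congʳ +-congʳ
           (solve 1 (λ x → (x :- :1) :+ :1 := x) refl) (solve 1 (λ x → (x :+ :1) :- :1 := x) refl))) ⟩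
    sum {q} enum ⊖ sum {q} enum ≈⟨ -‿inverseʳ _ ⟩
    0# ∎
    where open Reasoning

  -- A power of `char · 1#` equals `q · 1#`, and a domain has no nilpotent elements.
  p·1≈0 : char · 1# ≈ 0#
  p·1≈0 = Roots.power-zero commRing domain 1≉0 (char · 1#) (proj₁ (proj₂ pp)) (trans (sym (go (proj₁ (proj₂ pp)))) (trans (×-congˡ (≡.sym q≡p^k)) q·1≈0))
    where
      go : ∀ k → (char ^ k) · 1# ≈ (char · 1#) ↑ k
      go zero = +-identityʳ _
      go (suc k) = trans (×1-homo-* char (char ^ k)) (*-congˡ (go k))

  frobeniusRing : ∀ {B} → Hom commRing B → FrobeniusRing q B
  frobeniusRing {B} φ = record { positive = 1≤q ; additive = ≡.subst (λ m → ∀ x y → (x B.⊕ y) B.↑ m B.≈ x B.↑ m B.⊕ y B.↑ m) (≡.sym q≡p^k)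
      (Frobenius.↑p^k-⊕ B p-prime (B.trans (B.×-congʳ char (B.sym (Hom.1-homo φ))) (B.trans (B.sym (Hom.·-homo φ char 1#)) (B.trans (Hom.cong φ p·1≈0) (Hom.0-homo φ)))) (proj₁ (proj₂ pp))) }
    where module B = Kit B

  -- For a ≠ 0 multiplication by a permutes the field. `g` replaces 0 by 1, which makes the product
  -- Πg over all elements nonzero, and Πg = Πw Πg gives a^(q-1) = Πw = 1. The one factor a that `w`
  -- omits, at 0, is supplied by `δ`.
  fermat : ∀ a → a ↑ q ≈ a
  fermat a with a ≟ 0#
  ... | yes a≈0 = trans (^-congˡ q a≈0) (trans (FrobeniusPowers.0↑ (frobeniusRing idₕ) q 1≤q) (sym a≈0))
  ... | no a≉0 = begin
    a ↑ q ≈⟨ sym (Π.sum-replicate q) ⟩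
    Π.sum {q} (λ _ → a) ≈⟨ Π.sum-cong-≋ {q} (λ i → split (enum i)) ⟩
    Π.sum {q} (λ i → w (enum i) ⊗ δ (enum i)) ≈⟨ Π.∑-distrib-+ {q} (w ∘ enum) (δ ∘ enum) ⟩
    Π.sum {q} (w ∘ enum) ⊗ Π.sum {q} (δ ∘ enum) ≈⟨ *-cong Πw≈1 Πδ≈a ⟩
    1# ⊗ a ≈⟨ *-identityˡ a ⟩
    a ∎
    where
      open Reasoning
      M = CommutativeRing.*-commutativeMonoid commRing
      module Π = Algebra.Properties.CommutativeMonoid.Sum M
      g w δ : Carrier → Carrier
      g b with b ≟ 0#
      ... | yes _ = 1#
      ... | no _ = b
      w b with b ≟ 0#
      ... | yes _ = 1#
      ... | no _ = a
      δ b with b ≟ 0#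
      ... | yes _ = a
      ... | no _ = 1#
      split : ∀ b → a ≈ w b ⊗ δ b
      split b with b ≟ 0#
      ... | yes _ = sym (*-identityˡ a)
      ... | no _ = sym (*-identityʳ a)
      g-cong : ∀ {x y} → x ≈ y → g x ≈ g y
      g-cong {x} {y} e with x ≟ 0# | y ≟ 0#
      ... | yes _ | yes _ = refl
      ... | yes x≈0 | no y≉0 = ⊥-elim (y≉0 (trans (sym e) x≈0))
      ... | no x≉0 | yes y≈0 = ⊥-elim (x≉0 (trans e y≈0))
      ... | no _ | no _ = e
      g≉0 : ∀ b → ¬ (g b ≈ 0#)
      g≉0 b with b ≟ 0#
      ... | yes _ = 1≉0
      ... | no b≉0 = b≉0
      Πg≉0 : ∀ {n} (f : Fin n → Carrier) → ¬ (Π.sum (g ∘ f) ≈ 0#)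
      Πg≉0 {zero} f = 1≉0
      Πg≉0 {suc n} f e with domain _ _ e
      ... | inj₁ e′ = g≉0 (f zero) e′
      ... | inj₂ e′ = Πg≉0 (f ∘ suc) e′
      a⁻¹ = proj₁ (inverse a a≉0)
      aa⁻¹ = proj₂ (inverse a a≉0)
      cancel : ∀ x → a ⊗ (a⁻¹ ⊗ x) ≈ x
      cancel x = trans (sym (*-assoc a a⁻¹ x)) (trans (*-congʳ aa⁻¹) (*-identityˡ x))
      g-scale : ∀ b → g (a ⊗ b) ≈ w b ⊗ g b
      g-scale b with b ≟ 0# | a ⊗ b ≟ 0#
      ... | yes _ | yes _ = sym (*-identityˡ 1#)
      ... | yes b≈0 | no ab≉0 = ⊥-elim (ab≉0 (trans (*-congˡ b≈0) (zeroʳ a)))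
      ... | no b≉0 | no _ = refl
      ... | no b≉0 | yes ab≈0 with domain a b ab≈0
      ...   | inj₁ e = ⊥-elim (a≉0 e)
      ...   | inj₂ e = ⊥-elim (b≉0 e)
      Πw Πg : Carrier
      Πw = Π.sum {q} (w ∘ enum)
      Πg = Π.sum {q} (g ∘ enum)
      Πg-scale : Πg ≈ Πw ⊗ Πg
      Πg-scale = trans (sum-bijection M g g-cong (a ⊗_) (a⁻¹ ⊗_) *-congˡ *-congˡ cancel
        (λ x → trans (solve 3 (λ a i x → i :* (a :* x) := a :* (i :* x)) refl a a⁻¹ x) (cancel x)))
        (trans (Π.sum-cong-≋ {q} (λ i → g-scale (enum i))) (Π.∑-distrib-+ {q} (w ∘ enum) (g ∘ enum)))
      Πw≈1 : Πw ≈ 1#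
      Πw≈1 = conclude (domain (Πw ⊖ 1#) Πg (begin
          (Πw ⊖ 1#) ⊗ Πg ≈⟨ solve 2 (λ x y → (x :- :1) :* y := x :* y :- y) refl Πw Πg ⟩
          Πw ⊗ Πg ⊖ Πg ≈⟨ +-congʳ (sym Πg-scale) ⟩
          Πg ⊖ Πg ≈⟨ -‿inverseʳ _ ⟩
          0# ∎))
        where
          conclude : Πw ⊖ 1# ≈ 0# ⊎ Πg ≈ 0# → Πw ≈ 1#
          conclude (inj₁ e) = x∙y⁻¹≈ε⇒x≈y _ _ e
          conclude (inj₂ e) = ⊥-elim (Πg≉0 enum e)
      Πδ≈a : Π.sum {q} (δ ∘ enum) ≈ a
      Πδ≈a = trans (SingleTerm.sum-single M {q} (δ ∘ enum) (index 0#) off) on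
        where
          on : δ (enum (index 0#)) ≈ a
          on with enum (index 0#) ≟ 0#
          ... | yes _ = refl
          ... | no ne = ⊥-elim (ne (enum-index 0#))
          off : ∀ j → j ≢ index 0# → δ (enum j) ≈ 1#
          off j ne with enum j ≟ 0#
          ... | yes e = ⊥-elim (ne (≡.trans (≡.sym (index-enum j)) (index-cong e)))
          ... | no _ = refl

  fermat-q^ : ∀ a i → a ↑ (q ^ i) ≈ a
  fermat-q^ a zero = *-identityʳ a
  fermat-q^ a (suc i) = trans (sym (^-assocʳ a q (q ^ i))) (trans (^-congˡ (q ^ i) (fermat a)) (fermat-q^ a i))

module FrobeniusAlgebra {q : ℕ} (F : FiniteField q) (pp : IsPrimePower q) {B : CommutativeRing 0ℓ 0ℓ} (φ : Hom (FiniteField.commRing F) B) where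
  private module F = Field F pp
  open Kit B
  open Hom φ
  open FrobeniusPowers (F.frobeniusRing φ) public
  open Monic B

  ↑q-⊕ : ∀ x y → (x ⊕ y) ↑ q ≈ x ↑ q ⊕ y ↑ q
  ↑q-⊕ = FrobeniusRing.additive (F.frobeniusRing φ)

  scalar-fixed : ∀ a i → ⟦ a ⟧ ↑ (q ^ i) ≈ ⟦ a ⟧
  scalar-fixed a i = trans (sym (↑-homo a (q ^ i))) (cong (F.fermat-q^ a i))

  evalM-frobenius : ∀ {n} (v : Vec F.Carrier n) y i → evalM (Vec.map ⟦_⟧ v) (y ↑ (q ^ i)) ≈ evalM (Vec.map ⟦_⟧ v) y ↑ (q ^ i)
  evalM-frobenius [] y i = sym (1↑ (q ^ i))
    where
      1↑ : ∀ n → 1# ↑ n ≈ 1#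
      1↑ zero = refl
      1↑ (suc n) = trans (*-identityˡ _) (1↑ n)
  evalM-frobenius (c ∷ v) y i = begin
    ⟦ c ⟧ ⊕ y ↑ (q ^ i) ⊗ evalM (Vec.map ⟦_⟧ v) (y ↑ (q ^ i)) ≈⟨ +-cong (sym (scalar-fixed c i)) (*-congˡ (evalM-frobenius v y i)) ⟩
    ⟦ c ⟧ ↑ (q ^ i) ⊕ y ↑ (q ^ i) ⊗ evalM (Vec.map ⟦_⟧ v) y ↑ (q ^ i) ≈⟨ +-congˡ (sym (^-distrib-* y _ (q ^ i))) ⟩
    ⟦ c ⟧ ↑ (q ^ i) ⊕ (y ⊗ evalM (Vec.map ⟦_⟧ v) y) ↑ (q ^ i) ≈⟨ sym (↑q^-⊕ i _ _) ⟩
    (⟦ c ⟧ ⊕ y ⊗ evalM (Vec.map ⟦_⟧ v) y) ↑ (q ^ i) ∎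
    where open Reasoning

  -- The partial trace y + y^q + ... + y^(q^(n-1)) in an arbitrary algebra. It is the trace of a
  -- field extension only where y is fixed by the q^n-th power; Stepanov's method also uses the
  -- shorter ones.
  trace : ℕ → Carrier → Carrier
  trace zero y = 0#
  trace (suc n) y = y ⊕ trace n (y ↑ q)

  trace-↑q : ∀ n y → trace n (y ↑ q) ≈ trace n y ↑ q
  trace-↑q zero y = sym (0↑ q F.1≤q)
  trace-↑q (suc n) y = trans (+-congˡ (trace-↑q n (y ↑ q))) (sym (↑q-⊕ y _))

  trace-+ : ∀ m n y → trace (m ℕ.+ n) y ≈ trace m y ⊕ trace n y ↑ (q ^ m)
  trace-+ zero n y = sym (trans (+-identityˡ _) (*-identityʳ _))
  trace-+ (suc m) n y = begin
    y ⊕ trace (m ℕ.+ n) (y ↑ q) ≈⟨ +-congˡ (trace-+ m n (y ↑ q)) ⟩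
    y ⊕ (trace m (y ↑ q) ⊕ trace n (y ↑ q) ↑ (q ^ m)) ≈⟨ sym (+-assoc _ _ _) ⟩
    trace (suc m) y ⊕ trace n (y ↑ q) ↑ (q ^ m) ≈⟨ +-congˡ (trans (^-congˡ (q ^ m) (trace-↑q n y)) (^-assocʳ _ q (q ^ m))) ⟩
    trace (suc m) y ⊕ trace n y ↑ (q ^ suc m) ∎
    where open Reasoning

  trace-sum : ∀ n y → trace n y ≈ sum {n} (λ i → y ↑ (q ^ toℕ i))
  trace-sum zero y = refl
  trace-sum (suc n) y = +-cong (sym (*-identityʳ y)) (trans (trace-sum n (y ↑ q)) (sum-cong-≋ {n} (λ i → ^-assocʳ y q (q ^ toℕ i))))

module PolyOverField {q : ℕ} (F : FiniteField q) (pp : IsPrimePower q) where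
  open Field F pp
  open Polynomials commRing public
  open Series commRing using (_≋_; mk; at)

  infix 4 _∣ₚ_
  _∣ₚ_ : Poly → Poly → Set
  f ∣ₚ g = ∃ λ u → g ℙ.≈ u ℙ.⊗ f

  monic-vector : ∀ n f → VanishesFrom (suc n) (coeff f) → coeff f n ≈ 1# → ∃ λ (w : Vec Carrier n) → f ℙ.≈ toPoly w
  monic-vector zero f v e = [] , mk (mk λ { zero → e ; (suc k) → v (suc k) (s≤s z≤n) })
  monic-vector (suc n) f v e with monic-vector n (tail f) (λ k le → v (suc k) (s≤s le)) e
  ... | w , eq = coeff f 0 ∷ w , ℙ.trans (horner f) (ℙ.+-congˡ (ℙ.*-congˡ eq))

  -- Decidable equality in the field turns a bound into a degree: one descends until a coefficient
  -- is nonzero and divides by it.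
  normalise : ∀ n r → VanishesFrom n (coeff r) → r ℙ.≈ ℙ.0# ⊎ ∃ λ k → k < n × ∃ λ (w : Vec Carrier k) → ∃ λ c → ∃ λ c⁻¹ → c ⊗ c⁻¹ ≈ 1# × r ℙ.≈ C c ℙ.⊗ toPoly w
  normalise zero r v = inj₁ (mk (mk λ k → v k z≤n))
  normalise (suc n) r v with coeff r n ≟ 0#
  ... | yes e with normalise n r (λ k le → vanishes k (ℕₚ.m≤n⇒m<n∨m≡n le))
    where
      vanishes : ∀ k → n < k ⊎ n ≡ k → coeff r k ≈ 0#
      vanishes k (inj₁ lt) = v k lt
      vanishes k (inj₂ ≡.refl) = e
  ...   | inj₁ z = inj₁ z
  ...   | inj₂ (k , k<n , rest) = inj₂ (k , ℕₚ.m≤n⇒m≤1+n k<n , rest)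
  normalise (suc n) r v | no c≉0 = inj₂ (n , ℕₚ.n<1+n n , proj₁ mv , c , c⁻¹ , cc⁻¹ , (begin
      r ≈⟨ ℙ.sym (ℙ.trans (ℙ.sym (ℙ.*-assoc (C c) (C c⁻¹) r)) (ℙ.trans (ℙ.*-congʳ (ℙ.trans (ℙ.sym (Hom.⊗-homo constants c c⁻¹)) (Hom.cong constants cc⁻¹))) (ℙ.*-identityˡ r))) ⟩
      C c ℙ.⊗ (C c⁻¹ ℙ.⊗ r) ≈⟨ ℙ.*-congˡ (proj₂ mv) ⟩
      C c ℙ.⊗ toPoly (proj₁ mv) ∎))
    where
      open ℙ.Reasoning
      c = coeff r n
      c⁻¹ = proj₁ (inverse c c≉0)
      cc⁻¹ = proj₂ (inverse c c≉0)
      mv = monic-vector n (C c⁻¹ ℙ.⊗ r)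
        (λ k le → trans (coeff-C⊗ c⁻¹ r k) (trans (*-congˡ (v k le)) (zeroʳ _)))
        (trans (coeff-C⊗ c⁻¹ r n) (trans (*-comm _ _) cc⁻¹))

  record Irreducible {e : ℕ} (P : Vec Carrier e) : Set where
    field
      degree-positive : 1 ≤ e
      no-factor : ∀ {k} → 1 ≤ k → k < e → (w : Vec Carrier k) → ¬ (toPoly w ∣ₚ toPoly P)

  module Euclid {e : ℕ} (P : Vec Carrier e) (irr : Irreducible P) where
    open Irreducible irr
    private p = toPoly P

    cancel-unit : ∀ {c c⁻¹ f} b → c ⊗ c⁻¹ ≈ 1# → p ∣ₚ (C c ℙ.⊗ f) ℙ.⊗ b → p ∣ₚ f ℙ.⊗ b
    cancel-unit {c} {c⁻¹} {f} b cc⁻¹ (w , eq) = C c⁻¹ ℙ.⊗ w , (begin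
      f ℙ.⊗ b ≈⟨ ℙ.sym (ℙ.*-identityˡ _) ⟩
      ℙ.1# ℙ.⊗ (f ℙ.⊗ b) ≈⟨ ℙ.*-congʳ (ℙ.sym (ℙ.trans (ℙ.sym (Hom.⊗-homo constants c c⁻¹)) (Hom.cong constants cc⁻¹))) ⟩
      (C c ℙ.⊗ C c⁻¹) ℙ.⊗ (f ℙ.⊗ b) ≈⟨ ℙ.solve 4 (λ c d f b → (c ℙ.:* d) ℙ.:* (f ℙ.:* b) ℙ.:= d ℙ.:* ((c ℙ.:* f) ℙ.:* b)) ℙ.refl (C c) (C c⁻¹) f b ⟩
      C c⁻¹ ℙ.⊗ ((C c ℙ.⊗ f) ℙ.⊗ b) ≈⟨ ℙ.*-congˡ eq ⟩
      C c⁻¹ ℙ.⊗ (w ℙ.⊗ p) ≈⟨ ℙ.sym (ℙ.*-assoc _ _ _) ⟩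
      (C c⁻¹ ℙ.⊗ w) ℙ.⊗ p ∎)
      where open ℙ.Reasoning

    -- Euclid's algorithm run on (P , m): every remainder r still satisfies P ∣ r b.
    small-cofactor : ∀ fuel k → k ≤ fuel → k < e → (m : Vec Carrier k) → ∀ b → p ∣ₚ toPoly m ℙ.⊗ b → p ∣ₚ b
    small-cofactor fuel zero _ _ [] b (w , eq) = w , ℙ.trans (ℙ.sym (ℙ.*-identityˡ b)) eq
    small-cofactor (suc fuel) (suc k) (s≤s k≤) k<e m b (w , eq) with normalise (suc k) rem rem-vanish
      where open Division (divide m p)
    ... | inj₁ r≈0 = ⊥-elim (no-factor (s≤s z≤n) k<e m (quo , ℙ.trans division (ℙ.trans (ℙ.+-congˡ r≈0) (ℙ.+-identityʳ _))))
      where open Division (divide m p)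
    ... | inj₂ (k′ , k′<k , m′ , c , c⁻¹ , cc⁻¹ , r≈) = small-cofactor fuel k′ (ℕₚ.≤-trans (ℕₚ.≤-pred k′<k) k≤) (ℕₚ.<-trans k′<k k<e) m′ b
        (cancel-unit b cc⁻¹ (b ℙ.⊖ quo ℙ.⊗ w , (begin
          (C c ℙ.⊗ toPoly m′) ℙ.⊗ b ≈⟨ ℙ.*-congʳ (ℙ.sym r≈) ⟩
          rem ℙ.⊗ b ≈⟨ ℙ.solve 4 (λ r b u m → r ℙ.:* b ℙ.:= b ℙ.:* (u ℙ.:* m ℙ.:+ r) ℙ.:- u ℙ.:* (m ℙ.:* b)) ℙ.refl rem b quo (toPoly m) ⟩
          b ℙ.⊗ (quo ℙ.⊗ toPoly m ℙ.⊕ rem) ℙ.⊖ quo ℙ.⊗ (toPoly m ℙ.⊗ b) ≈⟨ ℙ.+-cong (ℙ.*-congˡ (ℙ.sym division)) (ℙ.-‿cong (ℙ.*-congˡ eq)) ⟩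
          b ℙ.⊗ p ℙ.⊖ quo ℙ.⊗ (w ℙ.⊗ p) ≈⟨ ℙ.solve 4 (λ b p u w → b ℙ.:* p ℙ.:- u ℙ.:* (w ℙ.:* p) ℙ.:= (b ℙ.:- u ℙ.:* w) ℙ.:* p) ℙ.refl b p quo w ⟩
          (b ℙ.⊖ quo ℙ.⊗ w) ℙ.⊗ p ∎)))
      where
        open Division (divide m p)
        open ℙ.Reasoning

    -- If the remainder of a modulo P is not zero, it is a unit times a monic polynomial of degree
    -- below e whose product with b is still a multiple of P, and Euclid's algorithm applies to it.
    euclid : ∀ a b → p ∣ₚ a ℙ.⊗ b → p ∣ₚ a ⊎ p ∣ₚ b
    euclid a b (w , eq) with normalise e rem rem-vanish
      where open Division (divide P a)
    ... | inj₁ r≈0 = inj₁ (quo , ℙ.trans division (ℙ.trans (ℙ.+-congˡ r≈0) (ℙ.+-identityʳ _)))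
      where open Division (divide P a)
    ... | inj₂ (k , k<e , m , c , c⁻¹ , cc⁻¹ , r≈) = inj₂ (small-cofactor k k ℕₚ.≤-refl k<e m b (cancel-unit b cc⁻¹ (w ℙ.⊖ quo ℙ.⊗ b , (begin
          (C c ℙ.⊗ toPoly m) ℙ.⊗ b ≈⟨ ℙ.*-congʳ (ℙ.sym r≈) ⟩
          rem ℙ.⊗ b ≈⟨ ℙ.solve 4 (λ r b u p → r ℙ.:* b ℙ.:= (u ℙ.:* p ℙ.:+ r) ℙ.:* b ℙ.:- u ℙ.:* b ℙ.:* p) ℙ.refl rem b quo p ⟩
          (quo ℙ.⊗ p ℙ.⊕ rem) ℙ.⊗ b ℙ.⊖ quo ℙ.⊗ b ℙ.⊗ p ≈⟨ ℙ.+-congʳ (ℙ.trans (ℙ.*-congʳ (ℙ.sym division)) eq) ⟩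
          w ℙ.⊗ p ℙ.⊖ quo ℙ.⊗ b ℙ.⊗ p ≈⟨ ℙ.solve 4 (λ w p u b → w ℙ.:* p ℙ.:- u ℙ.:* b ℙ.:* p ℙ.:= (w ℙ.:- u ℙ.:* b) ℙ.:* p) ℙ.refl w p quo b ⟩
          (w ℙ.⊖ quo ℙ.⊗ b) ℙ.⊗ p ∎))))
      where
        open Division (divide P a)
        open ℙ.Reasoning

  toPoly-injective : ∀ {n} (v w : Vec Carrier n) → toPoly v ℙ.≈ toPoly w → ∀ i → Vec.lookup v i ≈ Vec.lookup w i
  toPoly-injective (c ∷ v) (d ∷ w) (mk (mk eq)) zero = trans (sym (trans (toPoly-∷ c v 0) (+-identityʳ _))) (trans (eq 0) (trans (toPoly-∷ d w 0) (+-identityʳ _)))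
  toPoly-injective (c ∷ v) (d ∷ w) (mk (mk eq)) (suc i) = toPoly-injective v w (mk (mk λ k →
    trans (sym (trans (toPoly-∷ c v (suc k)) (+-identityˡ _))) (trans (eq (suc k)) (trans (toPoly-∷ d w (suc k)) (+-identityˡ _))))) i

-- Power sums of the roots

module Reversal (R : CommutativeRing 0ℓ 0ℓ) where
  open Kit R
  open Series R
  open Monic R
  open Polynomials R

  -- The series tⁿ f(1/t), for f of formal degree n. Its multiplicativity in f is what makes
  -- `traceForm` additive over products of polynomials.
  rev : ℕ → Seq → Seq
  rev zero f = const (f 0)
  rev (suc n) f = rev n (f ∘ suc) 𝕊.⊕ monomial (f 0) (suc n)

  rev-cong : ∀ n {f g} → (∀ i → f i ≈ g i) → rev n f 𝕊.≈ rev n g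
  rev-cong zero p = monomial-cong 0 (p 0)
  rev-cong (suc n) p = 𝕊.+-cong (rev-cong n (p ∘ suc)) (monomial-cong (suc n) (p 0))

  rev-⊕ : ∀ n f g → rev n (λ i → f i ⊕ g i) 𝕊.≈ rev n f 𝕊.⊕ rev n g
  rev-⊕ zero f g = monomial-⊕ (f 0) (g 0) 0
  rev-⊕ (suc n) f g = 𝕊.trans (𝕊.+-cong (rev-⊕ n (f ∘ suc) (g ∘ suc)) (monomial-⊕ (f 0) (g 0) (suc n)))
    (𝕊.solve 4 (λ a b c d → (a 𝕊.:+ b) 𝕊.:+ (c 𝕊.:+ d) 𝕊.:= (a 𝕊.:+ c) 𝕊.:+ (b 𝕊.:+ d)) 𝕊.refl (rev n (f ∘ suc)) (rev n (g ∘ suc)) (monomial (f 0) (suc n)) (monomial (g 0) (suc n)))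

  rev-scale : ∀ n a f → rev n (λ i → a ⊗ f i) 𝕊.≈ const a 𝕊.⊗ rev n f
  rev-scale zero a f = 𝕊.sym (monomial-⊗ a (f 0) 0 0)
  rev-scale (suc n) a f = 𝕊.trans (𝕊.+-cong (rev-scale n a (f ∘ suc)) (𝕊.sym (monomial-⊗ a (f 0) 0 (suc n))))
    (𝕊.sym (𝕊.distribˡ (const a) (rev n (f ∘ suc)) (monomial (f 0) (suc n))))

  rev-suc : ∀ n f → f (suc n) ≈ 0# → rev (suc n) f 𝕊.≈ monomial 1# 1 𝕊.⊗ rev n f
  rev-suc zero f p = 𝕊.trans (𝕊.+-congʳ {monomial (f 0) 1} (𝕊.trans (monomial-cong 0 p) (monomial-0 0)))
    (𝕊.trans (𝕊.+-identityˡ _) (𝕊.sym (𝕊.trans (monomial-⊗ 1# (f 0) 1 0) (monomial-cong 1 (*-identityˡ _)))))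
  rev-suc (suc n) f p = 𝕊.trans (𝕊.+-cong (rev-suc n (f ∘ suc) p) (𝕊.sym (𝕊.trans (monomial-⊗ 1# (f 0) 1 (suc n)) (monomial-cong (suc (suc n)) (*-identityˡ _)))))
    (𝕊.sym (𝕊.distribˡ (monomial 1# 1) (rev n (f ∘ suc)) (monomial (f 0) (suc n))))

  -- Overestimating the degree by j costs a factor t^j.
  rev-pad : ∀ j m f → VanishesFrom (suc m) f → rev (j ℕ.+ m) f 𝕊.≈ monomial 1# j 𝕊.⊗ rev m f
  rev-pad zero m f v = 𝕊.sym (𝕊.*-identityˡ (rev m f))
  rev-pad (suc j) m f v = begin
    rev (suc (j ℕ.+ m)) f ≈⟨ rev-suc (j ℕ.+ m) f (v _ (s≤s (ℕₚ.m≤n+m m j))) ⟩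
    monomial 1# 1 𝕊.⊗ rev (j ℕ.+ m) f ≈⟨ 𝕊.*-congˡ {monomial 1# 1} (rev-pad j m f v) ⟩
    monomial 1# 1 𝕊.⊗ (monomial 1# j 𝕊.⊗ rev m f) ≈⟨ 𝕊.sym (𝕊.*-assoc (monomial 1# 1) (monomial 1# j) (rev m f)) ⟩
    (monomial 1# 1 𝕊.⊗ monomial 1# j) 𝕊.⊗ rev m f ≈⟨ 𝕊.*-congʳ {rev m f} (𝕊.trans (monomial-⊗ 1# 1# 1 j) (monomial-cong (suc j) (*-identityˡ 1#))) ⟩
    monomial 1# (suc j) 𝕊.⊗ rev m f ∎
    where open 𝕊.Reasoning

  rev-conv : ∀ n m f g → VanishesFrom (suc n) f → VanishesFrom (suc m) g → rev (n ℕ.+ m) (conv f g) 𝕊.≈ rev n f 𝕊.⊗ rev m g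
  rev-conv zero m f g v w = 𝕊.trans (rev-cong m (λ i → trans (conv-cong {g = g} (λ { zero → refl ; (suc k) → v (suc k) (s≤s z≤n) }) (λ _ → refl) i) (conv-constˡ (f 0) g i)))
    (rev-scale m (f 0) g)
  rev-conv (suc n) m f g v w = begin
    rev (suc (n ℕ.+ m)) (conv f g)
      ≈⟨ rev-cong (suc (n ℕ.+ m)) {conv f g} {λ i → f 0 ⊗ g i ⊕ shift 1 (conv (f ∘ suc) g) i} (λ { zero → sym (+-identityʳ _) ; (suc i) → refl }) ⟩
    rev (suc (n ℕ.+ m)) (λ i → f 0 ⊗ g i ⊕ shift 1 (conv (f ∘ suc) g) i)
      ≈⟨ rev-⊕ (suc (n ℕ.+ m)) (λ i → f 0 ⊗ g i) (shift 1 (conv (f ∘ suc) g)) ⟩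
    rev (suc (n ℕ.+ m)) (λ i → f 0 ⊗ g i) 𝕊.⊕ (rev (n ℕ.+ m) (conv (f ∘ suc) g) 𝕊.⊕ monomial 0# (suc (n ℕ.+ m)))
      ≈⟨ 𝕊.+-cong (𝕊.trans (rev-scale (suc (n ℕ.+ m)) (f 0) g) (𝕊.*-congˡ {const (f 0)} (rev-pad (suc n) m g w)))
           (𝕊.trans (𝕊.+-cong (rev-conv n m (f ∘ suc) g (λ k le → v (suc k) (s≤s le)) w) (monomial-0 (suc (n ℕ.+ m)))) (𝕊.+-identityʳ _)) ⟩
    const (f 0) 𝕊.⊗ (monomial 1# (suc n) 𝕊.⊗ rev m g) 𝕊.⊕ rev n (f ∘ suc) 𝕊.⊗ rev m g
      ≈⟨ 𝕊.solve 4 (λ a b c d → a 𝕊.:* (b 𝕊.:* c) 𝕊.:+ d 𝕊.:* c 𝕊.:= (d 𝕊.:+ a 𝕊.:* b) 𝕊.:* c) 𝕊.refl (const (f 0)) (monomial 1# (suc n)) (rev m g) (rev n (f ∘ suc)) ⟩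
    (rev n (f ∘ suc) 𝕊.⊕ const (f 0) 𝕊.⊗ monomial 1# (suc n)) 𝕊.⊗ rev m g
      ≈⟨ 𝕊.*-congʳ {rev m g} (𝕊.+-congˡ {rev n (f ∘ suc)} (𝕊.trans (monomial-⊗ (f 0) 1# 0 (suc n)) (monomial-cong (suc n) (*-identityʳ _)))) ⟩
    rev (suc n) f 𝕊.⊗ rev m g ∎
    where open 𝕊.Reasoning

  reversed-rev : ∀ {n} (v : Vec Carrier n) → reversed v 𝕊.≈ rev n (coeff (toPoly v))
  reversed-rev [] = mk λ _ → refl
  reversed-rev {suc n} (c ∷ v) = 𝕊.+-cong (𝕊.trans (reversed-rev v) (rev-cong n λ i → sym (trans (toPoly-∷ c v (suc i)) (+-identityˡ _))))
    (monomial-cong (suc n) (sym (trans (toPoly-∷ c v 0) (+-identityʳ _))))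

  reversed-⊗ : ∀ {n m} (u : Vec Carrier n) (v : Vec Carrier m) (w : Vec Carrier (n ℕ.+ m)) → toPoly w ℙ.≈ toPoly u ℙ.⊗ toPoly v →
    reversed w 𝕊.≈ reversed u 𝕊.⊗ reversed v
  reversed-⊗ {n} {m} u v w (mk eq) = 𝕊.trans (reversed-rev w) (𝕊.trans (rev-cong (n ℕ.+ m) (at eq))
    (𝕊.trans (rev-conv n m (coeff (toPoly u)) (coeff (toPoly v)) (toPoly-vanish u) (toPoly-vanish v)) (𝕊.sym (𝕊.*-cong (reversed-rev u) (reversed-rev v)))))

  monomial-off : ∀ a e k → k < e → monomial a e k ≈ 0#
  monomial-off a e k lt = reflexive (shift-below e (const a) k lt)

  reversed-++ : ∀ {m n} (l : Vec Carrier m) (w : Vec Carrier n) k → k ≤ n → reversed (l Vec.++ w) k ≈ reversed w k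
  reversed-++ [] w k le = refl
  reversed-++ {suc m} {n} (c ∷ l) w k le = trans (+-cong (reversed-++ l w k le) (monomial-off c _ k (s≤s (ℕₚ.≤-trans le (ℕₚ.m≤n+m n m))))) (+-identityʳ _)

  -- The sum of h(α) over the roots α of the monic polynomial P, where h = ∑ aₖ Xᵏ.
  traceForm : ∀ {d n} → (Fin (suc d) → Carrier) → Vec Carrier n → Carrier
  traceForm {d} {n} a P = (n · a zero) ⊕ sum {d} (λ k → a (suc k) ⊗ powerSum (reversed P) (suc (toℕ k)))

  traceForm-⊗ : ∀ {d n m} (a : Fin (suc d) → Carrier) (u : Vec Carrier n) (v : Vec Carrier m) (w : Vec Carrier (n ℕ.+ m)) →
    toPoly w ℙ.≈ toPoly u ℙ.⊗ toPoly v → traceForm a w ≈ traceForm a u ⊕ traceForm a v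
  traceForm-⊗ {d} {n} {m} a u v w eq = trans (+-cong (×-homo-+ (a zero) n m)
      (trans (sum-cong-≋ {d} λ k → trans (*-congˡ (at (𝕊.trans (powerSum-cong (reversed-zero w) (reversed-⊗ u v w eq)) (powerSum-⊗ (reversed u) (reversed v) (reversed-zero u) (reversed-zero v))) (suc (toℕ k)))) (distribˡ _ _ _))
             (∑-distrib-+ {d} _ _)))
    (solve 4 (λ a b c d → (a :+ b) :+ (c :+ d) := (a :+ c) :+ (b :+ d)) refl _ _ _ _)

  -- Only the last power sum sees the coefficient a, and linearly: this is Newton's identity p_d = − d e + ….
  traceForm-linear : ∀ {D m} (a : Fin (suc (suc D)) → Carrier) (l : Vec Carrier m) (u : Vec Carrier D) →
    ∃ λ κ → ∀ c → traceForm a (l Vec.++ (c ∷ u)) ≈ κ ⊖ a (fromℕ (suc D)) ⊗ (suc D · c)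
  traceForm-linear {D} {m} a l u = ((m ℕ.+ suc D) · a zero) ⊕ sum {suc D} (λ k → a (suc k) ⊗ s (suc (toℕ k))) , λ c → begin
      ((m ℕ.+ suc D) · a zero) ⊕ sum {suc D} (λ k → a (suc k) ⊗ powerSum (A c) (suc (toℕ k)))
        ≈⟨ +-congˡ (sum-init-last {D} (λ k → a (suc k) ⊗ powerSum (A c) (suc (toℕ k)))) ⟩
      ((m ℕ.+ suc D) · a zero) ⊕ (sum {D} (λ k → a (suc (Fin.inject₁ k)) ⊗ powerSum (A c) (suc (toℕ (Fin.inject₁ k)))) ⊕ a (fromℕ (suc D)) ⊗ powerSum (A c) (suc (toℕ (fromℕ D))))
        ≈⟨ +-congˡ (+-cong (sum-cong-≋ {D} (λ k → *-congˡ (low c (suc (toℕ (Fin.inject₁ k))) (≡.subst (_< D) (≡.sym (Finₚ.toℕ-inject₁ k)) (Finₚ.toℕ<n k)))))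
              (trans (*-congˡ (top c)) (trans (distribˡ _ _ _) (+-congˡ (sym (-‿distribʳ-* _ _)))))) ⟩
      ((m ℕ.+ suc D) · a zero) ⊕ (sum {D} (λ k → a (suc (Fin.inject₁ k)) ⊗ s (suc (toℕ (Fin.inject₁ k)))) ⊕ (a (fromℕ (suc D)) ⊗ s (suc (toℕ (fromℕ D))) ⊖ a (fromℕ (suc D)) ⊗ (suc D · c)))
        ≈⟨ solve 4 (λ n s t x → n :+ (s :+ (t :- x)) := (n :+ (s :+ t)) :- x) refl _ _ _ _ ⟩
      (((m ℕ.+ suc D) · a zero) ⊕ (sum {D} (λ k → a (suc (Fin.inject₁ k)) ⊗ s (suc (toℕ (Fin.inject₁ k)))) ⊕ a (fromℕ (suc D)) ⊗ s (suc (toℕ (fromℕ D))))) ⊖ a (fromℕ (suc D)) ⊗ (suc D · c)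
        ≈⟨ +-congʳ (+-congˡ (sym (sum-init-last {D} (λ k → a (suc k) ⊗ s (suc (toℕ k)))))) ⟩
      (((m ℕ.+ suc D) · a zero) ⊕ sum {suc D} (λ k → a (suc k) ⊗ s (suc (toℕ k)))) ⊖ a (fromℕ (suc D)) ⊗ (suc D · c) ∎
    where
      open Reasoning
      open Algebra.Properties.Monoid.Sum (CommutativeRing.+-monoid R) using (sum-init-last)
      s : Seq
      s = powerSum (reversed u)
      -- `u` fills the coefficients of the reversed polynomial up to t^D, c is the one at t^(D+1),
      -- and `l` enters only beyond. Power sums up to D therefore see neither c nor `l`.
      A : Carrier → Seq
      A c = reversed (l Vec.++ (c ∷ u))
      A-zero : ∀ c → A c 0 ≈ 1#
      A-zero c = reversed-zero (l Vec.++ (c ∷ u))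
      A-low : ∀ c i → i ≤ D → A c i ≈ reversed u i
      A-low c i le = trans (reversed-++ l (c ∷ u) i (ℕₚ.m≤n⇒m≤1+n le)) (trans (+-congˡ (monomial-off c (suc D) i (s≤s le))) (+-identityʳ _))
      A-top : ∀ c → A c (suc D) ≈ c
      A-top c = trans (reversed-++ l (c ∷ u) (suc D) ℕₚ.≤-refl) (trans (+-cong (reversed-beyond u (suc D) ℕₚ.≤-refl)
        (reflexive (≡.trans (≡.cong (shift (suc D) (const c)) (≡.sym (ℕₚ.+-identityʳ (suc D)))) (shift-above (suc D) (const c) 0)))) (+-identityˡ _))
      low : ∀ c k → k ≤ D → powerSum (A c) k ≈ s k
      low c k le = powerSum-cong≤ (A-zero c) (reversed-zero u) D (A-low c) k le
      top : ∀ c → powerSum (A c) (suc (toℕ (fromℕ D))) ≈ s (suc (toℕ (fromℕ D))) ⊖ suc D · c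
      top c rewrite Finₚ.toℕ-fromℕ D = begin
        powerSum (A c) (suc D) ≈⟨ solve 2 (λ x y → x := (x :+ y) :- y) refl _ (suc D · A c (suc D)) ⟩
        (powerSum (A c) (suc D) ⊕ suc D · A c (suc D)) ⊖ suc D · A c (suc D)
          ≈⟨ +-cong (trans (powerSum-top (A-zero c) (reversed-zero u) D (A-low c)) (trans (+-congˡ (trans (×-congʳ (suc D) (reversed-beyond u (suc D) ℕₚ.≤-refl)) (·-zero (suc D)))) (+-identityʳ _)))
               (-‿cong (×-congʳ (suc D) (A-top c))) ⟩
        s (suc D) ⊖ suc D · c ∎

-- An abstract form of K = 𝔽_q[X]/(P) with x the class of X. `all-fixed` expresses that x generates
-- K, and `representative` that K has at least qᵉ elements. Then x, x^q, ..., x^(q^(e-1)) are e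
-- distinct roots of P.
module ConjugateRoots {q : ℕ} (F : FiniteField q) (pp : IsPrimePower q) {K : CommutativeRing 0ℓ 0ℓ} (φ : Hom (FiniteField.commRing F) K)
  (K-1≉0 : ¬ (Kit._≈_ K (Kit.1# K) (Kit.0# K))) (K-domain : IsDomain K) {e : ℕ} (P : Vec (FiniteField.Carrier F) e) (x : Kit.Carrier K)
  (x-root : Kit._≈_ K (Monic.evalM K (Vec.map (Hom.⟦_⟧ φ) P) x) (Kit.0# K))
  (all-fixed : ∀ r → Kit._≈_ K (Kit._↑_ K x (q ^ r)) x → ∀ y → Kit._≈_ K (Kit._↑_ K y (q ^ r)) y)
  (representative : Fin (q ^ e) → Kit.Carrier K)
  (representative-injective : ∀ i j → Kit._≈_ K (representative i) (representative j) → i ≡ j) where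
  open Field F pp using (commRing; 2≤q; 1≤q)
  private module F = Field F pp
  open Kit K
  open Monic K using (evalM; eval-xⁿ-x; xⁿ-x; reversed)
  open Hom φ
  open FrobeniusAlgebra F pp φ
  open Roots K K-domain

  conjugate : ℕ → Carrier
  conjugate i = x ↑ (q ^ i)

  conjugate-root : ∀ i → evalM (Vec.map ⟦_⟧ P) (conjugate i) ≈ 0#
  conjugate-root i = trans (evalM-frobenius P x i) (trans (^-congˡ (q ^ i) x-root) (↑q^-0 i))

  -- If the orbit of x were shorter than e, then all qᵉ residues would be roots of T^(q^r) − T.
  period : ∀ r → 1 ≤ r → x ↑ (q ^ r) ≈ x → e ≤ r
  period r 1≤r x-fixed with e ℕ.≤? r
  ... | yes e≤r = e≤r
  ... | no e≰r = ⊥-elim (contradiction (q ^ r) ≡.refl 2≤q^r)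
    where
      2≤q^r : 2 ≤ q ^ r
      2≤q^r = ℕₚ.≤-trans 2≤q (ℕₚ.≤-trans (ℕₚ.≤-reflexive (≡.sym (ℕₚ.*-identityʳ q))) (ℕₚ.^-monoʳ-≤ q {{ℕ.>-nonZero 1≤q}} 1≤r))
      contradiction : ∀ N → N ≡ q ^ r → 2 ≤ N → ⊥
      contradiction (suc (suc N)) N≡ (s≤s (s≤s _)) = collide (too-many-roots K-1≉0 (xⁿ-x N) α root)
        where
          fits : suc (suc (suc N)) ≤ q ^ e
          fits = ≡.subst (_< q ^ e) (≡.sym N≡) (ℕₚ.^-monoʳ-< q 2≤q (ℕₚ.≰⇒> e≰r))
          ι : Fin (suc (suc (suc N))) → Fin (q ^ e)
          ι i = Fin.inject≤ i fits
          α : Fin (suc (suc (suc N))) → Carrier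
          α i = representative (ι i)
          root : ∀ i → evalM (xⁿ-x N) (α i) ≈ 0#
          root i = trans (eval-xⁿ-x N (α i)) (x≈y⇒x∙y⁻¹≈ε (trans (^-congʳ (α i) N≡) (all-fixed r x-fixed (α i))))
          collide : (∃ λ i → ∃ λ j → i Fin.< j × α i ≈ α j) → ⊥
          collide (i , j , i<j , αi∼αj) = ℕₚ.<⇒≢ i<j (≡.cong toℕ (Finₚ.inject≤-injective fits fits i j (representative-injective (ι i) (ι j) αi∼αj)))

  conjugates-equal : ∀ i j → i ≤ j → conjugate i ≈ conjugate j → x ↑ (q ^ (j ∸ i)) ≈ x
  conjugates-equal i j i≤j ci∼cj = sym (x∙y⁻¹≈ε⇒x≈y _ _ (power-zero K-1≉0 _ (q ^ i) (begin
    (x ⊖ x ↑ (q ^ (j ∸ i))) ↑ (q ^ i) ≈⟨ ↑q^-⊖ i x (x ↑ (q ^ (j ∸ i))) ⟩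
    x ↑ (q ^ i) ⊖ (x ↑ (q ^ (j ∸ i))) ↑ (q ^ i) ≈⟨ +-congˡ (-‿cong (trans (↑q^-comm x (j ∸ i) i) (^-congʳ x (≡.cong (q ^_) (ℕₚ.m∸n+n≡m i≤j))))) ⟩
    x ↑ (q ^ i) ⊖ x ↑ (q ^ j) ≈⟨ x≈y⇒x∙y⁻¹≈ε ci∼cj ⟩
    0# ∎)))
    where open Reasoning

  -- Among the e + 1 elements x, ..., x^(q^e), all roots of a polynomial of degree e, two coincide.
  -- Their distance r ≤ e fixes x, and `period` forces r = e.
  x-fixed : x ↑ (q ^ e) ≈ x
  x-fixed with too-many-roots K-1≉0 (Vec.map ⟦_⟧ P) (λ (i : Fin (suc e)) → conjugate (toℕ i)) (λ i → conjugate-root (toℕ i))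
  ... | i , j , i<j , ci∼cj = ≡.subst (λ r → x ↑ (q ^ r) ≈ x) r≡e fixed
    where
      fixed = conjugates-equal (toℕ i) (toℕ j) (ℕₚ.<⇒≤ i<j) ci∼cj
      r≡e : toℕ j ∸ toℕ i ≡ e
      r≡e = ℕₚ.≤-antisym (ℕₚ.≤-trans (ℕₚ.m∸n≤m (toℕ j) (toℕ i)) (ℕₚ.≤-pred (Finₚ.toℕ<n j))) (period _ (ℕₚ.m<n⇒0<n∸m i<j) fixed)

  conjugates-distinct : ∀ (i j : Fin e) → i Fin.< j → ¬ (conjugate (toℕ i) ≈ conjugate (toℕ j))
  conjugates-distinct i j i<j ci∼cj = ℕₚ.<⇒≱ (Finₚ.toℕ<n j) (ℕₚ.≤-trans
    (period _ (ℕₚ.m<n⇒0<n∸m i<j) (conjugates-equal (toℕ i) (toℕ j) (ℕₚ.<⇒≤ i<j) ci∼cj)) (ℕₚ.m∸n≤m (toℕ j) (toℕ i)))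

  conjugate-powerSum : ∀ k → sum {e} (λ i → conjugate (toℕ i) ↑ suc k) ≈ ⟦ Series.powerSum commRing (Monic.reversed commRing P) (suc k) ⟧
  conjugate-powerSum k = begin
    sum {e} (λ i → conjugate (toℕ i) ↑ suc k)
      ≈⟨ sym (powerSum-roots (Vec.map ⟦_⟧ P) (λ i → conjugate (toℕ i)) (λ i → conjugate-root (toℕ i)) conjugates-distinct k) ⟩
    Series.powerSum K (reversed (Vec.map ⟦_⟧ P)) (suc k)
      ≈⟨ Series.at (Series.powerSum-cong K (Monic.reversed-zero K (Vec.map ⟦_⟧ P)) (Series.mk λ i → sym (MonicHom.reversed-homo φ P i))) (suc k) ⟩
    Series.powerSum K (λ i → ⟦ Monic.reversed commRing P i ⟧) (suc k)
      ≈⟨ sym (SeriesHom.powerSum-homo φ (Monic.reversed commRing P) (Monic.reversed-zero commRing P) (suc k)) ⟩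
    ⟦ Series.powerSum commRing (Monic.reversed commRing P) (suc k) ⟧ ∎
    where open Reasoning

  module _ {d : ℕ} (a : Fin (suc d) → F.Carrier) where
    value : Carrier
    value = sum {suc d} (λ k → ⟦ a k ⟧ ⊗ x ↑ toℕ k)

    traceValue : F.Carrier
    traceValue = Reversal.traceForm commRing a P

    -- Frobenius fixes the coefficients of h, so the summands of the trace of h(x) are the values of
    -- h at the conjugates, which are the roots of P. Exchanging the sums leaves the power sums of
    -- these roots.
    trace-value : trace e value ≈ ⟦ traceValue ⟧
    trace-value = begin
      trace e value ≈⟨ trace-sum e value ⟩
      sum {e} (λ i → value ↑ (q ^ toℕ i)) ≈⟨ sum-cong-≋ {e} (λ i → trans (↑q^-sum (toℕ i) (λ k → ⟦ a k ⟧ ⊗ x ↑ toℕ k)) (sum-cong-≋ {suc d} (λ k → term (toℕ i) k))) ⟩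
      sum {e} (λ i → sum {suc d} (λ k → ⟦ a k ⟧ ⊗ conjugate (toℕ i) ↑ toℕ k)) ≈⟨ ∑-comm {e} {suc d} (λ i k → ⟦ a k ⟧ ⊗ conjugate (toℕ i) ↑ toℕ k) ⟩
      sum {suc d} (λ k → sum {e} (λ i → ⟦ a k ⟧ ⊗ conjugate (toℕ i) ↑ toℕ k)) ≈⟨ sum-cong-≋ {suc d} (λ k → sym (*-distribˡ-sum {e} ⟦ a k ⟧ (λ i → conjugate (toℕ i) ↑ toℕ k))) ⟩
      sum {suc d} (λ k → ⟦ a k ⟧ ⊗ sum {e} (λ i → conjugate (toℕ i) ↑ toℕ k))
        ≈⟨ +-cong (trans (*-congˡ (sum-replicate e)) (trans (×-comm-* e ⟦ a zero ⟧ 1#) (trans (×-congʳ e (*-identityʳ _)) (sym (·-homo e (a zero))))))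
             (trans (sum-cong-≋ {d} (λ k → trans (*-congˡ (conjugate-powerSum (toℕ k))) (sym (⊗-homo _ _)))) (sym (sum-homo {d} _))) ⟩
      ⟦ e F.· a zero ⟧ ⊕ ⟦ F.sum {d} (λ k → a (suc k) F.⊗ Series.powerSum commRing (Monic.reversed commRing P) (suc (toℕ k))) ⟧ ≈⟨ sym (⊕-homo _ _) ⟩
      ⟦ traceValue ⟧ ∎
      where
        open Reasoning
        term : ∀ i k → (⟦ a k ⟧ ⊗ x ↑ toℕ k) ↑ (q ^ i) ≈ ⟦ a k ⟧ ⊗ conjugate i ↑ toℕ k
        term i k = trans (^-distrib-* _ _ (q ^ i)) (*-cong (scalar-fixed (a k) i)
          (trans (^-assocʳ x (toℕ k) (q ^ i)) (trans (^-congʳ x (ℕₚ.*-comm (toℕ k) (q ^ i))) (sym (^-assocʳ x (q ^ i) (toℕ k))))))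

    -- K is fixed by the qᵉ-th power, so a trace of length j e repeats the trace of length e exactly
    -- j times.
    trace-multiple : ∀ j → trace (j ℕ.* e) value ≈ ⟦ j F.· traceValue ⟧
    trace-multiple zero = sym 0-homo
    trace-multiple (suc j) = begin
      trace (e ℕ.+ j ℕ.* e) value ≈⟨ trace-+ e (j ℕ.* e) value ⟩
      trace e value ⊕ trace (j ℕ.* e) value ↑ (q ^ e) ≈⟨ +-cong trace-value (trans (all-fixed e x-fixed (trace (j ℕ.* e) value)) (trace-multiple j)) ⟩
      ⟦ traceValue ⟧ ⊕ ⟦ j F.· traceValue ⟧ ≈⟨ sym (⊕-homo _ _) ⟩
      ⟦ suc j F.· traceValue ⟧ ∎
      where open Reasoning

  x-fixed-multiple : ∀ j → x ↑ (q ^ (j ℕ.* e)) ≈ x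
  x-fixed-multiple zero = *-identityʳ x
  x-fixed-multiple (suc j) = trans (sym (↑q^-comm x e (j ℕ.* e))) (trans (^-congˡ (q ^ (j ℕ.* e)) x-fixed) (x-fixed-multiple j))

module ResidueField {q : ℕ} (F : FiniteField q) (pp : IsPrimePower q) {e : ℕ} (P : Vec (FiniteField.Carrier F) e)
  (irr : PolyOverField.Irreducible F pp P) where
  open Field F pp using (commRing; 1≉0; enum; index-enum; index-cong)
  private module F = Field F pp
  open PolyOverField F pp
  open Irreducible irr
  open Quotient polyRing (toPoly P) public renaming (quotientRing to residueField)
  open Kit residueField
  open Monic residueField using (evalM)

  scalars : Hom commRing residueField
  scalars = projection ∘ₕ constants

  open Hom scalars
  open FrobeniusAlgebra F pp scalars

  small-zero : ∀ f → VanishesFrom e (coeff f) → f ≈ 0# → f ℙ.≈ ℙ.0#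
  small-zero f v f∼0 with ∼0⇒multiple f∼0
  ... | u , f≈uP = ℙ.trans f≈uP (ℙ.trans (ℙ.*-congʳ (multiple-vanish P u (λ k le → F.trans (F.sym (Series.at (_≈ₚ_.eq f≈uP) k)) (v k le)))) (ℙ.zeroˡ _))

  residue-1≉0 : ¬ (1# ≈ 0#)
  residue-1≉0 1∼0 = 1≉0 (Series.at (_≈ₚ_.eq (small-zero ℙ.1# (λ { zero le → ⊥-elim (ℕₚ.<⇒≱ degree-positive le) ; (suc k) _ → F.refl }) 1∼0)) 0)

  residue-domain : IsDomain residueField
  residue-domain a b ab∼0 with Euclid.euclid P irr a b (∼0⇒multiple ab∼0)
  ... | inj₁ (u , eq) = inj₁ (multiple⇒∼0 eq)
  ... | inj₂ (u , eq) = inj₂ (multiple⇒∼0 eq)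

  X-root : evalM (Vec.map ⟦_⟧ P) X ≈ 0#
  X-root = trans (sym (trans (MonicHom.evalM-homo projection (Vec.map C P) X) (reflexive (≡.cong (λ v → evalM v X) (≡.sym (Vecₚ.map-∘ (λ x → x) C P)))))) modulus∼0

  all-fixed : ∀ r → X ↑ (q ^ r) ≈ X → ∀ f → f ↑ (q ^ r) ≈ f
  all-fixed r X-fixed = poly-induction (λ f → f ↑ (q ^ r) ≈ f)
    (λ f≈g f-fixed → trans (^-congˡ (q ^ r) (∼-reflexive (ℙ.sym f≈g))) (trans f-fixed (∼-reflexive f≈g)))
    (↑q^-0 r)
    (λ a f f-fixed → trans (↑q^-⊕ r ⟦ a ⟧ (X ⊗ f)) (+-cong (scalar-fixed a r) (trans (^-distrib-* X f (q ^ r)) (*-cong X-fixed f-fixed))))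

  -- The qᵉ coefficient vectors are later read as monic polynomials of degree e. In a difference the
  -- common term Xᵉ cancels, so they remain distinct modulo P.
  residue-index : Fin (q ^ e) → Vec F.Carrier e
  residue-index i = Vec.tabulate (enum ∘ Fin.finToFun i)

  residue-injective : ∀ i j → toPoly (residue-index i) ≈ toPoly (residue-index j) → i ≡ j
  residue-injective i j i∼j = ≡.trans (≡.sym (Finₚ.funToFin-finToFin {e} i)) (≡.trans (funToFin-cong same) (Finₚ.funToFin-finToFin {e} j))
    where
      vi = residue-index i
      vj = residue-index j
      difference : toPoly vi ℙ.⊖ toPoly vj ℙ.≈ ℙ.0#
      difference = small-zero _ (λ k le → vanishes k (ℕₚ.m≤n⇒m<n∨m≡n le)) (x≈y⇒x∙y⁻¹≈ε i∼j)
        where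
          vanishes : ∀ k → e < k ⊎ e ≡ k → coeff (toPoly vi ℙ.⊖ toPoly vj) k F.≈ F.0#
          vanishes k (inj₁ lt) = F.trans (F.+-cong (toPoly-vanish vi k lt) (F.trans (F.-‿cong (toPoly-vanish vj k lt)) F.-0#≈0#)) (F.+-identityˡ _)
          vanishes k (inj₂ ≡.refl) = F.trans (F.+-cong (toPoly-top vi) (F.-‿cong (toPoly-top vj))) (F.-‿inverseʳ _)
      same : ∀ l → Fin.finToFun i l ≡ Fin.finToFun j l
      same l = ≡.trans (≡.sym (index-enum _)) (≡.trans (index-cong (F.trans (F.reflexive (≡.sym (Vecₚ.lookup∘tabulate (enum ∘ Fin.finToFun i) l)))
        (F.trans (toPoly-injective vi vj (ℙ.x∙y⁻¹≈ε⇒x≈y _ _ difference) l) (F.reflexive (Vecₚ.lookup∘tabulate (enum ∘ Fin.finToFun j) l))))) (index-enum _))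
      funToFin-cong : ∀ {m n} {f g : Fin m → Fin n} → (∀ l → f l ≡ g l) → Fin.funToFin f ≡ Fin.funToFin g
      funToFin-cong {zero} p = ≡.refl
      funToFin-cong {suc m} p = ≡.cong₂ Fin.combine (p zero) (funToFin-cong (p ∘ suc))

-- The group ring and the Euler product

module GroupRing {q : ℕ} (F : FiniteField q) (pp : IsPrimePower q) (R : CommutativeRing 0ℓ 0ℓ) where
  private module F = Field F pp
  open F using (enum; index; index-enum; index-cong; enum-index)
  open Kit R

  infixl 6 _⊞_ _⊟_
  _⊞_ _⊟_ : Fin q → Fin q → Fin q
  i ⊞ j = index (enum i F.⊕ enum j)
  i ⊟ j = index (enum i F.⊖ enum j)

  0ᵢ : Fin q
  0ᵢ = index F.0#

  private
    by : ∀ {x} i → x F.≈ enum i → index x ≡ i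
    by i e = ≡.trans (index-cong e) (index-enum i)

  ⊟-⊟ : ∀ c i → c ⊟ (c ⊟ i) ≡ i
  ⊟-⊟ c i = by i (F.trans (F.+-congˡ (F.-‿cong (enum-index _))) (F.solve 2 (λ c i → c F.:- (c F.:- i) F.:= i) F.refl _ _))

  ⊞-⊟ : ∀ k i → (k ⊞ i) ⊟ i ≡ k
  ⊞-⊟ k i = by k (F.trans (F.+-congʳ (enum-index _)) (F.solve 2 (λ k i → (k F.:+ i) F.:- i F.:= k) F.refl _ _))

  ⊟-⊞ : ∀ j i → (j ⊟ i) ⊞ i ≡ j
  ⊟-⊞ j i = by j (F.trans (F.+-congʳ (enum-index _)) (F.solve 2 (λ k i → (k F.:- i) F.:+ i F.:= k) F.refl _ _))

  ⊟-assoc : ∀ c k i → c ⊟ (k ⊞ i) ≡ (c ⊟ i) ⊟ k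
  ⊟-assoc c k i = index-cong (F.trans (F.+-congˡ (F.-‿cong (enum-index _)))
    (F.trans (F.solve 3 (λ c k i → c F.:- (k F.:+ i) F.:= (c F.:- i) F.:- k) F.refl _ _ _) (F.+-congʳ (F.sym (enum-index _)))))

  ⊟-0 : ∀ c → c ⊟ 0ᵢ ≡ c
  ⊟-0 c = by c (F.trans (F.+-congˡ (F.-‿cong (enum-index _))) (F.solve 1 (λ c → c F.:- F.:0 F.:= c) F.refl _))

  reflection : Fin q → Perm.Permutation q q
  reflection c = Perm.permutation (c ⊟_) (c ⊟_) (⊟-⊟ c) (⊟-⊟ c)

  translation : Fin q → Perm.Permutation q q
  translation i = Perm.permutation (_⊞ i) (_⊟ i) (λ k → ⊟-⊞ k i) (λ k → ⊞-⊟ k i)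

  Fun : Set
  Fun = Fin q → Carrier

  infix 4 _≗_
  record _≗_ (f g : Fun) : Set where
    constructor mk
    field at : ∀ c → f c ≈ g c
  open _≗_ public

  infixl 7 _∗_
  _∗_ : Fun → Fun → Fun
  (f ∗ g) c = sum {q} (λ i → f i ⊗ g (c ⊟ i))

  δ : Fin q → Fun
  δ a c with a Finₚ.≟ c
  ... | yes _ = 1#
  ... | no _ = 0#

  δ-≡ : ∀ a c → a ≡ c → δ a c ≈ 1#
  δ-≡ a c e with a Finₚ.≟ c
  ... | yes _ = refl
  ... | no ne = ⊥-elim (ne e)

  δ-≢ : ∀ a c → a ≢ c → δ a c ≈ 0#
  δ-≢ a c ne with a Finₚ.≟ c
  ... | yes e = ⊥-elim (ne e)
  ... | no _ = refl

  open SingleTerm (CommutativeRing.+-commutativeMonoid R)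

  δ-∗ : ∀ a f c → (δ a ∗ f) c ≈ f (c ⊟ a)
  δ-∗ a f c = trans (sum-single {q} (λ i → δ a i ⊗ f (c ⊟ i)) a (λ j j≢a → trans (*-congʳ (δ-≢ a j (j≢a ∘ ≡.sym))) (zeroˡ _)))
    (trans (*-congʳ (δ-≡ a a ≡.refl)) (*-identityˡ _))

  ∗-comm : ∀ f g c → (f ∗ g) c ≈ (g ∗ f) c
  ∗-comm f g c = trans (sum-permute {q} {q} (λ i → f i ⊗ g (c ⊟ i)) (reflection c))
    (sum-cong-≋ {q} (λ i → trans (*-comm _ _) (*-congʳ (reflexive (≡.cong g (⊟-⊟ c i))))))

  ∗-assoc : ∀ f g h c → ((f ∗ g) ∗ h) c ≈ (f ∗ (g ∗ h)) c
  ∗-assoc f g h c = begin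
    sum {q} (λ j → sum {q} (λ i → f i ⊗ g (j ⊟ i)) ⊗ h (c ⊟ j)) ≈⟨ sum-cong-≋ {q} (λ j → *-distribʳ-sum {q} (h (c ⊟ j)) (λ i → f i ⊗ g (j ⊟ i))) ⟩
    sum {q} (λ j → sum {q} (λ i → (f i ⊗ g (j ⊟ i)) ⊗ h (c ⊟ j))) ≈⟨ ∑-comm {q} {q} (λ j i → (f i ⊗ g (j ⊟ i)) ⊗ h (c ⊟ j)) ⟩
    sum {q} (λ i → sum {q} (λ j → (f i ⊗ g (j ⊟ i)) ⊗ h (c ⊟ j))) ≈⟨ sum-cong-≋ {q} (λ i → sum-permute {q} {q} (λ j → (f i ⊗ g (j ⊟ i)) ⊗ h (c ⊟ j)) (translation i)) ⟩
    sum {q} (λ i → sum {q} (λ k → (f i ⊗ g ((k ⊞ i) ⊟ i)) ⊗ h (c ⊟ (k ⊞ i))))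
      ≈⟨ sum-cong-≋ {q} (λ i → trans (sum-cong-≋ {q} (λ k → trans (*-cong (*-congˡ (reflexive (≡.cong g (⊞-⊟ k i)))) (reflexive (≡.cong h (⊟-assoc c k i)))) (*-assoc _ _ _)))
           (sym (*-distribˡ-sum {q} (f i) (λ k → g k ⊗ h ((c ⊟ i) ⊟ k))))) ⟩
    sum {q} (λ i → f i ⊗ sum {q} (λ k → g k ⊗ h ((c ⊟ i) ⊟ k))) ∎
    where open Reasoning

  groupRing : CommutativeRing 0ℓ 0ℓ
  groupRing = toCommutativeRing {Fun} record
    { _≈_ = _≗_
    ; add = λ f g c → f c ⊕ g c ; mul = _∗_ ; neg = λ f c → - f c ; zer = λ _ → 0# ; one = δ 0ᵢ
    ; refl = mk λ _ → refl ; sym = λ p → mk λ c → sym (at p c) ; trans = λ p r → mk λ c → trans (at p c) (at r c)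
    ; add-cong = λ p r → mk λ c → +-cong (at p c) (at r c)
    ; mul-cong = λ p r → mk λ c → sum-cong-≋ {q} (λ i → *-cong (at p i) (at r (c ⊟ i)))
    ; neg-cong = λ p → mk λ c → -‿cong (at p c)
    ; add-assoc = λ _ _ _ → mk λ _ → +-assoc _ _ _
    ; add-comm = λ _ _ → mk λ _ → +-comm _ _
    ; add-zero = λ _ → mk λ _ → +-identityˡ _
    ; add-neg = λ _ → mk λ _ → -‿inverseˡ _
    ; mul-assoc = λ f g h → mk (∗-assoc f g h)
    ; mul-comm = λ f g → mk (∗-comm f g)
    ; mul-one = λ f → mk λ c → trans (δ-∗ 0ᵢ f c) (reflexive (≡.cong f (⊟-0 c)))
    ; distrib = λ f g h → mk λ c → trans (sum-cong-≋ {q} (λ i → distribˡ _ _ _)) (∑-distrib-+ {q} (λ i → f i ⊗ g (c ⊟ i)) (λ i → f i ⊗ h (c ⊟ i)))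
    }

  module 𝔾 = Kit groupRing

  δ-⊞ : ∀ a b → δ a 𝔾.⊗ δ b 𝔾.≈ δ (a ⊞ b)
  δ-⊞ a b = mk λ c → trans (δ-∗ a (δ b) c) (same c)
    where
      same : ∀ c → δ b (c ⊟ a) ≈ δ (a ⊞ b) c
      same c with b Finₚ.≟ c ⊟ a
      ... | yes e = sym (δ-≡ _ _ (≡.trans (≡.cong (a ⊞_) e) (≡.trans (index-cong (F.+-comm _ _)) (⊟-⊞ c a))))
      ... | no ne = sym (δ-≢ _ _ λ e → ne (≡.sym (≡.trans (≡.cong (_⊟ a) (≡.trans (≡.sym e) (index-cong (F.+-comm _ _)))) (⊞-⊟ b a))))

  δ-↑ : ∀ x n → δ (index x) 𝔾.↑ n 𝔾.≈ δ (index (n F.· x))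
  δ-↑ x zero = 𝔾.refl
  δ-↑ x (suc n) = 𝔾.trans (𝔾.*-congˡ {δ (index x)} (δ-↑ x n)) (𝔾.trans (δ-⊞ (index x) (index (n F.· x)))
    (𝔾.reflexive (≡.cong δ (index-cong (F.+-cong (enum-index _) (enum-index _))))))

  sum-at : ∀ {n} (f : Fin n → Fun) c → 𝔾.sum f c ≈ sum (λ i → f i c)
  sum-at {zero} f c = refl
  sum-at {suc n} f c = +-congˡ (sum-at (f ∘ suc) c)

  ·-at : ∀ n f c → (n 𝔾.· f) c ≈ n · f c
  ·-at zero f c = refl
  ·-at (suc n) f c = +-congˡ (·-at n f c)

  ones : Fun
  ones _ = 1#

  -- The group ring modulo its trivial-character part.
  open Quotient groupRing ones public renaming (quotientRing to reducedRing)

  -- The product w ∗ ones is the constant ∑ w, so the ideal generated by `ones` consists of the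
  -- constant functions.
  ∼⇒constant : ∀ {f g} → f ∼ g → ∃ λ k → ∀ c → f c ≈ g c ⊕ k
  ∼⇒constant {f} {g} (mk w e) = sum {q} w , λ c → trans (at e c) (+-congˡ (sum-cong-≋ {q} (λ i → *-identityʳ (w i))))

  constant⇒∼ : ∀ {f g} k → (∀ c → f c ≈ g c ⊕ k) → f ∼ g
  constant⇒∼ {f} {g} k p = mk (λ c → k ⊗ δ 0ᵢ c) (mk λ c → trans (p c) (+-congˡ (sym (trans
    (trans (sum-cong-≋ {q} (λ i → *-assoc _ _ _)) (sym (*-distribˡ-sum {q} k (λ i → δ 0ᵢ i ⊗ 1#)))) (trans (*-congˡ (δ-∗ 0ᵢ ones c)) (*-identityʳ k))))))

module Sieve {q : ℕ} (F : FiniteField q) (pp : IsPrimePower q) where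
  open Field F pp
  open PolyOverField F pp
  open Series commRing using (mk; at)

  -- Coefficients are indices and not field elements: equality of monic polynomials becomes
  -- propositional and decidable, and they can be listed and summed over.
  Mon : ℕ → Set
  Mon n = Vec (Fin q) n

  polyOf : ∀ {n} → Mon n → Poly
  polyOf g = toPoly (Vec.map enum g)

  indices : ∀ {n} → Vec Carrier n → Mon n
  indices = Vec.map index

  polyOf-indices : ∀ {n} (v : Vec Carrier n) → polyOf (indices v) ℙ.≈ toPoly v
  polyOf-indices [] = ℙ.refl
  polyOf-indices (c ∷ v) = ℙ.+-cong (Hom.cong constants (enum-index c)) (ℙ.*-congˡ {X} (polyOf-indices v))

  polyOf-injective : ∀ {n} (u v : Mon n) → polyOf u ℙ.≈ polyOf v → u ≡ v
  polyOf-injective [] [] _ = ≡.refl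
  polyOf-injective (i ∷ u) (j ∷ v) eq = ≡.cong₂ _∷_
    (≡.trans (≡.sym (index-enum i)) (≡.trans (index-cong (toPoly-injective (Vec.map enum (i ∷ u)) (Vec.map enum (j ∷ v)) eq zero)) (index-enum j)))
    (polyOf-injective u v (mk (mk λ k → trans (sym (trans (toPoly-∷ (enum i) (Vec.map enum u) (suc k)) (+-identityˡ _)))
      (trans (Series.at (_≈ₚ_.eq eq) (suc k)) (trans (toPoly-∷ (enum j) (Vec.map enum v) (suc k)) (+-identityˡ _))))))

  abstract
    -- A multiple of the monic P of smaller degree is zero, so the remainder decides. Only the
    -- answer is ever used, hence the opacity.
    _∣ₚ?_ : ∀ {n} (P : Vec Carrier n) f → Dec (toPoly P ∣ₚ f)
    _∣ₚ?_ {n} P f = decide (normalise n rem rem-vanish)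
      where
        open Division (divide P f)
        decide : (rem ℙ.≈ ℙ.0# ⊎ ∃ λ k → k < n × ∃ λ (w : Vec Carrier k) → ∃ λ c → ∃ λ c⁻¹ → c ⊗ c⁻¹ ≈ 1# × rem ℙ.≈ C c ℙ.⊗ toPoly w) → Dec (toPoly P ∣ₚ f)
        decide (inj₁ r≈0) = yes (quo , ℙ.trans division (ℙ.trans (ℙ.+-congˡ r≈0) (ℙ.+-identityʳ _)))
        decide (inj₂ (k , k<n , w , c , c⁻¹ , cc⁻¹ , r≈)) = no λ (u , f≈uP) → 1≉0 (begin
            1# ≈⟨ sym cc⁻¹ ⟩
            c ⊗ c⁻¹ ≈⟨ *-congʳ (begin
              c ≈⟨ sym (trans (*-congˡ (toPoly-top w)) (*-identityʳ c)) ⟩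
              c ⊗ coeff (toPoly w) k ≈⟨ sym (coeff-C⊗ c (toPoly w) k) ⟩
              coeff (C c ℙ.⊗ toPoly w) k ≈⟨ sym (Series.at (_≈ₚ_.eq r≈) k) ⟩
              coeff rem k ≈⟨ Series.at (_≈ₚ_.eq (rem≈0 u f≈uP)) k ⟩
              0# ∎) ⟩
            0# ⊗ c⁻¹ ≈⟨ zeroˡ _ ⟩
            0# ∎)
          where
            open Reasoning
            rem≈ : ∀ u → f ℙ.≈ u ℙ.⊗ toPoly P → rem ℙ.≈ (u ℙ.⊖ quo) ℙ.⊗ toPoly P
            rem≈ u f≈uP = ℙ.trans (ℙ.solve 2 (λ a r → r ℙ.:= (a ℙ.:+ r) ℙ.:- a) ℙ.refl (quo ℙ.⊗ toPoly P) rem)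
              (ℙ.trans (ℙ.+-congʳ (ℙ.trans (ℙ.sym division) f≈uP)) (ℙ.solve 3 (λ u p q → u ℙ.:* p ℙ.:- q ℙ.:* p ℙ.:= (u ℙ.:- q) ℙ.:* p) ℙ.refl u (toPoly P) quo))
            rem≈0 : ∀ u → f ℙ.≈ u ℙ.⊗ toPoly P → rem ℙ.≈ ℙ.0#
            rem≈0 u f≈uP = ℙ.trans (rem≈ u f≈uP) (ℙ.trans (ℙ.*-congʳ {toPoly P} (multiple-vanish P (u ℙ.⊖ quo)
              (λ k le → trans (sym (Series.at (_≈ₚ_.eq (rem≈ u f≈uP)) k)) (rem-vanish k le)))) (ℙ.zeroˡ _))

  monic-product : ∀ {e k} (u : Mon e) (v : Mon k) → ∃ λ (w : Vec Carrier (e ℕ.+ k)) → polyOf u ℙ.⊗ polyOf v ℙ.≈ toPoly w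
  monic-product {e} {k} u v = monic-vector (e ℕ.+ k) (polyOf u ℙ.⊗ polyOf v)
    (conv-vanishes< e k (toPoly-vanish (Vec.map enum u)) (toPoly-vanish (Vec.map enum v)))
    (trans (conv-top e k (toPoly-vanish (Vec.map enum u)) (toPoly-vanish (Vec.map enum v)))
      (trans (*-cong (toPoly-top (Vec.map enum u)) (toPoly-top (Vec.map enum v))) (*-identityˡ _)))

  abstract
    mul : ∀ {e k} → Mon e → Mon k → Mon (e ℕ.+ k)
    mul u v = indices (proj₁ (monic-product u v))

    mul-spec : ∀ {e k} (u : Mon e) (v : Mon k) → polyOf (mul u v) ℙ.≈ polyOf u ℙ.⊗ polyOf v
    mul-spec u v = ℙ.trans (polyOf-indices (proj₁ (monic-product u v))) (ℙ.sym (proj₂ (monic-product u v)))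

  monic-cofactor : ∀ {e k} (P : Mon e) (g : Mon (e ℕ.+ k)) → polyOf P ∣ₚ polyOf g → ∃ λ (g′ : Mon k) → mul P g′ ≡ g
  monic-cofactor {e} {k} P g (u , eq) = indices w , polyOf-injective _ g (begin
      polyOf (mul P (indices w)) ≈⟨ mul-spec P (indices w) ⟩
      polyOf P ℙ.⊗ polyOf (indices w) ≈⟨ ℙ.*-congˡ {polyOf P} (ℙ.trans (polyOf-indices w) (ℙ.sym (proj₂ mv))) ⟩
      polyOf P ℙ.⊗ u ≈⟨ ℙ.*-comm (polyOf P) u ⟩
      u ℙ.⊗ polyOf P ≈⟨ ℙ.sym eq ⟩
      polyOf g ∎)
    where
      open ℙ.Reasoning
      u-vanish : VanishesFrom (suc k) (coeff u)
      u-vanish = cofactor-vanish (Vec.map enum P) u (suc k) λ n le → trans (sym (Series.at (_≈ₚ_.eq eq) n))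
        (toPoly-vanish (Vec.map enum g) n (ℕₚ.≤-trans (ℕₚ.≤-reflexive (≡.cong suc (ℕₚ.+-comm e k))) le))
      u-top : coeff u k ≈ 1#
      u-top = trans (sym (trans (*-congˡ (toPoly-top (Vec.map enum P))) (*-identityʳ _))) (trans (sym (conv-top k e u-vanish (toPoly-vanish (Vec.map enum P))))
        (trans (reflexive (≡.cong (coeff (u ℙ.⊗ polyOf P)) (ℕₚ.+-comm k e))) (trans (sym (Series.at (_≈ₚ_.eq eq) (e ℕ.+ k))) (toPoly-top (Vec.map enum g)))))
      mv = monic-vector k u u-vanish u-top
      w = proj₁ mv

  mul-injective : ∀ {e k} (P : Mon e) (u v : Mon k) → mul P u ≡ mul P v → u ≡ v
  mul-injective P u v eq = polyOf-injective u v (ℙ.x∙y⁻¹≈ε⇒x≈y _ _ (multiple-vanish (Vec.map enum P) (polyOf u ℙ.⊖ polyOf v)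
      (λ n _ → Series.at (_≈ₚ_.eq zero-product) n)))
    where
      open ℙ.Reasoning
      zero-product : (polyOf u ℙ.⊖ polyOf v) ℙ.⊗ polyOf P ℙ.≈ ℙ.0#
      zero-product = begin
        (polyOf u ℙ.⊖ polyOf v) ℙ.⊗ polyOf P ≈⟨ ℙ.solve 3 (λ u v p → (u ℙ.:- v) ℙ.:* p ℙ.:= p ℙ.:* u ℙ.:- p ℙ.:* v) ℙ.refl (polyOf u) (polyOf v) (polyOf P) ⟩
        polyOf P ℙ.⊗ polyOf u ℙ.⊖ polyOf P ℙ.⊗ polyOf v ≈⟨ ℙ.x≈y⇒x∙y⁻¹≈ε (ℙ.trans (ℙ.sym (mul-spec P u)) (ℙ.trans (ℙ.reflexive (≡.cong polyOf eq)) (mul-spec P v))) ⟩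
        ℙ.0# ∎

  divisor-degree : ∀ {e n} (P : Mon e) (g : Mon n) → polyOf P ∣ₚ polyOf g → e ≤ n
  divisor-degree {e} {n} P g (u , eq) with e ℕ.≤? n
  ... | yes e≤n = e≤n
  ... | no e≰n = ⊥-elim (1≉0 (trans (sym (toPoly-top (Vec.map enum g))) (trans (Series.at (_≈ₚ_.eq eq) n)
      (Series.at (_≈ₚ_.eq (ℙ.trans (ℙ.*-congʳ {polyOf P} u≈0) (ℙ.zeroˡ _))) n))))
    where
      u≈0 : u ℙ.≈ ℙ.0#
      u≈0 = multiple-vanish (Vec.map enum P) u λ k le → trans (sym (Series.at (_≈ₚ_.eq eq) k)) (toPoly-vanish (Vec.map enum g) k (ℕₚ.≤-trans (ℕₚ.≰⇒> e≰n) le))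

  ∣ₚ-trans : ∀ {f g h} → f ∣ₚ g → g ∣ₚ h → f ∣ₚ h
  ∣ₚ-trans {f} (u , p) (v , r) = v ℙ.⊗ u , ℙ.trans r (ℙ.trans (ℙ.*-congˡ {v} p) (ℙ.sym (ℙ.*-assoc v u f)))

  ∣ₚ-respʳ : ∀ {f g h} → g ℙ.≈ h → f ∣ₚ g → f ∣ₚ h
  ∣ₚ-respʳ e (u , p) = u , ℙ.trans (ℙ.sym e) p

  Monics : Set
  Monics = List (Σ ℕ Mon)

  Free : Monics → Poly → Set
  Free [] f = ⊤
  Free ((e , P) ∷ L) f = ¬ (polyOf P ∣ₚ f) × Free L f

  free? : ∀ L f → Dec (Free L f)
  free? [] f = yes tt
  free? ((e , P) ∷ L) f with Vec.map enum P ∣ₚ? f | free? L f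
  ... | yes P∣f | _ = no λ (P∤f , _) → P∤f P∣f
  ... | no P∤f | yes fr = yes (P∤f , fr)
  ... | no P∤f | no ¬fr = no λ (_ , fr) → ¬fr fr

  Free-divisor : ∀ L {f g} → f ∣ₚ g → Free L g → Free L f
  Free-divisor [] f∣g fr = tt
  Free-divisor ((e , P) ∷ L) f∣g (P∤g , fr) = (λ P∣f → P∤g (∣ₚ-trans P∣f f∣g)) , Free-divisor L f∣g fr

  -- Freeness of each P from the later entries excludes repetitions, so distinct entries contribute
  -- distinct Euler factors.
  Primes : Monics → Set
  Primes [] = ⊤
  Primes ((e , P) ∷ L) = Irreducible (Vec.map enum P) × Free L (polyOf P) × Primes L

  Free-product : ∀ L → Primes L → ∀ {f g} → Free L f → Free L g → Free L (f ℙ.⊗ g)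
  Free-product [] _ _ _ = tt
  Free-product ((e , P) ∷ L) (irr , _ , primes) {f} {g} (P∤f , ff) (P∤g , fg) =
    (λ P∣fg → Sum.[ P∤f , P∤g ] (Euclid.euclid (Vec.map enum P) irr f g P∣fg)) , Free-product L primes ff fg

  Covers : ℕ → Monics → Set
  Covers N L = ∀ n → 1 ≤ n → n ≤ N → (g : Mon n) → ¬ Free L (polyOf g)

  sift : ∀ {n} → Mon n → Monics → Monics
  sift {n} g L with free? L (polyOf g)
  ... | yes _ = (n , g) ∷ L
  ... | no _ = L

  allMon : ∀ n → List (Mon n)
  allMon zero = [] ∷ []
  allMon (suc n) = List.concatMap (λ i → List.map (i ∷_) (allMon n)) (List.allFin q)

  ∈-allMon : ∀ {n} (g : Mon n) → g ∈ allMon n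
  ∈-allMon [] = here ≡.refl
  ∈-allMon {suc n} (i ∷ g) = ∈ₚ.∈-concatMap⁺ (λ i → List.map (i ∷_) (allMon n)) (lose (∈ₚ.∈-allFin i) (∈ₚ.∈-map⁺ (i ∷_) (∈-allMon g)))

  -- The sieve of Eratosthenes, run by degree: a polynomial is kept if nothing kept so far divides
  -- it. Unique factorisation is never invoked.
  primesUpTo : ℕ → Monics
  primesUpTo zero = []
  primesUpTo (suc N) = List.foldr sift (primesUpTo N) (allMon (suc N))

  sift-primes : ∀ {N} (g : Mon (suc N)) L → Primes L → Covers N L → Primes (sift g L) × Covers N (sift g L)
  sift-primes {N} g L primes covers with free? L (polyOf g)
  ... | no _ = primes , covers
  ... | yes fr = (record { degree-positive = s≤s z≤n ; no-factor = no-factor } , fr , primes) , λ n 1≤n n≤N g′ (_ , fr′) → covers n 1≤n n≤N g′ fr′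
    where
      -- A proper factor has degree at most N, hence is divisible by an entry of L; that entry would
      -- divide g, which is free of L.
      no-factor : ∀ {k} → 1 ≤ k → k < suc N → (w : Vec Carrier k) → ¬ (toPoly w ∣ₚ polyOf g)
      no-factor {k} 1≤k (s≤s k≤N) w (u , eq) = covers k 1≤k k≤N (indices w)
        (Free-divisor L (u , ℙ.trans eq (ℙ.*-congˡ {u} (ℙ.sym (polyOf-indices w)))) fr)

  sift-hits : ∀ {n} (g : Mon n) L → ¬ Free (sift g L) (polyOf g)
  sift-hits g L with free? L (polyOf g)
  ... | yes _ = λ (g∤g , _) → g∤g (ℙ.1# , ℙ.sym (ℙ.*-identityˡ _))
  ... | no ¬fr = ¬fr

  sift-keeps : ∀ {n} (g : Mon n) L f → ¬ Free L f → ¬ Free (sift g L) f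
  sift-keeps g L f ¬fr with free? L (polyOf g)
  ... | yes _ = λ (_ , fr) → ¬fr fr
  ... | no _ = ¬fr

  foldr-sift-hits : ∀ {n} (gs : List (Mon n)) L g → g ∈ gs → ¬ Free (List.foldr sift L gs) (polyOf g)
  foldr-sift-hits (g′ ∷ gs) L g (here ≡.refl) = sift-hits g (List.foldr sift L gs)
  foldr-sift-hits (g′ ∷ gs) L g (there g∈gs) = sift-keeps g′ (List.foldr sift L gs) (polyOf g) (foldr-sift-hits gs L g g∈gs)

  primesUpTo-correct : ∀ N → Primes (primesUpTo N) × Covers N (primesUpTo N)
  primesUpTo-correct zero = tt , λ n 1≤n n≤0 g _ → ℕₚ.<⇒≱ 1≤n n≤0
  primesUpTo-correct (suc N) = proj₁ sifted , covers
    where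
      fold-correct : ∀ gs → Primes (List.foldr sift (primesUpTo N) gs) × Covers N (List.foldr sift (primesUpTo N) gs)
      fold-correct [] = primesUpTo-correct N
      fold-correct (g ∷ gs) = sift-primes g (List.foldr sift (primesUpTo N) gs) (proj₁ (fold-correct gs)) (proj₂ (fold-correct gs))
      sifted = fold-correct (allMon (suc N))
      covers : Covers (suc N) (primesUpTo (suc N))
      covers n 1≤n n≤ g with ℕₚ.m≤n⇒m<n∨m≡n n≤
      ... | inj₁ (s≤s n≤N) = proj₂ sifted n 1≤n n≤N g
      ... | inj₂ ≡.refl = foldr-sift-hits (allMon (suc N)) (primesUpTo N) g (∈-allMon g)

module MonicSums (q : ℕ) (B : CommutativeRing 0ℓ 0ℓ) where
  open Kit B
  private
    module Single = SingleTerm (CommutativeRing.+-commutativeMonoid B)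

    Mon : ℕ → Set
    Mon n = Vec (Fin q) n

  sumᵛ : ∀ n → (Mon n → Carrier) → Carrier
  sumᵛ zero f = f []
  sumᵛ (suc n) f = sum {q} (λ i → sumᵛ n (λ v → f (i ∷ v)))

  sumᵛ-cong : ∀ n {f g : Mon n → Carrier} → (∀ v → f v ≈ g v) → sumᵛ n f ≈ sumᵛ n g
  sumᵛ-cong zero p = p []
  sumᵛ-cong (suc n) p = sum-cong-≋ {q} (λ i → sumᵛ-cong n (λ v → p (i ∷ v)))

  sumᵛ-0 : ∀ n {f : Mon n → Carrier} → (∀ v → f v ≈ 0#) → sumᵛ n f ≈ 0#
  sumᵛ-0 zero p = p []
  sumᵛ-0 (suc n) {f} p = Single.sum-ε {q} (λ i → sumᵛ n (λ v → f (i ∷ v))) (λ i → sumᵛ-0 n (λ v → p (i ∷ v)))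

  sumᵛ-⊕ : ∀ n (f g : Mon n → Carrier) → sumᵛ n (λ v → f v ⊕ g v) ≈ sumᵛ n f ⊕ sumᵛ n g
  sumᵛ-⊕ zero f g = refl
  sumᵛ-⊕ (suc n) f g = trans (sum-cong-≋ {q} (λ i → sumᵛ-⊕ n (λ v → f (i ∷ v)) (λ v → g (i ∷ v))))
    (∑-distrib-+ {q} (λ i → sumᵛ n (λ v → f (i ∷ v))) (λ i → sumᵛ n (λ v → g (i ∷ v))))

  sumᵛ-scale : ∀ n a (f : Mon n → Carrier) → sumᵛ n (λ v → a ⊗ f v) ≈ a ⊗ sumᵛ n f
  sumᵛ-scale zero a f = refl
  sumᵛ-scale (suc n) a f = trans (sum-cong-≋ {q} (λ i → sumᵛ-scale n a (λ v → f (i ∷ v)))) (sym (*-distribˡ-sum {q} a (λ i → sumᵛ n (λ v → f (i ∷ v)))))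

  sum-sumᵛ : ∀ k n (f : Fin k → Mon n → Carrier) → sum {k} (λ i → sumᵛ n (f i)) ≈ sumᵛ n (λ v → sum {k} (λ i → f i v))
  sum-sumᵛ k zero f = refl
  sum-sumᵛ k (suc n) f = trans (∑-comm {k} {q} (λ i j → sumᵛ n (λ v → f i (j ∷ v)))) (sum-cong-≋ {q} (λ j → sum-sumᵛ k n (λ i v → f i (j ∷ v))))

  sumᵛ-comm : ∀ m n (f : Mon m → Mon n → Carrier) → sumᵛ m (λ u → sumᵛ n (f u)) ≈ sumᵛ n (λ v → sumᵛ m (λ u → f u v))
  sumᵛ-comm zero n f = refl
  sumᵛ-comm (suc m) n f = trans (sum-cong-≋ {q} (λ i → sumᵛ-comm m n (λ u → f (i ∷ u)))) (sum-sumᵛ q n (λ i v → sumᵛ m (λ u → f (i ∷ u) v)))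

  sumᵛ-single : ∀ {n} (f : Mon n → Carrier) w → (∀ v → v ≢ w → f v ≈ 0#) → sumᵛ n f ≈ f w
  sumᵛ-single f [] p = refl
  sumᵛ-single {suc n} f (i ∷ w) p = trans
    (Single.sum-single {q} (λ j → sumᵛ n (λ v → f (j ∷ v))) i (λ j j≢i → sumᵛ-0 n (λ v → p (j ∷ v) (j≢i ∘ Vecₚ.∷-injectiveˡ))))
    (sumᵛ-single (λ v → f (i ∷ v)) w (λ v v≢w → p (i ∷ v) (v≢w ∘ Vecₚ.∷-injectiveʳ)))

  sumᵛ-++ : ∀ m {n} (f : Mon (m ℕ.+ n) → Carrier) → sumᵛ (m ℕ.+ n) f ≈ sumᵛ m (λ l → sumᵛ n (λ w → f (l Vec.++ w)))
  sumᵛ-++ zero f = refl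
  sumᵛ-++ (suc m) f = sum-cong-≋ {q} (λ i → sumᵛ-++ m (λ v → f (i ∷ v)))

  indicator : ∀ {A : Set} → Dec A → Carrier
  indicator (yes _) = 1#
  indicator (no _) = 0#

  indicator-yes : ∀ {A : Set} (d : Dec A) → A → indicator d ≈ 1#
  indicator-yes (yes _) a = refl
  indicator-yes (no ¬a) a = ⊥-elim (¬a a)

  indicator-no : ∀ {A : Set} (d : Dec A) → ¬ A → indicator d ≈ 0#
  indicator-no (yes a) ¬a = ⊥-elim (¬a a)
  indicator-no (no _) ¬a = refl

  indicator-⇔ : ∀ {A A′ : Set} (d : Dec A) (d′ : Dec A′) → (A → A′) → (A′ → A) → indicator d ≈ indicator d′
  indicator-⇔ (yes a) d′ f g = sym (indicator-yes d′ (f a))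
  indicator-⇔ (no ¬a) d′ f g = sym (indicator-no d′ (¬a ∘ g))

abstract
  -- Opaque, so that sums over primes meet divisibility only through functions such as `weigh`,
  -- which take the decision as an argument and can be analysed for either outcome.
  cofactor? : ∀ e n → (∃ λ j → n ≡ j * e) ⊎ (∀ j → n ≢ j * e)
  cofactor? e n with e Div.∣? n
  ... | yes (divides j eq) = inj₁ (j , eq)
  ... | no e∤n = inj₂ λ j eq → e∤n (divides j eq)

module PrimeSums (q : ℕ) (B : CommutativeRing 0ℓ 0ℓ) where
  open Kit B using (Carrier; 0#; _⊕_; _≈_; refl; sym; trans; +-cong)

  -- The share of a prime of degree e in the n-th power sum, nonzero only for n = j e. `ξ` is left
  -- open: it becomes e χ(P)^j for the trace character and e for plain counting.
  weigh : (∀ {e} → Vec (Fin q) e → ℕ → Carrier) → ∀ {e n} → Vec (Fin q) e → (∃ λ j → n ≡ j * e) ⊎ (∀ j → n ≢ j * e) → Carrier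
  weigh ξ P (inj₁ (j , _)) = ξ P j
  weigh ξ P (inj₂ _) = 0#

  primeSum : (∀ {e} → Vec (Fin q) e → ℕ → Carrier) → ℕ → List (Σ ℕ (Vec (Fin q))) → Carrier
  primeSum ξ n [] = 0#
  primeSum ξ n ((e , P) ∷ L) = weigh ξ P (cofactor? e n) ⊕ primeSum ξ n L

  primeSum-unique : (ξ : ∀ {e} → Vec (Fin q) e → ℕ → Carrier) (n : ℕ) (S : List (Σ ℕ (Vec (Fin q))) → Carrier)
    (w : ∀ {e} → Vec (Fin q) e → (∃ λ j → n ≡ j * e) ⊎ (∀ j → n ≢ j * e) → Carrier) →
    (∀ {e} (P : Vec (Fin q) e) s → weigh ξ P s ≈ w P s) → S [] ≈ 0# → (∀ {e} (P : Vec (Fin q) e) L → S ((e , P) ∷ L) ≈ w P (cofactor? e n) ⊕ S L) →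
    ∀ L → primeSum ξ n L ≈ S L
  primeSum-unique ξ n S w weigh≈ S-[] S-∷ [] = sym S-[]
  primeSum-unique ξ n S w weigh≈ S-[] S-∷ ((e , P) ∷ L) = trans (+-cong (weigh≈ P (cofactor? e n)) (primeSum-unique ξ n S w weigh≈ S-[] S-∷ L)) (sym (S-∷ P L))

module EulerProduct {q : ℕ} (F : FiniteField q) (pp : IsPrimePower q) (B : CommutativeRing 0ℓ 0ℓ)
  (χ : ∀ {n} → Vec (Fin q) n → Kit.Carrier B)
  (χ-[] : Kit._≈_ B (χ []) (Kit.1# B))
  (χ-mul : ∀ {e k} (u : Vec (Fin q) e) (v : Vec (Fin q) k) → Kit._≈_ B (χ (Sieve.mul F pp u v)) (Kit._⊗_ B (χ u) (χ v))) where
  open Sieve F pp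
  open PolyOverField F pp using (_∣ₚ_; toPoly; module ℙ; module Irreducible; module Euclid)
  private module F = Field F pp
  open Kit B
  open Series B
  open MonicSums q B
  open PrimeSums q B

  -- The generating series of χ over the monic polynomials prime to L. Adding primes to L strips
  -- Euler factors from `T []` one at a time; this finite process takes the place of an infinite
  -- product.
  T : Monics → Seq
  T L n = sumᵛ n (λ g → indicator (free? L (polyOf g)) ⊗ χ g)

  -- Multiplication by P is a bijection from degree k onto the multiples of P in degree e + k. The
  -- indicator of divisibility is expanded as a sum over the cofactors g′, and the two sums are
  -- exchanged.
  sum-multiples : ∀ {e} k (P : Mon e) (ψ : Mon (e ℕ.+ k) → Carrier) →
    sumᵛ (e ℕ.+ k) (λ g → indicator (Vec.map F.enum P ∣ₚ? polyOf g) ⊗ ψ g) ≈ sumᵛ k (λ g′ → ψ (mul P g′))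
  sum-multiples {e} k P ψ = begin
    sumᵛ (e ℕ.+ k) (λ g → indicator (divides? g) ⊗ ψ g) ≈⟨ sumᵛ-cong (e ℕ.+ k) (λ g → *-congʳ (expand g (divides? g))) ⟩
    sumᵛ (e ℕ.+ k) (λ g → sumᵛ k (λ g′ → hit g′ g) ⊗ ψ g) ≈⟨ sumᵛ-cong (e ℕ.+ k) (λ g → trans (*-comm _ _) (trans (sym (sumᵛ-scale k (ψ g) (λ g′ → hit g′ g))) (sumᵛ-cong k (λ g′ → *-comm _ _)))) ⟩
    sumᵛ (e ℕ.+ k) (λ g → sumᵛ k (λ g′ → hit g′ g ⊗ ψ g)) ≈⟨ sumᵛ-comm (e ℕ.+ k) k (λ g g′ → hit g′ g ⊗ ψ g) ⟩
    sumᵛ k (λ g′ → sumᵛ (e ℕ.+ k) (λ g → hit g′ g ⊗ ψ g))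
      ≈⟨ sumᵛ-cong k (λ g′ → trans (sumᵛ-single (λ g → hit g′ g ⊗ ψ g) (mul P g′) (λ g g≢ → trans (*-congʳ (indicator-no (mul P g′ ≟ᵛ g) (g≢ ∘ ≡.sym))) (zeroˡ _)))
           (trans (*-congʳ (indicator-yes (mul P g′ ≟ᵛ mul P g′) ≡.refl)) (*-identityˡ _))) ⟩
    sumᵛ k (λ g′ → ψ (mul P g′)) ∎
    where
      open Reasoning
      _≟ᵛ_ : ∀ {n} (u v : Mon n) → Dec (u ≡ v)
      _≟ᵛ_ = Vecₚ.≡-dec Finₚ._≟_
      divides? : ∀ (g : Mon (e ℕ.+ k)) → Dec (polyOf P ∣ₚ polyOf g)
      divides? g = Vec.map F.enum P ∣ₚ? polyOf g
      hit : Mon k → Mon (e ℕ.+ k) → Carrier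
      hit g′ g = indicator (mul P g′ ≟ᵛ g)
      found : ∀ g → (∃ λ (g₀ : Mon k) → mul P g₀ ≡ g) → 1# ≈ sumᵛ k (λ g′ → hit g′ g)
      found g (g₀ , ≡.refl) = sym (trans
        (sumᵛ-single (λ g′ → hit g′ (mul P g₀)) g₀ (λ g′ g′≢ → indicator-no (mul P g′ ≟ᵛ mul P g₀) (g′≢ ∘ mul-injective P g′ g₀)))
        (indicator-yes (mul P g₀ ≟ᵛ mul P g₀) ≡.refl))
      expand : ∀ g (d : Dec (polyOf P ∣ₚ polyOf g)) → indicator d ≈ sumᵛ k (λ g′ → hit g′ g)
      expand g (yes P∣g) = found g (monic-cofactor P g P∣g)
      expand g (no P∤g) = sym (sumᵛ-0 k (λ g′ → indicator-no (mul P g′ ≟ᵛ g) (λ { ≡.refl → P∤g (polyOf g′ , ℙ.trans (mul-spec P g′) (ℙ.*-comm (polyOf P) (polyOf g′))) })))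

  -- The series loses the multiples of P that are free of L. These are the products P g′ with g′
  -- free of L, because P itself is free of L and primes satisfy Euclid's lemma; they contribute
  -- χ(P) tᵉ times the series.
  T-∷ : ∀ {e} (P : Mon e) L → Primes ((e , P) ∷ L) → T ((e , P) ∷ L) 𝕊.≈ linear (χ P) e 𝕊.⊗ T L
  T-∷ {e} P L (irr , free-P , primes) = 𝕊.trans (mk difference) (𝕊.trans (𝕊.+-congˡ {T L} (𝕊.-‿cong (mk λ n → sym (conv-monomialˡ (χ P) e (T L) n))))
      (𝕊.solve 2 (λ t m → t 𝕊.:- m 𝕊.:* t 𝕊.:= (𝕊.:1 𝕊.:- m) 𝕊.:* t) 𝕊.refl (T L) (monomial (χ P) e)))
    where
      split : ∀ f → indicator (free? L f) ≈ indicator (free? ((e , P) ∷ L) f) ⊕ indicator (Vec.map F.enum P ∣ₚ? f) ⊗ indicator (free? L f)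
      split f with Vec.map F.enum P ∣ₚ? f | free? L f
      ... | yes _ | yes _ = solve 0 (:1 := :0 :+ :1 :* :1) refl
      ... | yes _ | no _ = solve 0 (:0 := :0 :+ :1 :* :0) refl
      ... | no _ | yes _ = solve 0 (:1 := :1 :+ :0 :* :1) refl
      ... | no _ | no _ = solve 0 (:0 := :0 :+ :0 :* :0) refl
      T-split : ∀ n → T L n ≈ T ((e , P) ∷ L) n ⊕ sumᵛ n (λ g → indicator (Vec.map F.enum P ∣ₚ? polyOf g) ⊗ (indicator (free? L (polyOf g)) ⊗ χ g))
      T-split n = trans (sumᵛ-cong n (λ g → trans (*-congʳ (split (polyOf g))) (solve 4 (λ a b c x → (a :+ b :* c) :* x := a :* x :+ b :* (c :* x)) refl _ _ _ _)))
        (sumᵛ-⊕ n (λ g → indicator (free? ((e , P) ∷ L) (polyOf g)) ⊗ χ g) _)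
      multiples : ∀ n → sumᵛ n (λ g → indicator (Vec.map F.enum P ∣ₚ? polyOf g) ⊗ (indicator (free? L (polyOf g)) ⊗ χ g)) ≈ shift e (λ i → χ P ⊗ T L i) n
      multiples n with n ℕ.<? e
      ... | yes n<e = trans (sumᵛ-0 n (λ g → trans (*-congʳ (indicator-no (Vec.map F.enum P ∣ₚ? polyOf g) (λ P∣g → ℕₚ.<⇒≱ n<e (divisor-degree P g P∣g)))) (zeroˡ _)))
              (reflexive (≡.sym (shift-below e _ n n<e)))
      ... | no n≮e = ≡.subst (λ n → sumᵛ n (λ g → indicator (Vec.map F.enum P ∣ₚ? polyOf g) ⊗ (indicator (free? L (polyOf g)) ⊗ χ g)) ≈ shift e (λ i → χ P ⊗ T L i) n)
              (ℕₚ.m+[n∸m]≡n (ℕₚ.≮⇒≥ n≮e)) (above (n ∸ e))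
        where
          above : ∀ k → sumᵛ (e ℕ.+ k) (λ g → indicator (Vec.map F.enum P ∣ₚ? polyOf g) ⊗ (indicator (free? L (polyOf g)) ⊗ χ g)) ≈ shift e (λ i → χ P ⊗ T L i) (e ℕ.+ k)
          above k = begin
            sumᵛ (e ℕ.+ k) (λ g → indicator (Vec.map F.enum P ∣ₚ? polyOf g) ⊗ (indicator (free? L (polyOf g)) ⊗ χ g))
              ≈⟨ sum-multiples k P (λ g → indicator (free? L (polyOf g)) ⊗ χ g) ⟩
            sumᵛ k (λ g′ → indicator (free? L (polyOf (mul P g′))) ⊗ χ (mul P g′))
              ≈⟨ sumᵛ-cong k (λ g′ → trans (*-cong (indicator-⇔ (free? L (polyOf (mul P g′))) (free? L (polyOf g′)) (to g′) (from g′)) (χ-mul P g′))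
                   (solve 3 (λ a b c → a :* (b :* c) := b :* (a :* c)) refl _ _ _)) ⟩
            sumᵛ k (λ g′ → χ P ⊗ (indicator (free? L (polyOf g′)) ⊗ χ g′)) ≈⟨ sumᵛ-scale k (χ P) (λ g′ → indicator (free? L (polyOf g′)) ⊗ χ g′) ⟩
            χ P ⊗ T L k ≈⟨ reflexive (≡.sym (shift-above e (λ i → χ P ⊗ T L i) k)) ⟩
            shift e (λ i → χ P ⊗ T L i) (e ℕ.+ k) ∎
            where
              open Reasoning
              to : ∀ g′ → Free L (polyOf (mul P g′)) → Free L (polyOf g′)
              to g′ = Free-divisor L (polyOf P , mul-spec P g′)
              from : ∀ g′ → Free L (polyOf g′) → Free L (polyOf (mul P g′))
              from g′ fr = Free-divisor L (ℙ.1# , ℙ.trans (ℙ.sym (mul-spec P g′)) (ℙ.sym (ℙ.*-identityˡ _))) (Free-product L primes free-P fr)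
      difference : ∀ n → T ((e , P) ∷ L) n ≈ T L n ⊖ shift e (λ i → χ P ⊗ T L i) n
      difference n = trans (solve 2 (λ a b → a := (a :+ b) :- b) refl _ _) (+-cong (sym (T-split n)) (-‿cong (multiples n)))

  T-zero : ∀ L → Primes L → T L 0 ≈ 1#
  T-zero [] _ = trans (*-identityˡ _) χ-[]
  T-zero ((e , P) ∷ L) primes@(irr , _ , rest) = trans (at (T-∷ P L primes) 0) (trans (*-cong (linear-zero (χ P) e (Irreducible.degree-positive irr)) (T-zero L rest)) (*-identityˡ _))

  primePowerSum : Monics → Seq
  primePowerSum [] n = 0#
  primePowerSum ((e , P) ∷ L) n = powerSum (linear (χ P) e) n ⊕ primePowerSum L n

  powerSum-T : ∀ L → Primes L → ∀ n → powerSum (T L) n ≈ primePowerSum L n ⊕ powerSum (T []) n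
  powerSum-T [] _ n = sym (+-identityˡ _)
  powerSum-T ((e , P) ∷ L) primes@(irr , _ , rest) n = begin
    powerSum (T ((e , P) ∷ L)) n ≈⟨ at (powerSum-cong (T-zero ((e , P) ∷ L) primes) (T-∷ P L primes)) n ⟩
    powerSum (linear (χ P) e 𝕊.⊗ T L) n ≈⟨ at (powerSum-⊗ (linear (χ P) e) (T L) (linear-zero (χ P) e (Irreducible.degree-positive irr)) (T-zero L rest)) n ⟩
    powerSum (linear (χ P) e) n ⊕ powerSum (T L) n ≈⟨ +-congˡ (powerSum-T L rest n) ⟩
    powerSum (linear (χ P) e) n ⊕ (primePowerSum L n ⊕ powerSum (T []) n) ≈⟨ sym (+-assoc _ _ _) ⟩
    primePowerSum ((e , P) ∷ L) n ⊕ powerSum (T []) n ∎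
    where open Reasoning

  -- Every monic polynomial of degree 1 to n is hit by the sieve, so the stripped series agrees with
  -- 1 up to tⁿ and its n-th power sum is zero.
  explicit-formula : ∀ n → primePowerSum (primesUpTo n) n ⊕ powerSum (T []) n ≈ 0#
  explicit-formula n = begin
    primePowerSum L n ⊕ powerSum (T []) n ≈⟨ sym (powerSum-T L primes n) ⟩
    powerSum (T L) n ≈⟨ powerSum-cong≤ (T-zero L primes) refl n agree n ℕₚ.≤-refl ⟩
    powerSum (const 1#) n ≈⟨ at powerSum-1 n ⟩
    0# ∎
    where
      open Reasoning
      L = primesUpTo n
      primes = proj₁ (primesUpTo-correct n)
      agree : ∀ i → i ≤ n → T L i ≈ const 1# i
      agree zero _ = T-zero L primes
      agree (suc i) i≤n = sumᵛ-0 (suc i) (λ g → trans (*-congʳ (indicator-no (free? L (polyOf g)) (proj₂ (primesUpTo-correct n) (suc i) (s≤s z≤n) i≤n g))) (zeroˡ (χ g)))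

  T-[] : ∀ n → T [] n ≈ sumᵛ n χ
  T-[] n = sumᵛ-cong n (λ g → *-identityˡ (χ g))

  T-one : T [] 1 ≈ sum {q} (λ c → χ (c ∷ []))
  T-one = T-[] 1

  -- With n = m + D + 1, the variable c is the coefficient of X^(n-D-1), up to sign the elementary
  -- symmetric function of degree D + 1 in the roots. Cancellation in this one coefficient already
  -- makes the whole sum vanish.
  T-vanishes-by-fibres : ∀ m D → (∀ (l : Mon m) (u : Mon D) → sum {q} (λ c → χ (l Vec.++ (c ∷ u))) ≈ 0#) → T [] (m ℕ.+ suc D) ≈ 0#
  T-vanishes-by-fibres m D fibre = begin
    T [] (m ℕ.+ suc D) ≈⟨ T-[] (m ℕ.+ suc D) ⟩
    sumᵛ (m ℕ.+ suc D) χ ≈⟨ sumᵛ-++ m χ ⟩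
    sumᵛ m (λ l → sum {q} (λ c → sumᵛ D (λ u → χ (l Vec.++ (c ∷ u))))) ≈⟨ sumᵛ-cong m (λ l → sum-sumᵛ q D (λ c u → χ (l Vec.++ (c ∷ u)))) ⟩
    sumᵛ m (λ l → sumᵛ D (λ u → sum {q} (λ c → χ (l Vec.++ (c ∷ u))))) ≈⟨ sumᵛ-0 m (λ l → sumᵛ-0 D (λ u → fibre l u)) ⟩
    0# ∎
    where open Reasoning

  primePowerSum-primeSum : (ξ : ∀ {e} → Mon e → ℕ → Carrier) → (∀ {e} (P : Mon e) j → ξ P j ≈ e · (χ P ↑ j)) →
    ∀ n → 1 ≤ n → ∀ L → Primes L → primePowerSum L n ≈ primeSum ξ n L
  primePowerSum-primeSum ξ ξ≈ n 1≤n [] _ = refl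
  primePowerSum-primeSum ξ ξ≈ n 1≤n ((e , P) ∷ L) (irr , _ , primes) = +-cong (each (cofactor? e n)) (primePowerSum-primeSum ξ ξ≈ n 1≤n L primes)
    where
      each : ∀ s → powerSum (linear (χ P) e) n ≈ weigh ξ P s
      each (inj₁ (zero , eq)) = ⊥-elim (ℕₚ.<⇒≢ 1≤n (≡.sym eq))
      each (inj₁ (suc j , eq)) = trans (reflexive (≡.cong (powerSum (linear (χ P) e)) eq)) (trans (powerSum-linear (χ P) e (Irreducible.degree-positive irr) j) (sym (ξ≈ P (suc j))))
      each (inj₂ e∤n) = powerSum-linear∤ (χ P) e (Irreducible.degree-positive irr) n e∤n

  powerSum-T[] : ∀ n → powerSum (T []) n ≈ - primePowerSum (primesUpTo n) n
  powerSum-T[] n = trans (solve 2 (λ s t → t := :- s :+ (s :+ t)) refl (primePowerSum (primesUpTo n) n) (powerSum (T []) n))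
    (trans (+-congˡ (explicit-formula n)) (+-identityʳ _))

-- Stepanov's method

module DegreeBounds {q : ℕ} (F : FiniteField q) (pp : IsPrimePower q) where
  open Field F pp
  open PolyOverField F pp
  open Sieve F pp
  open Series commRing using (mk; at)

  record ExactDegree (f : Poly) (n : ℕ) : Set where
    constructor exact
    field
      top : ¬ (coeff f n ≈ 0#)
      beyond : VanishesFrom (suc n) (coeff f)
  open ExactDegree public

  at-coeff : ∀ {f g} → f ℙ.≈ g → ∀ n → coeff f n ≈ coeff g n
  at-coeff eq = at (_≈ₚ_.eq eq)

  exact-resp : ∀ {f g n} → f ℙ.≈ g → ExactDegree f n → ExactDegree g n
  exact-resp e (exact t b) = exact (λ z → t (trans (at-coeff e _) z)) (λ k le → trans (sym (at-coeff e k)) (b k le))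

  exact≉0 : ∀ {f n} → ExactDegree f n → ¬ (f ℙ.≈ ℙ.0#)
  exact≉0 (exact t _) e = t (at-coeff e _)

  exact-unique : ∀ {f n m} → ExactDegree f n → ExactDegree f m → n ≡ m
  exact-unique {f} {n} {m} (exact t b) (exact t′ b′) with ℕₚ.<-cmp n m
  ... | Tri.tri< n<m _ _ = ⊥-elim (t′ (b m n<m))
  ... | Tri.tri≈ _ e _ = e
  ... | Tri.tri> _ _ m<n = ⊥-elim (t (b′ n m<n))

  exact-⊗ : ∀ {f g n m} → ExactDegree f n → ExactDegree g m → ExactDegree (f ℙ.⊗ g) (n ℕ.+ m)
  exact-⊗ {f} {g} {n} {m} (exact t b) (exact t′ b′) = exact
    (λ z → Sum.[ t , t′ ] (domain (coeff f n) (coeff g m) (trans (sym (conv-top n m b b′)) z)))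
    (conv-vanishes< n m b b′)

  exact-1 : ExactDegree ℙ.1# 0
  exact-1 = exact 1≉0 (λ { (suc k) _ → refl })

  exact-↑ : ∀ {f n} k → ExactDegree f n → ExactDegree (f ℙ.↑ k) (k ℕ.* n)
  exact-↑ zero _ = exact-1
  exact-↑ (suc k) ex = exact-⊗ ex (exact-↑ k ex)

  exact-C : ∀ {c} → ¬ (c ≈ 0#) → ExactDegree (C c) 0
  exact-C c≉0 = exact c≉0 (λ { (suc k) _ → refl })

  exact-X : ExactDegree X 1
  exact-X = exact 1≉0 (λ { (suc (suc k)) _ → refl ; (suc zero) (s≤s ()) })

  exact-X↑ : ∀ n → ExactDegree (X ℙ.↑ n) n
  exact-X↑ n = ≡.subst (ExactDegree (X ℙ.↑ n)) (ℕₚ.*-identityʳ n) (exact-↑ n exact-X)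

  exact-dominant : ∀ {f g n} → VanishesFrom n (coeff f) → ExactDegree g n → ExactDegree (f ℙ.⊕ g) n
  exact-dominant {f} {g} {n} v (exact t b) = exact
    (λ z → t (trans (sym (trans (+-congʳ (v n ℕₚ.≤-refl)) (+-identityˡ _))) z))
    (λ k le → trans (+-cong (v k (ℕₚ.<⇒≤ le)) (b k le)) (+-identityˡ _))

  exact-⊕-distinct : ∀ {f g n m} → ExactDegree f n → ExactDegree g m → n ≢ m → ExactDegree (f ℙ.⊕ g) n ⊎ ExactDegree (f ℙ.⊕ g) m
  exact-⊕-distinct {f} {g} {n} {m} ef eg n≢m with ℕₚ.<-cmp n m
  ... | Tri.tri< n<m _ _ = inj₂ (exact-dominant (λ k le → beyond ef k (ℕₚ.≤-trans n<m le)) eg)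
  ... | Tri.tri≈ _ e _ = ⊥-elim (n≢m e)
  ... | Tri.tri> _ _ m<n = inj₁ (exact-resp (ℙ.+-comm g f) (exact-dominant (λ k le → beyond eg k (ℕₚ.≤-trans m<n le)) ef))

  -- Summands of pairwise different degrees cannot cancel: the largest degree present survives.
  exact-sum : ∀ {N} (f : Fin N → Poly) (deg : Fin N → ℕ) → (∀ i j → deg i ≡ deg j → i ≡ j) →
    (∀ i → f i ℙ.≈ ℙ.0# ⊎ ExactDegree (f i) (deg i)) → (∀ i → f i ℙ.≈ ℙ.0#) ⊎ ∃ λ i → ExactDegree (ℙ.sum f) (deg i)
  exact-sum {zero} f deg inj p = inj₁ λ ()
  exact-sum {suc N} f deg inj p with p zero | exact-sum (f ∘ suc) (deg ∘ suc) (λ i j e → Finₚ.suc-injective (inj (suc i) (suc j) e)) (p ∘ suc)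
  ... | inj₁ z | inj₁ zs = inj₁ λ { zero → z ; (suc i) → zs i }
  ... | inj₁ z | inj₂ (i , ex) = inj₂ (suc i , exact-resp (ℙ.sym (ℙ.trans (ℙ.+-congʳ {ℙ.sum (f ∘ suc)} z) (ℙ.+-identityˡ _))) ex)
  ... | inj₂ ex | inj₁ zs = inj₂ (zero , exact-resp (ℙ.sym (ℙ.trans (ℙ.+-congˡ {f zero} (SingleTerm.sum-ε (CommutativeRing.+-commutativeMonoid polyRing) (f ∘ suc) zs)) (ℙ.+-identityʳ _))) ex)
  ... | inj₂ ex | inj₂ (i , ex′) with exact-⊕-distinct ex ex′ (λ e → case inj zero (suc i) e of λ ())
  ...   | inj₁ r = inj₂ (zero , r)
  ...   | inj₂ r = inj₂ (suc i , r)

  zero-or-exact : ∀ f → f ℙ.≈ ℙ.0# ⊎ ∃ λ n → ExactDegree f n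
  zero-or-exact f with normalise (bound f) f (vanish f)
  ... | inj₁ z = inj₁ z
  ... | inj₂ (k , _ , w , c , c⁻¹ , cc⁻¹ , eq) = inj₂ (k , exact-resp (ℙ.sym eq) (exact-⊗ (exact-C c≉0)
          (exact (λ z → 1≉0 (trans (sym (toPoly-top w)) z)) (toPoly-vanish w))))
    where
      c≉0 : ¬ (c ≈ 0#)
      c≉0 c≈0 = 1≉0 (trans (sym cc⁻¹) (trans (*-congʳ c≈0) (zeroˡ _)))

  exact-toPoly : ∀ {n} (w : Vec Carrier n) → ExactDegree (toPoly w) n
  exact-toPoly w = exact (λ z → 1≉0 (trans (sym (toPoly-top w)) z)) (toPoly-vanish w)

  weightIf : ∀ {A : Set} → Dec A → ℕ → ℕ
  weightIf (yes _) e = e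
  weightIf (no _) e = 0

  module _ (Good : ∀ {e} → Mon e → Set) (good? : ∀ {e} (P : Mon e) → Dec (Good P)) where
    -- A prime of degree e counts e times because it stands for its e conjugate roots, so this is a
    -- number of points.
    degreeSum : Monics → ℕ
    degreeSum [] = 0
    degreeSum ((e , P) ∷ L) = weightIf (good? P) e ℕ.+ degreeSum L

    GoodDivide : Monics → Poly → Set
    GoodDivide [] f = ⊤
    GoodDivide ((e , P) ∷ L) f = (Good P → polyOf P ∣ₚ f) × GoodDivide L f

    GoodDivide-cofactor : ∀ L → Primes L → ∀ {p u} → Free L p → GoodDivide L (u ℙ.⊗ p) → GoodDivide L u
    GoodDivide-cofactor [] _ _ _ = tt
    GoodDivide-cofactor ((e , P) ∷ L) (irr , _ , primes) {p} {u} (P∤p , fr) (div , divs) =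
      (λ good → Sum.[ id , (λ P∣p → ⊥-elim (P∤p P∣p)) ] (Euclid.euclid (Vec.map enum P) irr u p (div good))) , GoodDivide-cofactor L primes fr divs

    GoodDivide-resp : ∀ L {f g} → f ℙ.≈ g → GoodDivide L f → GoodDivide L g
    GoodDivide-resp [] e _ = tt
    GoodDivide-resp ((_ , P) ∷ L) e (div , divs) = (λ good → ∣ₚ-respʳ e (div good)) , GoodDivide-resp L e divs

    -- The primes in L are pairwise coprime, so the good ones can be divided out of f in turn, each
    -- lowering the degree by its own.
    degreeSum-bound : ∀ L → Primes L → ∀ {f n} → ExactDegree f n → GoodDivide L f → degreeSum L ≤ n
    degreeSum-bound [] _ _ _ = z≤n
    degreeSum-bound ((e , P) ∷ L) (irr , free-P , primes) {f} {n} ex (div , divs) with good? P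
    ... | no _ = degreeSum-bound L primes ex divs
    ... | yes good = bound-cofactor (div good)
      where
        bound-cofactor : polyOf P ∣ₚ f → e ℕ.+ degreeSum L ≤ n
        bound-cofactor (u , f≈uP) with zero-or-exact u
        ... | inj₁ u≈0 = ⊥-elim (exact≉0 ex (ℙ.trans f≈uP (ℙ.trans (ℙ.*-congʳ {polyOf P} u≈0) (ℙ.zeroˡ _))))
        ... | inj₂ (m , eu) = ≡.subst (e ℕ.+ degreeSum L ≤_)
                (≡.trans (ℕₚ.+-comm e m) (exact-unique (exact-resp (ℙ.sym f≈uP) (exact-⊗ eu (exact-toPoly (Vec.map enum P)))) ex))
                (ℕₚ.+-monoʳ-≤ e (degreeSum-bound L primes eu (GoodDivide-cofactor L primes free-P (GoodDivide-resp L f≈uP divs))))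

  -- A counting substitute for elimination: q^U combinations have at most q^V coefficient vectors,
  -- so two coincide and the difference of their scalars is a nontrivial relation.
  linear-dependence : ∀ {U V} (B : Fin U → Poly) → (∀ i → VanishesFrom V (coeff (B i))) → V < U →
    ∃ λ (z : Fin U → Carrier) → (∃ λ i → ¬ (z i ≈ 0#)) × ℙ.sum (λ i → C (z i) ℙ.⊗ B i) ℙ.≈ ℙ.0#
  linear-dependence {U} {V} B B-vanish V<U = z , z≉0 , combination≈0
    where
      combination : (Fin U → Carrier) → Poly
      combination y = ℙ.sum (λ i → C (y i) ℙ.⊗ B i)
      coeff-combination : ∀ {N} (y : Fin N → Carrier) (b : Fin N → Poly) k → coeff (ℙ.sum (λ i → C (y i) ℙ.⊗ b i)) k ≈ sum (λ i → y i ⊗ coeff (b i) k)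
      coeff-combination {zero} y b k = refl
      coeff-combination {suc N} y b k = +-cong (coeff-C⊗ (y zero) (b zero) k) (coeff-combination (y ∘ suc) (b ∘ suc) k)
      scalars : Fin (q ^ U) → Fin U → Carrier
      scalars t i = enum (Fin.finToFun t i)
      image : Fin (q ^ U) → Fin (q ^ V)
      image t = Fin.funToFin (λ (j : Fin V) → index (coeff (combination (scalars t)) (toℕ j)))
      collision : ∃ λ i → ∃ λ j → i Fin.< j × image i ≡ image j
      collision = Finₚ.pigeonhole (ℕₚ.^-monoʳ-< q 2≤q V<U) image
      s t : Fin (q ^ U)
      s = proj₁ collision
      t = proj₁ (proj₂ collision)
      z : Fin U → Carrier
      z i = scalars s i ⊖ scalars t i
      funToFin-cong : ∀ {m n} {f g : Fin m → Fin n} → (∀ l → f l ≡ g l) → Fin.funToFin f ≡ Fin.funToFin g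
      funToFin-cong {zero} p = ≡.refl
      funToFin-cong {suc m} p = ≡.cong₂ Fin.combine (p zero) (funToFin-cong (p ∘ suc))
      all-zero⇒⊥ : (∀ i → z i ≈ 0#) → ⊥
      all-zero⇒⊥ p = ℕₚ.<⇒≢ (proj₁ (proj₂ (proj₂ collision))) (≡.cong toℕ (≡.trans (≡.sym (Finₚ.funToFin-finToFin {U} s))
        (≡.trans (funToFin-cong (λ l → ≡.trans (≡.sym (index-enum _)) (≡.trans (index-cong (x∙y⁻¹≈ε⇒x≈y _ _ (p l))) (index-enum _)))) (Finₚ.funToFin-finToFin {U} t))))
      z≉0 : ∃ λ i → ¬ (z i ≈ 0#)
      z≉0 with any-or-all (λ i → decide i)
        where
          decide : ∀ i → ¬ (z i ≈ 0#) ⊎ z i ≈ 0#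
          decide i with z i ≟ 0#
          ... | yes e = inj₂ e
          ... | no ne = inj₁ ne
      ... | inj₁ found = found
      ... | inj₂ all = ⊥-elim (all-zero⇒⊥ all)
      same-coeff : ∀ k → coeff (combination (scalars s)) k ≈ coeff (combination (scalars t)) k
      same-coeff k with k ℕ.<? V
      ... | yes k<V = ≡.subst (λ k → coeff (combination (scalars s)) k ≈ coeff (combination (scalars t)) k) (Finₚ.toℕ-fromℕ< k<V)
              (index-injective (≡.trans (≡.sym (Finₚ.finToFun-funToFin _ j)) (≡.trans (≡.cong (λ x → Fin.finToFun x j) (proj₂ (proj₂ (proj₂ collision)))) (Finₚ.finToFun-funToFin _ j))))
        where
          j : Fin V
          j = Fin.fromℕ< k<V
      ... | no k≮V = trans (high s) (sym (high t))
        where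
          high : ∀ r → coeff (combination (scalars r)) k ≈ 0#
          high r = trans (coeff-combination (scalars r) B k) (SingleTerm.sum-ε (CommutativeRing.+-commutativeMonoid commRing) (λ i → scalars r i ⊗ coeff (B i) k)
            (λ i → trans (*-congˡ (B-vanish i k (ℕₚ.≮⇒≥ k≮V))) (zeroʳ _)))
      combination≈0 : combination z ℙ.≈ ℙ.0#
      combination≈0 = mk (mk λ k → begin
        coeff (combination z) k ≈⟨ coeff-combination z B k ⟩
        sum (λ i → z i ⊗ coeff (B i) k) ≈⟨ sum-cong-≋ {U} (λ i → solve 3 (λ s t b → (s :- t) :* b := s :* b :+ :- :1 :* (t :* b)) refl (scalars s i) (scalars t i) (coeff (B i) k)) ⟩
        sum (λ i → scalars s i ⊗ coeff (B i) k ⊕ - 1# ⊗ (scalars t i ⊗ coeff (B i) k)) ≈⟨ ∑-distrib-+ {U} (λ i → scalars s i ⊗ coeff (B i) k) (λ i → - 1# ⊗ (scalars t i ⊗ coeff (B i) k)) ⟩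
        sum (λ i → scalars s i ⊗ coeff (B i) k) ⊕ sum (λ i → - 1# ⊗ (scalars t i ⊗ coeff (B i) k))
          ≈⟨ +-cong (sym (coeff-combination (scalars s) B k)) (trans (sym (*-distribˡ-sum {U} (- 1#) (λ i → scalars t i ⊗ coeff (B i) k))) (trans (-1*x≈-x _) (-‿cong (sym (coeff-combination (scalars t) B k))))) ⟩
        coeff (combination (scalars s)) k ⊖ coeff (combination (scalars t)) k ≈⟨ x≈y⇒x∙y⁻¹≈ε (same-coeff k) ⟩
        0# ∎)
        where open Reasoning

module ParameterBounds (q d κ B : ℕ) (2≤q : 2 ≤ q) (1≤d : 1 ≤ d) (1≤κ : 1 ≤ κ) (1≤B : 1 ≤ B) (B≤qκ : B ≤ q * κ) where
  open ℕₚ.≤-Reasoning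
  open Data.Nat.Solver.+-*-Solver

  -- In the application κ = q^(α-1) and B = q^(β-1), so A = q^α and Q = q^β. The auxiliary
  -- polynomial has `U` unknown coefficients, indexed by l < κ, i < I and j < q. `V` lies above all
  -- degrees in the condition and so bounds the number of linear equations. `I` exceeds B by `t`,
  -- which is chosen to make V < U.
  A Q t I U V : ℕ
  A = q * κ
  Q = q * B
  t = 2 * (d * q)
  I = B + t
  U = κ * (I * q)
  V = suc ((κ ∸ 1) * Q + (I ∸ 1) + q * (d * B))

  1≤I : 1 ≤ I
  1≤I = ℕₚ.≤-trans 1≤B (ℕₚ.m≤m+n B t)

  condition-degree : ∀ l i j → l < κ → i < I → j < q → (l * Q + i) + j * (d * B) < V
  condition-degree l i j l<κ i<I j<q = s≤s (ℕₚ.+-mono-≤ (ℕₚ.+-mono-≤ (ℕₚ.*-monoˡ-≤ Q (ℕₚ.≤-pred (ℕₚ.≤-trans l<κ (ℕₚ.≤-reflexive (≡.sym (ℕₚ.m+[n∸m]≡n 1≤κ))))))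
      (ℕₚ.≤-pred (ℕₚ.≤-trans i<I (ℕₚ.≤-reflexive (≡.sym (ℕₚ.m+[n∸m]≡n 1≤I)))))) (ℕₚ.*-monoˡ-≤ (d * B) (ℕₚ.<⇒≤ j<q)))

  2≤A : 2 ≤ A
  2≤A = ℕₚ.*-mono-≤ 2≤q 1≤κ

  -- Here U = κ Q + A t, and one more than V is (κ - 1) Q + 1 + B + t + d Q. The Q saved by l ≤ κ -
  -- 1 pays for 1 + B, and A t pays for t + d Q.
  V<U : V < U
  V<U = go κ I ≡.refl ≡.refl 1≤κ 1≤I
    where
      -- Used for A′ = A - 1. The estimate B ≤ A ≤ 2 (A - 1) is the origin of the 2 in `t`.
      At : ∀ A′ → 1 ≤ A′ → B ≤ suc A′ → d * Q ≤ A′ * t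
      At A′ 1≤A′ B≤A = begin
        d * (q * B) ≤⟨ ℕₚ.*-monoʳ-≤ d (ℕₚ.*-monoʳ-≤ q (ℕₚ.≤-trans B≤A (ℕₚ.+-monoˡ-≤ A′ 1≤A′))) ⟩
        d * (q * (A′ + A′)) ≡⟨ solve 3 (λ d q a → d :* (q :* (a :+ a)) := a :* (con 2 :* (d :* q))) ≡.refl d q A′ ⟩
        A′ * t ∎
      go : ∀ k i → k ≡ κ → i ≡ I → 1 ≤ k → 1 ≤ i → suc ((k ∸ 1) * Q + (i ∸ 1) + q * (d * B)) < κ * (I * q)
      go (suc k) (suc i) k≡ i≡ _ _ = begin
        suc (suc (k * Q + i + q * (d * B))) ≡⟨ solve 5 (λ k Q i d B → con 2 :+ (k :* Q :+ i :+ d :* B) := k :* Q :+ (con 1 :+ (con 1 :+ i) :+ d :* B)) ≡.refl k Q i q (d * B) ⟩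
        k * Q + (1 + suc i + q * (d * B)) ≡⟨ ≡.cong (λ x → k * Q + (1 + x + q * (d * B))) i≡ ⟩
        k * Q + (1 + (B + t) + q * (d * B)) ≡⟨ solve 6 (λ k Q B t q d → k :* Q :+ (con 1 :+ (B :+ t) :+ q :* (d :* B)) := k :* Q :+ ((con 1 :+ B) :+ (t :+ d :* (q :* B)))) ≡.refl k Q B t q d ⟩
        k * Q + ((1 + B) + (t + d * Q)) ≤⟨ ℕₚ.+-monoʳ-≤ (k * Q) (ℕₚ.+-mono-≤ step₁ step₂) ⟩
        k * Q + (Q + A * t) ≡⟨ solve 4 (λ k Q A t → k :* Q :+ (Q :+ A :* t) := (con 1 :+ k) :* Q :+ A :* t) ≡.refl k Q A t ⟩
        suc k * Q + A * t ≡⟨ ≡.cong (λ x → x * Q + A * t) k≡ ⟩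
        κ * (q * B) + q * κ * t ≡⟨ solve 4 (λ κ q B t → κ :* (q :* B) :+ q :* κ :* t := κ :* ((B :+ t) :* q)) ≡.refl κ q B t ⟩
        κ * (I * q) ∎
        where
          step₁ : 1 + B ≤ Q
          step₁ = begin
            1 + B ≤⟨ ℕₚ.+-monoˡ-≤ B 1≤B ⟩
            B + B ≡⟨ solve 1 (λ B → B :+ B := con 2 :* B) ≡.refl B ⟩
            2 * B ≤⟨ ℕₚ.*-monoˡ-≤ B 2≤q ⟩
            q * B ∎
          step₂ : t + d * Q ≤ A * t
          step₂ = ≡.subst (λ a → t + d * Q ≤ a * t) (ℕₚ.m+[n∸m]≡n (ℕₚ.≤-trans (s≤s z≤n) 2≤A))
            (ℕₚ.+-monoʳ-≤ t (At (A ∸ 1) (ℕₚ.∸-monoˡ-≤ 1 2≤A) (ℕₚ.≤-trans B≤qκ (ℕₚ.≤-reflexive (≡.sym (ℕₚ.m+[n∸m]≡n (ℕₚ.≤-trans (s≤s z≤n) 2≤A)))))))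

  -- B A is the main term q^(α+β-1). Of the three error terms two come from `t`, and the third
  -- covers the powers of the trace.
  degree-bound : ∀ l i j → l < κ → i < I → j < q → (l + i * A) + j * (d * κ) ≤ B * A + 3 * (d * q) * A
  degree-bound l i j l<κ i<I j<q = begin
    (l + i * A) + j * (d * κ) ≤⟨ ℕₚ.+-mono-≤ (ℕₚ.+-monoˡ-≤ (i * A) (ℕₚ.≤-trans (ℕₚ.<⇒≤ l<κ) κ≤A)) (ℕₚ.*-monoˡ-≤ (d * κ) (ℕₚ.<⇒≤ j<q)) ⟩
    (A + i * A) + q * (d * κ) ≡⟨ solve 4 (λ i q d κ → (q :* κ :+ i :* (q :* κ)) :+ q :* (d :* κ) := (con 1 :+ i) :* (q :* κ) :+ d :* (q :* κ)) ≡.refl i q d κ ⟩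
    suc i * A + d * A ≤⟨ ℕₚ.+-mono-≤ (ℕₚ.*-monoˡ-≤ A i<I) (ℕₚ.*-monoˡ-≤ A (ℕₚ.≤-trans (ℕₚ.≤-reflexive (≡.sym (ℕₚ.*-identityʳ d))) (ℕₚ.*-monoʳ-≤ d (ℕₚ.≤-trans (s≤s z≤n) 2≤q)))) ⟩
    (B + 2 * (d * q)) * A + d * q * A ≡⟨ solve 3 (λ B x A → (B :+ con 2 :* x) :* A :+ x :* A := B :* A :+ con 3 :* x :* A) ≡.refl B (d * q) A ⟩
    B * A + 3 * (d * q) * A ∎
    where
      κ≤A : κ ≤ A
      κ≤A = ℕₚ.≤-trans (ℕₚ.≤-reflexive (≡.sym (ℕₚ.*-identityˡ κ))) (ℕₚ.*-monoˡ-≤ κ (ℕₚ.≤-trans (s≤s z≤n) 2≤q))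

division-unique : ∀ κ l l′ M M′ → l < κ → l′ < κ → l + M * κ ≡ l′ + M′ * κ → l ≡ l′ × M ≡ M′
division-unique κ@(suc _) l l′ M M′ l< l′< eq = l≡l′ , ℕₚ.*-cancelʳ-≡ M M′ κ (ℕₚ.+-cancelˡ-≡ l _ _ (≡.trans eq (≡.cong (_+ M′ * κ) (≡.sym l≡l′))))
  where
    l≡l′ : l ≡ l′
    l≡l′ = ≡.trans (≡.sym (≡.trans (DivMod.[m+kn]%n≡m%n l M κ) (DivMod.m<n⇒m%n≡m l<)))
      (≡.trans (≡.cong (DivMod._% κ) eq) (≡.trans (DivMod.[m+kn]%n≡m%n l′ M′ κ) (DivMod.m<n⇒m%n≡m l′<)))

prime-power-coprime : ∀ {p} → Prime p → ∀ {d} → p ∤ d → ∀ k x → (p ^ k) ∣ (x * d) → (p ^ k) ∣ x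
prime-power-coprime pr p∤d zero x _ = Div.1∣ x
prime-power-coprime {p} pr {d} p∤d (suc k) x p^∣ with euclidsLemma x d pr (Div.∣-trans (Div.m∣m*n (p ^ k)) p^∣)
... | inj₂ p∣d = ⊥-elim (p∤d p∣d)
... | inj₁ (divides y ≡.refl) = ≡.subst (p * p ^ k ∣_) (ℕₚ.*-comm p y) (Div.*-monoʳ-∣ p (prime-power-coprime pr p∤d k y
      (Div.*-cancelˡ-∣ p {{prime⇒nonZero pr}} (≡.subst (p * p ^ k ∣_) (≡.trans (≡.cong (_* d) (ℕₚ.*-comm y p)) (ℕₚ.*-assoc p y d)) p^∣))))

module TraceHom {q : ℕ} (F : FiniteField q) (pp : IsPrimePower q) {A B : CommutativeRing 0ℓ 0ℓ} (φ : Hom (FiniteField.commRing F) A) (ψ : Hom A B) where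
  private
    module A = Kit A
    module B = Kit B
    module TA = FrobeniusAlgebra F pp φ
    module TB = FrobeniusAlgebra F pp (ψ ∘ₕ φ)
    module φ = Hom φ
  open Hom ψ

  trace-cong : ∀ n {x y} → x B.≈ y → TB.trace n x B.≈ TB.trace n y
  trace-cong zero p = B.refl
  trace-cong (suc n) p = B.+-cong p (trace-cong n (B.^-congˡ q p))

  trace-homo : ∀ n y → ⟦ TA.trace n y ⟧ B.≈ TB.trace n ⟦ y ⟧
  trace-homo zero y = 0-homo
  trace-homo (suc n) y = B.trans (⊕-homo _ _) (B.+-congˡ (B.trans (trace-homo n (y A.↑ q)) (trace-cong n (↑-homo y q))))

  combination-homo : ∀ {U} (z : Fin U → FiniteField.Carrier F) (m j : Fin U → ℕ) x w →
    ⟦ A.sum (λ u → φ.⟦ z u ⟧ A.⊗ (x A.↑ m u A.⊗ w A.↑ j u)) ⟧ B.≈ B.sum (λ u → ⟦ φ.⟦ z u ⟧ ⟧ B.⊗ (⟦ x ⟧ B.↑ m u B.⊗ ⟦ w ⟧ B.↑ j u))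
  combination-homo {U} z m j x w = B.trans (sum-homo {U} _) (B.sum-cong-≋ {U} (λ u → B.trans (⊗-homo _ _) (B.*-congˡ (B.trans (⊗-homo _ _) (B.*-cong (↑-homo x (m u)) (↑-homo w (j u)))))))

-- Raising to the power q^β turns X^(iq^α) into X^i and the partial trace of length α into
-- c minus the partial trace of length β, as soon as X is fixed by q^(β+α) and the full trace is c.
module FrobeniusVanishing {q : ℕ} (F : FiniteField q) (pp : IsPrimePower q) {K : CommutativeRing 0ℓ 0ℓ} (φ : Hom (FiniteField.commRing F) K)
  (K-1≉0 : ¬ (Kit._≈_ K (Kit.1# K) (Kit.0# K))) (K-domain : IsDomain K) where
  open Kit K
  open Hom φ
  open FrobeniusAlgebra F pp φ

  vanishing : ∀ x y c α β → x ↑ (q ^ (β ℕ.+ α)) ≈ x → trace (β ℕ.+ α) y ≈ ⟦ c ⟧ →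
    ∀ {U} (z : Fin U → FiniteField.Carrier F) (l i j : Fin U → ℕ) →
    sum (λ u → ⟦ z u ⟧ ⊗ (x ↑ (l u ℕ.* q ^ β ℕ.+ i u) ⊗ (⟦ c ⟧ ⊖ trace β y) ↑ j u)) ≈ 0# →
    sum (λ u → ⟦ z u ⟧ ⊗ (x ↑ (l u ℕ.+ i u ℕ.* q ^ α) ⊗ trace α y ↑ j u)) ≈ 0#
  vanishing x y c α β x-fixed trace≈c {U} z l i j cond = Roots.power-zero K K-domain K-1≉0 _ (q ^ β) (begin
    sum (λ u → ⟦ z u ⟧ ⊗ (x ↑ (l u ℕ.+ i u ℕ.* q ^ α) ⊗ trace α y ↑ j u)) ↑ (q ^ β) ≈⟨ ↑q^-sum β {U} _ ⟩
    sum (λ u → (⟦ z u ⟧ ⊗ (x ↑ (l u ℕ.+ i u ℕ.* q ^ α) ⊗ trace α y ↑ j u)) ↑ (q ^ β)) ≈⟨ sum-cong-≋ {U} term ⟩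
    sum (λ u → ⟦ z u ⟧ ⊗ (x ↑ (l u ℕ.* q ^ β ℕ.+ i u) ⊗ (⟦ c ⟧ ⊖ trace β y) ↑ j u)) ≈⟨ cond ⟩
    0# ∎)
    where
      open Reasoning
      w-power : trace α y ↑ (q ^ β) ≈ ⟦ c ⟧ ⊖ trace β y
      w-power = trans (solve 2 (λ a b → a := (b :+ a) :- b) refl _ (trace β y)) (+-congʳ (trans (sym (trace-+ β α y)) trace≈c))
      exponents : ∀ l i → (l ℕ.+ i ℕ.* q ^ α) ℕ.* q ^ β ≡ l ℕ.* q ^ β ℕ.+ q ^ (β ℕ.+ α) ℕ.* i
      exponents l i = ≡.trans (Data.Nat.Solver.+-*-Solver.solve 4 (λ l i a b → (l S:+ i S:* a) S:* b S:= l S:* b S:+ b S:* a S:* i) ≡.refl l i (q ^ α) (q ^ β))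
        (≡.cong (λ e → l ℕ.* q ^ β ℕ.+ e ℕ.* i) (≡.sym (ℕₚ.^-distribˡ-+-* q β α)))
        where open Data.Nat.Solver.+-*-Solver using () renaming (_:+_ to _S:+_; _:*_ to _S:*_; _:=_ to _S:=_)
      x-power : ∀ l i → (x ↑ (l ℕ.+ i ℕ.* q ^ α)) ↑ (q ^ β) ≈ x ↑ (l ℕ.* q ^ β ℕ.+ i)
      x-power l i = begin
        (x ↑ (l ℕ.+ i ℕ.* q ^ α)) ↑ (q ^ β) ≈⟨ ^-assocʳ x (l ℕ.+ i ℕ.* q ^ α) (q ^ β) ⟩
        x ↑ ((l ℕ.+ i ℕ.* q ^ α) ℕ.* q ^ β) ≈⟨ ^-congʳ x (exponents l i) ⟩
        x ↑ (l ℕ.* q ^ β ℕ.+ q ^ (β ℕ.+ α) ℕ.* i) ≈⟨ ^-homo-* x (l ℕ.* q ^ β) _ ⟩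
        x ↑ (l ℕ.* q ^ β) ⊗ x ↑ (q ^ (β ℕ.+ α) ℕ.* i) ≈⟨ *-congˡ (trans (sym (^-assocʳ x (q ^ (β ℕ.+ α)) i)) (^-congˡ i x-fixed)) ⟩
        x ↑ (l ℕ.* q ^ β) ⊗ x ↑ i ≈⟨ sym (^-homo-* x (l ℕ.* q ^ β) i) ⟩
        x ↑ (l ℕ.* q ^ β ℕ.+ i) ∎
      term : ∀ u → (⟦ z u ⟧ ⊗ (x ↑ (l u ℕ.+ i u ℕ.* q ^ α) ⊗ trace α y ↑ j u)) ↑ (q ^ β) ≈ ⟦ z u ⟧ ⊗ (x ↑ (l u ℕ.* q ^ β ℕ.+ i u) ⊗ (⟦ c ⟧ ⊖ trace β y) ↑ j u)
      term u = trans (^-distrib-* _ _ (q ^ β)) (*-cong (scalar-fixed (z u) β) (trans (^-distrib-* _ _ (q ^ β)) (*-cong (x-power (l u) (i u))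
        (trans (^-assocʳ (trace α y) (j u) (q ^ β)) (trans (^-congʳ (trace α y) (ℕₚ.*-comm (j u) (q ^ β))) (trans (sym (^-assocʳ (trace α y) (q ^ β) (j u))) (^-congˡ (j u) w-power)))))))

-- A is the ring that contains the conditions and the auxiliary polynomial, K a field in which they
-- are evaluated by ψ. The Frobenius argument runs in K, where x is fixed, while the conditions hold
-- identically in A.
module TransportedVanishing {q : ℕ} (F : FiniteField q) (pp : IsPrimePower q) {A K : CommutativeRing 0ℓ 0ℓ} (φ : Hom (FiniteField.commRing F) A) (ψ : Hom A K)
  (K-1≉0 : ¬ (Kit._≈_ K (Kit.1# K) (Kit.0# K))) (K-domain : IsDomain K) where
  private
    module A = Kit A
    module K = Kit K
    module TA = FrobeniusAlgebra F pp φ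
    module TK = FrobeniusAlgebra F pp (ψ ∘ₕ φ)
    module φ = Hom φ
  open Hom ψ
  open TraceHom F pp φ ψ

  value-homo : ∀ {d} (a : Fin (suc d) → FiniteField.Carrier F) x →
    ⟦ A.sum {suc d} (λ k → φ.⟦ a k ⟧ A.⊗ x A.↑ toℕ k) ⟧ K.≈ K.sum {suc d} (λ k → ⟦ φ.⟦ a k ⟧ ⟧ K.⊗ ⟦ x ⟧ K.↑ toℕ k)
  value-homo {d} a x = K.trans (sum-homo {suc d} (λ k → φ.⟦ a k ⟧ A.⊗ x A.↑ toℕ k)) (K.sum-cong-≋ {suc d} (λ k → K.trans (⊗-homo φ.⟦ a k ⟧ (x A.↑ toℕ k)) (K.*-congˡ (↑-homo x (toℕ k)))))

  transported-vanishing : ∀ x y c α β → ⟦ x ⟧ K.↑ (q ^ (β ℕ.+ α)) K.≈ ⟦ x ⟧ → TK.trace (β ℕ.+ α) ⟦ y ⟧ K.≈ ⟦ φ.⟦ c ⟧ ⟧ →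
    ∀ {U} (z : Fin U → FiniteField.Carrier F) (l i j : Fin U → ℕ) →
    A.sum (λ u → φ.⟦ z u ⟧ A.⊗ (x A.↑ (l u ℕ.* q ^ β ℕ.+ i u) A.⊗ (φ.⟦ c ⟧ A.⊖ TA.trace β y) A.↑ j u)) A.≈ A.0# →
    ⟦ A.sum (λ u → φ.⟦ z u ⟧ A.⊗ (x A.↑ (l u ℕ.+ i u ℕ.* q ^ α) A.⊗ TA.trace α y A.↑ j u)) ⟧ K.≈ K.0#
  transported-vanishing x y c α β x-fixed trace≈c {U} z l i j cond = K.trans
      (K.trans (combination-homo z (λ u → l u ℕ.+ i u ℕ.* q ^ α) j x (TA.trace α y))
        (K.sum-cong-≋ {U} (λ u → K.*-congˡ (K.*-congˡ (K.^-congˡ (j u) (trace-homo α y))))))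
      (FrobeniusVanishing.vanishing F pp (ψ ∘ₕ φ) K-1≉0 K-domain ⟦ x ⟧ ⟦ y ⟧ c α β x-fixed trace≈c z l i j
        (K.trans (K.sum-cong-≋ {U} (λ u → K.*-congˡ (K.*-congˡ (K.^-congˡ (j u) (K.sym difference)))))
          (K.trans (K.sym (combination-homo z (λ u → l u ℕ.* q ^ β ℕ.+ i u) j x (φ.⟦ c ⟧ A.⊖ TA.trace β y))) (K.trans (cong cond) 0-homo))))
    where
      difference : ⟦ φ.⟦ c ⟧ A.⊖ TA.trace β y ⟧ K.≈ ⟦ φ.⟦ c ⟧ ⟧ K.⊖ TK.trace β ⟦ y ⟧
      difference = K.trans (⊕-homo _ _) (K.+-congˡ (K.trans (neg-homo _) (K.-‿cong (trace-homo β y))))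

module ConjugateVanishing {q : ℕ} (F : FiniteField q) (pp : IsPrimePower q) {A K : CommutativeRing 0ℓ 0ℓ} (φ : Hom (FiniteField.commRing F) A) (ψ : Hom A K)
  (K-1≉0 : ¬ (Kit._≈_ K (Kit.1# K) (Kit.0# K))) (K-domain : IsDomain K) {e : ℕ} (P : Vec (FiniteField.Carrier F) e) (x : Kit.Carrier A)
  (x-root : Kit._≈_ K (Monic.evalM K (Vec.map (Hom.⟦_⟧ (ψ ∘ₕ φ)) P) (Hom.⟦_⟧ ψ x)) (Kit.0# K))
  (all-fixed : ∀ r → Kit._≈_ K (Kit._↑_ K (Hom.⟦_⟧ ψ x) (q ^ r)) (Hom.⟦_⟧ ψ x) → ∀ y → Kit._≈_ K (Kit._↑_ K y (q ^ r)) y)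
  (representative : Fin (q ^ e) → Kit.Carrier K)
  (representative-injective : ∀ i j → Kit._≈_ K (representative i) (representative j) → i ≡ j) where
  private
    module A = Kit A
    module K = Kit K
    module F = Kit (FiniteField.commRing F)
    module TA = FrobeniusAlgebra F pp φ
    module TK = FrobeniusAlgebra F pp (ψ ∘ₕ φ)
    module φ = Hom φ
  open Hom ψ
  open ConjugateRoots F pp (ψ ∘ₕ φ) K-1≉0 K-domain P ⟦ x ⟧ x-root all-fixed representative representative-injective
  open TransportedVanishing F pp φ ψ K-1≉0 K-domain
  open TraceHom F pp φ ψ

  conjugate-vanishing : ∀ {d} (a : Fin (suc d) → F.Carrier) c α β j →
    β ℕ.+ α ≡ j ℕ.* e → j F.· Reversal.traceForm (FiniteField.commRing F) a P F.≈ c →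
    ∀ {U} (z : Fin U → F.Carrier) (l i k : Fin U → ℕ) →
    A.sum (λ u → φ.⟦ z u ⟧ A.⊗ (x A.↑ (l u ℕ.* q ^ β ℕ.+ i u) A.⊗ (φ.⟦ c ⟧ A.⊖ TA.trace β (A.sum {suc d} (λ k → φ.⟦ a k ⟧ A.⊗ x A.↑ toℕ k))) A.↑ k u)) A.≈ A.0# →
    ⟦ A.sum (λ u → φ.⟦ z u ⟧ A.⊗ (x A.↑ (l u ℕ.+ i u ℕ.* q ^ α) A.⊗ TA.trace α (A.sum {suc d} (λ k → φ.⟦ a k ⟧ A.⊗ x A.↑ toℕ k)) A.↑ k u)) ⟧ K.≈ K.0#
  conjugate-vanishing {d} a c α β j n≡ trace≈ = transported-vanishing x y c α β
      (≡.subst (λ m → ⟦ x ⟧ K.↑ (q ^ m) K.≈ ⟦ x ⟧) (≡.sym n≡) (x-fixed-multiple j))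
      (K.trans (trace-cong (β ℕ.+ α) (value-homo a x))
        (K.trans (≡.subst (λ m → TK.trace m (value a) K.≈ ⟦ φ.⟦ j F.· Reversal.traceForm (FiniteField.commRing F) a P ⟧ ⟧) (≡.sym n≡) (trace-multiple a j))
          (cong (φ.cong trace≈))))
    where
      y : A.Carrier
      y = A.sum {suc d} (λ k → φ.⟦ a k ⟧ A.⊗ x A.↑ toℕ k)

-- The auxiliary polynomial ∑ z X^(l + i q^α) τ_α^j vanishes at all points of degree dividing n = β + α
-- with trace c; its degree bounds their number.
module Stepanov {q : ℕ} (F : FiniteField q) (pp : IsPrimePower q) {D : ℕ} (a : Fin (suc (suc D)) → FiniteField.Carrier F)
  (lead : ¬ (FiniteField._≈_ F (a (fromℕ (suc D))) (FiniteField.0# F)))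
  (d≉0 : ¬ (FiniteField._≈_ F (Kit._·_ (FiniteField.commRing F) (suc D) (FiniteField.1# F)) (FiniteField.0# F))) where
  open Field F pp
  open PolyOverField F pp
  open Sieve F pp
  open DegreeBounds F pp
  open Reversal commRing using (traceForm)
  private
    module FA = FrobeniusAlgebra F pp constants

    d : ℕ
    d = suc D

  char∤d : char ∤ d
  char∤d char∣d = d≉0 (Frobenius.multiple·≈0 commRing p-prime p·1≈0 1# char∣d)

  h : Poly
  h = ℙ.sum {suc d} (λ k → C (a k) ℙ.⊗ X ℙ.↑ toℕ k)

  vanish-sum : ∀ {N n} (f : Fin N → Poly) → (∀ i → VanishesFrom n (coeff (f i))) → VanishesFrom n (coeff (ℙ.sum f))
  vanish-sum {zero} f v k le = refl
  vanish-sum {suc N} f v k le = trans (+-cong (v zero k le) (vanish-sum (f ∘ suc) (v ∘ suc) k le)) (+-identityˡ _)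

  exact-h : ExactDegree h d
  exact-h = exact-resp (ℙ.sym (sum-init-last {d} term)) (exact-dominant {ℙ.sum {d} (λ i → term (Fin.inject₁ i))} low high)
    where
      open Algebra.Properties.Monoid.Sum (CommutativeRing.+-monoid polyRing) using (sum-init-last)
      term : Fin (suc d) → Poly
      term k = C (a k) ℙ.⊗ X ℙ.↑ toℕ k
      low : VanishesFrom d (coeff (ℙ.sum {d} (λ i → term (Fin.inject₁ i))))
      low = vanish-sum {d} (λ i → term (Fin.inject₁ i)) λ i k le → conv-vanishes< 0 (toℕ (Fin.inject₁ i)) {const (a (Fin.inject₁ i))} (λ { (suc _) _ → refl }) (beyond (exact-X↑ (toℕ (Fin.inject₁ i)))) k
        (ℕₚ.≤-trans (ℕₚ.≤-trans (ℕₚ.≤-reflexive (≡.cong suc (Finₚ.toℕ-inject₁ i))) (Finₚ.toℕ<n i)) le)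
        where open Series commRing using (const)
      high : ExactDegree (term (fromℕ d)) d
      high = ≡.subst (ExactDegree (term (fromℕ d))) (Finₚ.toℕ-fromℕ d) (exact-⊗ (exact-C lead) (exact-X↑ (toℕ (fromℕ d))))

  d*q^-< : ∀ m → d * q ^ m < d * q ^ suc m
  d*q^-< m = ℕₚ.*-monoʳ-< d (ℕₚ.^-monoʳ-< q 2≤q (ℕₚ.n<1+n m))

  exact-trace : ∀ m → ExactDegree (FA.trace (suc m) h) (d * q ^ m)
  exact-trace zero = ≡.subst (ExactDegree (FA.trace 1 h)) (≡.sym (ℕₚ.*-identityʳ d)) (exact-resp (ℙ.sym (ℙ.+-identityʳ h)) exact-h)
  exact-trace (suc m) = exact-resp (ℙ.sym split) (exact-dominant (λ k le → beyond (exact-trace m) k (ℕₚ.≤-trans (d*q^-< m) le)) power)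
    where
      power : ExactDegree (h ℙ.↑ (q ^ suc m)) (d * q ^ suc m)
      power = ≡.subst (ExactDegree (h ℙ.↑ (q ^ suc m))) (ℕₚ.*-comm (q ^ suc m) d) (exact-↑ (q ^ suc m) exact-h)
      split : FA.trace (suc (suc m)) h ℙ.≈ FA.trace (suc m) h ℙ.⊕ h ℙ.↑ (q ^ suc m)
      split = ℙ.trans (ℙ.reflexive (≡.cong (λ n → FA.trace n h) (≡.sym (ℕₚ.+-comm (suc m) 1))))
        (ℙ.trans (FA.trace-+ (suc m) 1 h) (ℙ.+-congˡ {FA.trace (suc m) h} (ℙ.^-congˡ (q ^ suc m) (ℙ.+-identityʳ h))))

  -- A root of P generates the extension of degree e. For n = j e, the trace from 𝔽_(qⁿ) of h at
  -- this root is j times its trace from 𝔽_(qᵉ), which is the sum of h over the roots of P.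
  HasTraceAt : Fin q → ∀ {e n} → Mon e → (∃ λ j → n ≡ j * e) ⊎ (∀ j → n ≢ j * e) → Set
  HasTraceAt c P (inj₁ (j , _)) = index (j · traceForm a (Vec.map enum P)) ≡ c
  HasTraceAt c P (inj₂ _) = ⊥

  HasTrace : ℕ → Fin q → ∀ {e} → Mon e → Set
  HasTrace n c {e} P = HasTraceAt c P (cofactor? e n)

  hasTraceAt? : ∀ c {e n} (P : Mon e) (s : (∃ λ j → n ≡ j * e) ⊎ (∀ j → n ≢ j * e)) → Dec (HasTraceAt c P s)
  hasTraceAt? c P (inj₁ (j , _)) = index (j · traceForm a (Vec.map enum P)) Finₚ.≟ c
  hasTraceAt? c P (inj₂ _) = no id

  hasTrace? : ∀ n c {e} (P : Mon e) → Dec (HasTrace n c P)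
  hasTrace? n c {e} P = hasTraceAt? c P (cofactor? e n)

  hasTrace-elim : ∀ n c {e} (P : Mon e) → HasTrace n c P → ∃ λ j → n ≡ j * e × j · traceForm a (Vec.map enum P) ≈ enum c
  hasTrace-elim n c {e} P = each (cofactor? e n)
    where
      each : ∀ s → HasTraceAt c P s → ∃ λ j → n ≡ j * e × j · traceForm a (Vec.map enum P) ≈ enum c
      each (inj₁ (j , eq)) good = j , eq , trans (sym (enum-index _)) (reflexive (≡.cong enum good))

  module _ (α′ β′ : ℕ) (β′≤ : β′ ≤ suc α′) (c : Fin q) where
    private
      α β n : ℕ
      α = suc α′
      β = suc β′
      n = β + α

      q^-positive : ∀ i → 1 ≤ q ^ i
      q^-positive = FA.q^-positive

    open ParameterBounds q d (q ^ α′) (q ^ β′) 2≤q (s≤s z≤n) (q^-positive α′) (q^-positive β′) (ℕₚ.^-monoʳ-≤ q {{ℕ.>-nonZero 1≤q}} β′≤)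

    lOf iOf jOf : Fin U → ℕ
    lOf u = toℕ (proj₁ (Fin.remQuot {q ^ α′} (I * q) u))
    iOf u = toℕ (proj₁ (Fin.remQuot {I} q (proj₂ (Fin.remQuot {q ^ α′} (I * q) u))))
    jOf u = toℕ (proj₂ (Fin.remQuot {I} q (proj₂ (Fin.remQuot {q ^ α′} (I * q) u))))

    degreeOf : Fin U → ℕ
    degreeOf u = (lOf u + iOf u * A) + jOf u * (d * q ^ α′)

    -- Modulo q the equation reads j d = j′ d. As the characteristic does not divide d, this
    -- determines j in the range below q.
    same-j : ∀ i j i′ j′ → j ≤ j′ → j′ < q → i * q + j * d ≡ i′ * q + j′ * d → j ≡ j′
    same-j i j i′ j′ j≤j′ j′<q eq = case ℕₚ.m≤n⇒m<n∨m≡n j≤j′ of λ where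
        (inj₂ e) → e
        (inj₁ j<j′) → ⊥-elim (Div.>⇒∤ {{ℕ.>-nonZero (ℕₚ.m<n⇒0<n∸m j<j′)}} (ℕₚ.≤-trans (s≤s (ℕₚ.m∸n≤m j′ j)) j′<q) q∣difference)
      where
        open ≡.≡-Reasoning
        q∣gap : q ∣ (j′ ∸ j) * d
        q∣gap = Div.∣m+n∣m⇒∣n {m = i′ * q} (divides i (≡.sym (ℕₚ.+-cancelʳ-≡ (j * d) _ _ (begin
          i * q + j * d ≡⟨ eq ⟩
          i′ * q + j′ * d ≡⟨ ≡.cong (λ x → i′ * q + x * d) (≡.sym (ℕₚ.m∸n+n≡m j≤j′)) ⟩
          i′ * q + (j′ ∸ j + j) * d ≡⟨ Data.Nat.Solver.+-*-Solver.solve 4 (λ x y j d → x S:+ (y S:+ j) S:* d S:= (x S:+ y S:* d) S:+ j S:* d) ≡.refl (i′ * q) (j′ ∸ j) j d ⟩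
          (i′ * q + (j′ ∸ j) * d) + j * d ∎)))) (divides i′ ≡.refl)
          where open Data.Nat.Solver.+-*-Solver using () renaming (_:+_ to _S:+_; _:*_ to _S:*_; _:=_ to _S:=_)
        q∣difference : q ∣ (j′ ∸ j)
        q∣difference = ≡.subst (_∣ (j′ ∸ j)) (≡.sym q≡p^k) (prime-power-coprime p-prime char∤d (proj₁ (proj₂ pp)) (j′ ∸ j) (≡.subst (_∣ ((j′ ∸ j) * d)) q≡p^k q∣gap))

    same-ij : ∀ i j i′ j′ → j < q → j′ < q → i * q + j * d ≡ i′ * q + j′ * d → i ≡ i′ × j ≡ j′
    same-ij i j i′ j′ j<q j′<q eq = ℕₚ.*-cancelʳ-≡ i i′ q {{ℕ.>-nonZero 1≤q}} (ℕₚ.+-cancelʳ-≡ (j * d) _ _ (≡.trans eq (≡.cong (λ x → i′ * q + x * d) (≡.sym j≡j′)))) , j≡j′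
      where
        j≡j′ : j ≡ j′
        j≡j′ with ℕₚ.≤-total j j′
        ... | inj₁ j≤j′ = same-j i j i′ j′ j≤j′ j′<q eq
        ... | inj₂ j′≤j = ≡.sym (same-j i′ j′ i j j′≤j j<q (≡.sym eq))

    -- The degree is l + (i q + j d) κ with l < κ, so l is a remainder modulo κ, and i q + j d
    -- determines j modulo q. Distinct terms thus have distinct degrees, and a nontrivial relation
    -- among the conditions cannot yield the zero polynomial.
    degreeOf-injective : ∀ u v → degreeOf u ≡ degreeOf v → u ≡ v
    degreeOf-injective u v eq = ≡.trans (≡.sym (Finₚ.combine-remQuot {q ^ α′} (I * q) u)) (≡.trans (≡.cong₂ Fin.combine (Finₚ.toℕ-injective l≡)
        (≡.trans (≡.sym (Finₚ.combine-remQuot {I} q _)) (≡.trans (≡.cong₂ Fin.combine (Finₚ.toℕ-injective (proj₁ ij≡)) (Finₚ.toℕ-injective (proj₂ ij≡))) (Finₚ.combine-remQuot {I} q _))))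
        (Finₚ.combine-remQuot {q ^ α′} (I * q) v))
      where
        open Data.Nat.Solver.+-*-Solver using () renaming (_:+_ to _S:+_; _:*_ to _S:*_; _:=_ to _S:=_)
        regroup : ∀ l i j → (l + i * A) + j * (d * q ^ α′) ≡ l + (i * q + j * d) * q ^ α′
        regroup l i j = Data.Nat.Solver.+-*-Solver.solve 6 (λ l i j d q κ → (l S:+ i S:* (q S:* κ)) S:+ j S:* (d S:* κ) S:= l S:+ (i S:* q S:+ j S:* d) S:* κ) ≡.refl l i j d q (q ^ α′)
        split : lOf u ≡ lOf v × iOf u * q + jOf u * d ≡ iOf v * q + jOf v * d
        split = division-unique (q ^ α′) (lOf u) (lOf v) (iOf u * q + jOf u * d) (iOf v * q + jOf v * d) (Finₚ.toℕ<n (proj₁ (Fin.remQuot {q ^ α′} (I * q) u))) (Finₚ.toℕ<n (proj₁ (Fin.remQuot {q ^ α′} (I * q) v)))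
          (≡.trans (≡.sym (regroup (lOf u) (iOf u) (jOf u))) (≡.trans eq (regroup (lOf v) (iOf v) (jOf v))))
        l≡ = proj₁ split
        ij≡ : iOf u ≡ iOf v × jOf u ≡ jOf v
        ij≡ = same-ij (iOf u) (jOf u) (iOf v) (jOf v) (Finₚ.toℕ<n (proj₂ (Fin.remQuot {I} q (proj₂ (Fin.remQuot {q ^ α′} (I * q) u)))))
          (Finₚ.toℕ<n (proj₂ (Fin.remQuot {I} q (proj₂ (Fin.remQuot {q ^ α′} (I * q) v))))) (proj₂ split)

    private
      l< : ∀ u → lOf u < q ^ α′
      l< u = Finₚ.toℕ<n (proj₁ (Fin.remQuot {q ^ α′} (I * q) u))
      i< : ∀ u → iOf u < I
      i< u = Finₚ.toℕ<n (proj₁ (Fin.remQuot {I} q (proj₂ (Fin.remQuot {q ^ α′} (I * q) u))))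
      j< : ∀ u → jOf u < q
      j< u = Finₚ.toℕ<n (proj₂ (Fin.remQuot {I} q (proj₂ (Fin.remQuot {q ^ α′} (I * q) u))))

    τ-low τ-high : Poly
    τ-low = C (enum c) ℙ.⊖ FA.trace β h
    τ-high = FA.trace α h

    exact-low : ExactDegree τ-low (d * q ^ β′)
    exact-low = exact-dominant (λ k le → beyond′ k (ℕₚ.≤-trans (ℕₚ.*-mono-≤ {1} {d} {1} (s≤s z≤n) (q^-positive β′)) le))
        (exact (λ z → top (exact-trace β′) (trans (sym (-‿involutive _)) (trans (-‿cong z) -0#≈0#)))
               (λ k le → trans (-‿cong (beyond (exact-trace β′) k le)) -0#≈0#))
      where
        beyond′ : VanishesFrom 1 (coeff (C (enum c)))
        beyond′ (suc k) _ = refl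

    condition : Fin U → Poly
    condition u = X ℙ.↑ (lOf u * q ^ β + iOf u) ℙ.⊗ τ-low ℙ.↑ jOf u

    condition-vanishes : ∀ u → VanishesFrom V (coeff (condition u))
    condition-vanishes u k le = beyond (exact-⊗ (exact-X↑ (lOf u * q ^ β + iOf u)) (exact-↑ (jOf u) exact-low)) k
      (ℕₚ.≤-trans (condition-degree (lOf u) (iOf u) (jOf u) (l< u) (i< u) (j< u)) le)

    basis : Fin U → Poly
    basis u = X ℙ.↑ (lOf u + iOf u * q ^ α) ℙ.⊗ τ-high ℙ.↑ jOf u

    abstract
      -- Only the existence of a solution matters; opacity prevents the search among q^U vectors
      -- from being unfolded.
      auxiliary : ∃ λ (z : Fin U → Carrier) → (∃ λ i → ¬ (z i ≈ 0#)) × ℙ.sum (λ u → C (z u) ℙ.⊗ condition u) ℙ.≈ ℙ.0#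
      auxiliary = linear-dependence condition condition-vanishes V<U

    z : Fin U → Carrier
    z = proj₁ auxiliary

    g : Poly
    g = ℙ.sum (λ u → C (z u) ℙ.⊗ basis u)

    exact-term : ∀ u → ¬ (z u ≈ 0#) → ExactDegree (C (z u) ℙ.⊗ basis u) (degreeOf u)
    exact-term u z≉0 = exact-⊗ (exact-C z≉0) (exact-⊗ (exact-X↑ (lOf u + iOf u * q ^ α)) (exact-↑ (jOf u) (exact-trace α′)))

    zero-or-exact-term : ∀ u → C (z u) ℙ.⊗ basis u ℙ.≈ ℙ.0# ⊎ ExactDegree (C (z u) ℙ.⊗ basis u) (degreeOf u)
    zero-or-exact-term u = decide (z u ≟ 0#)
      where
        decide : Dec (z u ≈ 0#) → C (z u) ℙ.⊗ basis u ℙ.≈ ℙ.0# ⊎ ExactDegree (C (z u) ℙ.⊗ basis u) (degreeOf u)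
        decide (yes z≈0) = inj₁ (ℙ.trans (ℙ.*-congʳ {basis u} (ℙ.trans (Hom.cong constants z≈0) (Hom.0-homo constants))) (ℙ.zeroˡ (basis u)))
        decide (no z≉0) = inj₂ (exact-term u z≉0)

    exact-g : ∃ λ u → ExactDegree g (degreeOf u)
    exact-g = conclude (exact-sum (λ u → C (z u) ℙ.⊗ basis u) degreeOf degreeOf-injective zero-or-exact-term) (proj₁ (proj₂ auxiliary))
      where
        conclude : (∀ u → C (z u) ℙ.⊗ basis u ℙ.≈ ℙ.0#) ⊎ (∃ λ u → ExactDegree g (degreeOf u)) → (∃ λ u → ¬ (z u ≈ 0#)) → ∃ λ u → ExactDegree g (degreeOf u)
        conclude (inj₂ r) _ = r
        conclude (inj₁ all-zero) (u , z≉0) = ⊥-elim (exact≉0 (exact-term u z≉0) (all-zero u))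

    -- In the residue field of P the class of X is fixed by the q^n-th power and h has full trace c
    -- there, so the identity among the conditions forces the class of g to be zero.
    g-divisible : ∀ {e} (P : Mon e) → Irreducible (Vec.map enum P) → HasTrace n c P → polyOf P ∣ₚ g
    g-divisible {e} P irr good = R.∼0⇒multiple (CV.conjugate-vanishing a (enum c) α β (proj₁ elim) (proj₁ (proj₂ elim)) (proj₂ (proj₂ elim)) z lOf iOf jOf (proj₂ (proj₂ auxiliary)))
      where
        module R = ResidueField F pp (Vec.map enum P) irr
        module CV = ConjugateVanishing F pp constants R.projection R.residue-1≉0 R.residue-domain (Vec.map enum P) X R.X-root R.all-fixed (toPoly ∘ R.residue-index) R.residue-injective
        elim = hasTrace-elim n c P good

    all-divide : ∀ L → Primes L → GoodDivide (HasTrace n c) (hasTrace? n c) L g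
    all-divide [] _ = tt
    all-divide ((e , P) ∷ L) (irr , _ , primes) = g-divisible P irr , all-divide L primes

    -- All primes with trace c divide the nonzero polynomial g, so their degrees add up to at most
    -- its degree. The first term is q^(n-1), the fair share of one trace value among qⁿ points.
    stepanov : ∀ L → Primes L → degreeSum (HasTrace n c) (hasTrace? n c) L ≤ q ^ β′ * q ^ α + 3 * (d * q) * q ^ α
    stepanov L primes = ℕₚ.≤-trans (degreeSum-bound (HasTrace n c) (hasTrace? n c) L primes (proj₂ exact-g) (all-divide L primes))
      (degree-bound (lOf u) (iOf u) (jOf u) (l< u) (i< u) (j< u))
      where u = proj₁ exact-g

module _ {q : ℕ} (F : FiniteField q) (pp : IsPrimePower q) where
  open Field F pp using (commRing)
  open Sieve F pp
  open PolyOverField F pp using (module Irreducible)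

  degreeAt : ∀ {e n} → (∃ λ j → n ≡ j * e) ⊎ (∀ j → n ≢ j * e) → ℕ
  degreeAt {e} (inj₁ _) = e
  degreeAt (inj₂ _) = 0

  totalDegree : ℕ → Monics → ℕ
  totalDegree n [] = 0
  totalDegree n ((e , P) ∷ L) = degreeAt (cofactor? e n) ℕ.+ totalDegree n L

  module _ (R : CommutativeRing 0ℓ 0ℓ) where
    private module E = EulerProduct F pp R (λ _ → Kit.1# R) (Kit.refl R) (λ _ _ → Kit.sym R (Kit.*-identityˡ R _))
    open Kit R
    open Series R
    open PrimeSums q R

    private
      total : Seq
      total = E.T []

      total≈ : ∀ n → total n ≈ (q · 1#) ↑ n
      total≈ zero = *-identityˡ 1#
      total≈ (suc n) = trans (sum-cong-≋ {q} (λ _ → total≈ n)) (trans (sum-replicate q) (trans (×-congʳ q (sym (*-identityˡ _))) (sym (×-assoc-* q 1# _))))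

      geometric : linear (q · 1#) 1 𝕊.⊗ total 𝕊.≈ 𝕊.1#
      geometric = 𝕊.trans (𝕊.solve 2 (λ t m → (𝕊.:1 𝕊.:- m) 𝕊.:* t 𝕊.:= t 𝕊.:- m 𝕊.:* t) 𝕊.refl total (monomial (q · 1#) 1))
        (𝕊.trans (𝕊.+-congˡ {total} (𝕊.-‿cong (mk (conv-monomialˡ (q · 1#) 1 total)))) (mk λ where
          zero → trans (+-cong (total≈ 0) -0#≈0#) (+-identityʳ 1#)
          (suc n) → trans (+-cong (total≈ (suc n)) (-‿cong (*-congˡ (total≈ n)))) (-‿inverseʳ _)))

    -- For χ = 1 the series `T []` is the zeta function 1/(1 - q t). Its power sums are opposite to
    -- those of 1 - q t, so the degrees of the primes whose degree divides n add up to qⁿ.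
    primePowerSum-total : ∀ n → E.primePowerSum (primesUpTo (suc n)) (suc n) ≈ (q · 1#) ↑ suc n
    primePowerSum-total n = begin
      S ≈⟨ solve 2 (λ s t → s := (s :+ t) :- t) refl S t ⟩
      (S ⊕ t) ⊖ t ≈⟨ +-congʳ (E.explicit-formula (suc n)) ⟩
      0# ⊖ t ≈⟨ +-congʳ (sym zero-sum) ⟩
      (powerSum (linear (q · 1#) 1) (suc n) ⊕ t) ⊖ t ≈⟨ solve 2 (λ s t → (s :+ t) :- t := s) refl _ t ⟩
      powerSum (linear (q · 1#) 1) (suc n) ≈⟨ reflexive (≡.cong (powerSum (linear (q · 1#) 1)) (≡.sym (ℕₚ.*-identityʳ (suc n)))) ⟩
      powerSum (linear (q · 1#) 1) (suc n ℕ.* 1) ≈⟨ powerSum-linear (q · 1#) 1 (s≤s z≤n) n ⟩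
      1 · ((q · 1#) ↑ suc n) ≈⟨ +-identityʳ _ ⟩
      (q · 1#) ↑ suc n ∎
      where
        open Reasoning
        S = E.primePowerSum (primesUpTo (suc n)) (suc n)
        t = powerSum total (suc n)
        zero-sum : powerSum (linear (q · 1#) 1) (suc n) ⊕ t ≈ 0#
        zero-sum = trans (sym (at (powerSum-⊗ (linear (q · 1#) 1) total (linear-zero (q · 1#) 1 (s≤s z≤n)) (total≈ 0)) (suc n)))
          (trans (at (powerSum-cong (trans (at geometric 0) refl) geometric) (suc n)) (at powerSum-1 (suc n)))

    private
      ξ : ∀ {e} → Mon e → ℕ → Carrier
      ξ {e} P j = e · 1#

      1↑ : ∀ n → 1# ↑ n ≈ 1#
      1↑ zero = refl
      1↑ (suc n) = trans (*-identityˡ _) (1↑ n)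

      primeSum-total : ∀ n L → primeSum ξ n L ≈ totalDegree n L · 1#
      primeSum-total n [] = refl
      primeSum-total n ((e , P) ∷ L) = trans (+-cong (each (cofactor? e n)) (primeSum-total n L)) (sym (×-homo-+ 1# (degreeAt (cofactor? e n)) (totalDegree n L)))
        where
          each : ∀ s → weigh ξ {n = n} P s ≈ degreeAt s · 1#
          each (inj₁ _) = refl
          each (inj₂ _) = refl

    totalDegree-value : ∀ n → totalDegree (suc n) (primesUpTo (suc n)) · 1# ≈ (q · 1#) ↑ suc n
    totalDegree-value n = trans (sym (primeSum-total (suc n) L)) (trans (sym (E.primePowerSum-primeSum ξ (λ {e} P j → ×-congʳ e (sym (1↑ j))) (suc n) (s≤s z≤n) L (proj₁ (primesUpTo-correct (suc n)))))
        (primePowerSum-total n))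
      where
        L : Monics
        L = primesUpTo (suc n)

ℤ-ring : CommutativeRing 0ℓ 0ℓ
ℤ-ring = ℤₚ.+-*-commutativeRing

-- Oscillation of the point counts

module ℤ-facts where
  open Kit ℤ-ring

  ·1 : ∀ n → n · 1# ≡ ℤ.+ n
  ·1 zero = ≡.refl
  ·1 (suc n) = ≡.cong (1# ⊕_) (·1 n)

  +-↑ : ∀ m n → (ℤ.+ m) ↑ n ≡ ℤ.+ (m ^ n)
  +-↑ m zero = ≡.refl
  +-↑ m (suc n) = ≡.trans (≡.cong (ℤ.+ m ⊗_) (+-↑ m n)) (≡.sym (ℤₚ.pos-* m (m ^ n)))

  ∣difference∣ : ∀ m n B → m ≤ n + B → n ≤ m + B → ℤ.∣ ℤ.+ m ℤ.- ℤ.+ n ∣ ≤ B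
  ∣difference∣ m n B m≤ n≤ = ≡.subst (_≤ B) (≡.sym (≡.cong ℤ.∣_∣ (ℤₚ.[+m]-[+n]≡m⊖n m n))) (case ℕₚ.≤-total n m of λ where
    (inj₁ n≤m) → ≡.subst (_≤ B) (≡.sym (≡.cong ℤ.∣_∣ (ℤₚ.⊖-≥ n≤m))) (ℕₚ.m≤n+o⇒m∸n≤o m n m≤)
    (inj₂ m≤n) → ≡.subst (_≤ B) (≡.sym (≡.trans (ℤₚ.∣m⊖n∣≡∣n⊖m∣ m n) (≡.cong ℤ.∣_∣ (ℤₚ.⊖-≥ m≤n)))) (ℕₚ.m≤n+o⇒m∸n≤o n m n≤))

module ℕ-sums where
  open Algebra.Properties.CommutativeMonoid.Sum ℕₚ.+-0-commutativeMonoid public using (sum; sum-remove; ∑-distrib-+; sum-cong-≋)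
  open SingleTerm ℕₚ.+-0-commutativeMonoid public

  sum-≤ : ∀ {n} (f : Fin n → ℕ) M → (∀ i → f i ≤ M) → sum f ≤ n * M
  sum-≤ {zero} f M p = z≤n
  sum-≤ {suc n} f M p = ℕₚ.+-mono-≤ (p zero) (sum-≤ (f ∘ suc) M (p ∘ suc))

  term-≤-sum : ∀ {n} (f : Fin n → ℕ) i → f i ≤ sum f
  term-≤-sum f zero = ℕₚ.m≤m+n _ _
  term-≤-sum f (suc i) = ℕₚ.≤-trans (term-≤-sum (f ∘ suc) i) (ℕₚ.m≤n+m _ _)

  sum-≤-except : ∀ {n} (f : Fin (suc n) → ℕ) M → (∀ i → f i ≤ M) → ∀ i → sum f ≤ f i + n * M
  sum-≤-except f M p i = ℕₚ.≤-trans (ℕₚ.≤-reflexive (sum-remove {i = i} f)) (ℕₚ.+-monoʳ-≤ (f i) (sum-≤ _ M (λ j → p (Fin.punchIn i j))))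

  -- An upper bound for every term turns into a lower bound for each of them when it is close to the mean.
  near-mean : ∀ n (f : Fin n → ℕ) S E → sum f ≡ n * S → (∀ i → f i ≤ S + E) → ∀ i j → f i ≤ f j + n * E
  near-mean (suc n) f S E total upper i j = ℕₚ.≤-trans (upper i) (ℕₚ.≤-trans (ℕₚ.+-monoˡ-≤ E S≤) (ℕₚ.≤-reflexive (begin
      (f j + n * E) + E ≡⟨ solve 3 (λ x n E → (x :+ n :* E) :+ E := x :+ (con 1 :+ n) :* E) ≡.refl (f j) n E ⟩
      f j + suc n * E ∎)))
    where
      open ≡.≡-Reasoning
      open Data.Nat.Solver.+-*-Solver
      S≤ : S ≤ f j + n * E
      S≤ = ℕₚ.+-cancelˡ-≤ (n * S) S (f j + n * E) (ℕₚ.≤-trans (ℕₚ.≤-reflexive (≡.trans (ℕₚ.+-comm (n * S) S) (≡.sym total)))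
        (ℕₚ.≤-trans (sum-≤-except f (S + E) upper j) (ℕₚ.≤-reflexive (solve 4 (λ x n S E → x :+ n :* (S :+ E) := n :* S :+ (x :+ n :* E)) ≡.refl (f j) n S E))))

-- α = ⌊n/2⌋ and β = n - α. Both must be positive, which excludes n = 1, and β - 1 ≤ α is the
-- balance that Stepanov's parameters require.
halves : ∀ n → 2 ≤ n → ∃ λ α′ → ∃ λ β′ → β′ ≤ suc α′ × n ≡ suc β′ + suc α′ × ℕ.⌊ n /2⌋ ≡ suc α′
halves (suc (suc zero)) _ = 0 , 0 , z≤n , ≡.refl , ≡.refl
halves (suc (suc (suc zero))) _ = 0 , 1 , s≤s z≤n , ≡.refl , ≡.refl
halves (suc (suc n@(suc (suc _)))) _ with halves n (s≤s (s≤s z≤n))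
... | α′ , β′ , β≤ , n≡ , h≡ = suc α′ , suc β′ , s≤s β≤ , ≡.cong suc (≡.trans (≡.cong suc n≡) (≡.cong suc (≡.sym (ℕₚ.+-suc β′ (suc α′))))) , ≡.cong suc h≡
halves (suc zero) (s≤s ())

module PointCount {q : ℕ} (F : FiniteField q) (pp : IsPrimePower q) {D : ℕ} (a : Fin (suc (suc D)) → FiniteField.Carrier F)
  (lead : ¬ (FiniteField._≈_ F (a (fromℕ (suc D))) (FiniteField.0# F)))
  (d≉0 : ¬ (FiniteField._≈_ F (Kit._·_ (FiniteField.commRing F) (suc D) (FiniteField.1# F)) (FiniteField.0# F))) where
  open Field F pp using (2≤q; 1≤q; commRing; enum; index)
  open Sieve F pp
  open Stepanov F pp a lead d≉0
  open DegreeBounds F pp using (degreeSum; weightIf)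
  open ℕ-sums

  points : ℕ → Monics → Fin q → ℕ
  points n L c = degreeSum (HasTrace n c) (hasTrace? n c) L

  private
    fibre-weight : ∀ {e n} (P : Mon e) s → sum {q} (λ c → weightIf (hasTraceAt? c {n = n} P s) e) ≡ degreeAt F pp {n = n} s
    fibre-weight {e} P (inj₁ (j , _)) = ≡.trans (sum-single {q} (λ c → weightIf (t Finₚ.≟ c) e) t (λ c c≢ → off c (t Finₚ.≟ c) (c≢ ∘ ≡.sym))) (on (t Finₚ.≟ t))
      where
        t : Fin q
        t = index (Kit._·_ commRing j (Reversal.traceForm commRing a (Vec.map enum P)))
        off : ∀ c (s : Dec (t ≡ c)) → t ≢ c → weightIf s e ≡ 0
        off c (yes eq) ne = ⊥-elim (ne eq)
        off c (no _) _ = ≡.refl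
        on : (s : Dec (t ≡ t)) → weightIf s e ≡ e
        on (yes _) = ≡.refl
        on (no ne) = ⊥-elim (ne ≡.refl)
    fibre-weight P (inj₂ _) = sum-ε {q} (λ c → 0) (λ _ → ≡.refl)

  points-total : ∀ n L → sum {q} (points n L) ≡ totalDegree F pp n L
  points-total n [] = sum-ε {q} (λ c → 0) (λ _ → ≡.refl)
  points-total n ((e , P) ∷ L) = ≡.trans (∑-distrib-+ {q} (λ c → weightIf (hasTraceAt? c P (cofactor? e n)) e) (points n L))
    (≡.cong₂ _+_ (fibre-weight P (cofactor? e n)) (points-total n L))

  -- The identity was obtained for multiples of 1 in any commutative ring; in ℤ it becomes an
  -- equation between natural numbers.
  totalDegree-primes : ∀ n → totalDegree F pp (suc n) (primesUpTo (suc n)) ≡ q ^ suc n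
  totalDegree-primes n = ℤₚ.+-injective (≡.trans (≡.sym (ℤ-facts.·1 _)) (≡.trans (totalDegree-value F pp ℤ-ring n)
    (≡.trans (≡.cong (λ x → Kit._↑_ ℤ-ring x (suc n)) (ℤ-facts.·1 q)) (ℤ-facts.+-↑ q (suc n)))))

  private
    E : ℕ → ℕ
    E n = 3 * (suc D * q) * q ^ ℕ.⌊ n /2⌋

  points-upper : ∀ n c → points (suc n) (primesUpTo (suc n)) c ≤ q ^ n + E (suc n)
  points-upper zero c = begin
    -- For n = 1 there is nothing to halve, but the total of q points already lies within the error
    -- term.
    points 1 L c ≤⟨ term-≤-sum {q} (points 1 L) c ⟩
    sum {q} (points 1 L) ≡⟨ ≡.trans (points-total 1 L) (totalDegree-primes 0) ⟩
    q * 1 ≡⟨ ℕₚ.*-identityʳ q ⟩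
    q ≤⟨ ℕₚ.m≤n*m q (suc D) ⟩
    suc D * q ≤⟨ ℕₚ.m≤n*m (suc D * q) 3 ⟩
    3 * (suc D * q) ≡⟨ ≡.sym (ℕₚ.*-identityʳ _) ⟩
    E 1 ≤⟨ ℕₚ.m≤n+m (E 1) 1 ⟩
    1 + E 1 ∎
    where
      open ℕₚ.≤-Reasoning
      L = primesUpTo 1
  points-upper (suc n) c = from-halves (halves (suc (suc n)) (s≤s (s≤s z≤n)))
    where
      L = primesUpTo (suc (suc n))
      from-halves : (∃ λ α′ → ∃ λ β′ → β′ ≤ suc α′ × suc (suc n) ≡ suc β′ + suc α′ × ℕ.⌊ suc (suc n) /2⌋ ≡ suc α′) →
        points (suc (suc n)) L c ≤ q ^ suc n + E (suc (suc n))
      from-halves (α′ , β′ , β≤ , n≡ , h≡) = begin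
        points (suc (suc n)) L c ≡⟨ ≡.cong (λ m → points m L c) n≡ ⟩
        points (suc β′ + suc α′) L c ≤⟨ stepanov α′ β′ β≤ c L (proj₁ (primesUpTo-correct (suc (suc n)))) ⟩
        q ^ β′ * q ^ suc α′ + 3 * (suc D * q) * q ^ suc α′
          ≡⟨ ≡.cong₂ _+_ (≡.trans (≡.sym (ℕₚ.^-distribˡ-+-* q β′ (suc α′))) (≡.cong (q ^_) (≡.sym (ℕₚ.suc-injective n≡)))) (≡.cong (λ h → 3 * (suc D * q) * q ^ h) (≡.sym h≡)) ⟩
        q ^ suc n + E (suc (suc n)) ∎
        where open ℕₚ.≤-Reasoning

  points-oscillation : ∀ n c c′ → points (suc n) (primesUpTo (suc n)) c ≤ points (suc n) (primesUpTo (suc n)) c′ + q * E (suc n)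
  points-oscillation n = near-mean q (points (suc n) (primesUpTo (suc n))) (q ^ n) (E (suc n))
    (≡.trans (points-total (suc n) (primesUpTo (suc n))) (totalDegree-primes n)) (points-upper n)

-- x ≼ b reads ‖x‖ ≤ b.
record Norm (A : CommutativeRing 0ℓ 0ℓ) : Set₁ where
  open Kit A
  infix 4 _≼_
  field
    _≼_ : Carrier → ℕ → Set
    ≼-resp : ∀ {x y b} → x ≈ y → x ≼ b → y ≼ b
    ≼-mono : ∀ {x b c} → b ≤ c → x ≼ b → x ≼ c
    ≼-0 : 0# ≼ 0
    ≼-⊕ : ∀ {x y b c} → x ≼ b → y ≼ c → x ⊕ y ≼ b + c
    ≼-neg : ∀ {x b} → x ≼ b → - x ≼ b
    -- Products are controlled up to a constant. It enters only the factor and the exponent of the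
    -- polynomial part of later bounds, never their exponential rate.
    κ : ℕ
    ≼-⊗ : ∀ {x y b c} → x ≼ b → y ≼ c → x ⊗ y ≼ κ * (b * c)
    bounded : ∀ x → ∃ λ b → x ≼ b

  ≼-sum : ∀ {n} (f : Fin n → Carrier) b → (∀ i → f i ≼ b) → sum f ≼ n * b
  ≼-sum {zero} f b p = ≼-0
  ≼-sum {suc n} f b p = ≼-⊕ (p zero) (≼-sum (f ∘ suc) b (p ∘ suc))

  ≼-· : ∀ n {x b} → x ≼ b → n · x ≼ n * b
  ≼-· zero p = ≼-0
  ≼-· (suc n) p = ≼-⊕ p (≼-· n p)

module Oscillation {q : ℕ} (F : FiniteField q) (pp : IsPrimePower q) where
  open GroupRing F pp ℤ-ring
  open Kit ℤ-ring using (sum; sum-permute; sum-cong-≋; ∑-distrib-+; solve; _:=_; _:+_; _:*_; :-_; _:-_; :1)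
  private module 𝔸 = Kit reducedRing

  infix 4 _≼_
  record _≼_ (x : Fun) (b : ℕ) : Set where
    constructor mk
    field oscillation : ∀ c c′ → ℤ.∣ x c ℤ.- x c′ ∣ ≤ b
  open _≼_ public

  ∣sum∣ : ∀ {n} (f : Fin n → ℤ) b → (∀ i → ℤ.∣ f i ∣ ≤ b) → ℤ.∣ sum f ∣ ≤ n * b
  ∣sum∣ {zero} f b p = z≤n
  ∣sum∣ {suc n} f b p = ℕₚ.≤-trans (ℤₚ.∣i+j∣≤∣i∣+∣j∣ (f zero) (sum (f ∘ suc))) (ℕₚ.+-mono-≤ (p zero) (∣sum∣ (f ∘ suc) b (p ∘ suc)))

  sum-reflection : ∀ (f : Fun) c → sum {q} (λ i → f (c ⊟ i)) ≡ sum {q} f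
  sum-reflection f c = ≡.sym (sum-permute {q} {q} f (reflection c))

  -- As ∑ᵢ y(c − i) does not depend on c, x may be replaced by x − x(0).
  ∗-difference : ∀ (x y : Fun) k c c′ → (x ∗ y) c ℤ.- (x ∗ y) c′ ≡ sum {q} (λ i → (x i ℤ.- k) ℤ.* (y (c ⊟ i) ℤ.- y (c′ ⊟ i)))
  ∗-difference x y k c c′ = begin
    sum {q} f ℤ.- sum {q} g ≡⟨ solve 4 (λ a b k s → a :- b := a :+ (:- :1 :* b :+ (:- k :* s :+ k :* s))) ≡.refl (sum {q} f) (sum {q} g) k (sum {q} y) ⟩
    sum {q} f ℤ.+ (m1 ℤ.* sum {q} g ℤ.+ (ℤ.- k ℤ.* sum {q} y ℤ.+ k ℤ.* sum {q} y))
      ≡⟨ ≡.cong (λ t → sum {q} f ℤ.+ (m1 ℤ.* sum {q} g ℤ.+ t)) (≡.cong₂ (λ s t → ℤ.- k ℤ.* s ℤ.+ k ℤ.* t) (≡.sym (sum-reflection y c)) (≡.sym (sum-reflection y c′))) ⟩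
    sum {q} f ℤ.+ (m1 ℤ.* sum {q} g ℤ.+ (ℤ.- k ℤ.* sum {q} (λ i → y (c ⊟ i)) ℤ.+ k ℤ.* sum {q} (λ i → y (c′ ⊟ i))))
      ≡⟨ ≡.cong (λ t → sum {q} f ℤ.+ t) (≡.cong₂ ℤ._+_ (scale m1 g) (≡.cong₂ ℤ._+_ (scale (ℤ.- k) (λ i → y (c ⊟ i))) (scale k (λ i → y (c′ ⊟ i))))) ⟩
    sum {q} f ℤ.+ (sum {q} (λ i → m1 ℤ.* g i) ℤ.+ (sum {q} (λ i → ℤ.- k ℤ.* y (c ⊟ i)) ℤ.+ sum {q} (λ i → k ℤ.* y (c′ ⊟ i))))
      ≡⟨ ≡.cong (λ t → sum {q} f ℤ.+ t) (≡.cong (λ t → sum {q} (λ i → m1 ℤ.* g i) ℤ.+ t) (≡.sym (∑-distrib-+ {q} (λ i → ℤ.- k ℤ.* y (c ⊟ i)) (λ i → k ℤ.* y (c′ ⊟ i))))) ⟩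
    sum {q} f ℤ.+ (sum {q} (λ i → m1 ℤ.* g i) ℤ.+ sum {q} (λ i → ℤ.- k ℤ.* y (c ⊟ i) ℤ.+ k ℤ.* y (c′ ⊟ i)))
      ≡⟨ ≡.cong (λ t → sum {q} f ℤ.+ t) (≡.sym (∑-distrib-+ {q} (λ i → m1 ℤ.* g i) (λ i → ℤ.- k ℤ.* y (c ⊟ i) ℤ.+ k ℤ.* y (c′ ⊟ i)))) ⟩
    sum {q} f ℤ.+ sum {q} (λ i → m1 ℤ.* g i ℤ.+ (ℤ.- k ℤ.* y (c ⊟ i) ℤ.+ k ℤ.* y (c′ ⊟ i)))
      ≡⟨ ≡.sym (∑-distrib-+ {q} f (λ i → m1 ℤ.* g i ℤ.+ (ℤ.- k ℤ.* y (c ⊟ i) ℤ.+ k ℤ.* y (c′ ⊟ i)))) ⟩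
    sum {q} (λ i → f i ℤ.+ (m1 ℤ.* g i ℤ.+ (ℤ.- k ℤ.* y (c ⊟ i) ℤ.+ k ℤ.* y (c′ ⊟ i))))
      ≡⟨ sum-cong-≋ {q} (λ i → solve 4 (λ x k u v → x :* u :+ (:- :1 :* (x :* v) :+ (:- k :* u :+ k :* v)) := (x :- k) :* (u :- v)) ≡.refl (x i) k (y (c ⊟ i)) (y (c′ ⊟ i))) ⟩
    sum {q} (λ i → (x i ℤ.- k) ℤ.* (y (c ⊟ i) ℤ.- y (c′ ⊟ i))) ∎
    where
      open ≡.≡-Reasoning
      m1 : ℤ
      m1 = ℤ.- ℤ.+ 1
      f g : Fin q → ℤ
      f i = x i ℤ.* y (c ⊟ i)
      g i = x i ℤ.* y (c′ ⊟ i)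
      scale : ∀ t (h : Fin q → ℤ) → t ℤ.* sum {q} h ≡ sum {q} (λ i → t ℤ.* h i)
      scale t h = Kit.*-distribˡ-sum ℤ-ring {q} t h

  ≼-resp : ∀ {x y b} → x 𝔸.≈ y → x ≼ b → y ≼ b
  ≼-resp {x} {y} {b} x∼y (mk p) = mk λ c c′ → ≡.subst (λ t → ℤ.∣ t ∣ ≤ b) (≡.trans (≡.cong₂ ℤ._-_ (proj₂ (∼⇒constant x∼y) c) (proj₂ (∼⇒constant x∼y) c′))
    (solve 3 (λ u v k → (u :+ k) :- (v :+ k) := u :- v) ≡.refl (y c) (y c′) (proj₁ (∼⇒constant x∼y)))) (p c c′)

  ≼-⊕ : ∀ {x y b c} → x ≼ b → y ≼ c → (x 𝔾.⊕ y) ≼ (b + c)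
  ≼-⊕ {x} {y} {b} {d} (mk p) (mk r) = mk λ c c′ → ℕₚ.≤-trans (ℕₚ.≤-reflexive (≡.cong ℤ.∣_∣ (solve 4 (λ a b u v → (a :+ u) :- (b :+ v) := (a :- b) :+ (u :- v)) ≡.refl (x c) (x c′) (y c) (y c′))))
    (ℕₚ.≤-trans (ℤₚ.∣i+j∣≤∣i∣+∣j∣ (x c ℤ.- x c′) (y c ℤ.- y c′)) (ℕₚ.+-mono-≤ (p c c′) (r c c′)))

  ≼-neg : ∀ {x b} → x ≼ b → (𝔾.- x) ≼ b
  ≼-neg {x} (mk p) = mk λ c c′ → ℕₚ.≤-trans (ℕₚ.≤-reflexive (≡.cong ℤ.∣_∣ (solve 2 (λ a b → :- a :- :- b := b :- a) ≡.refl (x c) (x c′)))) (p c′ c)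

  ≼-∗ : ∀ {x y b c} → x ≼ b → y ≼ c → (x ∗ y) ≼ (q * (b * c))
  ≼-∗ {x} {y} {b} {d} (mk p) (mk r) = mk λ c c′ → ℕₚ.≤-trans (ℕₚ.≤-reflexive (≡.cong ℤ.∣_∣ (∗-difference x y (x 0ᵢ) c c′)))
    (∣sum∣ {q} (λ i → (x i ℤ.- x 0ᵢ) ℤ.* (y (c ⊟ i) ℤ.- y (c′ ⊟ i))) (b * d) (λ i → ℕₚ.≤-trans (ℕₚ.≤-reflexive (ℤₚ.abs-* (x i ℤ.- x 0ᵢ) (y (c ⊟ i) ℤ.- y (c′ ⊟ i)))) (ℕₚ.*-mono-≤ (p i 0ᵢ) (r (c ⊟ i) (c′ ⊟ i)))))

  ≼-bounded : ∀ x → ∃ λ b → x ≼ b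
  ≼-bounded x = B + B , mk λ c c′ → ℕₚ.≤-trans (ℤₚ.∣i-j∣≤∣i∣+∣j∣ (x c) (x c′)) (ℕₚ.+-mono-≤ (ℕ-sums.term-≤-sum (λ i → ℤ.∣ x i ∣) c) (ℕ-sums.term-≤-sum (λ i → ℤ.∣ x i ∣) c′))
    where
      B : ℕ
      B = ℕ-sums.sum {q} (λ i → ℤ.∣ x i ∣)

  oscillationNorm : Norm reducedRing
  oscillationNorm = record
    { _≼_ = _≼_ ; ≼-resp = ≼-resp ; ≼-mono = λ le (mk p) → mk λ c c′ → ℕₚ.≤-trans (p c c′) le ; ≼-0 = mk λ _ _ → z≤n
    ; ≼-⊕ = ≼-⊕ ; ≼-neg = ≼-neg ; κ = q ; ≼-⊗ = ≼-∗ ; bounded = ≼-bounded }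

  ·-reduce : ∀ n x → n 𝔾.· x 𝔸.≈ n 𝔸.· x
  ·-reduce n x = Hom.·-homo projection n x

  ·-scales : ∀ n (x : Fun) c → (n 𝔾.· x) c ≡ ℤ.+ n ℤ.* x c
  ·-scales n x c = ≡.trans (·-at n x c) (≡.trans (Kit.×-congʳ ℤ-ring n (≡.sym (ℤₚ.*-identityˡ (x c))))
    (≡.trans (≡.sym (Kit.×-assoc-* ℤ-ring n (ℤ.+ 1) (x c))) (≡.cong (ℤ._* x c) (ℤ-facts.·1 n))))

  -- Oscillation is multiplied exactly by n. This permits dividing the recurrence for n hₙ by n in a
  -- ring without denominators.
  ≼-cancel : ∀ n {x b} → 1 ≤ n → (n 𝔸.· x) ≼ (n * b) → x ≼ b
  ≼-cancel n {x} {b} 1≤n nx≼ = mk λ c c′ → ℕₚ.*-cancelˡ-≤ n {{ℕ.>-nonZero 1≤n}} (ℕₚ.≤-trans (ℕₚ.≤-reflexive (scaled c c′)) (oscillation (≼-resp (𝔸.sym (·-reduce n x)) nx≼) c c′))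
    where
      scaled : ∀ c c′ → n * ℤ.∣ x c ℤ.- x c′ ∣ ≡ ℤ.∣ (n 𝔾.· x) c ℤ.- (n 𝔾.· x) c′ ∣
      scaled c c′ = ≡.trans (≡.sym (ℤₚ.abs-* (ℤ.+ n) (x c ℤ.- x c′))) (≡.cong ℤ.∣_∣ (≡.trans (solve 3 (λ n a b → n :* (a :- b) := n :* a :- n :* b) ≡.refl (ℤ.+ n) (x c) (x c′))
        (≡.cong₂ ℤ._-_ (≡.sym (·-scales n x c)) (≡.sym (·-scales n x c′)))))

-- Adjoining roots

module MonicTop (R : CommutativeRing 0ℓ 0ℓ) where
  open Kit R
  open Monic R

  -- The coefficient of Xⁿ⁻¹, minus the sum of the roots. For the reversed polynomial of a series it
  -- is the linear coefficient of the series.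
  subleading : ∀ {n} → Vec Carrier n → Carrier
  subleading [] = 0#
  subleading (c ∷ []) = c
  subleading (c ∷ v@(_ ∷ _)) = subleading v

  -- Synthetic division adds α to this coefficient. In degree one the quotient has no such
  -- coefficient, and the equation for the root states c = -α.
  subleading-quot : ∀ {n} (v : Vec Carrier (suc n)) α → evalM v α ≈ 0# → subleading v ≈ subleading (quotM v α) ⊖ α
  subleading-quot (c ∷ []) α root = trans (solve 2 (λ c α → c := (c :+ α :* :1) :- α) refl c α) (+-congʳ root)
  subleading-quot (c ∷ v@(_ ∷ _)) α _ = general c v
    where
      general : ∀ {n} c (v : Vec Carrier (suc n)) → subleading (c ∷ v) ≈ subleading (quotM (c ∷ v) α) ⊖ α
      general c (b ∷ []) = solve 2 (λ b α → b := (b :+ α :* :1) :- α) refl b α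
      general c (b ∷ v@(_ ∷ _)) = general b v

module MonicTopHom {A B : CommutativeRing 0ℓ 0ℓ} (ψ : Hom A B) where
  private
    module A = Kit A
    module B = Kit B
    module MA = Monic A
    module MB = Monic B
  open Hom ψ

  subleading-homo : ∀ {n} (v : Vec A.Carrier n) → ⟦ MonicTop.subleading A v ⟧ B.≈ MonicTop.subleading B (Vec.map ⟦_⟧ v)
  subleading-homo [] = 0-homo
  subleading-homo (c ∷ []) = B.refl
  subleading-homo (c ∷ v@(_ ∷ _)) = subleading-homo v

  evalM-quotM-homo : ∀ {n} (v : Vec A.Carrier (suc n)) α x → MB.evalM (Vec.map ⟦_⟧ (MA.quotM v α)) x B.≈ MB.evalM (MB.quotM (Vec.map ⟦_⟧ v) ⟦ α ⟧) x
  evalM-quotM-homo (c ∷ []) α x = B.refl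
  evalM-quotM-homo (c ∷ v@(_ ∷ _)) α x = B.+-cong (MonicHom.evalM-homo ψ v α) (B.*-congˡ (evalM-quotM-homo v α x))

-- `embed` and `restrict` together say that the base has the same bounds before and after the
-- extension, so estimates may be proved upstairs and brought back.
record RootExtension {A : CommutativeRing 0ℓ 0ℓ} (N : Norm A) {D : ℕ} (T : Vec (Kit.Carrier A) (suc D)) : Set₁ where
  field
    extension : CommutativeRing 0ℓ 0ℓ
    norm : Norm extension
    base : Hom A extension
    ω : Kit.Carrier extension
    root : Kit._≈_ extension (Monic.evalM extension (Vec.map (Hom.⟦_⟧ base) T) ω) (Kit.0# extension)
    embed : ∀ {a b} → Norm._≼_ N a b → Norm._≼_ norm (Hom.⟦_⟧ base a) b
    restrict : ∀ {a b} → Norm._≼_ norm (Hom.⟦_⟧ base a) b → Norm._≼_ N a b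

powerCombination : ∀ {A A′ : CommutativeRing 0ℓ 0ℓ} (φ : Hom A A′) (ω : Kit.Carrier A′) n → (Fin n → Kit.Carrier A) → Kit.Carrier A′
powerCombination {A} {A′} φ ω n a = Kit.sum A′ {n} (λ j → Kit._⊗_ A′ (Hom.⟦_⟧ φ (a j)) (Kit._↑_ A′ ω (toℕ j)))

-- A ring extension with basis 1, ω, …, ω^D, normed by the largest coordinate.
module ExtensionNorm {A A′ : CommutativeRing 0ℓ 0ℓ} (N : Norm A) (φ : Hom A A′) (ω : Kit.Carrier A′) (D : ℕ)
  (coordinates : ∀ x → ∃ λ (a : Fin (suc D) → Kit.Carrier A) → Kit._≈_ A′ x (powerCombination φ ω (suc D) a))
  (constant-coordinate : ∀ b (a : Fin (suc D) → Kit.Carrier A) → Kit._≈_ A′ (Hom.⟦_⟧ φ b) (powerCombination φ ω (suc D) a) → Kit._≈_ A b (a zero)) where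
  private
    module A = Kit A
    module N = Norm N
  open Kit A′
  open Hom φ

  combination : (Fin (suc D) → A.Carrier) → Carrier
  combination = powerCombination φ ω (suc D)

  infix 4 _≼_
  record _≼_ (x : Carrier) (b : ℕ) : Set where
    constructor mk
    field
      coords : Fin (suc D) → A.Carrier
      represents : x ≈ combination coords
      small : ∀ j → coords j N.≼ b

  ≼-resp : ∀ {x y b} → x ≈ y → x ≼ b → y ≼ b
  ≼-resp e (mk a p s) = mk a (trans (sym e) p) s

  ≼-mono : ∀ {x b c} → b ≤ c → x ≼ b → x ≼ c
  ≼-mono le (mk a p s) = mk a p (λ j → N.≼-mono le (s j))

  combination-⊕ : ∀ a a′ → combination (λ j → a j A.⊕ a′ j) ≈ combination a ⊕ combination a′
  combination-⊕ a a′ = trans (sum-cong-≋ {suc D} (λ j → trans (*-congʳ (⊕-homo (a j) (a′ j))) (distribʳ (ω ↑ toℕ j) ⟦ a j ⟧ ⟦ a′ j ⟧))) (∑-distrib-+ {suc D} (λ j → ⟦ a j ⟧ ⊗ ω ↑ toℕ j) (λ j → ⟦ a′ j ⟧ ⊗ ω ↑ toℕ j))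

  combination-scale : ∀ c a → combination (λ j → c A.⊗ a j) ≈ ⟦ c ⟧ ⊗ combination a
  combination-scale c a = trans (sum-cong-≋ {suc D} (λ j → trans (*-congʳ (⊗-homo c (a j))) (*-assoc ⟦ c ⟧ ⟦ a j ⟧ (ω ↑ toℕ j)))) (sym (*-distribˡ-sum {suc D} ⟦ c ⟧ (λ j → ⟦ a j ⟧ ⊗ ω ↑ toℕ j)))

  ≼-0 : 0# ≼ 0
  ≼-0 = mk (λ _ → A.0#) (sym (SingleTerm.sum-ε (CommutativeRing.+-commutativeMonoid A′) {suc D} (λ j → ⟦ A.0# ⟧ ⊗ ω ↑ toℕ j) (λ j → trans (*-congʳ 0-homo) (zeroˡ _)))) (λ _ → N.≼-0)

  ≼-⊕ : ∀ {x y b c} → x ≼ b → y ≼ c → x ⊕ y ≼ b + c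
  ≼-⊕ (mk a p s) (mk a′ p′ s′) = mk (λ j → a j A.⊕ a′ j) (trans (+-cong p p′) (sym (combination-⊕ a a′))) (λ j → N.≼-⊕ (s j) (s′ j))

  ≼-neg : ∀ {x b} → x ≼ b → - x ≼ b
  ≼-neg {x} (mk a p s) = mk (λ j → A.- A.1# A.⊗ a j)
    (trans (-‿cong p) (trans (sym (-1*x≈-x _)) (trans (*-congʳ (trans (-‿cong (sym 1-homo)) (sym (neg-homo A.1#)))) (sym (combination-scale (A.- A.1#) a)))))
    (λ j → N.≼-resp (A.sym (A.-1*x≈-x (a j))) (N.≼-neg (s j)))

  ≼-scale : ∀ {a x b c} → a N.≼ b → x ≼ c → ⟦ a ⟧ ⊗ x ≼ N.κ * (b * c)
  ≼-scale {a} a≼ (mk a′ p s) = mk (λ j → a A.⊗ a′ j) (trans (*-congˡ p) (sym (combination-scale a a′))) (λ j → N.≼-⊗ a≼ (s j))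

  ≼-sum : ∀ {n} (f : Fin n → Carrier) b → (∀ i → f i ≼ b) → sum f ≼ n * b
  ≼-sum {zero} f b p = ≼-0
  ≼-sum {suc n} f b p = ≼-⊕ (p zero) (≼-sum (f ∘ suc) b (p ∘ suc))

  ≼-bounded : ∀ x → ∃ λ b → x ≼ b
  ≼-bounded x = ℕ-sums.sum {suc D} bounds , mk a (proj₂ (coordinates x)) (λ j → N.≼-mono (ℕ-sums.term-≤-sum bounds j) (proj₂ (N.bounded (a j))))
    where
      a : Fin (suc D) → A.Carrier
      a = proj₁ (coordinates x)
      bounds : Fin (suc D) → ℕ
      bounds j = proj₁ (N.bounded (a j))

  private
    product-bound : Fin (suc D) → Fin (suc D) → ℕ
    product-bound i j = proj₁ (≼-bounded (ω ↑ toℕ i ⊗ ω ↑ toℕ j))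

    B : ℕ
    B = ℕ-sums.sum {suc D} (λ i → ℕ-sums.sum {suc D} (product-bound i))

    product-≼ : ∀ i j → ω ↑ toℕ i ⊗ ω ↑ toℕ j ≼ B
    product-≼ i j = ≼-mono (ℕₚ.≤-trans (ℕ-sums.term-≤-sum (product-bound i) j) (ℕ-sums.term-≤-sum (λ i → ℕ-sums.sum {suc D} (product-bound i)) i)) (proj₂ (≼-bounded (ω ↑ toℕ i ⊗ ω ↑ toℕ j)))

  -- There are (D + 1)² products of basis elements, each multiplied by two coordinates from the
  -- base; `B` bounds all of the structure constants.
  κ′ : ℕ
  κ′ = suc D * (suc D * (N.κ * (N.κ * B)))

  ≼-⊗ : ∀ {x y b c} → x ≼ b → y ≼ c → x ⊗ y ≼ κ′ * (b * c)
  ≼-⊗ {x} {y} {b} {c} (mk a p s) (mk a′ p′ s′) = ≼-mono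
      (ℕₚ.≤-reflexive (Data.Nat.Solver.+-*-Solver.solve 5 (λ n k b c B → n S:* (n S:* (k S:* (b S:* (k S:* (c S:* B))))) S:= (n S:* (n S:* (k S:* (k S:* B)))) S:* (b S:* c)) ≡.refl (suc D) N.κ b c B))
      (≼-resp (sym expansion) (≼-sum {suc D} (λ i → sum {suc D} (λ j → ⟦ a i ⟧ ⊗ (⟦ a′ j ⟧ ⊗ (ω ↑ toℕ i ⊗ ω ↑ toℕ j)))) _
        (λ i → ≼-sum {suc D} (λ j → ⟦ a i ⟧ ⊗ (⟦ a′ j ⟧ ⊗ (ω ↑ toℕ i ⊗ ω ↑ toℕ j))) _ (λ j → ≼-scale (s i) (≼-scale (s′ j) (product-≼ i j))))))
    where
      open Data.Nat.Solver.+-*-Solver using () renaming (_:*_ to _S:*_; _:=_ to _S:=_)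
      expansion : x ⊗ y ≈ sum {suc D} (λ i → sum {suc D} (λ j → ⟦ a i ⟧ ⊗ (⟦ a′ j ⟧ ⊗ (ω ↑ toℕ i ⊗ ω ↑ toℕ j))))
      expansion = trans (*-cong p p′) (trans (*-distribʳ-sum {suc D} (combination a′) (λ i → ⟦ a i ⟧ ⊗ ω ↑ toℕ i))
        (sum-cong-≋ {suc D} (λ i → trans (*-distribˡ-sum {suc D} (⟦ a i ⟧ ⊗ ω ↑ toℕ i) (λ j → ⟦ a′ j ⟧ ⊗ ω ↑ toℕ j))
          (sum-cong-≋ {suc D} (λ j → solve 4 (λ a x b y → (a :* x) :* (b :* y) := a :* (b :* (x :* y))) refl ⟦ a i ⟧ (ω ↑ toℕ i) ⟦ a′ j ⟧ (ω ↑ toℕ j))))))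

  extensionNorm : Norm A′
  extensionNorm = record
    { _≼_ = _≼_ ; ≼-resp = ≼-resp ; ≼-mono = ≼-mono ; ≼-0 = ≼-0 ; ≼-⊕ = ≼-⊕ ; ≼-neg = ≼-neg ; κ = κ′ ; ≼-⊗ = ≼-⊗ ; bounded = ≼-bounded }

  private
    unit : A.Carrier → Fin (suc D) → A.Carrier
    unit a zero = a
    unit a (suc _) = A.0#

  embed : ∀ {a b} → a N.≼ b → ⟦ a ⟧ ≼ b
  embed {a} p = mk (unit a) (sym (trans (+-cong (*-identityʳ _) (SingleTerm.sum-ε (CommutativeRing.+-commutativeMonoid A′) {D} (λ j → ⟦ A.0# ⟧ ⊗ ω ↑ suc (toℕ j)) (λ j → trans (*-congʳ 0-homo) (zeroˡ _)))) (+-identityʳ _)))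
    (λ { zero → p ; (suc _) → N.≼-mono z≤n N.≼-0 })

  -- Whatever representation of ⟦ a ⟧ has small coordinates, its constant coordinate is a itself.
  restrict : ∀ {a b} → ⟦ a ⟧ ≼ b → a N.≼ b
  restrict {a} (mk c p s) = N.≼-resp (A.sym (constant-coordinate a c p)) (s zero)

  rootExtension : (T : Vec A.Carrier (suc D)) → Monic.evalM A′ (Vec.map ⟦_⟧ T) ω ≈ 0# → RootExtension N T
  rootExtension T root = record { extension = A′ ; norm = extensionNorm ; base = φ ; ω = ω ; root = root ; embed = embed ; restrict = restrict }

module PowerSums-Hom {R A B : CommutativeRing 0ℓ 0ℓ} (φ : Hom R A) (ψ : Hom A B) where
  private
    module A = Kit A
    module B = Kit B
    module φ = Hom φ
  open Hom ψ

  combination-homo : ∀ {n} (a : Fin n → Kit.Carrier R) x →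
    ⟦ A.sum {n} (λ j → φ.⟦ a j ⟧ A.⊗ x A.↑ toℕ j) ⟧ B.≈ B.sum {n} (λ j → ⟦ φ.⟦ a j ⟧ ⟧ B.⊗ ⟦ x ⟧ B.↑ toℕ j)
  combination-homo {n} a x = B.trans (sum-homo {n} (λ j → φ.⟦ a j ⟧ A.⊗ x A.↑ toℕ j))
    (B.sum-cong-≋ {n} (λ j → B.trans (⊗-homo φ.⟦ a j ⟧ (x A.↑ toℕ j)) (B.*-congˡ (↑-homo x (toℕ j)))))

module ConstantCoordinate (A : CommutativeRing 0ℓ 0ℓ) where
  private module A = Kit A
  open Polynomials A

  combination : ∀ n → (Fin n → A.Carrier) → Poly
  combination n a = ℙ.sum {n} (λ j → C (a j) ℙ.⊗ X ℙ.↑ toℕ j)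

  X↑-vanish : ∀ j → VanishesFrom (suc j) (coeff (X ℙ.↑ j))
  X↑-vanish zero (suc k) _ = A.refl
  X↑-vanish (suc j) = conv-vanishes< 1 j (λ { (suc (suc k)) _ → A.refl ; (suc zero) (s≤s ()) }) (X↑-vanish j)

  sum-vanish : ∀ {n N} (f : Fin n → Poly) → (∀ i → VanishesFrom N (coeff (f i))) → VanishesFrom N (coeff (ℙ.sum f))
  sum-vanish {zero} f v k le = A.refl
  sum-vanish {suc n} f v k le = A.trans (A.+-cong (v zero k le) (sum-vanish (f ∘ suc) (v ∘ suc) k le)) (A.+-identityˡ _)

  combination-vanish : ∀ n a → VanishesFrom n (coeff (combination n a))
  combination-vanish n a = sum-vanish {n} (λ j → C (a j) ℙ.⊗ X ℙ.↑ toℕ j) λ j k le →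
    A.trans (coeff-C⊗ (a j) (X ℙ.↑ toℕ j) k) (A.trans (A.*-congˡ (X↑-vanish (toℕ j) k (ℕₚ.≤-trans (Finₚ.toℕ<n j) le))) (A.zeroʳ _))

  combination-constant : ∀ n a → coeff (combination (suc n) a) 0 A.≈ a zero
  combination-constant n a = A.trans (A.+-cong (A.*-identityʳ (a zero)) (rest {n} (λ j → C (a (suc j)) ℙ.⊗ X ℙ.↑ suc (toℕ j)) (λ j → shifted (a (suc j)) (toℕ j)))) (A.+-identityʳ _)
    where
      shifted : ∀ c j → coeff (C c ℙ.⊗ X ℙ.↑ suc j) 0 A.≈ A.0#
      shifted c j = A.trans (coeff-C⊗ c (X ℙ.↑ suc j) 0) (A.trans (A.*-congˡ (A.zeroˡ _)) (A.zeroʳ _))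
      rest : ∀ {n} (f : Fin n → Poly) → (∀ j → coeff (f j) 0 A.≈ A.0#) → coeff (ℙ.sum f) 0 A.≈ A.0#
      rest {zero} f p = A.refl
      rest {suc n} f p = A.trans (A.+-cong (p zero) (rest (f ∘ suc) (p ∘ suc))) (A.+-identityˡ _)

  -- Both polynomials have degree at most D and T is monic of degree D + 1, so congruence modulo T
  -- is equality.
  congruent-constant : ∀ {D} (T : Vec A.Carrier (suc D)) b a u → C b ℙ.⊖ combination (suc D) a ℙ.≈ u ℙ.⊗ toPoly T → b A.≈ a zero
  congruent-constant {D} T b a u eq = A.trans (Series.at (_≈ₚ_.eq (ℙ.x∙y⁻¹≈ε⇒x≈y (C b) (combination (suc D) a) difference≈0)) 0) (combination-constant D a)
    where
      difference-vanish : VanishesFrom (suc D) (coeff (C b ℙ.⊖ combination (suc D) a))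
      difference-vanish (suc k) le = A.trans (A.+-cong A.refl (A.trans (A.-‿cong (combination-vanish (suc D) a (suc k) le)) A.-0#≈0#)) (A.+-identityˡ _)
      difference≈0 : C b ℙ.⊖ combination (suc D) a ℙ.≈ ℙ.0#
      difference≈0 = ℙ.trans eq (ℙ.trans (ℙ.*-congʳ {toPoly T} (multiple-vanish T u
        (λ k le → A.trans (A.sym (Series.at (_≈ₚ_.eq eq) k)) (difference-vanish k le)))) (ℙ.zeroˡ (toPoly T)))

module AdjoinRoot (A : CommutativeRing 0ℓ 0ℓ) {D : ℕ} (T : Vec (Kit.Carrier A) (suc D)) where
  private module A = Kit A
  open Polynomials A
  open Quotient polyRing (toPoly T)

  extension : CommutativeRing 0ℓ 0ℓ
  extension = quotientRing

  open Kit extension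
  open ConstantCoordinate A using (combination; congruent-constant)

  base : Hom A extension
  base = projection ∘ₕ constants

  generator : Kit.Carrier extension
  generator = X

  to-extension : ∀ n (a : Fin n → A.Carrier) → combination n a ≈ powerCombination {A} {extension} base generator n a
  to-extension n a = PowerSums-Hom.combination-homo constants projection {n} a X

  remainder-∼ : ∀ f (d : Division f (toPoly T) (suc D)) → f ≈ Division.rem d
  remainder-∼ f d = mk (Division.quo d) (ℙ.trans (Division.division d) (ℙ.+-comm (Division.quo d ℙ.⊗ toPoly T) (Division.rem d)))

  coordinates : ∀ x → ∃ λ (a : Fin (suc D) → A.Carrier) → x ≈ powerCombination {A} {extension} base generator (suc D) a
  coordinates f = from-division (divide T f)
    where
      from-division : Division f (toPoly T) (suc D) → ∃ λ (a : Fin (suc D) → A.Carrier) → f ≈ powerCombination {A} {extension} base generator (suc D) a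
      from-division d = (λ j → coeff (Division.rem d) (toℕ j)) , trans {f} {Division.rem d} (remainder-∼ f d)
        (trans {Division.rem d} {combination (suc D) (λ j → coeff (Division.rem d) (toℕ j))} (∼-reflexive (expand (suc D) (Division.rem d) (Division.rem-vanish d))) (to-extension (suc D) (λ j → coeff (Division.rem d) (toℕ j))))

  constant-coordinate : ∀ b (a : Fin (suc D) → A.Carrier) → C b ≈ powerCombination {A} {extension} base generator (suc D) a → b A.≈ a zero
  constant-coordinate b a eq = congruent-constant T b a (proj₁ difference) (proj₂ difference)
    where
      difference : ∃ λ u → C b ℙ.⊖ combination (suc D) a ℙ.≈ u ℙ.⊗ toPoly T
      difference = ∼0⇒multiple (x≈y⇒x∙y⁻¹≈ε {C b} {combination (suc D) a} (trans {C b} {_} {combination (suc D) a} eq (sym (to-extension (suc D) a))))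

  X-root : Monic.evalM extension (Vec.map (Hom.⟦_⟧ base) T) generator ≈ 0#
  X-root = trans (sym (trans (MonicHom.evalM-homo projection (Vec.map C T) X) (reflexive (≡.cong (λ v → Monic.evalM extension v X) (≡.sym (Vecₚ.map-∘ (λ x → x) C T)))))) modulus∼0

adjoinRoot : ∀ {A : CommutativeRing 0ℓ 0ℓ} (N : Norm A) {D : ℕ} (T : Vec (Kit.Carrier A) (suc D)) → RootExtension N T
adjoinRoot {A} N {D} T = ExtensionNorm.rootExtension {A} {R.extension} N R.base R.generator D R.coordinates R.constant-coordinate T R.X-root
  where module R = AdjoinRoot A T

module Tower (w : ℕ → ℕ) (1≤w0 : 1 ≤ w 0) (w-+ : ∀ a b → w a * w b ≤ w (a + b)) where

  -- The shape of every bound: rate D, weight `w`, and a polynomial factor. A single constant serves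
  -- as factor and as exponent, so that enlarging it absorbs both kinds of loss.
  growth : ℕ → ℕ → ℕ → ℕ
  growth C D n = C * (suc n ^ C * (D ^ n * w n))

  -- The powers of every root of T lie in a fixed finitely generated module, with coefficients of moderate growth.
  record RootBound {A : CommutativeRing 0ℓ 0ℓ} (N : Norm A) {D : ℕ} (T : Vec (Kit.Carrier A) D) : Set₁ where
    open Norm N using (_≼_)
    field
      M C : ℕ
      coefficient : ℕ → Fin M → Kit.Carrier A
      coefficient-≼ : ∀ n j → coefficient n j ≼ growth C 1 n
      -- Quantified over all algebras, because the later roots live in rings that are only
      -- constructed during the induction. Just `r` depends on the root; the coefficients are fixed
      -- in A.
      powers-of-root : ∀ {B : CommutativeRing 0ℓ 0ℓ} (φ : Hom A B) ω → Kit._≈_ B (Monic.evalM B (Vec.map (Hom.⟦_⟧ φ) T) ω) (Kit.0# B) →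
        ∃ λ (r : Fin M → Kit.Carrier B) → ∀ n → Kit._≈_ B (Kit._↑_ B ω n) (Kit.sum B (λ j → Kit._⊗_ B (Hom.⟦_⟧ φ (coefficient n j)) (r j)))

  growth-⊗ : ∀ C C′ D i j → growth C D i * growth C′ 1 j ≤ (C * C′) * (suc (i + j) ^ (C + C′) * (D ^ i * w (i + j)))
  growth-⊗ C C′ D i j = begin
    C * (suc i ^ C * (D ^ i * w i)) * (C′ * (suc j ^ C′ * (1 ^ j * w j)))
      ≡⟨ ≡.cong (λ x → C * (suc i ^ C * (D ^ i * w i)) * (C′ * (suc j ^ C′ * (x * w j)))) (ℕₚ.^-zeroˡ j) ⟩
    C * (suc i ^ C * (D ^ i * w i)) * (C′ * (suc j ^ C′ * (1 * w j)))
      ≡⟨ solve 7 (λ C x d u C′ y v → C :* (x :* (d :* u)) :* (C′ :* (y :* (con 1 :* v))) := (C :* C′) :* ((x :* y) :* (d :* (u :* v)))) ≡.refl C (suc i ^ C) (D ^ i) (w i) C′ (suc j ^ C′) (w j) ⟩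
    (C * C′) * ((suc i ^ C * suc j ^ C′) * (D ^ i * (w i * w j)))
      ≤⟨ ℕₚ.*-monoʳ-≤ (C * C′) (ℕₚ.*-mono-≤ (ℕₚ.≤-trans (ℕₚ.*-mono-≤ (ℕₚ.^-monoˡ-≤ C (s≤s (ℕₚ.m≤m+n i j))) (ℕₚ.^-monoˡ-≤ C′ (s≤s (ℕₚ.m≤n+m j i)))) (ℕₚ.≤-reflexive (≡.sym (ℕₚ.^-distribˡ-+-* (suc (i + j)) C C′))))
           (ℕₚ.*-monoʳ-≤ (D ^ i) (w-+ i j))) ⟩
    (C * C′) * (suc (i + j) ^ (C + C′) * (D ^ i * w (i + j))) ∎
    where
      open ℕₚ.≤-Reasoning
      open Data.Nat.Solver.+-*-Solver

  -- The binomial expansion of (s + o)^K, with the binomial coefficients absorbed in (D + 1)^K.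
  module SumPowers {A : CommutativeRing 0ℓ 0ℓ} (N : Norm A) (D : ℕ) (s o : Kit.Carrier A) (C C′ : ℕ) where
    open Kit A
    open Norm N

    module _ (s-≼ : ∀ K → s ↑ K ≼ growth C D K) (o-≼ : ∀ K → o ↑ K ≼ growth C′ 1 K) where
      G : ℕ
      G = κ * (C * C′) + (C + C′)

      private
        poly-weight : ℕ → ℕ
        poly-weight n = G * (suc n ^ G * w n)

      monomial-≼ : ∀ i j → s ↑ i ⊗ o ↑ j ≼ D ^ i * poly-weight (i + j)
      monomial-≼ i j = ≼-mono (begin
        κ * (growth C D i * growth C′ 1 j) ≤⟨ ℕₚ.*-monoʳ-≤ κ (growth-⊗ C C′ D i j) ⟩
        κ * ((C * C′) * (suc (i + j) ^ (C + C′) * (D ^ i * w (i + j)))) ≡⟨ ≡.sym (ℕₚ.*-assoc κ (C * C′) _) ⟩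
        κ * (C * C′) * (suc (i + j) ^ (C + C′) * (D ^ i * w (i + j)))
          ≤⟨ ℕₚ.*-mono-≤ (ℕₚ.m≤m+n (κ * (C * C′)) (C + C′)) (ℕₚ.*-monoˡ-≤ (D ^ i * w (i + j)) (ℕₚ.^-monoʳ-≤ (suc (i + j)) (ℕₚ.m≤n+m (C + C′) (κ * (C * C′))))) ⟩
        G * (suc (i + j) ^ G * (D ^ i * w (i + j))) ≡⟨ solveℕ 4 (λ g x d u → g S:* (x S:* (d S:* u)) S:= d S:* (g S:* (x S:* u))) ≡.refl G (suc (i + j) ^ G) (D ^ i) (w (i + j)) ⟩
        D ^ i * poly-weight (i + j) ∎) (≼-⊗ (s-≼ i) (o-≼ j))
        where
          open ℕₚ.≤-Reasoning
          open Data.Nat.Solver.+-*-Solver using () renaming (solve to solveℕ; _:*_ to _S:*_; _:=_ to _S:=_)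

      expand-≼ : ∀ K i j → (s ⊕ o) ↑ K ⊗ (s ↑ i ⊗ o ↑ j) ≼ suc D ^ K * (D ^ i * poly-weight (K + (i + j)))
      expand-≼ zero i j = ≼-mono (ℕₚ.≤-reflexive (≡.sym (ℕₚ.*-identityˡ _))) (≼-resp (sym (*-identityˡ _)) (monomial-≼ i j))
      expand-≼ (suc K) i j = ≼-mono (ℕₚ.≤-reflexive collect) (≼-resp (sym split) (≼-⊕ (expand-≼ K (suc i) j) (expand-≼ K i (suc j))))
        where
          open Data.Nat.Solver.+-*-Solver using () renaming (_:*_ to _S:*_; _:=_ to _S:=_; _:+_ to _S:+_; con to Scon; solve to solveℕ)
          split : (s ⊕ o) ↑ suc K ⊗ (s ↑ i ⊗ o ↑ j) ≈ (s ⊕ o) ↑ K ⊗ (s ↑ suc i ⊗ o ↑ j) ⊕ (s ⊕ o) ↑ K ⊗ (s ↑ i ⊗ o ↑ suc j)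
          split = solve 5 (λ s o p x y → ((s :+ o) :* p) :* (x :* y) := p :* ((s :* x) :* y) :+ p :* (x :* (o :* y))) refl s o ((s ⊕ o) ↑ K) (s ↑ i) (o ↑ j)
          collect : suc D ^ K * (D ^ suc i * poly-weight (K + (suc i + j))) + suc D ^ K * (D ^ i * poly-weight (K + (i + suc j))) ≡ suc D ^ suc K * (D ^ i * poly-weight (suc K + (i + j)))
          collect = ≡.trans (≡.cong₂ (λ a b → suc D ^ K * (D ^ suc i * poly-weight a) + suc D ^ K * (D ^ i * poly-weight b)) (ℕₚ.+-suc K (i + j)) (≡.trans (≡.cong (λ x → K + x) (ℕₚ.+-suc i j)) (ℕₚ.+-suc K (i + j))))
            (solveℕ 4 (λ p d x y → p S:* ((d S:* x) S:* y) S:+ p S:* (x S:* y) S:= ((Scon 1 S:+ d) S:* p) S:* (x S:* y)) ≡.refl (suc D ^ K) D (D ^ i) (poly-weight (suc K + (i + j))))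

      sum-power-≼ : ∀ K → (s ⊕ o) ↑ K ≼ growth G (suc D) K
      sum-power-≼ K = ≼-mono (ℕₚ.≤-reflexive (≡.trans (≡.cong (λ x → suc D ^ K * (1 * poly-weight x)) (ℕₚ.+-identityʳ K))
          (Data.Nat.Solver.+-*-Solver.solve 4 (λ p g x u → p S:* (Scon 1 S:* (g S:* (x S:* u))) S:= g S:* (x S:* (p S:* u))) ≡.refl (suc D ^ K) G (suc K ^ G) (w K))))
          (≼-resp (solve 1 (λ p → p :* (:1 :* :1) := p) refl ((s ⊕ o) ↑ K)) (expand-≼ K 0 0))
        where open Data.Nat.Solver.+-*-Solver using () renaming (_:*_ to _S:*_; _:=_ to _S:=_; con to Scon)

  module _ {A : CommutativeRing 0ℓ 0ℓ} (N : Norm A) where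
    open Kit A
    open Norm N

    combination-≼ : ∀ {M} (c : ℕ → Fin M → Carrier) (r : Fin M → Carrier) C → (∀ n j → c n j ≼ growth C 1 n) →
      ∃ λ C′ → ∀ n → sum (λ j → c n j ⊗ r j) ≼ growth C′ 1 n
    combination-≼ {M} c r C c-≼ = M * (κ * (C * ρ)) + C , λ n → ≼-mono (begin
        M * (κ * (growth C 1 n * ρ)) ≡⟨ solveℕ 6 (λ M k C x u r → M S:* (k S:* ((C S:* (x S:* u)) S:* r)) S:= (M S:* (k S:* (C S:* r))) S:* (x S:* u)) ≡.refl M κ C (suc n ^ C) (1 ^ n * w n) ρ ⟩
        M * (κ * (C * ρ)) * (suc n ^ C * (1 ^ n * w n)) ≤⟨ ℕₚ.*-mono-≤ (ℕₚ.m≤m+n (M * (κ * (C * ρ))) C) (ℕₚ.*-monoˡ-≤ (1 ^ n * w n) (ℕₚ.^-monoʳ-≤ (suc n) (ℕₚ.m≤n+m C (M * (κ * (C * ρ)))))) ⟩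
        growth (M * (κ * (C * ρ)) + C) 1 n ∎)
        (≼-sum (λ j → c n j ⊗ r j) (κ * (growth C 1 n * ρ)) (λ j → ≼-⊗ (c-≼ n j) (≼-mono (ℕ-sums.term-≤-sum bounds j) (proj₂ (bounded (r j))))))
      where
        open ℕₚ.≤-Reasoning
        open Data.Nat.Solver.+-*-Solver using () renaming (solve to solveℕ; _:*_ to _S:*_; _:=_ to _S:=_)
        bounds : Fin M → ℕ
        bounds j = proj₁ (bounded (r j))
        ρ : ℕ
        ρ = ℕ-sums.sum bounds

    neg-power-≼ : ∀ {x b} n → x ↑ n ≼ b → (- x) ↑ n ≼ b
    neg-power-≼ {x} {b} n p = case sign n of λ where
        (inj₁ e) → ≼-resp (sym e) p
        (inj₂ e) → ≼-resp (sym e) (≼-neg p)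
      where
        sign : ∀ n → (- x) ↑ n ≈ x ↑ n ⊎ (- x) ↑ n ≈ - (x ↑ n)
        sign zero = inj₁ refl
        sign (suc n) = case sign n of λ where
          (inj₁ e) → inj₂ (trans (*-congˡ e) (sym (-‿distribˡ-* x _)))
          (inj₂ e) → inj₁ (trans (*-congˡ e) (solve 2 (λ x y → :- x :* :- y := x :* y) refl x (x ↑ n)))

  -- Induction on the degree. Adjoin a root ω and divide by X - ω: the roots of the quotient are
  -- roots of T, so the same coefficients bound their powers. The subleading coefficient of T is
  -- that of the quotient minus ω, its rate grows from D to D + 1, and the estimate descends to the
  -- base.
  subleading-growth : ∀ D {A : CommutativeRing 0ℓ 0ℓ} (N : Norm A) (T : Vec (Kit.Carrier A) D) → RootBound N T →
    ∃ λ C → ∀ K → Norm._≼_ N (Kit._↑_ A (MonicTop.subleading A T) K) (growth C D K)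

  module Step {A A′ : CommutativeRing 0ℓ 0ℓ} (N : Norm A) (N′ : Norm A′) (φ : Hom A A′) (ω : Kit.Carrier A′) {D : ℕ} (T : Vec (Kit.Carrier A) (suc D))
    (root : Kit._≈_ A′ (Monic.evalM A′ (Vec.map (Hom.⟦_⟧ φ) T) ω) (Kit.0# A′))
    (embed : ∀ {a b} → Norm._≼_ N a b → Norm._≼_ N′ (Hom.⟦_⟧ φ a) b)
    (restrict : ∀ {a b} → Norm._≼_ N′ (Hom.⟦_⟧ φ a) b → Norm._≼_ N a b)
    (bound : RootBound N T) where
    private
      module A = Kit A
      module N′ = Norm N′
    open Kit A′
    open Hom φ
    open RootBound bound
    open Monic A′ using (quotM; evalM; eval-quot)
    open MonicTop A′ using (subleading; subleading-quot)

    T′ : Vec Carrier (suc D)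
    T′ = Vec.map ⟦_⟧ T

    Q : Vec Carrier D
    Q = quotM T′ ω

    quotient-bound : RootBound N′ Q
    quotient-bound = record
      { M = M ; C = C ; coefficient = λ n j → ⟦ coefficient n j ⟧ ; coefficient-≼ = λ n j → embed (coefficient-≼ n j)
      ; powers-of-root = λ {B} ψ ω₂ root₂ → powers-of-root (ψ ∘ₕ φ) ω₂ (root-lift ψ ω₂ root₂) }
      where
        root-lift : ∀ {B} (ψ : Hom A′ B) ω₂ → Kit._≈_ B (Monic.evalM B (Vec.map (Hom.⟦_⟧ ψ) Q) ω₂) (Kit.0# B) →
          Kit._≈_ B (Monic.evalM B (Vec.map (Hom.⟦_⟧ (ψ ∘ₕ φ)) T) ω₂) (Kit.0# B)
        root-lift {B} ψ ω₂ root₂ = B.trans (B.reflexive (≡.cong (λ v → Monic.evalM B v ω₂) (Vecₚ.map-∘ (Hom.⟦_⟧ ψ) ⟦_⟧ T)))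
          (B.trans (Monic.eval-quot B (Vec.map (Hom.⟦_⟧ ψ) T′) (Hom.⟦_⟧ ψ ω) ω₂)
            (B.trans (B.+-cong (B.trans (B.*-congˡ (B.trans (B.sym (MonicTopHom.evalM-quotM-homo ψ T′ ω ω₂)) root₂)) (B.zeroʳ _))
              (B.trans (B.sym (MonicHom.evalM-homo ψ T′ ω)) (B.trans (Hom.cong ψ root) (Hom.0-homo ψ)))) (B.+-identityˡ _)))
          where module B = Kit B

    conclude : (∃ λ C → ∀ K → subleading Q ↑ K N′.≼ growth C D K) → ∃ λ C → ∀ K → Norm._≼_ N (MonicTop.subleading A T A.↑ K) (growth C (suc D) K)
    conclude (C₁ , Q-≼) = SP.G Q-≼ ω-≼ , λ K → restrict (N′.≼-resp (sym (power K)) (SP.sum-power-≼ Q-≼ ω-≼ K))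
      where
        r = powers-of-root φ ω root
        combined : ∃ λ C′ → ∀ n → sum (λ j → ⟦ coefficient n j ⟧ ⊗ proj₁ r j) N′.≼ growth C′ 1 n
        combined = combination-≼ N′ (λ n j → ⟦ coefficient n j ⟧) (proj₁ r) C (λ n j → embed (coefficient-≼ n j))
        ω-≼ : ∀ K → (- ω) ↑ K N′.≼ growth (proj₁ combined) 1 K
        ω-≼ K = neg-power-≼ N′ K (N′.≼-resp (sym (proj₂ r K)) (proj₂ combined K))
        module SP = SumPowers N′ D (subleading Q) (- ω) C₁ (proj₁ combined)
        power : ∀ K → ⟦ MonicTop.subleading A T A.↑ K ⟧ ≈ (subleading Q ⊖ ω) ↑ K
        power K = trans (↑-homo (MonicTop.subleading A T) K) (^-congˡ K (trans (MonicTopHom.subleading-homo φ T) (subleading-quot T′ ω root)))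

  subleading-growth zero {A} N [] bound = C , power-≼
    where
      open Kit A
      open Norm N
      C : ℕ
      C = proj₁ (bounded 1#)
      power-≼ : ∀ K → 0# ↑ K ≼ growth C 0 K
      -- The convention 0⁰ = 1 holds on both sides and leaves room for the norm of `1#`.
      power-≼ zero = ≼-mono (ℕₚ.≤-trans (ℕₚ.≤-reflexive (≡.sym (ℕₚ.*-identityʳ C))) (ℕₚ.*-monoʳ-≤ C (ℕₚ.*-mono-≤ {1} {1 ^ C} (ℕₚ.≤-reflexive (≡.sym (ℕₚ.^-zeroˡ C))) (ℕₚ.≤-trans 1≤w0 (ℕₚ.≤-reflexive (≡.sym (ℕₚ.*-identityˡ (w 0)))))))) (proj₂ (bounded 1#))
      power-≼ (suc K) = ≼-mono z≤n (≼-resp (sym (zeroˡ _)) ≼-0)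
  subleading-growth (suc D) {A} N T bound = step (adjoinRoot N T)
    where
      step : RootExtension N T → ∃ λ C → ∀ K → Norm._≼_ N (Kit._↑_ A (MonicTop.subleading A T) K) (growth C (suc D) K)
      step R = S.conclude (subleading-growth D norm S.Q S.quotient-bound)
        where
          open RootExtension R
          module S = Step N norm base ω T root embed restrict bound

-- Bernoulli's inequality 1 + c/x ≤ (1 + 1/x)^c with denominators cleared.
bernoulli : ∀ x c → (x + c) * x ^ c ≤ x * suc x ^ c
bernoulli x zero = ℕₚ.≤-reflexive (≡.cong (_* 1) (ℕₚ.+-identityʳ x))
bernoulli x (suc c) = begin
  (x + suc c) * (x * x ^ c) ≡⟨ solve 3 (λ x c p → (x :+ (con 1 :+ c)) :* (x :* p) := x :* ((x :+ c) :* p) :+ x :* p) ≡.refl x c (x ^ c) ⟩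
  x * ((x + c) * x ^ c) + x * x ^ c ≤⟨ ℕₚ.+-monoʳ-≤ (x * ((x + c) * x ^ c)) (ℕₚ.*-monoˡ-≤ (x ^ c) (ℕₚ.m≤m+n x c)) ⟩
  x * ((x + c) * x ^ c) + (x + c) * x ^ c ≡⟨ ℕₚ.+-comm (x * ((x + c) * x ^ c)) _ ⟩
  suc x * ((x + c) * x ^ c) ≤⟨ ℕₚ.*-monoʳ-≤ (suc x) (bernoulli x c) ⟩
  suc x * (x * suc x ^ c) ≡⟨ solve 2 (λ x p → (con 1 :+ x) :* (x :* p) := x :* ((con 1 :+ x) :* p)) ≡.refl x (suc x ^ c) ⟩
  x * (suc x * suc x ^ c) ∎
  where
    open ℕₚ.≤-Reasoning
    open Data.Nat.Solver.+-*-Solver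

powerTotal : ℕ → ℕ → ℕ
powerTotal c zero = 1
powerTotal c (suc n) = suc (suc n) ^ c + powerTotal c n

-- A discrete form of the integral of x^c, for the sum 1^c + ... + (n+1)^c. The factor n + 1 on the
-- right is the one that the recurrence for the inverse series divides out.
powerTotal-bound : ∀ c n → c * powerTotal c n ≤ suc n * suc (suc n) ^ c
powerTotal-bound c zero = begin
  c * 1 ≡⟨ ℕₚ.*-identityʳ c ⟩
  c ≤⟨ ℕₚ.m≤n+m c 1 ⟩
  1 + c ≡⟨ ≡.sym (≡.trans (≡.cong ((1 + c) *_) (ℕₚ.^-zeroˡ c)) (ℕₚ.*-identityʳ (1 + c))) ⟩
  (1 + c) * 1 ^ c ≤⟨ bernoulli 1 c ⟩
  1 * 2 ^ c ∎
  where open ℕₚ.≤-Reasoning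
powerTotal-bound c (suc n) = begin
  c * (x ^ c + powerTotal c n) ≡⟨ ℕₚ.*-distribˡ-+ c (x ^ c) _ ⟩
  c * x ^ c + c * powerTotal c n ≤⟨ ℕₚ.+-monoʳ-≤ (c * x ^ c) (powerTotal-bound c n) ⟩
  c * x ^ c + suc n * x ^ c ≤⟨ ℕₚ.+-monoʳ-≤ (c * x ^ c) (ℕₚ.*-monoˡ-≤ (x ^ c) (ℕₚ.n≤1+n (suc n))) ⟩
  c * x ^ c + x * x ^ c ≡⟨ ≡.trans (≡.sym (ℕₚ.*-distribʳ-+ (x ^ c) c x)) (≡.cong (_* x ^ c) (ℕₚ.+-comm c x)) ⟩
  (x + c) * x ^ c ≤⟨ bernoulli x c ⟩
  x * suc x ^ c ∎
  where
    open ℕₚ.≤-Reasoning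
    x = suc (suc n)

-- Growth of the linear coefficient

module SeriesRoots (A : CommutativeRing 0ℓ 0ℓ) (T : ℕ → Kit.Carrier A) (T0 : Kit._≈_ A (T 0) (Kit.1# A)) where
  private module A = Kit A
  open Series A using (shift; inverse; inverse-correct; at)
  open Kit A using (Carrier)

  -- The monic polynomial Xⁿ + T₁ Xⁿ⁻¹ + ... + Tₙ, whose roots are the inverse roots of the
  -- truncated series.
  unreverse : ∀ n → Vec Carrier n
  unreverse zero = []
  unreverse (suc n) = T (suc n) ∷ unreverse n

  subleading-unreverse : ∀ n → MonicTop.subleading A (unreverse (suc n)) A.≈ T 1
  subleading-unreverse zero = A.refl
  subleading-unreverse (suc n) = subleading-unreverse n

  -- With G = ∑ ωⁿ tⁿ the series T G is a polynomial, so G = T⁻¹ (T G).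
  module _ {B : CommutativeRing 0ℓ 0ℓ} (φ : Hom A B) (ω : Kit.Carrier B) where
    open Kit B
    open Hom φ
    private module SB = Series B
    open SB using (conv; conv-snoc; conv-comm; conv-cong; conv-scaleˡ; module 𝕊)

    T′ G : ℕ → Kit.Carrier B
    T′ n = ⟦ T n ⟧
    G n = ω ↑ n

    conv-suc : ∀ n → conv T′ G (suc n) ≈ ω ⊗ conv T′ G n ⊕ T′ (suc n)
    conv-suc n = trans (conv-snoc T′ G n) (+-cong
      (trans (conv-comm T′ (G ∘ suc) n) (trans (conv-scaleˡ ω G T′ n) (*-congˡ (conv-comm G T′ n)))) (*-identityʳ _))

    -- The coefficients of T G obey Horner's recursion at ω. The one at the degree of T is the value
    -- at a root, hence zero, and from there on the recursion continues with zeros.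
    conv-eval : ∀ n → conv T′ G n ≈ Monic.evalM B (Vec.map ⟦_⟧ (unreverse n)) ω
    conv-eval zero = trans (*-identityʳ _) (trans (cong T0) 1-homo)
    conv-eval (suc n) = trans (conv-suc n) (trans (+-comm _ _) (+-congˡ (*-congˡ (conv-eval n))))

    module _ (D : ℕ) (T-vanishes : ∀ n → T (suc (n ℕ.+ D)) A.≈ A.0#) (root : Monic.evalM B (Vec.map ⟦_⟧ (unreverse D)) ω ≈ 0#) where
      remainder : Fin D → Kit.Carrier B
      remainder j = conv T′ G (toℕ j)

      remainder-vanishes : ∀ n → conv T′ G (n ℕ.+ D) ≈ 0#
      remainder-vanishes zero = trans (conv-eval D) root
      remainder-vanishes (suc n) = trans (conv-suc (n ℕ.+ D)) (trans (+-cong (trans (*-congˡ (remainder-vanishes n)) (zeroʳ _)) (trans (cong (T-vanishes n)) 0-homo)) (+-identityˡ _))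

      conv-finite : ∀ D (r h : ℕ → Kit.Carrier B) → (∀ n → r (n ℕ.+ D) ≈ 0#) → ∀ n → conv r h n ≈ sum {D} (λ j → SB.shift (toℕ j) h n ⊗ r (toℕ j))
      conv-finite zero r h p n = SB.conv-zeroˡ r h (λ i → trans (reflexive (≡.cong r (≡.sym (ℕₚ.+-identityʳ i)))) (p i)) n
      conv-finite (suc D) r h p zero = trans (*-comm _ _) (sym (trans (+-congˡ (SingleTerm.sum-ε (CommutativeRing.+-commutativeMonoid B) {D} (λ j → 0# ⊗ r (suc (toℕ j))) (λ j → zeroˡ _))) (+-identityʳ _)))
      conv-finite (suc D) r h p (suc n) = +-cong (*-comm _ _) (conv-finite D (r ∘ suc) h (λ n → trans (reflexive (≡.cong r (≡.sym (ℕₚ.+-suc n D)))) (p n)) n)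

      shift-homo : ∀ j h n → SB.shift j (λ i → ⟦ h i ⟧) n ≈ ⟦ shift j h n ⟧
      shift-homo zero h n = refl
      shift-homo (suc j) h zero = sym 0-homo
      shift-homo (suc j) h (suc n) = shift-homo j h n

      inverse-image : T′ 𝕊.⊗ (λ n → ⟦ inverse T n ⟧) 𝕊.≈ 𝕊.1#
      inverse-image = SB.mk λ n → trans (sym (SeriesHom.conv-homo φ T (inverse T) n)) (trans (cong (at (inverse-correct T T0) n)) (one n))
        where
          one : ∀ n → ⟦ Series.const A A.1# n ⟧ ≈ SB.const 1# n
          one zero = 1-homo
          one (suc n) = 0-homo

      -- ω enters only through the D coefficients of T G. The growth in n is carried by shifted
      -- coefficients of 1/T, which lie in A and are common to all roots.
      power-expansion : ∀ n → ω ↑ n ≈ sum {D} (λ j → ⟦ shift (toℕ j) (inverse T) n ⟧ ⊗ remainder j)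
      power-expansion n = begin
        G n ≈⟨ SB.at (𝕊.sym cancelled) n ⟩
        conv (conv T′ G) h n ≈⟨ conv-finite D (conv T′ G) h remainder-vanishes n ⟩
        sum {D} (λ j → SB.shift (toℕ j) h n ⊗ remainder j) ≈⟨ sum-cong-≋ {D} (λ j → *-congʳ (shift-homo (toℕ j) (inverse T) n)) ⟩
        sum {D} (λ j → ⟦ shift (toℕ j) (inverse T) n ⟧ ⊗ remainder j) ∎
        where
          open Reasoning
          h : ℕ → Kit.Carrier B
          h n = ⟦ inverse T n ⟧
          cancelled : (T′ 𝕊.⊗ G) 𝕊.⊗ h 𝕊.≈ G
          cancelled = 𝕊.trans (𝕊.solve 3 (λ t g h → (t 𝕊.:* g) 𝕊.:* h 𝕊.:= (t 𝕊.:* h) 𝕊.:* g) 𝕊.refl T′ G h)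
            (𝕊.trans (𝕊.*-congʳ {G} inverse-image) (𝕊.*-identityˡ G))

module SeriesGrowth (w : ℕ → ℕ) (1≤w : ∀ n → 1 ≤ w n) (w-+ : ∀ a b → w a * w b ≤ w (a + b))
  {A : CommutativeRing 0ℓ 0ℓ} (N : Norm A) (≼-cancel : ∀ n {x b} → 1 ≤ n → Norm._≼_ N (Kit._·_ A n x) (n * b) → Norm._≼_ N x b)
  (T : ℕ → Kit.Carrier A) (T0 : Kit._≈_ A (T 0) (Kit.1# A)) (C : ℕ)
  (powerSum-≼ : ∀ n → Norm._≼_ N (Series.powerSum A T (suc n)) (C * w (suc n))) where
  open Kit A
  open Norm N
  open Series A
  open Tower w (1≤w 0) w-+

  private
    h : Seq
    h = inverse T

    c b : ℕ
    c = κ * C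
    b = proj₁ (bounded 1#)

    -- The power sums of h = 1/T are opposite to those of T, so t h′ = s h with s the power sums of
    -- T. This expresses n hₙ through earlier coefficients.
    deriv-inverse : deriv h 𝕊.≈ powerSum T 𝕊.⊗ h
    deriv-inverse = begin
      deriv h ≈⟨ 𝕊.sym (𝕊.-‿involutive (deriv h)) ⟩
      𝕊.- (𝕊.- deriv h) ≈⟨ 𝕊.-‿cong (𝕊.sym (powerSum-spec h refl)) ⟩
      𝕊.- (h 𝕊.⊗ powerSum h) ≈⟨ 𝕊.solve 3 (λ h s t → 𝕊.:- (h 𝕊.:* s) 𝕊.:= t 𝕊.:* h 𝕊.:- h 𝕊.:* (t 𝕊.:+ s)) 𝕊.refl h (powerSum h) (powerSum T) ⟩
      powerSum T 𝕊.⊗ h 𝕊.⊖ h 𝕊.⊗ (powerSum T 𝕊.⊕ powerSum h)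
        ≈⟨ 𝕊.+-congˡ {powerSum T 𝕊.⊗ h} (𝕊.-‿cong (𝕊.*-congˡ {h} sum-zero)) ⟩
      powerSum T 𝕊.⊗ h 𝕊.⊖ h 𝕊.⊗ 𝕊.0# ≈⟨ 𝕊.solve 2 (λ t h → t 𝕊.:- h 𝕊.:* 𝕊.:0 𝕊.:= t) 𝕊.refl (powerSum T 𝕊.⊗ h) h ⟩
      powerSum T 𝕊.⊗ h ∎
      where
        open 𝕊.Reasoning
        sum-zero : powerSum T 𝕊.⊕ powerSum h 𝕊.≈ 𝕊.0#
        sum-zero = 𝕊.trans (𝕊.sym (powerSum-⊗ T h T0 refl)) (𝕊.trans (powerSum-cong (trans (*-cong T0 refl) (*-identityˡ 1#)) (inverse-correct T T0)) powerSum-1)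

    recurrence : ∀ n → suc n · h (suc n) ≈ conv (powerSum T ∘ suc) h n
    recurrence n = trans (at deriv-inverse (suc n)) (trans (+-congʳ (trans (*-congʳ (powerSum-zero T T0)) (zeroˡ _))) (+-identityˡ _))

    bound : ℕ → ℕ
    bound n = b * (suc n ^ c * w n)

    -- m counts how often f has been shifted. The inequality for `w` merges all weights into w (m +
    -- n), and the remaining factors (j + 1)^c sum to `powerTotal c n`.
    conv-≼ : ∀ n m f → (∀ i → f i ≼ C * w (m + i)) → (∀ j → j ≤ n → h j ≼ bound j) → conv f h n ≼ κ * (C * (b * powerTotal c n)) * w (m + n)
    conv-≼ zero m f f-≼ h-≼ = ≼-mono (begin
        κ * (C * w (m + 0) * (b * (1 ^ c * w 0))) ≡⟨ ≡.cong (λ x → κ * (C * w (m + 0) * (b * (x * w 0)))) (ℕₚ.^-zeroˡ c) ⟩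
        κ * (C * w (m + 0) * (b * (1 * w 0))) ≡⟨ solveℕ 5 (λ k C u b v → k S:* (C S:* u S:* (b S:* (Scon 1 S:* v))) S:= (k S:* (C S:* (b S:* Scon 1))) S:* (u S:* v)) ≡.refl κ C (w (m + 0)) b (w 0) ⟩
        κ * (C * (b * 1)) * (w (m + 0) * w 0) ≤⟨ ℕₚ.*-monoʳ-≤ (κ * (C * (b * 1))) (ℕₚ.≤-trans (w-+ (m + 0) 0) (ℕₚ.≤-reflexive (≡.cong w (ℕₚ.+-identityʳ (m + 0))))) ⟩
        κ * (C * (b * 1)) * w (m + 0) ∎) (≼-⊗ (f-≼ 0) (h-≼ 0 z≤n))
      where
        open ℕₚ.≤-Reasoning
        open Data.Nat.Solver.+-*-Solver using () renaming (_:*_ to _S:*_; _:=_ to _S:=_; con to Scon; solve to solveℕ)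
    conv-≼ (suc n) m f f-≼ h-≼ = ≼-mono (begin
        κ * (C * w (m + 0) * (b * (suc (suc n) ^ c * w (suc n)))) + κ * (C * (b * powerTotal c n)) * w (suc m + n)
          ≡⟨ ≡.cong₂ _+_ (solveℕ 6 (λ k C u b x v → k S:* (C S:* u S:* (b S:* (x S:* v))) S:= (k S:* (C S:* (b S:* x))) S:* (u S:* v)) ≡.refl κ C (w (m + 0)) b (suc (suc n) ^ c) (w (suc n)))
               (≡.cong (λ k → κ * (C * (b * powerTotal c n)) * w k) (≡.sym (ℕₚ.+-suc m n))) ⟩
        κ * (C * (b * suc (suc n) ^ c)) * (w (m + 0) * w (suc n)) + κ * (C * (b * powerTotal c n)) * w (m + suc n)
          ≤⟨ ℕₚ.+-monoˡ-≤ (κ * (C * (b * powerTotal c n)) * w (m + suc n)) (ℕₚ.*-monoʳ-≤ (κ * (C * (b * suc (suc n) ^ c)))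
               (ℕₚ.≤-trans (w-+ (m + 0) (suc n)) (ℕₚ.≤-reflexive (≡.cong (λ k → w (k + suc n)) (ℕₚ.+-identityʳ m))))) ⟩
        κ * (C * (b * suc (suc n) ^ c)) * w (m + suc n) + κ * (C * (b * powerTotal c n)) * w (m + suc n)
          ≡⟨ solveℕ 6 (λ k C b x y u → (k S:* (C S:* (b S:* x))) S:* u S:+ (k S:* (C S:* (b S:* y))) S:* u S:= (k S:* (C S:* (b S:* (x S:+ y)))) S:* u) ≡.refl κ C b (suc (suc n) ^ c) (powerTotal c n) (w (m + suc n)) ⟩
        κ * (C * (b * powerTotal c (suc n))) * w (m + suc n) ∎)
        (≼-⊕ (≼-⊗ (f-≼ 0) (h-≼ (suc n) ℕₚ.≤-refl))
          (conv-≼ n (suc m) (f ∘ suc) (λ i → ≼-mono (ℕₚ.≤-reflexive (≡.cong (λ k → C * w k) (ℕₚ.+-suc m i))) (f-≼ (suc i))) (λ j j≤n → h-≼ j (ℕₚ.m≤n⇒m≤1+n j≤n))))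
      where
        open ℕₚ.≤-Reasoning
        open Data.Nat.Solver.+-*-Solver using () renaming (_:*_ to _S:*_; _:=_ to _S:=_; _:+_ to _S:+_; solve to solveℕ)

  -- The exponent c = κ C is dictated by the induction: the recurrence produces the factor κ C times
  -- `powerTotal c n`, which for this c is at most (n + 1)(n + 2)^c.
  inverse-≼ : ∀ N n → n ≤ N → inverse T n ≼ b * (suc n ^ c * w n)
  inverse-≼ N zero _ = ≼-mono (ℕₚ.≤-trans (ℕₚ.≤-reflexive (≡.sym (ℕₚ.*-identityʳ b))) (ℕₚ.*-monoʳ-≤ b (ℕₚ.*-mono-≤ {1} (ℕₚ.≤-reflexive (≡.sym (ℕₚ.^-zeroˡ c))) (1≤w 0)))) (proj₂ (bounded 1#))
  inverse-≼ (suc N) (suc n) (s≤s n≤N) = ≼-cancel (suc n) (s≤s z≤n) (≼-mono (begin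
      κ * (C * (b * powerTotal c n)) * w (1 + n) ≡⟨ solveℕ 5 (λ k C b x u → (k S:* (C S:* (b S:* x))) S:* u S:= b S:* ((k S:* C) S:* x S:* u)) ≡.refl κ C b (powerTotal c n) (w (suc n)) ⟩
      b * (c * powerTotal c n * w (suc n)) ≤⟨ ℕₚ.*-monoʳ-≤ b (ℕₚ.*-monoˡ-≤ (w (suc n)) (powerTotal-bound c n)) ⟩
      b * (suc n * suc (suc n) ^ c * w (suc n)) ≡⟨ solveℕ 4 (λ b n x u → b S:* (n S:* x S:* u) S:= n S:* (b S:* (x S:* u))) ≡.refl b (suc n) (suc (suc n) ^ c) (w (suc n)) ⟩
      suc n * (b * (suc (suc n) ^ c * w (suc n))) ∎)
      (≼-resp (sym (recurrence n)) (conv-≼ n 1 (powerSum T ∘ suc) powerSum-≼ (λ j j≤n → inverse-≼ N j (ℕₚ.≤-trans j≤n n≤N)))))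
    where
      open ℕₚ.≤-Reasoning
      open Data.Nat.Solver.+-*-Solver using () renaming (_:*_ to _S:*_; _:=_ to _S:=_; solve to solveℕ)

  w-mono : ∀ j k → w k ≤ w (j + k)
  w-mono j k = ℕₚ.≤-trans (ℕₚ.≤-trans (ℕₚ.≤-reflexive (≡.sym (ℕₚ.*-identityˡ (w k)))) (ℕₚ.*-monoˡ-≤ (w k) (1≤w j))) (w-+ j k)

  shift-inverse-≼ : ∀ j n → shift j (inverse T) n ≼ growth (b + c) 1 n
  shift-inverse-≼ zero n = ≼-mono (ℕₚ.*-mono-≤ (ℕₚ.m≤m+n b c) (ℕₚ.*-mono-≤ (ℕₚ.^-monoʳ-≤ (suc n) (ℕₚ.m≤n+m c b)) (ℕₚ.≤-reflexive (≡.sym (≡.trans (≡.cong (_* w n) (ℕₚ.^-zeroˡ n)) (ℕₚ.*-identityˡ (w n)))))))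
    (inverse-≼ n n ℕₚ.≤-refl)
  shift-inverse-≼ (suc j) zero = ≼-mono z≤n ≼-0
  shift-inverse-≼ (suc j) (suc n) = ≼-mono (ℕₚ.*-monoʳ-≤ (b + c) (ℕₚ.*-mono-≤ (ℕₚ.^-monoˡ-≤ (b + c) (ℕₚ.n≤1+n (suc n)))
      (ℕₚ.*-mono-≤ (ℕₚ.≤-reflexive (≡.trans (ℕₚ.^-zeroˡ n) (≡.sym (ℕₚ.^-zeroˡ (suc n))))) (w-mono 1 n)))) (shift-inverse-≼ j n)

  module SR = SeriesRoots A T T0

  -- If T is a polynomial of degree D + 1, its linear coefficient is minus a sum of D + 1 inverse roots.
  linear-coefficient-growth : ∀ D → (∀ n → T (suc (n ℕ.+ suc D)) ≈ 0#) → ∃ λ C′ → ∀ K → T 1 ↑ K ≼ growth C′ (suc D) K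
  linear-coefficient-growth D T-vanishes = transfer (subleading-growth (suc D) N (SR.unreverse (suc D)) (record
      { M = suc D ; C = b + c ; coefficient = λ n j → shift (toℕ j) (inverse T) n ; coefficient-≼ = λ n j → shift-inverse-≼ (toℕ j) n
      ; powers-of-root = λ φ ω root → SR.remainder φ ω (suc D) T-vanishes root , SR.power-expansion φ ω (suc D) T-vanishes root }))
    where
      transfer : (∃ λ C′ → ∀ K → MonicTop.subleading A (SR.unreverse (suc D)) ↑ K ≼ growth C′ (suc D) K) → ∃ λ C′ → ∀ K → T 1 ↑ K ≼ growth C′ (suc D) K
      transfer (C′ , p) = C′ , λ K → ≼-resp (^-congˡ K (SR.subleading-unreverse D)) (p K)

module Assembly {q : ℕ} (F : FiniteField q) (pp : IsPrimePower q) (B : CommutativeRing 0ℓ 0ℓ) (N : Norm B)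
  (w : ℕ → ℕ) (1≤w : ∀ n → 1 ≤ w n) (w-+ : ∀ a b → w a * w b ≤ w (a + b))
  (≼-cancel : ∀ n {x b} → 1 ≤ n → Norm._≼_ N (Kit._·_ B n x) (n * b) → Norm._≼_ N x b)
  (χ : ∀ {n} → Vec (Fin q) n → Kit.Carrier B)
  (χ-[] : Kit._≈_ B (χ []) (Kit.1# B))
  (χ-mul : ∀ {e k} (u : Vec (Fin q) e) (v : Vec (Fin q) k) → Kit._≈_ B (χ (Sieve.mul F pp u v)) (Kit._⊗_ B (χ u) (χ v))) where
  open Kit B
  open Norm N
  open Sieve F pp using (primesUpTo; primesUpTo-correct)
  open EulerProduct F pp B χ χ-[] χ-mul
  open PrimeSums q B

  linear-sum-growth : (ξ : ∀ {e} → Vec (Fin q) e → ℕ → Carrier) → (∀ {e} (P : Vec (Fin q) e) j → ξ P j ≈ e · (χ P ↑ j)) →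
    (counts : ℕ → Carrier) → (∀ n → primeSum ξ n (primesUpTo n) ≈ counts n) →
    (C : ℕ) → (∀ n → 1 ≤ n → counts n ≼ C * w n) →
    ∀ D → (∀ {m} (l : Vec (Fin q) m) (u : Vec (Fin q) D) → sum {q} (λ c → χ (l Vec.++ (c ∷ u))) ≈ 0#) →
    ∀ D₀ → D ≡ suc D₀ → ∃ λ C′ → ∀ K → (sum {q} (λ c → χ (c ∷ []))) ↑ K ≼ C′ * (suc K ^ C′ * (D ^ K * w K))
  linear-sum-growth ξ ξ≈ counts counts≈ C counts-≼ D fibre D₀ ≡.refl = transfer (SG.linear-coefficient-growth D₀ vanishes)
    where
      powerSum-≼ : ∀ n → Series.powerSum B (T []) (suc n) ≼ C * w (suc n)
      powerSum-≼ n = ≼-resp (sym (trans (powerSum-T[] (suc n)) (-‿cong (trans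
        (primePowerSum-primeSum ξ ξ≈ (suc n) (s≤s z≤n) (primesUpTo (suc n)) (proj₁ (primesUpTo-correct (suc n)))) (counts≈ (suc n)))))) (≼-neg (counts-≼ (suc n) (s≤s z≤n)))
      module SG = SeriesGrowth w 1≤w w-+ N ≼-cancel (T []) (T-zero [] tt) C powerSum-≼
      vanishes : ∀ n → T [] (suc (n ℕ.+ suc D₀)) ≈ 0#
      vanishes n = trans (reflexive (≡.cong (T []) (≡.sym (ℕₚ.+-suc n (suc D₀))))) (T-vanishes-by-fibres n (suc D₀) fibre)
      transfer : (∃ λ C′ → ∀ K → T [] 1 ↑ K ≼ C′ * (suc K ^ C′ * (suc D₀ ^ K * w K))) → ∃ λ C′ → ∀ K → (sum {q} (λ c → χ (c ∷ []))) ↑ K ≼ C′ * (suc K ^ C′ * (suc D₀ ^ K * w K))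
      transfer (C′ , p) = C′ , λ K → ≼-resp (^-congˡ K T-one) (p K)

module TraceSeries {q : ℕ} (F : FiniteField q) (pp : IsPrimePower q) {D : ℕ} (a : Fin (suc (suc D)) → FiniteField.Carrier F)
  (lead : ¬ (FiniteField._≈_ F (a (fromℕ (suc D))) (FiniteField.0# F)))
  (d≉0 : ¬ (FiniteField._≈_ F (Kit._·_ (FiniteField.commRing F) (suc D) (FiniteField.1# F)) (FiniteField.0# F)))
  (R : CommutativeRing 0ℓ 0ℓ) where
  open Field F pp using (commRing; enum; index; index-enum; index-cong; enum-index; domain; inverse; 1≉0)
  private
    module F = Field F pp
    module R = Kit R
  open Sieve F pp using (Mon; mul; mul-spec; Monics; Primes; polyOf; primesUpTo; primesUpTo-correct)
  open PolyOverField F pp using (toPoly; module ℙ; module Irreducible)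
  open Reversal commRing using (traceForm; traceForm-⊗; traceForm-linear)
  open GroupRing F pp R
  open Kit reducedRing

  χ : ∀ {n} → Mon n → Fun
  χ g = δ (index (traceForm a (Vec.map enum g)))

  abstract
    χ-[] : χ [] ≈ 1#
    -- Additivity applied to 1 = 1 · 1 gives t = t + t for the trace form of the empty product,
    -- hence t = 0.
    χ-[] = reflexive (≡.cong δ (index-cong (F.trans (F.solve 1 (λ t → t F.:= (t F.:+ t) F.:- t) F.refl _)
      (F.trans (F.+-congʳ (F.sym (traceForm-⊗ a [] [] [] (ℙ.sym (ℙ.*-identityˡ ℙ.1#))))) (F.-‿inverseʳ _)))))

    χ-mul : ∀ {e k} (u : Mon e) (v : Mon k) → χ (mul u v) ≈ χ u ⊗ χ v
    χ-mul u v = trans (reflexive (≡.cong δ (index-cong (F.trans (traceForm-⊗ a (Vec.map enum u) (Vec.map enum v) (Vec.map enum (mul u v)) (mul-spec u v))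
        (F.+-cong (F.sym (enum-index _)) (F.sym (enum-index _)))))))
      (sym (∼-reflexive (δ-⊞ (index (traceForm a (Vec.map enum u))) (index (traceForm a (Vec.map enum v))))))

  private
    -- The slope of `affine`, a unit because the leading coefficient of h and the degree are nonzero
    -- in the field.
    u₀ : F.Carrier
    u₀ = a (fromℕ (suc D)) F.⊗ (suc D F.· F.1#)

    u₀≉0 : ¬ (u₀ F.≈ F.0#)
    u₀≉0 e = Sum.[ lead , d≉0 ] (domain _ _ e)

    u₀⁻¹ : F.Carrier
    u₀⁻¹ = proj₁ (inverse u₀ u₀≉0)

    affine : F.Carrier → F.Carrier → F.Carrier
    affine κ c = κ F.⊖ a (fromℕ (suc D)) F.⊗ (suc D F.· c)

    affine≈ : ∀ κ c → affine κ c F.≈ κ F.⊖ u₀ F.⊗ c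
    affine≈ κ c = F.+-congˡ (F.-‿cong (F.trans (F.*-congˡ (F.trans (F.×-congʳ (suc D) (F.sym (F.*-identityˡ c))) (F.sym (F.×-assoc-* (suc D) F.1# c)))) (F.sym (F.*-assoc _ _ _))))

    preimage : F.Carrier → Fin q → Fin q
    preimage κ y = index (u₀⁻¹ F.⊗ (κ F.⊖ enum y))

    inverse-law : ∀ x → u₀ F.⊗ (u₀⁻¹ F.⊗ x) F.≈ x
    inverse-law x = F.trans (F.sym (F.*-assoc u₀ u₀⁻¹ x)) (F.trans (F.*-congʳ (proj₂ (inverse u₀ u₀≉0))) (F.*-identityˡ x))

    affine-preimage : ∀ κ y → index (affine κ (enum (preimage κ y))) ≡ y
    affine-preimage κ y = ≡.trans (index-cong (F.trans (affine≈ κ _) (F.trans (F.+-congˡ (F.-‿cong (F.trans (F.*-congˡ (enum-index _)) (inverse-law (κ F.⊖ enum y)))))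
      (F.solve 2 (λ κ y → κ F.:- (κ F.:- y) F.:= y) F.refl κ (enum y))))) (index-enum y)

    preimage-affine : ∀ κ c y → index (affine κ (enum c)) ≡ y → c ≡ preimage κ y
    preimage-affine κ c y ≡.refl = ≡.sym (≡.trans (index-cong (F.trans (F.*-congˡ (F.trans (F.+-congˡ (F.-‿cong (F.trans (enum-index _) (affine≈ κ (enum c)))))
        (F.solve 2 (λ κ x → κ F.:- (κ F.:- x) F.:= x) F.refl κ (u₀ F.⊗ enum c))))
      (F.trans (F.solve 3 (λ i u c → i F.:* (u F.:* c) F.:= u F.:* (i F.:* c)) F.refl u₀⁻¹ u₀ (enum c)) (inverse-law (enum c))))) (index-enum c))

    -- An affine map with invertible slope takes each value once, so the sum is ∑ [c], which is zero
    -- in the quotient.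
    uniform : ∀ κ → 𝔾.sum {q} (λ c → δ (index (affine κ (enum c)))) 𝔾.≈ ones
    uniform κ = mk λ y → R.trans (sum-at {q} (λ c → δ (index (affine κ (enum c)))) y)
      (R.trans (SingleTerm.sum-single (CommutativeRing.+-commutativeMonoid R) {q} (λ c → δ (index (affine κ (enum c))) y) (preimage κ y)
          (λ c c≢ → δ-≢ _ y (c≢ ∘ preimage-affine κ c y)))
        (δ-≡ _ y (affine-preimage κ y)))

    fibre : ∀ {m} (l : Mon m) (u : Mon D) → sum {q} (λ c → χ (l Vec.++ (c ∷ u))) ≈ 0#
    fibre l u = trans (sym (Hom.sum-homo projection {q} (λ c → χ (l Vec.++ (c ∷ u))))) (trans (∼-reflexive (𝔾.trans (𝔾.sum-cong-≋ {q} to-affine) (uniform κ))) modulus∼0)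
      where
        κ : F.Carrier
        κ = proj₁ (traceForm-linear a (Vec.map enum l) (Vec.map enum u))
        to-affine : ∀ c → χ (l Vec.++ (c ∷ u)) 𝔾.≈ δ (index (affine κ (enum c)))
        to-affine c = 𝔾.reflexive (≡.cong δ (≡.trans (≡.cong (λ v → index (traceForm a v)) (Vecₚ.map-++ enum l (c ∷ u)))
          (index-cong (proj₂ (traceForm-linear a (Vec.map enum l) (Vec.map enum u)) (enum c)))))

  open Stepanov F pp a lead d≉0 using (HasTrace; hasTrace?; hasTraceAt?)
  open DegreeBounds F pp using (degreeSum; weightIf)

  pointCount : ℕ → Monics → Fin q → ℕ
  pointCount n L c = degreeSum (HasTrace n c) (hasTrace? n c) L

  multiples : (Fin q → ℕ) → Fun
  multiples u c = u c R.· R.1#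

  private
    ξ : ∀ {e} → Mon e → ℕ → Fun
    ξ {e} P j c = e R.· δ (index (j F.· traceForm a (Vec.map enum P))) c

    ξ≈ : ∀ {e} (P : Mon e) j → ξ P j ≈ e · (χ P ↑ j)
    ξ≈ {e} P j = trans (∼-reflexive in-groupRing) (trans (Hom.·-homo projection e (χ P 𝔾.↑ j)) (×-congʳ e (Hom.↑-homo projection (χ P) j)))
      where
        in-groupRing : ξ P j 𝔾.≈ e 𝔾.· (χ P 𝔾.↑ j)
        in-groupRing = 𝔾.trans (mk λ c → R.sym (·-at e (δ (index (j F.· traceForm a (Vec.map enum P)))) c)) (𝔾.×-congʳ e (𝔾.sym (δ-↑ (traceForm a (Vec.map enum P)) j)))

    weigh-multiples : ∀ {e n} (P : Mon e) s → PrimeSums.weigh q reducedRing ξ {n = n} P s ≈ multiples (λ c → weightIf (hasTraceAt? c {n = n} P s) e)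
    weigh-multiples {e} P (inj₁ (j , _)) = ∼-reflexive (mk λ c → each c (index (j F.· traceForm a (Vec.map enum P)) Finₚ.≟ c))
      where
        each : ∀ c (t : Dec (index (j F.· traceForm a (Vec.map enum P)) ≡ c)) → e R.· δ (index (j F.· traceForm a (Vec.map enum P))) c R.≈ weightIf t e R.· R.1#
        each c (yes eq) = R.×-congʳ e (δ-≡ _ c eq)
        each c (no ne) = R.trans (R.×-congʳ e (δ-≢ _ c ne)) (Series.·-zero R e)
    weigh-multiples P (inj₂ _) = ∼-reflexive (mk λ c → R.refl)

    weights : ∀ n {e} → Mon e → (∃ λ j → n ≡ j * e) ⊎ (∀ j → n ≢ j * e) → Fun
    weights n {e} P s = multiples (λ c → weightIf (hasTraceAt? c P s) e)

    multiples-[] : ∀ n → 0# ≈ multiples (pointCount n [])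
    multiples-[] n = ∼-reflexive (mk λ c → R.refl)

    multiples-∷ : ∀ n {e} (P : Mon e) L → multiples (pointCount n ((e , P) ∷ L)) ≈ weights n P (cofactor? e n) ⊕ multiples (pointCount n L)
    multiples-∷ n {e} P L = ∼-reflexive (mk λ c → R.×-homo-+ R.1# (weightIf (hasTraceAt? c P (cofactor? e n)) e) (pointCount n L c))

    -- A prime of degree e with n = j e adds e at its trace value. The prime side of the explicit
    -- formula is therefore the function that counts points by trace, the one Stepanov's method
    -- controls.
    primeSum-multiples : ∀ n L → PrimeSums.primeSum q reducedRing ξ n L ≈ multiples (pointCount n L)
    primeSum-multiples n L = PrimeSums.primeSum-unique q reducedRing ξ n (λ L → multiples (pointCount n L)) (weights n) (λ P s → weigh-multiples P s) (sym (multiples-[] n)) (λ P L → multiples-∷ n P L) L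

  values-growth : (w : ℕ → ℕ) (1≤w : ∀ n → 1 ≤ w n) (w-+ : ∀ a b → w a * w b ≤ w (a + b))
    (N : Norm reducedRing) (≼-cancel : ∀ n {x b} → 1 ≤ n → Norm._≼_ N (n · x) (n * b) → Norm._≼_ N x b) (C : ℕ) →
    (∀ n → 1 ≤ n → Norm._≼_ N (multiples (pointCount n (primesUpTo n))) (C * w n)) →
    ∀ D₀ → D ≡ suc D₀ → ∃ λ C′ → ∀ K → Norm._≼_ N ((sum {q} (λ c → χ (c ∷ []))) ↑ K) (C′ * (suc K ^ C′ * (D ^ K * w K)))
  values-growth w 1≤w w-+ N ≼-cancel C counts-≼ D₀ D≡ = Assembly.linear-sum-growth F pp reducedRing N w 1≤w w-+ (λ n → ≼-cancel n) χ χ-[] (λ u v → χ-mul u v)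
    ξ (λ P j → ξ≈ P j) (λ n → multiples (pointCount n (primesUpTo n))) (λ n → primeSum-multiples n (primesUpTo n)) C counts-≼ D (λ l u → fibre l u) D₀ D≡

  values : Fun
  values = 𝔾.sum {q} (λ c → χ (c ∷ []))

  values-power : ∀ K → (sum {q} (λ c → χ (c ∷ []))) ↑ K ≈ values 𝔾.↑ K
  values-power K = sym (trans (Hom.↑-homo projection values K) (^-congˡ K (Hom.sum-homo projection {q} (λ c → χ (c ∷ [])))))

-- The energy of a group ring element

-- Q(x) = ∑ x(c)² is the value at 0 of x ∗ x̃, so Q(x ∗ x) = Q(x ∗ x̃) ≥ (x ∗ x̃)(0)² = Q(x)².
module Energy {q : ℕ} (F : FiniteField q) (pp : IsPrimePower q) where
  private module F = Field F pp
  open F using (enum; index; index-enum; index-cong; enum-index; 1≤q)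
  open GroupRing F pp ℤ-ring
  private
    module Z = Kit ℤ-ring
    module ℕΣ = ℕ-sums

  energy : Fun → ℕ
  energy x = ℕΣ.sum {q} (λ c → ℤ.∣ x c ∣ * ℤ.∣ x c ∣)

  tilde : Fun → Fun
  tilde x c = x (0ᵢ ⊟ c)

  tilde-tilde : ∀ x c → tilde (tilde x) c ≡ x c
  tilde-tilde x c = ≡.cong x (⊟-⊟ 0ᵢ c)

  private
    square-∣∣ : ∀ i → ℤ.+ (ℤ.∣ i ∣ * ℤ.∣ i ∣) ≡ i ℤ.* i
    square-∣∣ (ℤ.+ n) = ℤₚ.pos-* n n
    square-∣∣ ℤ.-[1+ n ] = ≡.refl

    +-sum : ∀ {n} (f : Fin n → ℕ) → ℤ.+ (ℕΣ.sum f) ≡ Z.sum (λ i → ℤ.+ f i)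
    +-sum {zero} f = ≡.refl
    +-sum {suc n} f = ≡.cong (λ t → ℤ.+ f zero ℤ.+ t) (+-sum (f ∘ suc))

  energy-∗ : ∀ x → (x ∗ tilde x) 0ᵢ ≡ ℤ.+ energy x
  energy-∗ x = ≡.sym (≡.trans (+-sum {q} (λ c → ℤ.∣ x c ∣ * ℤ.∣ x c ∣))
    (Z.sum-cong-≋ {q} (λ c → ≡.trans (square-∣∣ (x c)) (≡.cong (x c ℤ.*_) (≡.sym (tilde-tilde x c))))))

  energy-cong : ∀ {x y} → (∀ c → x c ≡ y c) → energy x ≡ energy y
  energy-cong p = ℕΣ.sum-cong-≋ {q} (λ c → ≡.cong (λ t → ℤ.∣ t ∣ * ℤ.∣ t ∣) (p c))

  tilde-∗ : ∀ x y → tilde (x ∗ y) 𝔾.≈ tilde x ∗ tilde y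
  tilde-∗ x y = mk λ c → ≡.sym (≡.trans (Z.sum-permute {q} {q} (λ i → x (0ᵢ ⊟ i) ℤ.* y (0ᵢ ⊟ (c ⊟ i))) (reflection 0ᵢ))
    (Z.sum-cong-≋ {q} (λ i → ≡.cong₂ ℤ._*_ (≡.cong x (⊟-⊟ 0ᵢ i)) (≡.cong y (law c i)))))
    where
      law : ∀ c i → 0ᵢ ⊟ (c ⊟ (0ᵢ ⊟ i)) ≡ (0ᵢ ⊟ c) ⊟ i
      law c i = index-cong (F.trans (F.+-congˡ (F.-‿cong (F.trans (enum-index _) (F.+-congˡ (F.-‿cong (enum-index _))))))
        (F.trans (F.solve 3 (λ o c i → o F.:- (c F.:- (o F.:- i)) F.:= (o F.:- c) F.:- i F.:+ o) F.refl (enum 0ᵢ) (enum c) (enum i))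
          (F.trans (F.+-cong (F.+-congʳ (F.sym (enum-index _))) (enum-index F.0#)) (F.+-identityʳ _))))

  energy-square : ∀ x → energy x * energy x ≤ energy (x ∗ x)
  energy-square x = ≡.subst (energy x * energy x ≤_) energies (≡.subst (_≤ energy y) at-zero (ℕΣ.term-≤-sum {q} (λ c → ℤ.∣ y c ∣ * ℤ.∣ y c ∣) 0ᵢ))
    where
      y : Fun
      y = x ∗ tilde x
      at-zero : ℤ.∣ y 0ᵢ ∣ * ℤ.∣ y 0ᵢ ∣ ≡ energy x * energy x
      at-zero = ≡.cong (λ t → ℤ.∣ t ∣ * ℤ.∣ t ∣) (energy-∗ x)
      rearrange : y ∗ tilde y 𝔾.≈ (x ∗ x) ∗ tilde (x ∗ x)
      rearrange = begin
        y ∗ tilde y ≈⟨ 𝔾.*-congˡ {y} (𝔾.trans (tilde-∗ x (tilde x)) (𝔾.*-congˡ {tilde x} (mk (tilde-tilde x)))) ⟩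
        (x ∗ tilde x) ∗ (tilde x ∗ x) ≈⟨ 𝔾.solve 2 (λ x y → (x 𝔾.:* y) 𝔾.:* (y 𝔾.:* x) 𝔾.:= (x 𝔾.:* x) 𝔾.:* (y 𝔾.:* y)) 𝔾.refl x (tilde x) ⟩
        (x ∗ x) ∗ (tilde x ∗ tilde x) ≈⟨ 𝔾.*-congˡ {x ∗ x} (𝔾.sym (tilde-∗ x x)) ⟩
        (x ∗ x) ∗ tilde (x ∗ x) ∎
        where open 𝔾.Reasoning
      energies : energy y ≡ energy (x ∗ x)
      energies = ℤₚ.+-injective (≡.trans (≡.sym (energy-∗ y)) (≡.trans (at rearrange 0ᵢ) (energy-∗ (x ∗ x))))

  energy-powers : ∀ x j → energy x ^ (2 ^ j) ≤ energy (x 𝔾.↑ (2 ^ j))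
  energy-powers x zero = ℕₚ.≤-reflexive (≡.trans (ℕₚ.*-identityʳ _) (energy-cong (λ c → ≡.sym (at (𝔾.*-identityʳ x) c))))
  energy-powers x (suc j) = begin
    energy x ^ (2 * 2 ^ j) ≡⟨ ≡.cong (energy x ^_) (≡.cong (λ t → 2 ^ j + t) (ℕₚ.+-identityʳ (2 ^ j))) ⟩
    energy x ^ (2 ^ j + 2 ^ j) ≡⟨ ℕₚ.^-distribˡ-+-* (energy x) (2 ^ j) (2 ^ j) ⟩
    energy x ^ (2 ^ j) * energy x ^ (2 ^ j) ≤⟨ ℕₚ.*-mono-≤ (energy-powers x j) (energy-powers x j) ⟩
    energy z * energy z ≤⟨ energy-square z ⟩
    energy (z ∗ z) ≡⟨ energy-cong (λ c → at (𝔾.sym (𝔾.^-homo-* x (2 ^ j) (2 ^ j))) c) ⟩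
    energy (x 𝔾.↑ (2 ^ j + 2 ^ j)) ≡⟨ ≡.cong (λ n → energy (x 𝔾.↑ n)) (≡.cong (λ t → 2 ^ j + t) (≡.sym (ℕₚ.+-identityʳ (2 ^ j)))) ⟩
    energy (x 𝔾.↑ (2 * 2 ^ j)) ∎
    where
      open ℕₚ.≤-Reasoning
      z : Fun
      z = x 𝔾.↑ (2 ^ j)

  total : Fun → ℤ
  total x = Z.sum {q} x

  total-∗ : ∀ x y → total (x ∗ y) ≡ total x ℤ.* total y
  total-∗ x y = begin
    Z.sum {q} (λ c → Z.sum {q} (λ i → x i ℤ.* y (c ⊟ i))) ≡⟨ Z.∑-comm {q} {q} (λ c i → x i ℤ.* y (c ⊟ i)) ⟩
    Z.sum {q} (λ i → Z.sum {q} (λ c → x i ℤ.* y (c ⊟ i)))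
      ≡⟨ Z.sum-cong-≋ {q} (λ i → ≡.trans (≡.sym (Z.*-distribˡ-sum {q} (x i) (λ c → y (c ⊟ i)))) (≡.cong (x i ℤ.*_) (≡.sym (Z.sum-permute {q} {q} y (Perm.flip (translation i)))))) ⟩
    Z.sum {q} (λ i → x i ℤ.* total y) ≡⟨ ≡.sym (Z.*-distribʳ-sum {q} (total y) x) ⟩
    total x ℤ.* total y ∎
    where open ≡.≡-Reasoning

  total-δ : ∀ a → total (δ a) ≡ ℤ.+ 1
  total-δ a = ≡.trans (SingleTerm.sum-single (CommutativeRing.+-commutativeMonoid ℤ-ring) {q} (δ a) a (λ c c≢ → δ-≢ a c (c≢ ∘ ≡.sym))) (δ-≡ a a ≡.refl)

  total-↑ : ∀ x n → total (x 𝔾.↑ n) ≡ total x Z.↑ n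
  total-↑ x zero = total-δ 0ᵢ
  total-↑ x (suc n) = ≡.trans (total-∗ x (x 𝔾.↑ n)) (≡.cong (total x ℤ.*_) (total-↑ x n))

  open Oscillation F pp using (_≼_; oscillation; ∣sum∣)

  -- When the total is zero, q x(c) is the sum of the q differences x(c) - x(c′).
  zero-total-small : ∀ x b → total x ≡ ℤ.+ 0 → x ≼ b → ∀ c → ℤ.∣ x c ∣ ≤ b
  zero-total-small x b total≡0 x≼b c = ℕₚ.*-cancelˡ-≤ q {{ℕ.>-nonZero 1≤q}} (ℕₚ.≤-trans (ℕₚ.≤-reflexive scaled)
      (∣sum∣ {q} (λ c′ → x c ℤ.- x c′) b (λ c′ → oscillation x≼b c c′)))
    where
      difference : Z.sum {q} (λ c′ → x c ℤ.- x c′) ≡ ℤ.+ q ℤ.* x c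
      difference = begin
        Z.sum {q} (λ c′ → x c ℤ.- x c′) ≡⟨ Z.sum-cong-≋ {q} (λ c′ → Z.solve 2 (λ a b → a Z.:- b Z.:= a Z.:+ (Z.:- Z.:1) Z.:* b) ≡.refl (x c) (x c′)) ⟩
        Z.sum {q} (λ c′ → x c ℤ.+ ℤ.- (ℤ.+ 1) ℤ.* x c′) ≡⟨ Z.∑-distrib-+ {q} (λ _ → x c) (λ c′ → ℤ.- (ℤ.+ 1) ℤ.* x c′) ⟩
        Z.sum {q} (λ _ → x c) ℤ.+ Z.sum {q} (λ c′ → ℤ.- (ℤ.+ 1) ℤ.* x c′)
          ≡⟨ ≡.cong₂ ℤ._+_ (≡.trans (Z.sum-replicate q) (≡.trans (Z.×-congʳ q (≡.sym (ℤₚ.*-identityˡ (x c)))) (≡.trans (≡.sym (Z.×-assoc-* q (ℤ.+ 1) (x c))) (≡.cong (ℤ._* x c) (ℤ-facts.·1 q)))))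
               (≡.trans (≡.sym (Z.*-distribˡ-sum {q} (ℤ.- (ℤ.+ 1)) x)) (≡.cong (ℤ.- (ℤ.+ 1) ℤ.*_) total≡0)) ⟩
        ℤ.+ q ℤ.* x c ℤ.+ ℤ.+ 0 ≡⟨ ℤₚ.+-identityʳ _ ⟩
        ℤ.+ q ℤ.* x c ∎
        where open ≡.≡-Reasoning
      scaled : q * ℤ.∣ x c ∣ ≡ ℤ.∣ Z.sum {q} (λ c′ → x c ℤ.- x c′) ∣
      scaled = ≡.sym (≡.trans (≡.cong ℤ.∣_∣ difference) (ℤₚ.abs-* (ℤ.+ q) (x c)))

  energy-small : ∀ x b → total x ≡ ℤ.+ 0 → x ≼ b → energy x ≤ q * (b * b)
  energy-small x b total≡0 x≼b = ℕΣ.sum-≤ {q} (λ c → ℤ.∣ x c ∣ * ℤ.∣ x c ∣) (b * b) (λ c → ℕₚ.*-mono-≤ (zero-total-small x b total≡0 x≼b c) (zero-total-small x b total≡0 x≼b c))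

  private module 𝔸 = Kit reducedRing

  -- For the function x = q y − ∑ y, of total 0, this bounds |x(c)| by the oscillation of the powers of y.
  energy-bound : ∀ (y : Fun) t → total y ≡ ℤ.+ t → ∀ c → y c ≡ ℤ.+ 0 → ∀ j b → (y 𝔾.↑ (2 ^ j)) ≼ b →
    (t * t) ^ (2 ^ j) ≤ q * ((q ^ (2 ^ j) * b) * (q ^ (2 ^ j) * b))
  energy-bound y t total≡ c yc≡0 j b yʲ≼ = ℕₚ.≤-trans (ℕₚ.^-monoˡ-≤ (2 ^ j) energy-lower) (ℕₚ.≤-trans (energy-powers x j) (energy-small (x 𝔾.↑ (2 ^ j)) (q ^ (2 ^ j) * b) total-power x-power-≼))
    where
      x : Fun
      x c = ℤ.+ q ℤ.* y c ℤ.+ ℤ.- (ℤ.+ t)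
      energy-lower : t * t ≤ energy x
      energy-lower = ≡.subst (_≤ energy x) (≡.cong (λ n → n * n) (≡.trans (≡.cong ℤ.∣_∣ xc) (ℤₚ.∣-i∣≡∣i∣ (ℤ.+ t)))) (ℕΣ.term-≤-sum {q} (λ c → ℤ.∣ x c ∣ * ℤ.∣ x c ∣) c)
        where
          xc : x c ≡ ℤ.- (ℤ.+ t)
          xc = ≡.trans (≡.cong (λ v → ℤ.+ q ℤ.* v ℤ.+ ℤ.- (ℤ.+ t)) yc≡0) (≡.trans (≡.cong (ℤ._+ ℤ.- (ℤ.+ t)) (ℤₚ.*-zeroʳ (ℤ.+ q))) (ℤₚ.+-identityˡ _))
      total-x : total x ≡ ℤ.+ 0
      total-x = begin
        Z.sum {q} (λ c → ℤ.+ q ℤ.* y c ℤ.+ ℤ.- (ℤ.+ t)) ≡⟨ Z.∑-distrib-+ {q} (λ c → ℤ.+ q ℤ.* y c) (λ _ → ℤ.- (ℤ.+ t)) ⟩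
        Z.sum {q} (λ c → ℤ.+ q ℤ.* y c) ℤ.+ Z.sum {q} (λ _ → ℤ.- (ℤ.+ t))
          ≡⟨ ≡.cong₂ ℤ._+_ (≡.trans (≡.sym (Z.*-distribˡ-sum {q} (ℤ.+ q) y)) (≡.cong (ℤ.+ q ℤ.*_) total≡))
               (≡.trans (Z.sum-replicate q) (≡.trans (Z.×-congʳ q (≡.sym (ℤₚ.*-identityˡ _))) (≡.trans (≡.sym (Z.×-assoc-* q (ℤ.+ 1) (ℤ.- (ℤ.+ t)))) (≡.cong (ℤ._* ℤ.- (ℤ.+ t)) (ℤ-facts.·1 q))))) ⟩
        ℤ.+ q ℤ.* ℤ.+ t ℤ.+ ℤ.+ q ℤ.* ℤ.- (ℤ.+ t) ≡⟨ Z.solve 2 (λ q t → q Z.:* t Z.:+ q Z.:* (Z.:- t) Z.:= Z.:0) ≡.refl (ℤ.+ q) (ℤ.+ t) ⟩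
        ℤ.+ 0 ∎
        where open ≡.≡-Reasoning
      zero-power : ∀ n → 1 ≤ n → (ℤ.+ 0) Z.↑ n ≡ ℤ.+ 0
      zero-power (suc n) _ = ℤₚ.*-zeroˡ ((ℤ.+ 0) Z.↑ n)
      total-power : total (x 𝔾.↑ (2 ^ j)) ≡ ℤ.+ 0
      total-power = ≡.trans (total-↑ x (2 ^ j)) (≡.trans (≡.cong (Z._↑ (2 ^ j)) total-x) (zero-power (2 ^ j) (ℕₚ.m^n>0 2 j)))
      scalar-power : ∀ n k → (n 𝔸.· y) 𝔸.↑ k 𝔸.≈ (n ^ k) 𝔸.· (y 𝔸.↑ k)
      scalar-power n zero = 𝔸.sym (𝔸.+-identityʳ _)
      scalar-power n (suc k) = 𝔸.trans (𝔸.*-congˡ {n 𝔸.· y} (scalar-power n k)) (𝔸.trans (𝔸.×-assoc-* n y ((n ^ k) 𝔸.· (y 𝔸.↑ k)))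
        (𝔸.trans (𝔸.×-congʳ n (𝔸.×-comm-* (n ^ k) y (y 𝔸.↑ k))) (𝔸.×-assocˡ _ n (n ^ k))))
      -- Modulo constants x is q y, so the oscillation of its powers is that of the powers of y
      -- times a power of q.
      x∼qy : x 𝔸.≈ q 𝔸.· y
      x∼qy = 𝔸.trans (constant⇒∼ (ℤ.- (ℤ.+ t)) (λ c → ≡.cong (ℤ._+ ℤ.- (ℤ.+ t)) (≡.sym (≡.trans (·-at q y c) (≡.trans (Z.×-congʳ q (≡.sym (ℤₚ.*-identityˡ (y c))))
          (≡.trans (≡.sym (Z.×-assoc-* q (ℤ.+ 1) (y c))) (≡.cong (ℤ._* y c) (ℤ-facts.·1 q))))))))
        (Hom.·-homo projection q y)
      x-power-≼ : (x 𝔾.↑ (2 ^ j)) ≼ (q ^ (2 ^ j) * b)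
      x-power-≼ = Oscillation.≼-resp F pp (𝔸.sym (𝔸.trans (Hom.↑-homo projection x (2 ^ j)) (𝔸.trans (𝔸.^-congˡ (2 ^ j) x∼qy)
          (𝔸.trans (scalar-power q (2 ^ j)) (𝔸.×-congʳ (q ^ (2 ^ j)) (𝔸.sym (Hom.↑-homo projection y (2 ^ j))))))))
        (Norm.≼-· (Oscillation.oscillationNorm F pp) (q ^ (2 ^ j)) yʲ≼)

-- Exponential against polynomial growth

n<2^n : ∀ n → n < 2 ^ n
n<2^n zero = s≤s z≤n
n<2^n (suc n) = ℕₚ.≤-trans (ℕₚ.+-mono-≤ {1} {2 ^ n} (ℕₚ.m^n>0 2 n) (n<2^n n)) (ℕₚ.≤-reflexive (≡.cong (λ t → 2 ^ n + t) (≡.sym (ℕₚ.+-identityʳ (2 ^ n)))))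

-- Since Y X^r ≥ Y^r (Y + r), raising to the power 2^c > c leaves r ≤ const.
exponential-beats-polynomial : ∀ X Y c s → Y < X → 1 ≤ Y → 1 ≤ s → ¬ (∀ j → X ^ (s * 2 ^ j) ≤ c * suc (s * 2 ^ j) ^ c * Y ^ (s * 2 ^ j))
exponential-beats-polynomial X Y c s Y<X 1≤Y 1≤s bound = ℕₚ.<⇒≱ K<r r≤K
  where
    -- E > c makes r · r^c ≤ r^E. K is what remains as a constant after Y^(r E) and r^c are
    -- cancelled, and r = s 2^K exceeds it. As E is a power of 2, r E is again an exponent of the
    -- form s 2ʲ, so the assumed bound applies to it.
    E K r : ℕ
    E = 2 ^ c
    K = Y ^ E * (c * suc E ^ c)
    r = s * 2 ^ K
    1≤r : 1 ≤ r
    1≤r = ℕₚ.*-mono-≤ 1≤s (ℕₚ.m^n>0 2 K)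
    K<r : K < r
    K<r = ℕₚ.≤-trans (n<2^n K) (ℕₚ.≤-trans (ℕₚ.≤-reflexive (≡.sym (ℕₚ.*-identityˡ (2 ^ K)))) (ℕₚ.*-monoˡ-≤ (2 ^ K) 1≤s))
    exponent : s * 2 ^ (K + c) ≡ r * E
    exponent = ≡.trans (≡.cong (s *_) (ℕₚ.^-distribˡ-+-* 2 K c)) (≡.sym (ℕₚ.*-assoc s (2 ^ K) E))
    open ℕₚ.≤-Reasoning
    base : Y ^ r * r ≤ Y * X ^ r
    base = begin
      Y ^ r * r ≡⟨ ℕₚ.*-comm (Y ^ r) r ⟩
      r * Y ^ r ≤⟨ ℕₚ.*-monoˡ-≤ (Y ^ r) (ℕₚ.m≤n+m r Y) ⟩
      (Y + r) * Y ^ r ≤⟨ bernoulli Y r ⟩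
      Y * suc Y ^ r ≤⟨ ℕₚ.*-monoʳ-≤ Y (ℕₚ.^-monoˡ-≤ r Y<X) ⟩
      Y * X ^ r ∎
    power-* : ∀ a b n → (a * b) ^ n ≡ a ^ n * b ^ n
    power-* a b zero = ≡.refl
    power-* a b (suc n) = ≡.trans (≡.cong (a * b *_) (power-* a b n)) (Data.Nat.Solver.+-*-Solver.solve 4 (λ a b x y → a S:* b S:* (x S:* y) S:= a S:* x S:* (b S:* y)) ≡.refl a b (a ^ n) (b ^ n))
      where open Data.Nat.Solver.+-*-Solver using () renaming (_:*_ to _S:*_; _:=_ to _S:=_)
    raised : Y ^ (r * E) * r ^ E ≤ Y ^ E * X ^ (r * E)
    raised = begin
      Y ^ (r * E) * r ^ E ≡⟨ ≡.cong (_* r ^ E) (≡.sym (ℕₚ.^-*-assoc Y r E)) ⟩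
      (Y ^ r) ^ E * r ^ E ≡⟨ ≡.sym (power-* (Y ^ r) r E) ⟩
      (Y ^ r * r) ^ E ≤⟨ ℕₚ.^-monoˡ-≤ E base ⟩
      (Y * X ^ r) ^ E ≡⟨ power-* Y (X ^ r) E ⟩
      Y ^ E * (X ^ r) ^ E ≡⟨ ≡.cong (Y ^ E *_) (ℕₚ.^-*-assoc X r E) ⟩
      Y ^ E * X ^ (r * E) ∎
    r^E≤ : r ^ E ≤ K * r ^ c
    r^E≤ = ℕₚ.*-cancelˡ-≤ (Y ^ (r * E)) {{ℕ.>-nonZero (ℕₚ.m^n>0 Y {{ℕ.>-nonZero 1≤Y}} (r * E))}} (begin
      Y ^ (r * E) * r ^ E ≤⟨ raised ⟩
      Y ^ E * X ^ (r * E) ≤⟨ ℕₚ.*-monoʳ-≤ (Y ^ E) (≡.subst (λ M → X ^ M ≤ c * suc M ^ c * Y ^ M) exponent (bound (K + c))) ⟩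
      Y ^ E * (c * suc (r * E) ^ c * Y ^ (r * E)) ≤⟨ ℕₚ.*-monoʳ-≤ (Y ^ E) (ℕₚ.*-monoˡ-≤ (Y ^ (r * E)) (ℕₚ.*-monoʳ-≤ c (ℕₚ.^-monoˡ-≤ c (ℕₚ.+-monoˡ-≤ (r * E) 1≤r)))) ⟩
      Y ^ E * (c * (r + r * E) ^ c * Y ^ (r * E)) ≡⟨ ≡.cong (λ x → Y ^ E * (c * x * Y ^ (r * E))) (≡.trans (≡.cong (_^ c) (≡.trans (≡.sym (ℕₚ.*-suc r E)) (ℕₚ.*-comm r (suc E)))) (power-* (suc E) r c)) ⟩
      Y ^ E * (c * (suc E ^ c * r ^ c) * Y ^ (r * E)) ≡⟨ Data.Nat.Solver.+-*-Solver.solve 5 (λ y c e x z → y S:* (c S:* (e S:* x) S:* z) S:= z S:* ((y S:* (c S:* e)) S:* x)) ≡.refl (Y ^ E) c (suc E ^ c) (r ^ c) (Y ^ (r * E)) ⟩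
      Y ^ (r * E) * (K * r ^ c) ∎)
      where open Data.Nat.Solver.+-*-Solver using () renaming (_:*_ to _S:*_; _:=_ to _S:=_)
    r≤K : r ≤ K
    r≤K = ℕₚ.*-cancelʳ-≤ r K (r ^ c) {{ℕ.>-nonZero (ℕₚ.m^n>0 r {{ℕ.>-nonZero 1≤r}} c)}} (ℕₚ.≤-trans (ℕₚ.^-monoʳ-≤ r {{ℕ.>-nonZero 1≤r}} (n<2^n c)) r^E≤)

-- The integral substitute for q^(n/2): exact for even n, and rounding down gives the inequality w a
-- · w b ≤ w (a + b).
halfPower : ℕ → ℕ → ℕ
halfPower q n = q ^ ℕ.⌊ n /2⌋

⌊⌋-+ : ∀ a b → ℕ.⌊ a /2⌋ + ℕ.⌊ b /2⌋ ≤ ℕ.⌊ a + b /2⌋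
⌊⌋-+ zero b = ℕₚ.≤-refl
⌊⌋-+ (suc zero) b = ℕₚ.⌊n/2⌋-mono (ℕₚ.n≤1+n b)
⌊⌋-+ (suc (suc a)) b = s≤s (⌊⌋-+ a b)

halfPower-+ : ∀ q → 1 ≤ q → ∀ a b → halfPower q a * halfPower q b ≤ halfPower q (a + b)
halfPower-+ q 1≤q a b = ℕₚ.≤-trans (ℕₚ.≤-reflexive (≡.sym (ℕₚ.^-distribˡ-+-* q ℕ.⌊ a /2⌋ ℕ.⌊ b /2⌋))) (ℕₚ.^-monoʳ-≤ q {{ℕ.>-nonZero 1≤q}} (⌊⌋-+ a b))

module _ (q X Y C m : ℕ) (1≤q : 1 ≤ q) (1≤m : 1 ≤ m) (Y<X : Y < X) (1≤Y : 1 ≤ Y) (gap : q ^ 2 * X ^ (2 * m) ≤ q ^ m) where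
  private
    G : ℕ → ℕ
    G K = C * (suc K ^ C * (Y ^ K * halfPower q K))

  -- Raise `gap` to the power 2ʲ⁺¹ and compare it with the upper bound at j + 1. The powers of q
  -- cancel except for one factor q, and X^(4H) is bounded by a polynomial times Y^(4H), where H = m
  -- 2ʲ.
  growth-contradiction : ¬ (∀ j → (q ^ m * q ^ m) ^ (2 ^ j) ≤ q * ((q ^ (2 ^ j) * G (m * 2 ^ j)) * (q ^ (2 ^ j) * G (m * 2 ^ j))))
  growth-contradiction upper = exponential-beats-polynomial X Y c (4 * m) Y<X 1≤Y (ℕₚ.*-mono-≤ {1} {4} (s≤s z≤n) 1≤m) bound
    where
      c : ℕ
      -- q C² is the remaining constant factor and 2 C the remaining exponent; their sum serves as
      -- both.
      c = q * (C * C) + (C + C)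
      bound : ∀ j → X ^ (4 * m * 2 ^ j) ≤ c * suc (4 * m * 2 ^ j) ^ c * Y ^ (4 * m * 2 ^ j)
      bound j = ℕₚ.*-cancelˡ-≤ (q ^ H * q ^ H * (q ^ k * q ^ k)) {{ℕ.>-nonZero positive}} (begin
          (q ^ H * q ^ H * (q ^ k * q ^ k)) * X ^ (4 * m * 2 ^ j) ≡⟨ ≡.cong ((q ^ H * q ^ H * (q ^ k * q ^ k)) *_) (≡.trans (≡.cong (X ^_) 4H) (ℕₚ.^-distribˡ-+-* X (H + H) (H + H))) ⟩
          (q ^ H * q ^ H * (q ^ k * q ^ k)) * (X ^ (H + H) * X ^ (H + H)) ≡⟨ ℕₚ.*-assoc (q ^ H * q ^ H) (q ^ k * q ^ k) _ ⟩
          (q ^ H * q ^ H) * ((q ^ k * q ^ k) * (X ^ (H + H) * X ^ (H + H))) ≤⟨ ℕₚ.*-monoʳ-≤ (q ^ H * q ^ H) gap-power ⟩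
          (q ^ H * q ^ H) * (q ^ H * q ^ H) ≡⟨ ≡.sym left ⟩
          -- Taking j + 1 makes m 2ʲ⁺¹ even, so the half power is exactly q^H.
          (q ^ m * q ^ m) ^ k ≤⟨ upper (suc j) ⟩
          q * ((q ^ k * G (m * k)) * (q ^ k * G (m * k))) ≡⟨ ≡.cong (λ x → q * ((q ^ k * x) * (q ^ k * x))) right ⟩
          q * ((q ^ k * (C * (S ^ C * (Y ^ (H + H) * q ^ H)))) * (q ^ k * (C * (S ^ C * (Y ^ (H + H) * q ^ H)))))
            ≡⟨ solve 6 (λ q k C s y h → q :* ((k :* (C :* (s :* (y :* h)))) :* (k :* (C :* (s :* (y :* h))))) := (h :* h :* (k :* k)) :* ((q :* (C :* C)) :* (s :* s) :* (y :* y))) ≡.refl q (q ^ k) C (S ^ C) (Y ^ (H + H)) (q ^ H) ⟩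
          (q ^ H * q ^ H * (q ^ k * q ^ k)) * ((q * (C * C)) * (S ^ C * S ^ C) * (Y ^ (H + H) * Y ^ (H + H)))
            ≤⟨ ℕₚ.*-monoʳ-≤ (q ^ H * q ^ H * (q ^ k * q ^ k)) (ℕₚ.*-mono-≤ (ℕₚ.*-mono-≤ (ℕₚ.m≤m+n (q * (C * C)) (C + C)) S-bound) (ℕₚ.≤-reflexive (≡.trans (≡.sym (ℕₚ.^-distribˡ-+-* Y (H + H) (H + H))) (≡.cong (Y ^_) (≡.sym 4H))))) ⟩
          (q ^ H * q ^ H * (q ^ k * q ^ k)) * (c * suc (4 * m * 2 ^ j) ^ c * Y ^ (4 * m * 2 ^ j)) ∎)
        where
          open ℕₚ.≤-Reasoning
          open Data.Nat.Solver.+-*-Solver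
          k H S : ℕ
          k = 2 ^ suc j
          H = m * 2 ^ j
          S = suc (H + H)
          4H : 4 * m * 2 ^ j ≡ (H + H) + (H + H)
          4H = solve 2 (λ m p → con 4 :* m :* p := (m :* p :+ m :* p) :+ (m :* p :+ m :* p)) ≡.refl m (2 ^ j)
          mk : m * k ≡ H + H
          mk = solve 2 (λ m p → m :* (con 2 :* p) := m :* p :+ m :* p) ≡.refl m (2 ^ j)
          positive : 1 ≤ q ^ H * q ^ H * (q ^ k * q ^ k)
          positive = ℕₚ.*-mono-≤ (ℕₚ.*-mono-≤ (p H) (p H)) (ℕₚ.*-mono-≤ (p k) (p k))
            where
              p : ∀ n → 1 ≤ q ^ n
              p n = ℕₚ.m^n>0 q {{ℕ.>-nonZero 1≤q}} n
          q^mk : (q ^ m) ^ k ≡ q ^ H * q ^ H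
          q^mk = ≡.trans (ℕₚ.^-*-assoc q m k) (≡.trans (≡.cong (q ^_) mk) (ℕₚ.^-distribˡ-+-* q H H))
          power-* : ∀ a b n → (a * b) ^ n ≡ a ^ n * b ^ n
          power-* a b zero = ≡.refl
          power-* a b (suc n) = ≡.trans (≡.cong (a * b *_) (power-* a b n)) (solve 4 (λ a b x y → a :* b :* (x :* y) := a :* x :* (b :* y)) ≡.refl a b (a ^ n) (b ^ n))
          left : (q ^ m * q ^ m) ^ k ≡ (q ^ H * q ^ H) * (q ^ H * q ^ H)
          left = ≡.trans (power-* (q ^ m) (q ^ m) k) (≡.cong₂ _*_ q^mk q^mk)
          gap-power : (q ^ k * q ^ k) * (X ^ (H + H) * X ^ (H + H)) ≤ q ^ H * q ^ H
          gap-power = begin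
            (q ^ k * q ^ k) * (X ^ (H + H) * X ^ (H + H))
              ≡⟨ ≡.cong₂ _*_ (≡.trans (≡.sym (power-* q q k)) (≡.cong (_^ k) (≡.cong (q *_) (≡.sym (ℕₚ.*-identityʳ q)))))
                   (≡.trans (≡.sym (ℕₚ.^-distribˡ-+-* X (H + H) (H + H))) (≡.trans (≡.cong (X ^_) (solve 2 (λ m p → (m :* p :+ m :* p) :+ (m :* p :+ m :* p) := (con 2 :* m) :* (con 2 :* p)) ≡.refl m (2 ^ j))) (≡.sym (ℕₚ.^-*-assoc X (2 * m) k)))) ⟩
            (q ^ 2) ^ k * (X ^ (2 * m)) ^ k ≡⟨ ≡.sym (power-* (q ^ 2) (X ^ (2 * m)) k) ⟩
            (q ^ 2 * X ^ (2 * m)) ^ k ≤⟨ ℕₚ.^-monoˡ-≤ k gap ⟩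
            (q ^ m) ^ k ≡⟨ q^mk ⟩
            q ^ H * q ^ H ∎
          right : G (m * k) ≡ C * (S ^ C * (Y ^ (H + H) * q ^ H))
          right = ≡.trans (≡.cong G mk) (≡.cong (λ h → C * (S ^ C * (Y ^ (H + H) * q ^ h))) (≡.sym (ℕₚ.n≡⌊n+n/2⌋ H)))
          S-bound : S ^ C * S ^ C ≤ suc (4 * m * 2 ^ j) ^ c
          S-bound = begin
            S ^ C * S ^ C ≡⟨ ≡.sym (ℕₚ.^-distribˡ-+-* S C C) ⟩
            S ^ (C + C) ≤⟨ ℕₚ.^-monoʳ-≤ S (ℕₚ.m≤n+m (C + C) (q * (C * C))) ⟩
            S ^ c ≤⟨ ℕₚ.^-monoˡ-≤ c (s≤s (ℕₚ.≤-trans (ℕₚ.m≤m+n (H + H) (H + H)) (ℕₚ.≤-reflexive (≡.sym 4H)))) ⟩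
            suc (4 * m * 2 ^ j) ^ c ∎

-- Conclusion: growth of yᴷ over ℤ and solvability of the equation

module TraceSeriesGrowth {q : ℕ} (F : FiniteField q) (pp : IsPrimePower q) {D : ℕ} (a : Fin (suc (suc D)) → FiniteField.Carrier F)
  (lead : ¬ (FiniteField._≈_ F (a (fromℕ (suc D))) (FiniteField.0# F)))
  (d≉0 : ¬ (FiniteField._≈_ F (Kit._·_ (FiniteField.commRing F) (suc D) (FiniteField.1# F)) (FiniteField.0# F))) where
  private
    module TS = TraceSeries F pp a lead d≉0 ℤ-ring
    module PC = PointCount F pp a lead d≉0
    module O = Oscillation F pp

  -- 3 d q is Stepanov's error constant, with d = `suc D`; the other q comes from passing from upper
  -- bounds to differences.
  C : ℕ
  C = q * (3 * (suc D * q))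

  multiples-≼ : ∀ (u : Fin q → ℕ) B → (∀ c c′ → u c ≤ u c′ + B) → TS.multiples u O.≼ B
  multiples-≼ u B osc = O.mk λ c c′ → ≡.subst (ℕ._≤ B)
    (≡.cong ℤ.∣_∣ (≡.cong₂ ℤ._-_ (≡.sym (ℤ-facts.·1 (u c))) (≡.sym (ℤ-facts.·1 (u c′)))))
    (ℤ-facts.∣difference∣ (u c) (u c′) B (osc c c′) (osc c′ c))

  points-oscillation : ∀ n → 1 ≤ n → ∀ c c′ → PC.points n (Sieve.primesUpTo F pp n) c ≤ PC.points n (Sieve.primesUpTo F pp n) c′ + C * halfPower q n
  points-oscillation (suc n) _ c c′ = ℕₚ.≤-trans (PC.points-oscillation n c c′)
    (ℕₚ.≤-reflexive (≡.cong (PC.points (suc n) (Sieve.primesUpTo F pp (suc n)) c′ +_) (≡.sym (ℕₚ.*-assoc q (3 * (suc D * q)) (halfPower q (suc n))))))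

  points-≼ : ∀ n → 1 ≤ n → TS.multiples (TS.pointCount n (Sieve.primesUpTo F pp n)) O.≼ (C * halfPower q n)
  points-≼ n 1≤n = multiples-≼ (TS.pointCount n (Sieve.primesUpTo F pp n)) (C * halfPower q n) (points-oscillation n 1≤n)

  values-growth : ∀ D₀ → D ≡ suc D₀ → ∃ λ C′ → ∀ K → (Kit._↑_ (GroupRing.groupRing F pp ℤ-ring) TS.values K) O.≼ (C′ * (suc K ^ C′ * (D ^ K * halfPower q K)))
  values-growth D₀ D≡ = transfer (TS.values-growth (halfPower q) (λ n → ℕₚ.m^n>0 q {{ℕ.>-nonZero (Field.1≤q F pp)}} ℕ.⌊ n /2⌋) (halfPower-+ q (Field.1≤q F pp))
      O.oscillationNorm (λ n → O.≼-cancel n) C points-≼ D₀ D≡)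
    where
      module 𝔸 = Kit (GroupRing.reducedRing F pp ℤ-ring)
      transfer : (∃ λ C′ → ∀ K → (𝔸.sum {q} (λ c → TS.χ (c ∷ [])) 𝔸.↑ K) O.≼ (C′ * (suc K ^ C′ * (D ^ K * halfPower q K)))) →
        ∃ λ C′ → ∀ K → (Kit._↑_ (GroupRing.groupRing F pp ℤ-ring) TS.values K) O.≼ (C′ * (suc K ^ C′ * (D ^ K * halfPower q K)))
      transfer (C′ , p) = C′ , λ K → O.≼-resp (TS.values-power K) (p K)

module Waring {q : ℕ} (F : FiniteField q) (pp : IsPrimePower q) {D₀ : ℕ} (h : PolyOfDegree F (suc (suc D₀)))
  (d≉0 : ¬ (FiniteField._≈_ F (Kit._·_ (FiniteField.commRing F) (suc (suc D₀)) (FiniteField.1# F)) (FiniteField.0# F))) where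
  open PolyOfDegree h using () renaming (coeff to a; leading to lead)
  open Field F pp using (commRing; enum; index; enum-index; index-enum; 1≤q)
  private
    module F = Field F pp
    module TS = TraceSeries F pp a lead d≉0 ℤ-ring
    module Z = Kit ℤ-ring
    module En = Energy F pp
  open GroupRing F pp ℤ-ring
  open Reversal commRing using (traceForm)
  open Series commRing using (powerSum; linear; powerSum-linear; powerSum-cong; monomial; mk; at)
  open Monic commRing using (reversed; reversed-zero)

  -- X + c has the single root -c. The linear coefficient of T is thus the sum of [h(x)] over the
  -- field, the element whose powers count solutions.
  traceForm-linear-factor : ∀ c → traceForm a (c ∷ []) F.≈ eval F h (F.- c)
  traceForm-linear-factor c = F.+-cong (F.trans (F.+-identityʳ _) (F.sym (F.*-identityʳ _))) (sums (λ k → a (suc k)) (λ k → k))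
    where
      reversed-linear : ∀ k → reversed (c ∷ []) k F.≈ linear (F.- c) 1 k
      reversed-linear zero = F.+-congˡ (F.sym F.-0#≈0#)
      reversed-linear (suc zero) = F.+-congˡ (F.sym (F.-‿involutive c))
      reversed-linear (suc (suc k)) = F.+-congˡ (F.sym F.-0#≈0#)
      pow-↑ : ∀ x n → pow F x n ≡ x F.↑ n
      pow-↑ x zero = ≡.refl
      pow-↑ x (suc n) = ≡.cong (x F.⊗_) (pow-↑ x n)
      powers : ∀ k → powerSum (reversed (c ∷ [])) (suc k) F.≈ pow F (F.- c) (suc k)
      powers k = F.trans (at (powerSum-cong (reversed-zero (c ∷ [])) (mk reversed-linear)) (suc k))
        (F.trans (F.reflexive (≡.cong (powerSum (linear (F.- c) 1)) (≡.sym (ℕₚ.*-identityʳ (suc k)))))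
          (F.trans (powerSum-linear (F.- c) 1 (s≤s z≤n) k) (F.trans (F.+-identityʳ _) (F.reflexive (≡.sym (pow-↑ (F.- c) (suc k)))))))
      sums : ∀ {n m} (b : Fin n → F.Carrier) (κ : Fin n → Fin m) →
        F.sum {n} (λ k → b k F.⊗ powerSum (reversed (c ∷ [])) (suc (toℕ (κ k)))) F.≈ sumF F (λ k → b k F.⊗ pow F (F.- c) (suc (toℕ (κ k))))
      sums {zero} b κ = F.refl
      sums {suc n} b κ = F.+-cong (F.*-congˡ (powers (toℕ (κ zero)))) (sums (b ∘ suc) (κ ∘ suc))

  private
    nonzero-term : ∀ {n} (f : Fin n → ℤ) → Z.sum f ≢ ℤ.+ 0 → ∃ λ i → f i ≢ ℤ.+ 0
    nonzero-term f sum≢0 with any-or-all (λ i → decide (f i ℤ.≟ ℤ.+ 0))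
      where
        decide : ∀ {i} → Dec (f i ≡ ℤ.+ 0) → f i ≢ ℤ.+ 0 ⊎ f i ≡ ℤ.+ 0
        decide (yes e) = inj₂ e
        decide (no ne) = inj₁ ne
    ... | inj₁ found = found
    ... | inj₂ all = ⊥-elim (sum≢0 (SingleTerm.sum-ε (CommutativeRing.+-commutativeMonoid ℤ-ring) f all))

    δ-nonzero : ∀ x c → δ x c ≢ ℤ.+ 0 → x ≡ c
    δ-nonzero x c ne = case x Finₚ.≟ c of λ where
      (yes e) → e
      (no x≢c) → ⊥-elim (ne (δ-≢ x c x≢c))

  value-found : ∀ i → TS.values i ≢ ℤ.+ 0 → ∃ λ x → eval F h x F.≈ enum i
  value-found i ne = found (nonzero-term {q} (λ c → TS.χ (c ∷ []) i) (λ e → ne (≡.trans (sum-at {q} (λ c → TS.χ (c ∷ [])) i) e)))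
    where
      found : (∃ λ c → TS.χ (c ∷ []) i ≢ ℤ.+ 0) → ∃ λ x → eval F h x F.≈ enum i
      found (c , ne′) = F.- enum c , F.trans (F.sym (traceForm-linear-factor (enum c)))
        (F.trans (F.sym (enum-index _)) (F.reflexive (≡.cong enum (δ-nonzero (index (traceForm a (enum c ∷ []))) i ne′))))

  -- A nonzero coefficient of a convolution has a nonzero summand, whose two factors provide one
  -- value of h and, recursively, a representation of the difference.
  solution : ∀ m β → (TS.values 𝔾.↑ m) β ≢ ℤ.+ 0 → ∃ λ (x : Fin m → F.Carrier) → sumF F (λ i → eval F h (x i)) F.≈ enum β
  solution zero β ne = (λ ()) , F.trans (F.sym (enum-index F.0#)) (F.reflexive (≡.cong enum (δ-nonzero 0ᵢ β ne)))
  solution (suc m) β ne = found (nonzero-term {q} (λ i → TS.values i ℤ.* (TS.values 𝔾.↑ m) (β ⊟ i)) ne)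
    where
      found : (∃ λ i → TS.values i ℤ.* (TS.values 𝔾.↑ m) (β ⊟ i) ≢ ℤ.+ 0) → ∃ λ (x : Fin (suc m) → F.Carrier) → sumF F (λ i → eval F h (x i)) F.≈ enum β
      found (i , ne′) = combine (value-found i (λ e → ne′ (≡.trans (≡.cong (ℤ._* (TS.values 𝔾.↑ m) (β ⊟ i)) e) (ℤₚ.*-zeroˡ ((TS.values 𝔾.↑ m) (β ⊟ i))))))
          (solution m (β ⊟ i) (λ e → ne′ (≡.trans (≡.cong (TS.values i ℤ.*_) e) (ℤₚ.*-zeroʳ (TS.values i)))))
        where
          combine : (∃ λ x → eval F h x F.≈ enum i) → (∃ λ (x : Fin m → F.Carrier) → sumF F (λ i → eval F h (x i)) F.≈ enum (β ⊟ i)) →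
            ∃ λ (x : Fin (suc m) → F.Carrier) → sumF F (λ i → eval F h (x i)) F.≈ enum β
          combine (x , hx) (xs , hxs) = (λ { zero → x ; (suc k) → xs k }) , F.trans (F.+-cong hx (F.trans hxs (enum-index _)))
            (F.solve 2 (λ i b → i F.:+ (b F.:- i) F.:= b) F.refl (enum i) (enum β))

  total-values : En.total TS.values ≡ ℤ.+ q
  total-values = begin
    Z.sum {q} TS.values ≡⟨ Z.sum-cong-≋ {q} (λ i → sum-at {q} (λ c → TS.χ (c ∷ [])) i) ⟩
    Z.sum {q} (λ i → Z.sum {q} (λ c → TS.χ (c ∷ []) i)) ≡⟨ Z.∑-comm {q} {q} (λ i c → TS.χ (c ∷ []) i) ⟩
    Z.sum {q} (λ c → Z.sum {q} (TS.χ (c ∷ []))) ≡⟨ Z.sum-cong-≋ {q} (λ c → En.total-δ (index (traceForm a (enum c ∷ [])))) ⟩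
    Z.sum {q} (λ c → ℤ.+ 1) ≡⟨ ≡.trans (Z.sum-replicate q) (ℤ-facts.·1 q) ⟩
    ℤ.+ q ∎
    where open ≡.≡-Reasoning

  total-power : ∀ m → En.total (TS.values 𝔾.↑ m) ≡ ℤ.+ (q ^ m)
  total-power m = ≡.trans (En.total-↑ TS.values m) (≡.trans (≡.cong (Z._↑ m) total-values) (ℤ-facts.+-↑ q m))

  power-nonzero : ∀ m → 1 ≤ m → q ^ 2 * (suc (suc D₀) + 2) ^ (2 * m) ≤ q ^ m → ∀ β → (TS.values 𝔾.↑ m) β ≢ ℤ.+ 0
  power-nonzero m 1≤m gap β zero-at = contradiction (TraceSeriesGrowth.values-growth F pp a lead d≉0 D₀ ≡.refl)
    where
      open Oscillation F pp using (_≼_; ≼-resp)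
      contradiction : (∃ λ C → ∀ K → (TS.values 𝔾.↑ K) ≼ (C * (suc K ^ C * (suc D₀ ^ K * halfPower q K)))) → ⊥
      -- With d = D₀ + 2 the rate of growth is d - 1 = D₀ + 1, and the base in `gap` is d + 2 = D₀ +
      -- 4.
      contradiction (C , growth) = growth-contradiction q (suc (suc D₀) + 2) (suc D₀) C m 1≤q 1≤m (s≤s (ℕₚ.m≤m+n (suc D₀) 2)) (s≤s z≤n) gap
        (λ j → En.energy-bound (TS.values 𝔾.↑ m) (q ^ m) (total-power m) β zero-at j (C * (suc (m * 2 ^ j) ^ C * (suc D₀ ^ (m * 2 ^ j) * halfPower q (m * 2 ^ j))))
          (≼-resp (∼-reflexive (𝔾.sym (𝔾.^-assocʳ TS.values m (2 ^ j)))) (growth (m * 2 ^ j))))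

natF-· : ∀ {q} (F : FiniteField q) n → natF F n ≡ Kit._·_ (FiniteField.commRing F) n (FiniteField.1# F)
natF-· F zero = ≡.refl
natF-· F (suc n) = ≡.cong (FiniteField._+_ F (FiniteField.1# F)) (natF-· F n)

theorem4p16 : (n d q : ℕ) → 3 ≤ n → 4 ≤ d → IsPrimePower q →
    (F : FiniteField q) →
    ¬ (FiniteField._≈_ F (natF F d) (FiniteField.0# F)) →
    (d + 2) ^ (2 * (d ∸ 1)) < q ^ (d ∸ 3) →
    (h : PolyOfDegree F d) → (m : ℕ) → IsCeilLogRatio q d m →
    GammaAtMost F h m
theorem4p16 n (suc (suc D₀)) q 3≤n (s≤s (s≤s _)) pp F d≉0 _ h m (gap , _) = m , ℕₚ.≤-refl , λ β → solve-for β
    (W.solution m (FiniteField.index F β) (W.power-nonzero m 1≤m gap (FiniteField.index F β)))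
  where
    module W = Waring F pp h (≡.subst (λ x → ¬ (FiniteField._≈_ F x (FiniteField.0# F))) (natF-· F (suc (suc D₀))) d≉0)
    -- For m = 0 the inequality in the definition of the ceiling would read q² ≤ 1.
    1≤m : 1 ≤ m
    1≤m = positive m gap
      where
        positive : ∀ m → q ^ 2 * (suc (suc D₀) + 2) ^ (2 * m) ≤ q ^ m → 1 ≤ m
        positive (suc m) _ = s≤s z≤n
        positive zero q²≤1 = ⊥-elim (ℕₚ.<⇒≱ (ℕₚ.≤-trans (s≤s (s≤s z≤n)) (ℕₚ.*-mono-≤ (ℕₚ.^-monoˡ-≤ 2 (Field.2≤q F pp)) (ℕₚ.≤-refl {1}))) q²≤1)
    solve-for : ∀ β → (∃ λ (x : Fin m → FiniteField.Carrier F) → FiniteField._≈_ F (sumF F (λ i → eval F h (x i))) (FiniteField.enum F (FiniteField.index F β))) →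
      ∃ λ (x : Fin m → FiniteField.Carrier F) → FiniteField._≈_ F (sumF F (λ i → eval F h (x i))) β
    solve-for β (x , eq) = x , FiniteField.trans F eq (FiniteField.enum-index F β)
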